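{- Let $d=d(n)$ be a positive-integer-valued function of $n$ with $d(n)=o(n^{1/5})$ (and $dn$ even). For every constant $\varepsilon>0$ there exists an integer $n_0=n_0(\varepsilon)$ such that for every $n>n_0$ there exists an integer $t=t(n,d,\varepsilon)$ with $$\Pr\big[\chi(\mathcal{G}_{n,d})\in\{t,t+1\}\big]\geq 1-\varepsilon.$$
   Context: $\mathcal{G}_{n,d}$ denotes the uniform probability space of all (simple) $d$-regular graphs on the vertex set $[n]=\{1,\dots,n\}$ (defined when $dn$ is even), and also a random graph drawn from it. $\chi(G)$ is the chromatic number of $G$. -}

module Defs where

open import Data.Bool using (Bool; true; false; _∧_; _∨_; not; if_then_else_)
open import Data.Nat using (ℕ; zero; suc; _+_; _*_; _≡ᵇ_; _^_)
open import Data.Fin using (Fin) renaming (zero to fzero; suc to fsuc)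
open import Data.Fin.Properties using (_≟_)
open import Data.List using (List; []; _∷_; map; concatMap; length; allFin; upTo)
open import Data.Bool.ListAction using (all; any)
open import Data.Integer using (+_)
open import Data.Rational using (ℚ; _/_; 0ℚ)
open import Relation.Nullary.Decidable using (⌊_⌋)

bfilter : {A : Set} → (A → Bool) → List A → List A
bfilter p [] = []
bfilter p (x ∷ xs) = if p x then x ∷ bfilter p xs else bfilter p xs

Graph : ℕ → Set
Graph n = Fin n → Fin n → Bool

funs : {A : Set} → List A → (n : ℕ) → List (Fin n → A)
funs xs zero = (λ ()) ∷ []
funs xs (suc n) =
  concatMap (λ x → map (λ f → λ { fzero → x ; (fsuc i) → f i }) (funs xs n)) xs

-- Every adjacency function Fin n → Fin n → Bool (each exactly once).
allAdj : (n : ℕ) → List (Graph n)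
allAdj n = funs (funs (true ∷ false ∷ []) n) n

degree : {n : ℕ} → Graph n → Fin n → ℕ
degree {n} G i = length (bfilter (G i) (allFin n))

boolEq : Bool → Bool → Bool
boolEq true b = b
boolEq false b = not b

isSimple : {n : ℕ} → Graph n → Bool
isSimple {n} G =
  all (λ i → not (G i i) ∧ all (λ j → boolEq (G i j) (G j i)) (allFin n)) (allFin n)

isRegular : {n : ℕ} → ℕ → Graph n → Bool
isRegular {n} d G = isSimple G ∧ all (λ i → degree G i ≡ᵇ d) (allFin n)

regularGraphs : (n d : ℕ) → List (Graph n)
regularGraphs n d = bfilter (isRegular d) (allAdj n)

isProper : {n k : ℕ} → Graph n → (Fin n → Fin k) → Bool
isProper {n} G c =
  all (λ i → all (λ j → not (G i j ∧ ⌊ c i ≟ c j ⌋)) (allFin n)) (allFin n)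

colourable : {n : ℕ} → ℕ → Graph n → Bool
colourable {n} k G = any (isProper G) (funs (allFin k) n)

-- Chromatic number: least k (≤ n) such that G is k-colourable
-- (every graph on n vertices is n-colourable, so the search always succeeds).
firstColourable : {n : ℕ} → Graph n → List ℕ → ℕ
firstColourable {n} G [] = n
firstColourable {n} G (k ∷ ks) = if colourable k G then k else firstColourable G ks

χ : {n : ℕ} → Graph n → ℕ
χ {n} G = firstColourable G (upTo (suc n))

probList : {A : Set} → (A → Bool) → List A → ℚ
probList P xs with length xs
... | zero = 0ℚ
... | suc m = (+ length (bfilter P xs)) / suc m

Pr : (n d : ℕ) → (Graph n → Bool) → ℚ
Pr n d P = probList P (regularGraphs n d)

χIn : {n : ℕ} → ℕ → Graph n → Bool
χIn t G = (χ G ≡ᵇ t) ∨ (χ G ≡ᵇ suc t)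

module Submission where

-- Replacing two edges ab, xy of a regular graph by ax, by is reversible, so counting such switchings compares the
-- numbers of regular graphs with and without a given structure. Applied to the exposure of a random regular graph edge
-- by edge, it shows that a function changed by O(1) by every switching has bounded martingale differences. For the least
-- number of monochromatic darts over all t-colourings (with classes of size at most α), the variance of the martingale
-- is of smaller order than Λ², where Λ is √n times a power of log n. Let t be least such that t-colourability is not
-- too unlikely: by Chebyshev, almost every graph has a t-colouring with fewer than Λ monochromatic darts. Small sets of
-- vertices span few edges, so the endpoints of these darts can be recoloured greedily, at the cost of a single new colour
-- for their neighbours; hence almost every graph is (t + 1)-colourable.

open import Defs
open import Data.Bool using (Bool; true; false; _∧_; _∨_; not; if_then_else_; _xor_)
open import Data.Bool.ListAction using (all; any)
open import Data.Nat using (ℕ; zero; suc; pred; _+_; _*_; _∸_; _^_; _⊓_; ∣_-_∣; _≡ᵇ_; _≤_; _<_; _≥_; z≤n; s≤s; NonZero; ⌊_/2⌋; ⌈_/2⌉; _!; >-nonZero; >-nonZero⁻¹) renaming (_/_ to _div_; _%_ to _mod_)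
open import Data.Nat.Properties hiding (_≟_)
open import Data.Nat.DivMod using (m≡m%n+[m/n]*n; m%n<n; m/n*n≤m; /-monoʳ-≤)
open import Data.Nat.Divisibility using (_∣_; divides)
open import Data.Nat.Tactic.RingSolver using (solve-∀)
open import Data.Fin using (Fin; toℕ; fromℕ<; inject₁; fromℕ) renaming (zero to fzero; suc to fsuc)
open import Data.Fin.Properties using (_≟_; toℕ<n; toℕ-injective; toℕ-fromℕ<; inject₁-injective; fromℕ≢inject₁)
open import Data.List using (List; []; _∷_; _++_; map; concatMap; length; allFin; lookup; tabulate; applyUpTo)
import Data.List.Relation.Unary.Any as Any
open Any using (Any; here; there; index)
open import Data.List.Relation.Unary.Any.Properties using (lookup-index; concatMap⁺; map⁺)
open import Data.Product using (∃; _×_; _,_; proj₁; proj₂)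
open import Data.Sum using (_⊎_; inj₁; inj₂)
open import Data.Empty using (⊥; ⊥-elim)
open import Function using (_∘_)
open import Relation.Nullary using (¬_; Dec; yes; no)
open import Relation.Nullary.Decidable using (⌊_⌋)
open import Relation.Binary.PropositionalEquality using (_≡_; _≢_; _≗_; refl; sym; trans; cong; cong₂; subst; subst₂; module ≡-Reasoning)

-- The obstacle is the size of the variance. A switching changes the defect by at most 4, which over
-- nd / 2 exposed edges would only give variance O(nd), too much for Λ of order √n. But the defect
-- increases only if a new edge falls inside a class of an optimal colouring, and classes have at
-- most α vertices. So the conditional mean lies in an interval [-q, p] about its average with one
-- side short, and a centred variable there has variance at most p q. The total becomes αd log n,
-- that is n up to powers of the logarithm, plus error terms of switchings. Second moments suffice
-- because t-colourability has probability at least a constant 1 / (3e). Hence everything stays in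
-- ℕ: probabilities are sums over regular graphs, and all ratios are cross-multiplied. Two ranges of
-- d are needed. Up to a power of log n, three colours must suffice to repair a colouring, and α = n
-- is affordable. Beyond it, large independent sets are excluded, t is at least of order d / log n,
-- and the many colours make the repair easy.

⟦_⟧ : Bool → ℕ
⟦ true ⟧ = 1
⟦ false ⟧ = 0

infix 7 _==_
_==_ : ∀ {n} → Fin n → Fin n → Bool
i == j = ⌊ i ≟ j ⌋

==-refl : ∀ {n} (i : Fin n) → (i == i) ≡ true
==-refl i with i ≟ i
... | yes _ = refl
... | no ¬p = ⊥-elim (¬p refl)

==⇒≡ : ∀ {n} {i j : Fin n} → (i == j) ≡ true → i ≡ j
==⇒≡ {i = i} {j} e with i ≟ j
... | yes p = p

≢⇒== : ∀ {n} {i j : Fin n} → i ≢ j → (i == j) ≡ false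
≢⇒== {i = i} {j} ne with i ≟ j
... | yes p = ⊥-elim (ne p)
... | no _ = refl

==-sym : ∀ {n} (i j : Fin n) → (i == j) ≡ (j == i)
==-sym i j with i ≟ j | j ≟ i
... | yes _ | yes _ = refl
... | no _ | no _ = refl
... | yes p | no q = ⊥-elim (q (sym p))
... | no p | yes q = ⊥-elim (p (sym q))

∧-split : ∀ {a b} → a ∧ b ≡ true → a ≡ true × b ≡ true
∧-split {true} {true} _ = refl , refl

∧-join : ∀ {a b} → a ≡ true → b ≡ true → a ∧ b ≡ true
∧-join refl refl = refl

∨-split : ∀ {a b} → a ∨ b ≡ true → a ≡ true ⊎ b ≡ true
∨-split {true} _ = inj₁ refl
∨-split {false} e = inj₂ e

not-true : ∀ {b} → b ≡ false → not b ≡ true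
not-true refl = refl

not-false : ∀ {b} → not b ≡ true → b ≡ false
not-false {false} _ = refl

true≢false : ∀ {b} → b ≡ true → b ≡ false → ⊥
true≢false refl ()

bool-cases : ∀ b → b ≡ true ⊎ b ≡ false
bool-cases true = inj₁ refl
bool-cases false = inj₂ refl

⟦⟧≤1 : ∀ b → ⟦ b ⟧ ≤ 1
⟦⟧≤1 true = ≤-refl
⟦⟧≤1 false = z≤n

⟦∧⟧ : ∀ a b → ⟦ a ∧ b ⟧ ≡ ⟦ a ⟧ * ⟦ b ⟧
⟦∧⟧ true b = sym (*-identityˡ _)
⟦∧⟧ false b = refl

⟦⟧-mono : ∀ {a b} → (a ≡ true → b ≡ true) → ⟦ a ⟧ ≤ ⟦ b ⟧
⟦⟧-mono {true} {b} h rewrite h refl = ≤-refl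
⟦⟧-mono {false} h = z≤n

⟦⟧-true : ∀ {a} → a ≡ true → ⟦ a ⟧ ≡ 1
⟦⟧-true refl = refl

⟦⟧-false : ∀ {a} → a ≡ false → ⟦ a ⟧ ≡ 0
⟦⟧-false refl = refl

⟦⟧-pos : ∀ {a} → 0 < ⟦ a ⟧ → a ≡ true
⟦⟧-pos {true} _ = refl

⟦⟧-zero : ∀ {a} → ⟦ a ⟧ ≡ 0 → a ≡ false
⟦⟧-zero {false} _ = refl

⟦not⟧ : ∀ a → ⟦ a ⟧ + ⟦ not a ⟧ ≡ 1
⟦not⟧ true = refl
⟦not⟧ false = refl

⟦⟧*-mono : ∀ a {x y} → (a ≡ true → x ≤ y) → ⟦ a ⟧ * x ≤ ⟦ a ⟧ * y
⟦⟧*-mono true h = *-monoʳ-≤ 1 (h refl)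
⟦⟧*-mono false h = z≤n

⟦⟧*-cong : ∀ a {x y} → (a ≡ true → x ≡ y) → ⟦ a ⟧ * x ≡ ⟦ a ⟧ * y
⟦⟧*-cong true h = cong (1 *_) (h refl)
⟦⟧*-cong false h = refl

⟦⟧*≤ : ∀ a x → ⟦ a ⟧ * x ≤ x
⟦⟧*≤ true x = ≤-reflexive (*-identityˡ x)
⟦⟧*≤ false x = z≤n

bool-ext : ∀ {a b} → (a ≡ true → b ≡ true) → (b ≡ true → a ≡ true) → a ≡ b
bool-ext {true} {b} f g = sym (f refl)
bool-ext {false} {false} f g = refl
bool-ext {false} {true} f g with g refl
... | ()

-- Finite sums and counting

opaque
  sum : ∀ {n} → (Fin n → ℕ) → ℕ
  sum {zero} f = 0
  sum {suc n} f = f fzero + sum (f ∘ fsuc)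

  sum-cong : ∀ {n} {f g : Fin n → ℕ} → (∀ i → f i ≡ g i) → sum f ≡ sum g
  sum-cong {zero} h = refl
  sum-cong {suc n} h = cong₂ _+_ (h fzero) (sum-cong (h ∘ fsuc))

  sum-+ : ∀ {n} (f g : Fin n → ℕ) → sum (λ i → f i + g i) ≡ sum f + sum g
  sum-+ {zero} f g = refl
  sum-+ {suc n} f g = trans (cong (f fzero + g fzero +_) (sum-+ (f ∘ fsuc) (g ∘ fsuc)))
    (lem (f fzero) (g fzero) (sum (f ∘ fsuc)) (sum (g ∘ fsuc)))
    where
    lem : ∀ a b c d → a + b + (c + d) ≡ a + c + (b + d)
    lem = solve-∀

  sum-*ˡ : ∀ {n} x (f : Fin n → ℕ) → sum (λ i → x * f i) ≡ x * sum f
  sum-*ˡ {zero} x f = sym (*-zeroʳ x)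
  sum-*ˡ {suc n} x f = trans (cong (x * f fzero +_) (sum-*ˡ x (f ∘ fsuc))) (sym (*-distribˡ-+ x (f fzero) _))

sum-*ʳ : ∀ {n} x (f : Fin n → ℕ) → sum (λ i → f i * x) ≡ sum f * x
sum-*ʳ x f = trans (sum-cong (λ i → *-comm (f i) x)) (trans (sum-*ˡ x f) (*-comm x (sum f)))

opaque
  unfolding sum
  sum-mono : ∀ {n} {f g : Fin n → ℕ} → (∀ i → f i ≤ g i) → sum f ≤ sum g
  sum-mono {zero} h = z≤n
  sum-mono {suc n} h = +-mono-≤ (h fzero) (sum-mono (h ∘ fsuc))

  sum-const : ∀ n c → sum {n} (λ _ → c) ≡ n * c
  sum-const zero c = refl
  sum-const (suc n) c = cong (c +_) (sum-const n c)

  sum-zero : ∀ {n} {f : Fin n → ℕ} → (∀ i → f i ≡ 0) → sum f ≡ 0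
  sum-zero {n} h = trans (sum-cong h) (trans (sum-const n 0) (*-zeroʳ n))

  sum-term : ∀ {n} (f : Fin n → ℕ) i → f i ≤ sum f
  sum-term f fzero = m≤m+n _ _
  sum-term f (fsuc i) = ≤-trans (sum-term (f ∘ fsuc) i) (m≤n+m _ _)

  sum-bound : ∀ {n} {f : Fin n → ℕ} {c} → (∀ i → f i ≤ c) → sum f ≤ n * c
  sum-bound {n} {c = c} h = ≤-trans (sum-mono h) (≤-reflexive (sum-const n c))

  sum-pos : ∀ {n} (f : Fin n → ℕ) → 0 < sum f → ∃ λ i → 0 < f i
  sum-pos {suc n} f p with f fzero in eq
  ... | suc k = fzero , subst (0 <_) (sym eq) (s≤s z≤n)
  ... | zero with sum-pos (f ∘ fsuc) p
  ...   | i , q = fsuc i , q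

  sum-small : ∀ {n} (f : Fin n → ℕ) → sum f < n → ∃ λ i → f i ≡ 0
  sum-small {suc n} f p with f fzero in eq
  ... | zero = fzero , eq
  ... | suc k with sum-small (f ∘ fsuc) (≤-trans (s≤s (m≤n+m _ k)) (≤-pred p))
  ...   | i , q = fsuc i , q

  sum-δ : ∀ {n} (a : Fin n) (f : Fin n → ℕ) → sum (λ j → ⟦ a == j ⟧ * f j) ≡ f a
  sum-δ {suc n} fzero f = trans (cong₂ _+_ (*-identityˡ (f fzero)) (sum-zero {f = λ j → ⟦ fzero == fsuc j ⟧ * f (fsuc j)} (λ i → refl))) (+-identityʳ _)
  sum-δ {suc n} (fsuc a) f = trans (sum-cong (λ j → cong (λ b → ⟦ b ⟧ * f (fsuc j)) (lem j))) (sum-δ a (f ∘ fsuc))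
    where
    lem : ∀ j → (fsuc a == fsuc j) ≡ (a == j)
    lem j with a ≟ j
    ... | yes _ = refl
    ... | no _ = refl

  sum-comm : ∀ {m n} (f : Fin m → Fin n → ℕ) → sum (λ i → sum (f i)) ≡ sum (λ j → sum (λ i → f i j))
  sum-comm {zero} {n} f = sym (trans (sum-const n 0) (*-zeroʳ n))
  sum-comm {suc m} f = trans (cong (sum (f fzero) +_) (sum-comm (f ∘ fsuc))) (sym (sum-+ (f fzero) _))

count : ∀ {n} → (Fin n → Bool) → ℕ
count p = sum (λ i → ⟦ p i ⟧)

count≤ : ∀ {n} (p : Fin n → Bool) → count p ≤ n
count≤ {n} p = ≤-trans (sum-bound (λ i → ⟦⟧≤1 (p i))) (≤-reflexive (*-identityʳ n))

count-mono : ∀ {n} {p q : Fin n → Bool} → (∀ i → p i ≡ true → q i ≡ true) → count p ≤ count q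
count-mono h = sum-mono (λ i → ⟦⟧-mono (h i))

count-∨ : ∀ {n} (p q : Fin n → Bool) → count (λ i → p i ∨ q i) ≤ count p + count q
count-∨ p q = ≤-trans (sum-mono (λ i → lem (p i) (q i))) (≤-reflexive (sum-+ (λ i → ⟦ p i ⟧) (λ i → ⟦ q i ⟧)))
  where
  lem : ∀ a b → ⟦ a ∨ b ⟧ ≤ ⟦ a ⟧ + ⟦ b ⟧
  lem true b = s≤s z≤n
  lem false b = ≤-refl

some : ∀ {n} → (Fin n → Bool) → Bool
some {zero} p = false
some {suc n} p = p fzero ∨ some (p ∘ fsuc)

some-intro : ∀ {n} (p : Fin n → Bool) i → p i ≡ true → some p ≡ true
some-intro p fzero e rewrite e = refl
some-intro p (fsuc i) e with p fzero
... | true = refl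
... | false = some-intro (p ∘ fsuc) i e

some-elim : ∀ {n} (p : Fin n → Bool) → some p ≡ true → ∃ λ i → p i ≡ true
some-elim {suc n} p e with p fzero in eq
... | true = fzero , eq
... | false with some-elim (p ∘ fsuc) e
...   | i , q = fsuc i , q

some-cong : ∀ {n} {p q : Fin n → Bool} → p ≗ q → some p ≡ some q
some-cong {zero} h = refl
some-cong {suc n} h = cong₂ _∨_ (h fzero) (some-cong (h ∘ fsuc))

some-false : ∀ {n} (p : Fin n → Bool) → some p ≡ false → ∀ i → p i ≡ false
some-false p e i with bool-cases (p i)
... | inj₂ q = q
... | inj₁ q = ⊥-elim (true≢false (some-intro p i q) e)

some≤ : ∀ {n} (p : Fin n → Bool) → ⟦ some p ⟧ ≤ count p
some≤ p with some p in eq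
... | false = z≤n
... | true with some-elim p eq
...   | i , q = ≤-trans (≤-reflexive (sym (⟦⟧-true q))) (sum-term (λ i → ⟦ p i ⟧) i)

count-some : ∀ {m n} (p : Fin m → Fin n → Bool) → count (λ v → some (λ u → p u v)) ≤ sum (λ u → count (p u))
count-some p = ≤-trans (sum-mono (λ v → some≤ (λ u → p u v))) (≤-reflexive (sum-comm (λ v u → ⟦ p u v ⟧)))

every : ∀ {n} → (Fin n → Bool) → Bool
every p = not (some (not ∘ p))

every-intro : ∀ {n} (p : Fin n → Bool) → (∀ i → p i ≡ true) → every p ≡ true
every-intro p h with some (not ∘ p) in eq
... | false = refl
... | true with some-elim (not ∘ p) eq
...   | i , q = ⊥-elim (true≢false (h i) (not-false q))

every-elim : ∀ {n} (p : Fin n → Bool) → every p ≡ true → ∀ i → p i ≡ true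
every-elim p e i with p i in eq
... | true = refl
... | false = ⊥-elim (true≢false (some-intro (not ∘ p) i (not-true eq)) (not-false e))

sumₗ : ∀ {A : Set} → List A → (A → ℕ) → ℕ
sumₗ xs φ = sum (λ i → φ (lookup xs i))

opaque
  unfolding sum
  sumₗ-++ : ∀ {A : Set} (xs ys : List A) φ → sumₗ (xs ++ ys) φ ≡ sumₗ xs φ + sumₗ ys φ
  sumₗ-++ [] ys φ = refl
  sumₗ-++ (x ∷ xs) ys φ = trans (cong (φ x +_) (sumₗ-++ xs ys φ)) (sym (+-assoc (φ x) _ _))

  sumₗ-map : ∀ {A B : Set} (g : A → B) xs φ → sumₗ (map g xs) φ ≡ sumₗ xs (φ ∘ g)
  sumₗ-map g [] φ = refl
  sumₗ-map g (x ∷ xs) φ = cong (φ (g x) +_) (sumₗ-map g xs φ)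

  sumₗ-concatMap : ∀ {A B : Set} (g : A → List B) xs φ → sumₗ (concatMap g xs) φ ≡ sumₗ xs (λ x → sumₗ (g x) φ)
  sumₗ-concatMap g [] φ = refl
  sumₗ-concatMap g (x ∷ xs) φ = trans (sumₗ-++ (g x) (concatMap g xs) φ) (cong (sumₗ (g x) φ +_) (sumₗ-concatMap g xs φ))

  length-bfilter : ∀ {A : Set} (p : A → Bool) xs → length (bfilter p xs) ≡ sumₗ xs (⟦_⟧ ∘ p)
  length-bfilter p [] = refl
  length-bfilter p (x ∷ xs) with p x
  ... | true = cong suc (length-bfilter p xs)
  ... | false = length-bfilter p xs

  sumₗ-bfilter : ∀ {A : Set} (p : A → Bool) xs φ → sumₗ (bfilter p xs) φ ≡ sumₗ xs (λ x → ⟦ p x ⟧ * φ x)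
  sumₗ-bfilter p [] φ = refl
  sumₗ-bfilter p (x ∷ xs) φ with p x
  ... | true = cong₂ _+_ (sym (+-identityʳ _)) (sumₗ-bfilter p xs φ)
  ... | false = sumₗ-bfilter p xs φ

  sumₗ-tabulate : ∀ {A : Set} {n} (g : Fin n → A) φ → sumₗ (tabulate g) φ ≡ sum (φ ∘ g)
  sumₗ-tabulate {n = zero} g φ = refl
  sumₗ-tabulate {n = suc n} g φ = cong (φ (g fzero) +_) (sumₗ-tabulate (g ∘ fsuc) φ)

-- Sums over finite function spaces

infixr 5 _◂_
_◂_ : ∀ {A : Set} {n} → A → (Fin n → A) → Fin (suc n) → A
(x ◂ f) fzero = x
(x ◂ f) (fsuc i) = f i

-- Functions are compared through a pointwise relation, so everything is stated for summands that
-- respect it. The module is instantiated twice, for rows over Bool and for matrices over rows.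
module FunctionSpace {A : Set} (_~_ : A → A → Set) (~-refl : ∀ {x} → x ~ x) where

  Resp : ∀ {n} {B : Set} → ((Fin n → A) → B) → Set
  Resp φ = ∀ f g → (∀ i → f i ~ g i) → φ f ≡ φ g

  opaque
    unfolding sum
    single : ∀ (f : Fin 0 → A) (φ : (Fin 0 → A) → ℕ) (g : Fin 0 → A → A) → Resp φ →
      sumₗ (f ∷ []) φ ≡ sumₗ (f ∷ []) (λ f → φ (λ i → g i (f i)))
    single f φ g ext = cong (_+ 0) (ext _ _ (λ ()))

  sumₗ-funs : ∀ xs {n} (φ : (Fin (suc n) → A) → ℕ) → Resp φ →
    sumₗ (funs xs (suc n)) φ ≡ sumₗ xs (λ x → sumₗ (funs xs n) (λ f → φ (x ◂ f)))
  sumₗ-funs xs {n} φ ext = trans (sumₗ-concatMap _ xs φ)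
    (sum-cong (λ k → trans (sumₗ-map _ (funs xs n) φ)
      (sum-cong (λ l → ext _ (lookup xs k ◂ lookup (funs xs n) l) (λ { fzero → ~-refl ; (fsuc i) → ~-refl })))))

  -- Acting on each coordinate by a map that preserves sums preserves the sum over all functions:
  -- peel off the first coordinate and induct on the others.
  funs-invariant : ∀ xs {n} (g : Fin n → A → A) →
    (∀ i {x y} → x ~ y → g i x ~ g i y) →
    (∀ i (ψ : A → ℕ) → (∀ x y → x ~ y → ψ x ≡ ψ y) → sumₗ xs ψ ≡ sumₗ xs (ψ ∘ g i)) →
    ∀ φ → Resp φ → sumₗ (funs xs n) φ ≡ sumₗ (funs xs n) (λ f → φ (λ i → g i (f i)))
  funs-invariant xs {zero} g gr inv φ ext = single _ φ g ext
  funs-invariant xs {suc n} g gr inv φ ext = begin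
    sumₗ (funs xs (suc n)) φ
      ≡⟨ sumₗ-funs xs φ ext ⟩
    sumₗ xs (λ x → sumₗ (funs xs n) (λ f → φ (x ◂ f)))
      ≡⟨ inv fzero (λ x → sumₗ (funs xs n) (λ f → φ (x ◂ f)))
           (λ x y e → sum-cong (λ k → ext (x ◂ lookup (funs xs n) k) (y ◂ lookup (funs xs n) k) (λ { fzero → e ; (fsuc i) → ~-refl }))) ⟩
    sumₗ xs (λ x → sumₗ (funs xs n) (λ f → φ (g fzero x ◂ f)))
      ≡⟨ sum-cong (λ k → funs-invariant xs (g ∘ fsuc) (gr ∘ fsuc) (inv ∘ fsuc)
           (λ f → φ (g fzero (lookup xs k) ◂ f))
           (λ f f′ e → ext (g fzero (lookup xs k) ◂ f) (g fzero (lookup xs k) ◂ f′) (λ { fzero → ~-refl ; (fsuc i) → e i }))) ⟩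
    sumₗ xs (λ x → sumₗ (funs xs n) (λ f → φ (g fzero x ◂ (λ i → g (fsuc i) (f i)))))
      ≡⟨ sum-cong (λ k → sum-cong (λ l → ext
           (g fzero (lookup xs k) ◂ (λ i → g (fsuc i) (lookup (funs xs n) l i)))
           (λ i → g i ((lookup xs k ◂ lookup (funs xs n) l) i))
           (λ { fzero → ~-refl ; (fsuc i) → ~-refl }))) ⟩
    sumₗ xs (λ x → sumₗ (funs xs n) (λ f → φ (λ i → g i ((x ◂ f) i))))
      ≡⟨ sumₗ-funs xs (λ f → φ (λ i → g i (f i))) (λ f f′ e → ext _ _ (λ i → gr i (e i))) ⟨
    sumₗ (funs xs (suc n)) (λ f → φ (λ i → g i (f i))) ∎
    where open ≡-Reasoning

  any-cons : ∀ {n} {h : A → (Fin n → A) → Fin (suc n) → A} {f : Fin (suc n) → A} {fs} →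
    (∀ x f′ → x ~ f fzero → (∀ i → f′ i ~ f (fsuc i)) → ∀ i → h x f′ i ~ f i) →
    Any (λ f′ → ∀ i → f′ i ~ f (fsuc i)) fs → ∀ ys → Any (_~ f fzero) ys →
    Any (λ f′ → ∀ i → f′ i ~ f i) (concatMap (λ x → map (h x) fs) ys)
  any-cons {h = h} {f} {fs} hh af ys ay = concatMap⁺ (λ x → map (h x) fs)
    (Any.map (λ {x} e → map⁺ (Any.map (λ {f′} es → hh x f′ e es) af)) ay)

  funs-any : ∀ xs → (∀ x → Any (_~ x) xs) → ∀ {n} (f : Fin n → A) → Any (λ f′ → ∀ i → f′ i ~ f i) (funs xs n)
  funs-any xs all {zero} f = here (λ ())
  funs-any xs all {suc n} f = any-cons (λ x f′ e es → λ { fzero → e ; (fsuc i) → es i }) (funs-any xs all (f ∘ fsuc)) xs (all (f fzero))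

  funs-index : ∀ xs → (∀ x → Any (_~ x) xs) → ∀ {n} (f : Fin n → A) → ∃ λ k → ∀ i → lookup (funs xs n) k i ~ f i
  funs-index xs all f = index (funs-any xs all f) , lookup-index (funs-any xs all f)

-- Regular graphs and switchings

all-intro : ∀ {A : Set} {n} (p : A → Bool) (g : Fin n → A) → (∀ i → p (g i) ≡ true) → all p (tabulate g) ≡ true
all-intro {n = zero} p g h = refl
all-intro {n = suc n} p g h = ∧-join (h fzero) (all-intro p (g ∘ fsuc) (h ∘ fsuc))

all-elim : ∀ {A : Set} {n} (p : A → Bool) (g : Fin n → A) → all p (tabulate g) ≡ true → ∀ i → p (g i) ≡ true
all-elim p g e fzero = proj₁ (∧-split e)
all-elim p g e (fsuc i) = all-elim p (g ∘ fsuc) (proj₂ (∧-split {p (g fzero)} e)) i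

≡ᵇ-true : ∀ {m n} → (m ≡ᵇ n) ≡ true → m ≡ n
≡ᵇ-true {zero} {zero} _ = refl
≡ᵇ-true {suc m} {suc n} e = cong suc (≡ᵇ-true e)

≡ᵇ-refl : ∀ m → (m ≡ᵇ m) ≡ true
≡ᵇ-refl zero = refl
≡ᵇ-refl (suc m) = ≡ᵇ-refl m

infix 4 _≈_
_≈_ : ∀ {n} → Graph n → Graph n → Set
G ≈ H = ∀ i j → G i j ≡ H i j

Ext : ∀ {n} {B : Set} → (Graph n → B) → Set
Ext φ = ∀ G H → G ≈ H → φ G ≡ φ H

Symm : ∀ {n} → Graph n → Set
Symm G = ∀ i j → G i j ≡ G j i

record Regular {n} (d : ℕ) (G : Graph n) : Set where
  field
    symm : Symm G
    irr : ∀ i → G i i ≡ false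
    deg : ∀ i → count (G i) ≡ d

open Regular public

degree≡count : ∀ {n} (G : Graph n) i → degree G i ≡ count (G i)
degree≡count G i = trans (length-bfilter (G i) (allFin _)) (sumₗ-tabulate (λ j → j) (⟦_⟧ ∘ G i))

boolEq-true : ∀ {a b} → boolEq a b ≡ true → a ≡ b
boolEq-true {true} {true} _ = refl
boolEq-true {false} {false} _ = refl

boolEq-refl : ∀ {a b} → a ≡ b → boolEq a b ≡ true
boolEq-refl {true} refl = refl
boolEq-refl {false} refl = refl

regular⇒ : ∀ {n d} (G : Graph n) → isRegular d G ≡ true → Regular d G
regular⇒ {n} {d} G e = record
  { symm = λ i j → boolEq-true (all-elim (λ j → boolEq (G i j) (G j i)) (λ j → j) (proj₂ (∧-split {not (G i i)} (sim i))) j)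
  ; irr = λ i → not-false (proj₁ (∧-split {not (G i i)} (sim i)))
  ; deg = λ i → trans (sym (degree≡count G i)) (≡ᵇ-true (all-elim (λ i → degree G i ≡ᵇ d) (λ i → i) (proj₂ (∧-split {isSimple G} e)) i)) }
  where
  sim = all-elim (λ i → not (G i i) ∧ all (λ j → boolEq (G i j) (G j i)) (allFin n)) (λ i → i) (proj₁ (∧-split e))

regular⇐ : ∀ {n d} {G : Graph n} → Regular d G → isRegular d G ≡ true
regular⇐ {n} {d} {G} r = ∧-join
  (all-intro _ (λ i → i) (λ i → ∧-join (not-true (irr r i)) (all-intro _ (λ j → j) (λ j → boolEq-refl (symm r i j)))))
  (all-intro _ (λ i → i) (λ i → subst (λ k → (k ≡ᵇ d) ≡ true) (sym (trans (degree≡count G i) (deg r i))) (≡ᵇ-refl d)))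

regular-≈ : ∀ {n d} {G H : Graph n} → G ≈ H → Regular d G → Regular d H
regular-≈ e r = record
  { symm = λ i j → trans (sym (e i j)) (trans (symm r i j) (e j i))
  ; irr = λ i → trans (sym (e i i)) (irr r i)
  ; deg = λ i → trans (sum-cong (λ j → cong ⟦_⟧ (sym (e i j)))) (deg r i) }

isRegular-ext : ∀ {n} d → Ext {n} (isRegular d)
isRegular-ext d G H e = bool-ext
  (λ r → regular⇐ (regular-≈ e (regular⇒ G r)))
  (λ r → regular⇐ (regular-≈ (λ i j → sym (e i j)) (regular⇒ H r)))

opaque
  sumG : ∀ {n} → (Graph n → ℕ) → ℕ
  sumG {n} φ = sumₗ (allAdj n) φ

infixr 6 _⊕_
-- Graphs are added modulo 2. A switching then becomes translation by a fixed 4-cycle, a permutation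
-- of all adjacency functions, and no inverse map has to be constructed.
_⊕_ : ∀ {n} → Graph n → Graph n → Graph n
(P ⊕ G) i j = P i j xor G i j

module Rows = FunctionSpace {Bool} _≡_ refl
module Matrices {n : ℕ} = FunctionSpace {Fin n → Bool} _≗_ (λ _ → refl)

opaque
  unfolding sum
  sum-bits : ∀ b (ψ : Bool → ℕ) → sumₗ (true ∷ false ∷ []) ψ ≡ sumₗ (true ∷ false ∷ []) (λ c → ψ (b xor c))
  sum-bits true ψ = lem (ψ true) (ψ false)
    where
    lem : ∀ p q → p + (q + 0) ≡ q + (p + 0)
    lem = solve-∀
  sum-bits false ψ = refl

opaque
  unfolding sumG
  sumG-⊕ : ∀ {n} (P : Graph n) φ → Ext φ → sumG φ ≡ sumG (φ ∘ (P ⊕_))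
  sumG-⊕ P φ ext = Matrices.funs-invariant _ (λ i r j → P i j xor r j) (λ i e j → cong (P i j xor_) (e j))
    (λ i ψ ψ-ext → Rows.funs-invariant _ (λ j b → P i j xor b) (λ j e → cong (P i j xor_) e)
      (λ j ψ _ → sum-bits (P i j) ψ) ψ ψ-ext) φ ext

  sumG-mono : ∀ {n} {φ ψ : Graph n → ℕ} → (∀ G → φ G ≤ ψ G) → sumG φ ≤ sumG ψ
  sumG-mono h = sum-mono (λ k → h (lookup (allAdj _) k))

  sumG-cong : ∀ {n} {φ ψ : Graph n → ℕ} → (∀ G → φ G ≡ ψ G) → sumG φ ≡ sumG ψ
  sumG-cong h = sum-cong (λ k → h (lookup (allAdj _) k))

  sumG-+ : ∀ {n} (φ ψ : Graph n → ℕ) → sumG (λ G → φ G + ψ G) ≡ sumG φ + sumG ψ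
  sumG-+ φ ψ = sum-+ _ _

  sumG-*ˡ : ∀ {n} c (φ : Graph n → ℕ) → sumG (λ G → c * φ G) ≡ c * sumG φ
  sumG-*ˡ c φ = sum-*ˡ c _

  sumG-sum : ∀ {n m} (φ : Fin m → Graph n → ℕ) → sumG (λ G → sum (λ i → φ i G)) ≡ sum (λ i → sumG (φ i))
  sumG-sum {n} φ = sum-comm (λ k i → φ i (lookup (allAdj n) k))

pair : ∀ {n} → Fin n → Fin n → Graph n
pair a b i j = (a == i ∧ b == j) ∨ (b == i ∧ a == j)

-- The 4-cycle a b y x, whose edges a b and x y are exchanged for a x and b y.
square : ∀ {n} → Fin n → Fin n → Fin n → Fin n → Graph n
square a b x y i j = (pair a b i j ∨ pair x y i j) ∨ (pair a x i j ∨ pair b y i j)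

switch : ∀ {n} → Fin n → Fin n → Fin n → Fin n → Graph n → Graph n
switch a b x y G = square a b x y ⊕ G

-- In a regular graph these conditions already force the four vertices to be distinct: `a b` and
-- `x y` are edges, `a x` and `b y` are not, and there are no loops.
valid : ∀ {n} → Graph n → Fin n → Fin n → Fin n → Fin n → Bool
valid G a b x y = (G a b ∧ G x y) ∧ ((not (G a x) ∧ not (a == x)) ∧ (not (G b y) ∧ not (b == y)))

record Valid {n} (G : Graph n) (a b x y : Fin n) : Set where
  field
    ab : G a b ≡ true
    xy : G x y ≡ true
    ax : G a x ≡ false
    by : G b y ≡ false
    a≢x : a ≢ x
    b≢y : b ≢ y

==false⇒≢ : ∀ {n} {i j : Fin n} → (i == j) ≡ false → i ≢ j
==false⇒≢ {i = i} e refl = true≢false (==-refl i) e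

valid⇒ : ∀ {n} {G : Graph n} {a b x y} → valid G a b x y ≡ true → Valid G a b x y
valid⇒ {G = G} {a} {b} {x} {y} e = record
  { ab = proj₁ (∧-split (proj₁ s)) ; xy = proj₂ (∧-split {G a b} (proj₁ s))
  ; ax = not-false (proj₁ s₁) ; by = not-false (proj₁ s₂)
  ; a≢x = ==false⇒≢ (not-false (proj₂ s₁)) ; b≢y = ==false⇒≢ (not-false (proj₂ s₂)) }
  where
  s = ∧-split {G a b ∧ G x y} e
  t = ∧-split {not (G a x) ∧ not (a == x)} (proj₂ s)
  s₁ = ∧-split {not (G a x)} (proj₁ t)
  s₂ = ∧-split {not (G b y)} (proj₂ t)

valid⇐ : ∀ {n} {G : Graph n} {a b x y} → Valid G a b x y → valid G a b x y ≡ true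
valid⇐ v = ∧-join (∧-join ab xy) (∧-join (∧-join (not-true ax) (not-true (≢⇒== a≢x))) (∧-join (not-true by) (not-true (≢⇒== b≢y))))
  where open Valid v

valid-ext : ∀ {n} (a b x y : Fin n) → Ext (λ G → valid G a b x y)
valid-ext a b x y G H e rewrite e a b | e x y | e a x | e b y = refl

-- A vertex is one of the four switched ones or none of them, so an entry of the switched matrix is
-- determined by a pair of roles: 25 cases that hold by computation.
data Role : Set where
  ra rb rx ry ro : Role

isA isB isX isY : Role → Bool
isA ra = true
isA _ = false
isB rb = true
isB _ = false
isX rx = true
isX _ = false
isY ry = true
isY _ = false

module Switch {n d} {G : Graph n} (R : Regular d G) {a b x y} (V : Valid G a b x y) where
  open Valid V

  a≢b : a ≢ b
  a≢b refl = true≢false ab (irr R a)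
  x≢y : x ≢ y
  x≢y refl = true≢false xy (irr R x)
  b≢x : b ≢ x
  b≢x refl = true≢false ab ax
  a≢y : a ≢ y
  a≢y refl = true≢false (trans (symm R a x) xy) ax

  role : Fin n → Role
  role i = if a == i then ra else if b == i then rb else if x == i then rx else if y == i then ry else ro

  private
    off : ∀ {p q : Fin n} (i : Fin n) → p ≢ q → (p == i) ≡ true → (q == i) ≡ false
    off {p} {q} i ne e = ≢⇒== (λ q≡i → ne (trans (==⇒≡ e) (sym q≡i)))

  roleA : ∀ i → isA (role i) ≡ (a == i)
  roleA i with a == i | b == i | x == i | y == i
  ... | true | _ | _ | _ = refl
  ... | false | true | _ | _ = refl
  ... | false | false | true | _ = refl
  ... | false | false | false | true = refl
  ... | false | false | false | false = refl

  roleB : ∀ i → isB (role i) ≡ (b == i)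
  roleB i with a == i in e | b == i in e′ | x == i | y == i
  ... | true | true | _ | _ = ⊥-elim (true≢false e′ (off i a≢b e))
  ... | true | false | _ | _ = refl
  ... | false | true | _ | _ = refl
  ... | false | false | true | _ = refl
  ... | false | false | false | true = refl
  ... | false | false | false | false = refl

  roleX : ∀ i → isX (role i) ≡ (x == i)
  roleX i with a == i in e | b == i in e′ | x == i in e″ | y == i
  ... | true | _ | true | _ = ⊥-elim (true≢false e″ (off i a≢x e))
  ... | true | _ | false | _ = refl
  ... | false | true | true | _ = ⊥-elim (true≢false e″ (off i b≢x e′))
  ... | false | true | false | _ = refl
  ... | false | false | true | _ = refl
  ... | false | false | false | true = refl
  ... | false | false | false | false = refl

  roleY : ∀ i → isY (role i) ≡ (y == i)
  roleY i with a == i in e | b == i in e′ | x == i in e″ | y == i in e‴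
  ... | true | _ | _ | true = ⊥-elim (true≢false e‴ (off i a≢y e))
  ... | true | _ | _ | false = refl
  ... | false | true | _ | true = ⊥-elim (true≢false e‴ (off i b≢y e′))
  ... | false | true | _ | false = refl
  ... | false | false | true | true = ⊥-elim (true≢false e‴ (off i x≢y e″))
  ... | false | false | true | false = refl
  ... | false | false | false | true = refl
  ... | false | false | false | false = refl

  private
    isA⇒ : ∀ {i} → role i ≡ ra → a ≡ i
    isA⇒ {i} e = ==⇒≡ (trans (sym (roleA i)) (cong isA e))
    isB⇒ : ∀ {i} → role i ≡ rb → b ≡ i
    isB⇒ {i} e = ==⇒≡ (trans (sym (roleB i)) (cong isB e))
    isX⇒ : ∀ {i} → role i ≡ rx → x ≡ i
    isX⇒ {i} e = ==⇒≡ (trans (sym (roleX i)) (cong isX e))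
    isY⇒ : ∀ {i} → role i ≡ ry → y ≡ i
    isY⇒ {i} e = ==⇒≡ (trans (sym (roleY i)) (cong isY e))

    pairᵇ : (a₁ b₁ a₂ b₂ : Bool) → Bool
    pairᵇ a₁ b₁ a₂ b₂ = (a₁ ∧ b₂) ∨ (b₁ ∧ a₂)

    squareᵇ : (a₁ b₁ x₁ y₁ a₂ b₂ x₂ y₂ : Bool) → Bool
    squareᵇ a₁ b₁ x₁ y₁ a₂ b₂ x₂ y₂ =
      (pairᵇ a₁ b₁ a₂ b₂ ∨ pairᵇ x₁ y₁ x₂ y₂) ∨ (pairᵇ a₁ x₁ a₂ x₂ ∨ pairᵇ b₁ y₁ b₂ y₂)

    dartsᵇ : (a₁ b₁ x₁ y₁ a₂ b₂ x₂ y₂ : Bool) → ℕ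
    dartsᵇ a₁ b₁ x₁ y₁ a₂ b₂ x₂ y₂ = (⟦ a₁ ⟧ * ⟦ b₂ ⟧ + ⟦ b₁ ⟧ * ⟦ a₂ ⟧) + (⟦ x₁ ⟧ * ⟦ y₂ ⟧ + ⟦ y₁ ⟧ * ⟦ x₂ ⟧)

    goal : Role → Role → Bool → Set
    goal r s g = ⟦ squareᵇ (isA r) (isB r) (isX r) (isY r) (isA s) (isB s) (isX s) (isY s) xor g ⟧
        + dartsᵇ (isA r) (isB r) (isX r) (isY r) (isA s) (isB s) (isX s) (isY s)
      ≡ ⟦ g ⟧ + dartsᵇ (isA r) (isX r) (isB r) (isY r) (isA s) (isX s) (isB s) (isY s)

    entry : ∀ {i j p q} {v : Bool} → p ≡ i → q ≡ j → G p q ≡ v → G i j ≡ v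
    entry refl refl e = e

    flipped : ∀ {i j v} → G i j ≡ v → G j i ≡ v
    flipped {i} {j} e = trans (symm R j i) e

    table : ∀ i j r s → role i ≡ r → role j ≡ s → goal r s (G i j)
    table i j ra rb e f = subst (goal ra rb) (sym (entry (isA⇒ e) (isB⇒ f) ab)) refl
    table i j rb ra e f = subst (goal rb ra) (sym (entry (isB⇒ e) (isA⇒ f) (flipped ab))) refl
    table i j rx ry e f = subst (goal rx ry) (sym (entry (isX⇒ e) (isY⇒ f) xy)) refl
    table i j ry rx e f = subst (goal ry rx) (sym (entry (isY⇒ e) (isX⇒ f) (flipped xy))) refl
    table i j ra rx e f = subst (goal ra rx) (sym (entry (isA⇒ e) (isX⇒ f) ax)) refl
    table i j rx ra e f = subst (goal rx ra) (sym (entry (isX⇒ e) (isA⇒ f) (flipped ax))) refl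
    table i j rb ry e f = subst (goal rb ry) (sym (entry (isB⇒ e) (isY⇒ f) by)) refl
    table i j ry rb e f = subst (goal ry rb) (sym (entry (isY⇒ e) (isB⇒ f) (flipped by))) refl
    table i j ra ra e f = refl
    table i j ra ry e f = refl
    table i j ra ro e f = refl
    table i j rb rb e f = refl
    table i j rb rx e f = refl
    table i j rb ro e f = refl
    table i j rx rx e f = refl
    table i j rx rb e f = refl
    table i j rx ro e f = refl
    table i j ry ry e f = refl
    table i j ry ra e f = refl
    table i j ry ro e f = refl
    table i j ro ra e f = refl
    table i j ro rb e f = refl
    table i j ro rx e f = refl
    table i j ro ry e f = refl
    table i j ro ro e f = refl

  darts : Fin n → Fin n → Fin n → Fin n → Fin n → Fin n → ℕ
  darts a b x y i j = (⟦ a == i ⟧ * ⟦ b == j ⟧ + ⟦ b == i ⟧ * ⟦ a == j ⟧) + (⟦ x == i ⟧ * ⟦ y == j ⟧ + ⟦ y == i ⟧ * ⟦ x == j ⟧)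

  -- Removed darts stand on the left and inserted darts on the right, which expresses the signed
  -- change of an entry as an equation in ℕ.
  switch-entry : ∀ i j → ⟦ switch a b x y G i j ⟧ + darts a b x y i j ≡ ⟦ G i j ⟧ + darts a x b y i j
  switch-entry i j with table i j (role i) (role j) refl refl
  ... | t rewrite roleA i | roleB i | roleX i | roleY i | roleA j | roleB j | roleX j | roleY j = t

-- Double sums, and the effect of a switching on weights of darts

opaque
  sum₂ : ∀ {m n} → (Fin m → Fin n → ℕ) → ℕ
  sum₂ w = sum (λ i → sum (w i))

  sum₂-cong : ∀ {m n} {f g : Fin m → Fin n → ℕ} → (∀ i j → f i j ≡ g i j) → sum₂ f ≡ sum₂ g
  sum₂-cong h = sum-cong (λ i → sum-cong (h i))

  sum₂-mono : ∀ {m n} {f g : Fin m → Fin n → ℕ} → (∀ i j → f i j ≤ g i j) → sum₂ f ≤ sum₂ g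
  sum₂-mono h = sum-mono (λ i → sum-mono (h i))

  sum₂-+ : ∀ {m n} (f g : Fin m → Fin n → ℕ) → sum₂ (λ i j → f i j + g i j) ≡ sum₂ f + sum₂ g
  sum₂-+ f g = trans (sum-cong (λ i → sum-+ (f i) (g i))) (sum-+ _ _)

  sum₂-*ˡ : ∀ {m n} x (f : Fin m → Fin n → ℕ) → sum₂ (λ i j → x * f i j) ≡ x * sum₂ f
  sum₂-*ˡ x f = trans (sum-cong (λ i → sum-*ˡ x (f i))) (sum-*ˡ x _)

  sum₂-product : ∀ {m n} (f : Fin m → ℕ) (g : Fin n → ℕ) → sum₂ (λ i j → f i * g j) ≡ sum f * sum g
  sum₂-product f g = trans (sum-cong (λ i → sum-*ˡ (f i) g)) (sum-*ʳ (sum g) f)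

  sum₂-δ : ∀ {m n} (a : Fin m) (b : Fin n) (w : Fin m → Fin n → ℕ) → sum₂ (λ i j → ⟦ a == i ⟧ * ⟦ b == j ⟧ * w i j) ≡ w a b
  sum₂-δ a b w = begin
    sum₂ (λ i j → ⟦ a == i ⟧ * ⟦ b == j ⟧ * w i j)
      ≡⟨ sum₂-cong (λ i j → *-assoc ⟦ a == i ⟧ ⟦ b == j ⟧ (w i j)) ⟩
    sum₂ (λ i j → ⟦ a == i ⟧ * (⟦ b == j ⟧ * w i j))
      ≡⟨ sum-cong (λ i → trans (sum-*ˡ ⟦ a == i ⟧ _) (cong (⟦ a == i ⟧ *_) (sum-δ b (w i)))) ⟩
    sum (λ i → ⟦ a == i ⟧ * w i b)
      ≡⟨ sum-δ a (λ i → w i b) ⟩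
    w a b ∎
    where open ≡-Reasoning

  sum₂-swap : ∀ {m n} (w : Fin m → Fin n → ℕ) → sum₂ w ≡ sum₂ (λ j i → w i j)
  sum₂-swap w = sum-comm w

  sum₂-rows : ∀ {m n} (w : Fin m → Fin n → ℕ) → sum₂ w ≡ sum (λ i → sum (w i))
  sum₂-rows w = refl

weight : ∀ {n} → (Fin n → Fin n → ℕ) → Graph n → ℕ
weight w G = sum₂ (λ i j → w i j * ⟦ G i j ⟧)

weight-cong : ∀ {n} {w w′ : Fin n → Fin n → ℕ} {G H : Graph n} → (∀ i j → w i j ≡ w′ i j) → G ≈ H → weight w G ≡ weight w′ H
weight-cong h e = sum₂-cong (λ i j → cong₂ (λ p q → p * ⟦ q ⟧) (h i j) (e i j))

weight-row : ∀ {n} (k : Fin n) (G : Graph n) → weight (λ i _ → ⟦ k == i ⟧) G ≡ count (G k)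
weight-row k G = trans (sum₂-rows (λ i j → ⟦ k == i ⟧ * ⟦ G i j ⟧)) (trans (sum-cong (λ i → sum-*ˡ ⟦ k == i ⟧ (λ j → ⟦ G i j ⟧))) (sum-δ k (λ i → count (G i))))

pair-self : ∀ {n} (a b : Fin n) → pair a b a b ≡ true
pair-self a b rewrite ==-refl a | ==-refl b = refl

∧∨-swap : ∀ p q r s → (p ∧ q) ∨ (r ∧ s) ≡ (s ∧ r) ∨ (q ∧ p)
∧∨-swap true true true true = refl
∧∨-swap true true true false = refl
∧∨-swap true true false true = refl
∧∨-swap true true false false = refl
∧∨-swap true false true true = refl
∧∨-swap true false true false = refl
∧∨-swap true false false true = refl
∧∨-swap true false false false = refl
∧∨-swap false q true true = refl
∧∨-swap false true true false = refl
∧∨-swap false false true false = refl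
∧∨-swap false true false true = refl
∧∨-swap false false false true = refl
∧∨-swap false true false false = refl
∧∨-swap false false false false = refl

pair-symm : ∀ {n} (a b : Fin n) → Symm (pair a b)
pair-symm a b i j = ∧∨-swap (a == i) (b == j) (b == i) (a == j)

square-symm : ∀ {n} (a b x y : Fin n) → Symm (square a b x y)
square-symm a b x y i j = cong₂ _∨_ (cong₂ _∨_ (pair-symm a b i j) (pair-symm x y i j)) (cong₂ _∨_ (pair-symm a x i j) (pair-symm b y i j))

∨-true : ∀ {a b} → a ≡ true ⊎ b ≡ true → a ∨ b ≡ true
∨-true (inj₁ refl) = refl
∨-true {true} (inj₂ refl) = refl
∨-true {false} (inj₂ refl) = refl

module SwitchProps {n d} {G : Graph n} (R : Regular d G) {a b x y} (V : Valid G a b x y) where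
  open Switch R V public
  open Valid V public

  G′ : Graph n
  G′ = switch a b x y G

  darts-sum : ∀ (w : Fin n → Fin n → ℕ) a b x y →
    sum₂ (λ i j → w i j * darts a b x y i j) ≡ (w a b + w b a) + (w x y + w y x)
  darts-sum w a b x y = begin
    sum₂ (λ i j → w i j * darts a b x y i j)
      ≡⟨ sum₂-cong (λ i j → expand (w i j) (⟦ a == i ⟧ * ⟦ b == j ⟧) (⟦ b == i ⟧ * ⟦ a == j ⟧) (⟦ x == i ⟧ * ⟦ y == j ⟧) (⟦ y == i ⟧ * ⟦ x == j ⟧)) ⟩
    sum₂ (λ i j → (e a b i j + e b a i j) + (e x y i j + e y x i j))
      ≡⟨ sum₂-+ (λ i j → e a b i j + e b a i j) (λ i j → e x y i j + e y x i j) ⟩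
    sum₂ (λ i j → e a b i j + e b a i j) + sum₂ (λ i j → e x y i j + e y x i j)
      ≡⟨ cong₂ _+_ (trans (sum₂-+ (e a b) (e b a)) (cong₂ _+_ (sum₂-δ a b w) (sum₂-δ b a w)))
                   (trans (sum₂-+ (e x y) (e y x)) (cong₂ _+_ (sum₂-δ x y w) (sum₂-δ y x w))) ⟩
    (w a b + w b a) + (w x y + w y x) ∎
    where
    open ≡-Reasoning
    e : Fin n → Fin n → Fin n → Fin n → ℕ
    e p q i j = ⟦ p == i ⟧ * ⟦ q == j ⟧ * w i j
    expand : ∀ w p q r s → w * ((p + q) + (r + s)) ≡ (p * w + q * w) + (r * w + s * w)
    expand = solve-∀

  -- Every effect of a switching is read off here by a choice of `w`: the indicator of a row gives
  -- degrees, that of a set the darts inside it, that of equal colours the monochromatic darts.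
  balance : ∀ (w : Fin n → Fin n → ℕ) →
    weight w G′ + ((w a b + w b a) + (w x y + w y x)) ≡ weight w G + ((w a x + w x a) + (w b y + w y b))
  balance w = begin
    weight w G′ + ((w a b + w b a) + (w x y + w y x))
      ≡⟨ cong (weight w G′ +_) (darts-sum w a b x y) ⟨
    weight w G′ + sum₂ (λ i j → w i j * darts a b x y i j)
      ≡⟨ sum₂-+ (λ i j → w i j * ⟦ G′ i j ⟧) (λ i j → w i j * darts a b x y i j) ⟨
    sum₂ (λ i j → w i j * ⟦ G′ i j ⟧ + w i j * darts a b x y i j)
      ≡⟨ sum₂-cong (λ i j → trans (sym (*-distribˡ-+ (w i j) _ _)) (trans (cong (w i j *_) (switch-entry i j)) (*-distribˡ-+ (w i j) _ _))) ⟩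
    sum₂ (λ i j → w i j * ⟦ G i j ⟧ + w i j * darts a x b y i j)
      ≡⟨ sum₂-+ (λ i j → w i j * ⟦ G i j ⟧) (λ i j → w i j * darts a x b y i j) ⟩
    weight w G + sum₂ (λ i j → w i j * darts a x b y i j)
      ≡⟨ cong (weight w G +_) (darts-sum w a x b y) ⟩
    weight w G + ((w a x + w x a) + (w b y + w y b)) ∎
    where open ≡-Reasoning

  regular′ : Regular d G′
  regular′ = record { symm = sy ; irr = ir ; deg = de }
    where
    sy : Symm G′
    sy i j = cong₂ _xor_ (square-symm a b x y i j) (symm R i j)
    clash : ∀ {p q} i → p ≢ q → ⟦ p == i ⟧ * ⟦ q == i ⟧ ≡ 0
    clash {p} {q} i ne with p == i in e | q == i in e′
    ... | true | true = ⊥-elim (ne (trans (==⇒≡ e) (sym (==⇒≡ e′))))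
    ... | true | false = refl
    ... | false | _ = refl
    ir : ∀ i → G′ i i ≡ false
    ir i = ⟦⟧-zero (n≤0⇒n≡0 (≤-trans (m≤m+n _ (darts a b x y i i)) (≤-reflexive (trans (switch-entry i i) zeros))))
      where
      zeros : ⟦ G i i ⟧ + darts a x b y i i ≡ 0
      zeros rewrite irr R i | clash i a≢x | clash i (a≢x ∘ sym) | clash i b≢y | clash i (b≢y ∘ sym) = refl
    de : ∀ k → count (G′ k) ≡ d
    de k = trans (sym (weight-row k G′)) (trans (+-cancelʳ-≡ _ (weight (λ i _ → ⟦ k == i ⟧) G′) _
      (trans (balance (λ i _ → ⟦ k == i ⟧)) (cong (weight (λ i _ → ⟦ k == i ⟧) G +_) (perm ⟦ k == a ⟧ ⟦ k == b ⟧ ⟦ k == x ⟧ ⟦ k == y ⟧))))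
      (trans (weight-row k G) (deg R k)))
      where
      perm : ∀ a b x y → (a + x) + (b + y) ≡ (a + b) + (x + y)
      perm = solve-∀

  valid′ : Valid G′ a x b y
  valid′ = record
    { ab = trans (cong (_xor G a x) (∨-true {pair a b a x ∨ pair x y a x} (inj₂ (∨-true (inj₁ (pair-self a x)))))) (cong not ax)
    ; xy = trans (cong (_xor G b y) (∨-true {pair a b b y ∨ pair x y b y} (inj₂ (∨-true {pair a x b y} (inj₂ (pair-self b y)))))) (cong not by)
    ; ax = trans (cong (_xor G a b) (∨-true (inj₁ (∨-true (inj₁ (pair-self a b)))))) (cong not ab)
    ; by = trans (cong (_xor G x y) (∨-true (inj₁ (∨-true {pair a b x y} (inj₂ (pair-self x y)))))) (cong not xy)
    ; a≢x = a≢b ; b≢y = x≢y }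

-- Double counting by switchings

opaque
  sumR : ∀ {n} → ℕ → (Graph n → ℕ) → ℕ
  sumR d φ = sumG (λ G → ⟦ isRegular d G ⟧ * φ G)

module _ {n : ℕ} (d : ℕ) where

  opaque
    unfolding sumR
    sumR-mono : ∀ {φ ψ : Graph n → ℕ} → (∀ G → Regular d G → φ G ≤ ψ G) → sumR d φ ≤ sumR d ψ
    sumR-mono h = sumG-mono (λ G → ⟦⟧*-mono (isRegular d G) (λ e → h G (regular⇒ G e)))

    sumR-cong : ∀ {φ ψ : Graph n → ℕ} → (∀ G → Regular d G → φ G ≡ ψ G) → sumR d φ ≡ sumR d ψ
    sumR-cong h = sumG-cong (λ G → ⟦⟧*-cong (isRegular d G) (λ e → h G (regular⇒ G e)))

    sumR-+ : ∀ (φ ψ : Graph n → ℕ) → sumR d (λ G → φ G + ψ G) ≡ sumR d φ + sumR d ψ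
    sumR-+ φ ψ = trans (sumG-cong (λ G → *-distribˡ-+ ⟦ isRegular d G ⟧ (φ G) (ψ G))) (sumG-+ _ _)

    sumR-*ˡ : ∀ c (φ : Graph n → ℕ) → sumR d (λ G → c * φ G) ≡ c * sumR d φ
    sumR-*ˡ c φ = trans (sumG-cong (λ G → comm ⟦ isRegular d G ⟧ c (φ G))) (sumG-*ˡ c _)
      where
      comm : ∀ r c p → r * (c * p) ≡ c * (r * p)
      comm = solve-∀

    sumR-sum : ∀ {m} (φ : Fin m → Graph n → ℕ) → sumR d (λ G → sum (λ i → φ i G)) ≡ sum (λ i → sumR d (φ i))
    sumR-sum φ = trans (sumG-cong (λ G → sym (sum-*ˡ ⟦ isRegular d G ⟧ (λ i → φ i G)))) (sumG-sum (λ i G → ⟦ isRegular d G ⟧ * φ i G))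

    -- The elementary double count: for fixed a, b, x, y the switch carries the regular graphs where
    -- it is valid to regular graphs where the inverse switch is valid. All switching bounds are
    -- sums of this one.
    move : ∀ a b x y (u v : Graph n → ℕ) → Ext v →
      (∀ G → Regular d G → Valid G a b x y → u G ≤ v (switch a b x y G)) →
      sumR d (λ G → ⟦ valid G a b x y ⟧ * u G) ≤ sumR d (λ G → ⟦ valid G a x b y ⟧ * v G)
    move a b x y u v v-ext h = ≤-trans (sumG-mono step) (≤-reflexive (sym (sumG-⊕ (square a b x y) ψ ψ-ext)))
      where
      ψ : Graph n → ℕ
      ψ G = ⟦ isRegular d G ⟧ * (⟦ valid G a x b y ⟧ * v G)
      ψ-ext : Ext ψ
      ψ-ext G H e = cong₂ _*_ (cong ⟦_⟧ (isRegular-ext d G H e)) (cong₂ _*_ (cong ⟦_⟧ (valid-ext a x b y G H e)) (v-ext G H e))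
      step : ∀ G → ⟦ isRegular d G ⟧ * (⟦ valid G a b x y ⟧ * u G) ≤ ψ (switch a b x y G)
      step G with isRegular d G in eR | valid G a b x y in eV
      ... | false | _ = z≤n
      ... | true | false = z≤n
      ... | true | true = begin
        1 * (1 * u G) ≡⟨ trans (*-identityˡ _) (*-identityˡ _) ⟩
        u G ≤⟨ h G R V ⟩
        v G″ ≡⟨ trans (*-identityˡ _) (*-identityˡ _) ⟨
        1 * (1 * v G″)
          ≡⟨ cong₂ (λ p q → ⟦ p ⟧ * (⟦ q ⟧ * v G″)) (regular⇐ S.regular′) (valid⇐ S.valid′) ⟨
        ψ G″ ∎
        where
        open ≤-Reasoning
        R : Regular d G
        R = regular⇒ G eR
        V : Valid G a b x y
        V = valid⇒ {G = G} eV
        module S = SwitchProps R V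
        G″ : Graph n
        G″ = switch a b x y G

  sumR-*ʳ : ∀ c (φ : Graph n → ℕ) → sumR d (λ G → φ G * c) ≡ sumR d φ * c
  sumR-*ʳ c φ = trans (sumR-cong (λ G _ → *-comm (φ G) c)) (trans (sumR-*ˡ c φ) (*-comm c _))

  sumR-sum₂ : ∀ {l m} (φ : Fin l → Fin m → Graph n → ℕ) → sumR d (λ G → sum₂ (λ i j → φ i j G)) ≡ sum₂ (λ i j → sumR d (φ i j))
  sumR-sum₂ φ = trans (sumR-cong (λ G _ → sum₂-rows (λ i j → φ i j G)))
    (trans (sumR-sum (λ i G → sum (λ j → φ i j G))) (trans (sum-cong (λ i → sumR-sum (φ i))) (sym (sum₂-rows (λ i j → sumR d (φ i j))))))

⟦not∨⟧ : ∀ a b → ⟦ not (a ∨ b) ⟧ ≡ ⟦ not a ⟧ * ⟦ not b ⟧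
⟦not∨⟧ true b = refl
⟦not∨⟧ false b = sym (*-identityˡ _)

-- For a fixed edge `a b` the conditions on x and on y separate, which is the shape in which `avoid`
-- counts the admissible edges `x y`.
valid-factors : ∀ {n} (G : Graph n) a b x y →
  ⟦ valid G a b x y ⟧ ≡ (⟦ G a b ⟧ * ⟦ G x y ⟧) * (⟦ not (G a x ∨ a == x) ⟧ * ⟦ not (G b y ∨ b == y) ⟧)
valid-factors G a b x y
  rewrite ⟦∧⟧ (G a b ∧ G x y) ((not (G a x) ∧ not (a == x)) ∧ (not (G b y) ∧ not (b == y)))
        | ⟦∧⟧ (G a b) (G x y)
        | ⟦∧⟧ (not (G a x) ∧ not (a == x)) (not (G b y) ∧ not (b == y))
        | ⟦∧⟧ (not (G a x)) (not (a == x)) | ⟦∧⟧ (not (G b y)) (not (b == y))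
        | ⟦not∨⟧ (G a x) (a == x) | ⟦not∨⟧ (G b y) (b == y) = refl

valid≤edges : ∀ {n} (G : Graph n) a b x y → ⟦ valid G a b x y ⟧ ≤ ⟦ G a b ⟧ * ⟦ G x y ⟧
valid≤edges G a b x y with G a b | G x y
... | true | true = ⟦⟧≤1 _
... | true | false = z≤n
... | false | _ = z≤n

module _ {n : ℕ} where

  -- Each excluded first or second end costs at most `r` darts; with small excluded sets almost
  -- every dart can take part in a switching.
  avoid : ∀ (H : Graph n) (P Q : Fin n → Bool) r → (∀ x → count (H x) ≤ r) → (∀ y → count (λ x → H x y) ≤ r) →
    sum₂ (λ x y → ⟦ H x y ⟧) ≤ sum₂ (λ x y → ⟦ H x y ⟧ * (⟦ not (P x) ⟧ * ⟦ not (Q y) ⟧)) + (count P + count Q) * r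
  avoid H P Q r rows cols = begin
    sum₂ (λ x y → ⟦ H x y ⟧)
      ≤⟨ sum₂-mono (λ x y → cases (H x y) (P x) (Q y)) ⟩
    sum₂ (λ x y → ⟦ H x y ⟧ * (⟦ not (P x) ⟧ * ⟦ not (Q y) ⟧) + (⟦ P x ⟧ * ⟦ H x y ⟧ + ⟦ Q y ⟧ * ⟦ H x y ⟧))
      ≡⟨ trans (sum₂-+ _ _) (cong (sum₂ (λ x y → ⟦ H x y ⟧ * (⟦ not (P x) ⟧ * ⟦ not (Q y) ⟧)) +_) (sum₂-+ _ _)) ⟩
    sum₂ (λ x y → ⟦ H x y ⟧ * (⟦ not (P x) ⟧ * ⟦ not (Q y) ⟧)) + (sum₂ (λ x y → ⟦ P x ⟧ * ⟦ H x y ⟧) + sum₂ (λ x y → ⟦ Q y ⟧ * ⟦ H x y ⟧))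
      ≤⟨ +-monoʳ-≤ (sum₂ (λ x y → ⟦ H x y ⟧ * (⟦ not (P x) ⟧ * ⟦ not (Q y) ⟧))) (+-mono-≤ (side P H rows) (≤-trans (≤-reflexive (sum₂-swap (λ x y → ⟦ Q y ⟧ * ⟦ H x y ⟧))) (side Q (λ y x → H x y) cols))) ⟩
    sum₂ (λ x y → ⟦ H x y ⟧ * (⟦ not (P x) ⟧ * ⟦ not (Q y) ⟧)) + (count P * r + count Q * r)
      ≡⟨ cong (sum₂ (λ x y → ⟦ H x y ⟧ * (⟦ not (P x) ⟧ * ⟦ not (Q y) ⟧)) +_) (*-distribʳ-+ r (count P) (count Q)) ⟨
    sum₂ (λ x y → ⟦ H x y ⟧ * (⟦ not (P x) ⟧ * ⟦ not (Q y) ⟧)) + (count P + count Q) * r ∎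
    where
    open ≤-Reasoning
    cases : ∀ h p q → ⟦ h ⟧ ≤ ⟦ h ⟧ * (⟦ not p ⟧ * ⟦ not q ⟧) + (⟦ p ⟧ * ⟦ h ⟧ + ⟦ q ⟧ * ⟦ h ⟧)
    cases false p q = z≤n
    cases true true q = s≤s z≤n
    cases true false true = s≤s z≤n
    cases true false false = s≤s z≤n
    side : ∀ P (H : Graph n) → (∀ x → count (H x) ≤ r) → sum₂ (λ x y → ⟦ P x ⟧ * ⟦ H x y ⟧) ≤ count P * r
    side P H rows = begin
      sum₂ (λ x y → ⟦ P x ⟧ * ⟦ H x y ⟧) ≡⟨ trans (sum₂-rows (λ x y → ⟦ P x ⟧ * ⟦ H x y ⟧)) (sum-cong (λ x → sum-*ˡ ⟦ P x ⟧ (λ y → ⟦ H x y ⟧))) ⟩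
      sum (λ x → ⟦ P x ⟧ * count (H x)) ≤⟨ sum-mono (λ x → *-monoʳ-≤ ⟦ P x ⟧ (rows x)) ⟩
      sum (λ x → ⟦ P x ⟧ * r) ≡⟨ sum-*ʳ r (λ x → ⟦ P x ⟧) ⟩
      count P * r ∎

  count-== : ∀ (a : Fin n) → count (λ x → a == x) ≡ 1
  count-== a = trans (sum-cong (λ x → sym (*-identityʳ _))) (sum-δ a (λ _ → 1))

  closed-nbhd : ∀ {d} {G : Graph n} → Regular d G → ∀ a → count (λ x → G a x ∨ a == x) ≤ suc d
  closed-nbhd {d} {G} R a = ≤-trans (count-∨ (G a) (λ x → a == x))
    (≤-reflexive (trans (cong₂ _+_ (deg R a) (count-== a)) (+-comm d 1)))

  columns : ∀ {d} {G : Graph n} → Regular d G → ∀ y → count (λ x → G x y) ≡ d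
  columns R y = trans (sum-cong (λ x → cong ⟦_⟧ (symm R x y))) (deg R y)

  set-degree : ∀ {d} {G : Graph n} → Regular d G → ∀ (S : Fin n → Bool) → sum₂ (λ x y → ⟦ S x ⟧ * ⟦ G x y ⟧) ≡ count S * d
  set-degree {d} {G} R S = trans (trans (sum₂-rows (λ x y → ⟦ S x ⟧ * ⟦ G x y ⟧)) (sum-cong (λ x → trans (sum-*ˡ ⟦ S x ⟧ (λ y → ⟦ G x y ⟧)) (cong (⟦ S x ⟧ *_) (deg R x))))) (sum-*ʳ d (λ x → ⟦ S x ⟧))

  all-darts : ∀ {d} {G : Graph n} → Regular d G → sum₂ (λ x y → ⟦ G x y ⟧) ≡ n * d
  all-darts {d} {G} R = trans (sum₂-rows (λ x y → ⟦ G x y ⟧)) (trans (sum-cong (deg R)) (sum-const n d))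

  dartsIn : (Fin n → Bool) → Graph n → ℕ
  dartsIn S = weight (λ i j → ⟦ S i ⟧ * ⟦ S j ⟧)

  dartsIn-cong : ∀ {S T : Fin n → Bool} {G H} → S ≗ T → G ≈ H → dartsIn S G ≡ dartsIn T H
  dartsIn-cong h e = weight-cong (λ i j → cong₂ (λ p q → ⟦ p ⟧ * ⟦ q ⟧) (h i) (h j)) e

  square-off : ∀ {a b x y i : Fin n} → a ≢ i → b ≢ i → x ≢ i → y ≢ i → ∀ j → square a b x y i j ≡ false
  square-off p q r s j rewrite ≢⇒== p | ≢⇒== q | ≢⇒== r | ≢⇒== s = refl

  module _ (d : ℕ) where

    moves₂ : ∀ a b (u v : Fin n → Fin n → Graph n → ℕ) → (∀ x y → Ext (v x y)) →
      (∀ x y G → Regular d G → Valid G a b x y → u x y G ≤ v x y (switch a b x y G)) →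
      sumR d (λ G → sum₂ (λ x y → ⟦ valid G a b x y ⟧ * u x y G)) ≤ sumR d (λ G → sum₂ (λ x y → ⟦ valid G a x b y ⟧ * v x y G))
    moves₂ a b u v ext h = begin
      sumR d (λ G → sum₂ (λ x y → ⟦ valid G a b x y ⟧ * u x y G)) ≡⟨ sumR-sum₂ d _ ⟩
      sum₂ (λ x y → sumR d (λ G → ⟦ valid G a b x y ⟧ * u x y G)) ≤⟨ sum₂-mono (λ x y → move d a b x y (u x y) (v x y) (ext x y) (h x y)) ⟩
      sum₂ (λ x y → sumR d (λ G → ⟦ valid G a x b y ⟧ * v x y G)) ≡⟨ sumR-sum₂ d _ ⟨
      sumR d (λ G → sum₂ (λ x y → ⟦ valid G a x b y ⟧ * v x y G)) ∎
      where open ≤-Reasoning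

    moves₄ : ∀ (u v : Fin n → Fin n → Fin n → Fin n → Graph n → ℕ) → (∀ a b x y → Ext (v a b x y)) →
      (∀ a b x y G → Regular d G → Valid G a b x y → u a b x y G ≤ v a b x y (switch a b x y G)) →
      sumR d (λ G → sum₂ (λ a b → sum₂ (λ x y → ⟦ valid G a b x y ⟧ * u a b x y G)))
        ≤ sumR d (λ G → sum₂ (λ a b → sum₂ (λ x y → ⟦ valid G a x b y ⟧ * v a b x y G)))
    moves₄ u v ext h = begin
      sumR d (λ G → sum₂ (λ a b → sum₂ (λ x y → ⟦ valid G a b x y ⟧ * u a b x y G))) ≡⟨ sumR-sum₂ d _ ⟩
      sum₂ (λ a b → sumR d (λ G → sum₂ (λ x y → ⟦ valid G a b x y ⟧ * u a b x y G)))
        ≤⟨ sum₂-mono (λ a b → moves₂ a b (u a b) (v a b) (ext a b) (h a b)) ⟩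
      sum₂ (λ a b → sumR d (λ G → sum₂ (λ x y → ⟦ valid G a x b y ⟧ * v a b x y G))) ≡⟨ sumR-sum₂ d _ ⟨
      sumR d (λ G → sum₂ (λ a b → sum₂ (λ x y → ⟦ valid G a x b y ⟧ * v a b x y G))) ∎
      where open ≤-Reasoning

-- Switching estimates for the number of darts inside a set

atLeast : ℕ → ℕ → Bool
atLeast k m = ⌊ k ≤? m ⌋

atLeast⇒ : ∀ {k m} → atLeast k m ≡ true → k ≤ m
atLeast⇒ {k} {m} e with k ≤? m
... | yes p = p

atLeast⇐ : ∀ {k m} → k ≤ m → atLeast k m ≡ true
atLeast⇐ {k} {m} p with k ≤? m
... | yes _ = refl
... | no ¬p = ⊥-elim (¬p p)

-- B(G) depends only on the rows of G in U, so it survives every switch that avoids U.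
module SparseSets {n : ℕ} (d β : ℕ) .{{d≢0 : NonZero d}} (U : Fin n → Bool) (B : Graph n → Fin n → Bool)
  (disjoint : ∀ G v → B G v ≡ true → U v ≡ false)
  (local : ∀ G H → (∀ i → U i ≡ true → ∀ j → G i j ≡ H i j) → B G ≗ B H)
  (small : ∀ G → Regular d G → count (B G) ≤ β)
  (room : 2 * (β + count U + count U + 2 * suc d) ≤ n) where

  tail : ℕ → Graph n → Bool
  tail k G = atLeast (2 * k) (dartsIn (B G) G)

  tail-ext : ∀ k → Ext (tail k)
  tail-ext k G H e = cong (atLeast (2 * k)) (dartsIn-cong (local G H (λ i _ → e i)) e)

  tailCount : ℕ → ℕ
  tailCount k = sumR d (λ G → ⟦ tail k G ⟧)

  private
    inB : Graph n → Fin n → Fin n → ℕ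
    inB G a b = ⟦ B G a ⟧ * ⟦ B G b ⟧

    u v : ℕ → Fin n → Fin n → Fin n → Fin n → Graph n → ℕ
    u k a b x y G = ⟦ tail k G ⟧ * (inB G a b * (⟦ not (B G x ∨ U x) ⟧ * ⟦ not (U y) ⟧))
    v k a b x y G = ⟦ tail k G ⟧ * inB G a b

    v-ext : ∀ k a b x y → Ext (v k a b x y)
    v-ext k a b x y G H e = cong₂ (λ p q → ⟦ p ⟧ * q) (tail-ext k G H e)
      (cong₂ (λ p q → ⟦ p ⟧ * ⟦ q ⟧) (local G H (λ i _ → e i) a) (local G H (λ i _ → e i) b))

    step : ∀ k a b x y G → Regular d G → Valid G a b x y → u (suc k) a b x y G ≤ v k a b x y (switch a b x y G)
    step k a b x y G R V with tail (suc k) G in eT | B G a in eA | B G b in eB | B G x in eX | U x in eUx | U y in eUy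
    ... | false | _ | _ | _ | _ | _ = z≤n
    ... | true | false | _ | _ | _ | _ = z≤n
    ... | true | true | false | _ | _ | _ = z≤n
    ... | true | true | true | true | _ | _ = z≤n
    ... | true | true | true | false | true | _ = z≤n
    ... | true | true | true | false | false | true = z≤n
    ... | true | true | true | false | false | false = ≤-reflexive (sym (cong₂ _*_ (⟦⟧-true tail′)
           (cong₂ (λ p q → ⟦ p ⟧ * ⟦ q ⟧) (trans (same a) eA) (trans (same b) eB))))
      where
      open SwitchProps R V
      off : ∀ {p i} → U p ≡ false → U i ≡ true → p ≢ i
      off e f refl = true≢false f e
      same : B G′ ≗ B G
      same = local G′ G (λ i Ui j → cong (_xor G i j) (square-off (off (disjoint G a eA) Ui) (off (disjoint G b eB) Ui) (off eUx Ui) (off eUy Ui) j))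
      w : Fin n → Fin n → ℕ
      w i j = ⟦ B G i ⟧ * ⟦ B G j ⟧
      -- Of the two removed edges only `a b` lies inside `B G`, because x does not; the inserted
      -- edges cannot lower the weight.
      few : weight w G ≤ weight w G′ + 2
      few = begin
        weight w G ≤⟨ m≤m+n _ _ ⟩
        weight w G + ((w a x + w x a) + (w b y + w y b)) ≡⟨ balance w ⟨
        weight w G′ + ((w a b + w b a) + (w x y + w y x))
          ≤⟨ +-monoʳ-≤ (weight w G′) (≤-reflexive extra) ⟩
        weight w G′ + 2 ∎
        where
        open ≤-Reasoning
        extra : (w a b + w b a) + (w x y + w y x) ≡ 2
        extra rewrite eA | eB | eX | *-zeroʳ ⟦ B G y ⟧ = refl
      tail′ : tail k G′ ≡ true
      tail′ = atLeast⇐ (≤-trans (+-cancelʳ-≤ 2 (2 * k) (weight w G′) (≤-trans (≤-reflexive (two k)) (≤-trans (atLeast⇒ eT) few)))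
        (≤-reflexive (sym (dartsIn-cong {S = B G′} {T = B G} same (λ _ _ → refl)))))
        where
        two : ∀ k → 2 * k + 2 ≡ 2 * suc k
        two = solve-∀

    forward : ∀ k G → Regular d G →
      ⟦ tail k G ⟧ * (2 * k * (n * d)) ≤ 2 * sum₂ (λ a b → sum₂ (λ x y → ⟦ valid G a b x y ⟧ * u k a b x y G))
    forward k G R = begin
      ⟦ tail k G ⟧ * (2 * k * (n * d)) ≤⟨ ⟦⟧*-mono (tail k G) (λ e → *-monoˡ-≤ (n * d) (atLeast⇒ e)) ⟩
      ⟦ tail k G ⟧ * (dartsIn (B G) G * (n * d)) ≡⟨ sum-form ⟨
      sum₂ (λ a b → c a b * (n * d)) ≤⟨ sum₂-mono (λ a b → *-monoʳ-≤ (c a b) (inner a b)) ⟩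
      sum₂ (λ a b → c a b * (2 * good a b)) ≡⟨ sum₂-cong (λ a b → swap (c a b) 2 (good a b)) ⟩
      sum₂ (λ a b → 2 * (c a b * good a b)) ≡⟨ sum₂-*ˡ 2 _ ⟩
      2 * sum₂ (λ a b → c a b * good a b)
        ≡⟨ cong (2 *_) (sum₂-cong (λ a b → trans (sym (sum₂-*ˡ (c a b) _)) (sum₂-cong (λ x y → regroup a b x y)))) ⟩
      2 * sum₂ (λ a b → sum₂ (λ x y → ⟦ valid G a b x y ⟧ * u k a b x y G)) ∎
      where
      open ≤-Reasoning
      c : Fin n → Fin n → ℕ
      c a b = ⟦ tail k G ⟧ * (inB G a b * ⟦ G a b ⟧)
      P Q : Fin n → Fin n → Bool
      P a x = (G a x ∨ a == x) ∨ (B G x ∨ U x)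
      Q b y = (G b y ∨ b == y) ∨ U y
      good : Fin n → Fin n → ℕ
      good a b = sum₂ (λ x y → ⟦ G x y ⟧ * (⟦ not (P a x) ⟧ * ⟦ not (Q b y) ⟧))
      swap : ∀ c t g → c * (t * g) ≡ t * (c * g)
      swap = solve-∀
      sum-form : sum₂ (λ a b → c a b * (n * d)) ≡ ⟦ tail k G ⟧ * (dartsIn (B G) G * (n * d))
      sum-form = trans (sum₂-cong (λ a b → lem ⟦ tail k G ⟧ (inB G a b * ⟦ G a b ⟧) (n * d)))
        (trans (sum₂-*ˡ (⟦ tail k G ⟧ * (n * d)) (λ a b → inB G a b * ⟦ G a b ⟧)) (lem′ ⟦ tail k G ⟧ (n * d) (dartsIn (B G) G)))
        where
        lem : ∀ t w m → t * w * m ≡ t * m * w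
        lem = solve-∀
        lem′ : ∀ t m w → t * m * w ≡ t * (w * m)
        lem′ = solve-∀
      -- The excluded vertices meet at most half of all darts; `room` is tailored to this.
      inner : ∀ a b → n * d ≤ 2 * good a b
      inner a b = +-cancelʳ-≤ (n * d) (n * d) (2 * good a b) (begin
        n * d + n * d ≡⟨ cong (λ z → z + z) (all-darts R) ⟨
        total + total ≤⟨ +-mono-≤ lower lower ⟩
        (good a b + (count (P a) + count (Q b)) * d) + (good a b + (count (P a) + count (Q b)) * d)
          ≡⟨ lem (good a b) (count (P a) + count (Q b)) d ⟩
        2 * good a b + (2 * (count (P a) + count (Q b))) * d
          ≤⟨ +-monoʳ-≤ (2 * good a b) (*-monoˡ-≤ d (≤-trans (*-monoʳ-≤ 2 sizes) room)) ⟩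
        2 * good a b + n * d ∎)
        where
        total = sum₂ (λ x y → ⟦ G x y ⟧)
        lower = avoid G (P a) (Q b) d (λ x → ≤-reflexive (deg R x)) (λ y → ≤-reflexive (columns R y))
        lem : ∀ g p d → (g + p * d) + (g + p * d) ≡ 2 * g + (2 * p) * d
        lem = solve-∀
        sizes : count (P a) + count (Q b) ≤ β + count U + count U + 2 * suc d
        sizes = begin
          count (P a) + count (Q b)
            ≤⟨ +-mono-≤ (≤-trans (count-∨ (λ x → G a x ∨ a == x) (λ x → B G x ∨ U x)) (+-mono-≤ (closed-nbhd R a) (≤-trans (count-∨ (B G) U) (+-monoˡ-≤ (count U) (small G R)))))
                        (≤-trans (count-∨ (λ y → G b y ∨ b == y) U) (+-monoˡ-≤ (count U) (closed-nbhd R b))) ⟩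
          (suc d + (β + count U)) + (suc d + count U) ≡⟨ lem′ (suc d) β (count U) ⟩
          β + count U + count U + 2 * suc d ∎
          where
          lem′ : ∀ d b u → (d + (b + u)) + (d + u) ≡ b + u + u + 2 * d
          lem′ = solve-∀
      regroup : ∀ a b x y → c a b * (⟦ G x y ⟧ * (⟦ not (P a x) ⟧ * ⟦ not (Q b y) ⟧)) ≡ ⟦ valid G a b x y ⟧ * u k a b x y G
      regroup a b x y rewrite valid-factors G a b x y | ⟦not∨⟧ (G a x ∨ a == x) (B G x ∨ U x) | ⟦not∨⟧ (G b y ∨ b == y) (U y) =
        lem ⟦ tail k G ⟧ (inB G a b) ⟦ G a b ⟧ ⟦ G x y ⟧ ⟦ not (G a x ∨ a == x) ⟧ ⟦ not (B G x ∨ U x) ⟧ ⟦ not (G b y ∨ b == y) ⟧ ⟦ not (U y) ⟧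
        where
        lem : ∀ t w g h p q r s → t * (w * g) * (h * ((p * q) * (r * s))) ≡ (g * h) * (p * r) * (t * (w * (q * s)))
        lem = solve-∀

    backward : ∀ k G → Regular d G →
      sum₂ (λ a b → sum₂ (λ x y → ⟦ valid G a x b y ⟧ * v k a b x y G)) ≤ ⟦ tail k G ⟧ * ((β * d) * (β * d))
    backward k G R = begin
      sum₂ (λ a b → sum₂ (λ x y → ⟦ valid G a x b y ⟧ * v k a b x y G))
        ≤⟨ sum₂-mono (λ a b → sum₂-mono (λ x y → *-monoˡ-≤ (v k a b x y G) (valid≤edges G a x b y))) ⟩
      sum₂ (λ a b → sum₂ (λ x y → (⟦ G a x ⟧ * ⟦ G b y ⟧) * (⟦ tail k G ⟧ * inB G a b)))
        ≡⟨ sum₂-cong (λ a b → trans (sum₂-cong (λ x y → *-comm (⟦ G a x ⟧ * ⟦ G b y ⟧) _))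
             (trans (sum₂-*ˡ (⟦ tail k G ⟧ * inB G a b) _) (cong (⟦ tail k G ⟧ * inB G a b *_) (trans (sum₂-product (λ x → ⟦ G a x ⟧) (λ y → ⟦ G b y ⟧)) (cong₂ _*_ (deg R a) (deg R b)))))) ⟩
      sum₂ (λ a b → ⟦ tail k G ⟧ * inB G a b * (d * d))
        ≡⟨ trans (sum₂-cong (λ a b → lem ⟦ tail k G ⟧ (inB G a b) (d * d))) (sum₂-*ˡ (⟦ tail k G ⟧ * (d * d)) (inB G)) ⟩
      ⟦ tail k G ⟧ * (d * d) * sum₂ (inB G) ≡⟨ cong (⟦ tail k G ⟧ * (d * d) *_) (sum₂-product (λ a → ⟦ B G a ⟧) (λ b → ⟦ B G b ⟧)) ⟩
      ⟦ tail k G ⟧ * (d * d) * (count (B G) * count (B G)) ≤⟨ *-monoʳ-≤ (⟦ tail k G ⟧ * (d * d)) (*-mono-≤ (small G R) (small G R)) ⟩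
      ⟦ tail k G ⟧ * (d * d) * (β * β) ≡⟨ lem′ ⟦ tail k G ⟧ d β ⟩
      ⟦ tail k G ⟧ * ((β * d) * (β * d)) ∎
      where
      open ≤-Reasoning
      lem : ∀ t w m → t * w * m ≡ t * m * w
      lem = solve-∀
      lem′ : ∀ t d b → t * (d * d) * (b * b) ≡ t * ((b * d) * (b * d))
      lem′ = solve-∀

  -- An edge inside the set can be switched away together with at least half of all darts.
  -- Conversely a graph arises in at most (βd)² ways, since a and b lie in the set and x and y are
  -- their neighbours after the switch.
  tail-step : ∀ k → tailCount (suc k) * (suc k * n) ≤ tailCount k * (β * β * d)
  tail-step k = *-cancelˡ-≤ (2 * d) {{m*n≢0 2 d}} (begin
    2 * d * (tailCount (suc k) * (suc k * n)) ≡⟨ lem d (tailCount (suc k)) (suc k) n ⟩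
    tailCount (suc k) * (2 * suc k * (n * d)) ≡⟨ sumR-*ʳ d _ _ ⟨
    sumR d (λ G → ⟦ tail (suc k) G ⟧ * (2 * suc k * (n * d))) ≤⟨ sumR-mono d (forward (suc k)) ⟩
    sumR d (λ G → 2 * sum₂ (λ a b → sum₂ (λ x y → ⟦ valid G a b x y ⟧ * u (suc k) a b x y G))) ≡⟨ sumR-*ˡ d 2 _ ⟩
    2 * sumR d (λ G → sum₂ (λ a b → sum₂ (λ x y → ⟦ valid G a b x y ⟧ * u (suc k) a b x y G)))
      ≤⟨ *-monoʳ-≤ 2 (moves₄ d (u (suc k)) (v k) (v-ext k) (step k)) ⟩
    2 * sumR d (λ G → sum₂ (λ a b → sum₂ (λ x y → ⟦ valid G a x b y ⟧ * v k a b x y G)))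
      ≤⟨ *-monoʳ-≤ 2 (sumR-mono d (backward k)) ⟩
    2 * sumR d (λ G → ⟦ tail k G ⟧ * ((β * d) * (β * d))) ≡⟨ cong (2 *_) (sumR-*ʳ d _ _) ⟩
    2 * (tailCount k * ((β * d) * (β * d))) ≡⟨ lem′ (tailCount k) β d ⟩
    2 * d * (tailCount k * (β * β * d)) ∎)
    where
    open ≤-Reasoning
    lem : ∀ d t k n → 2 * d * (t * (k * n)) ≡ t * (2 * k * (n * d))
    lem = solve-∀
    lem′ : ∀ t b d → 2 * (t * ((b * d) * (b * d))) ≡ 2 * d * (t * (b * b * d))
    lem′ = solve-∀

  -- Iteration gives the tail of a Poisson variable of mean β²d / n.
  tail-bound : ∀ k → tailCount k * (k ! * n ^ k) ≤ sumR {n} d (λ _ → 1) * (β * β * d) ^ k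
  tail-bound zero = *-mono-≤ (sumR-mono d (λ G _ → ⟦⟧≤1 (tail 0 G))) (≤-refl {1})
  tail-bound (suc k) = begin
    tailCount (suc k) * ((k ! + k * k !) * (n * n ^ k)) ≡⟨ lem (tailCount (suc k)) (k !) k n (n ^ k) ⟩
    tailCount (suc k) * (suc k * n) * (k ! * n ^ k) ≤⟨ *-monoˡ-≤ (k ! * n ^ k) (tail-step k) ⟩
    tailCount k * (β * β * d) * (k ! * n ^ k) ≡⟨ lem′ (tailCount k) (β * β * d) (k ! * n ^ k) ⟩
    (β * β * d) * (tailCount k * (k ! * n ^ k)) ≤⟨ *-monoʳ-≤ (β * β * d) (tail-bound k) ⟩
    (β * β * d) * (sumR {n} d (λ _ → 1) * (β * β * d) ^ k) ≡⟨ lem″ (β * β * d) (sumR {n} d (λ _ → 1)) ((β * β * d) ^ k) ⟩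
    sumR {n} d (λ _ → 1) * (β * β * d) ^ suc k ∎
    where
    open ≤-Reasoning
    lem : ∀ t f k n m → t * ((f + k * f) * (n * m)) ≡ t * ((1 + k) * n) * (f * m)
    lem = solve-∀
    lem′ : ∀ t b c → t * b * c ≡ b * (t * c)
    lem′ = solve-∀
    lem″ : ∀ b s p → b * (s * p) ≡ s * (b * p)
    lem″ = solve-∀

-- Moving two edges that cross A into A and its complement increases the number of edges inside A.
module Independent {n : ℕ} (d : ℕ) (A : Fin n → Bool) where

  Aᶜ : Fin n → Bool
  Aᶜ x = not (A x)

  layer : ℕ → Graph n → Bool
  layer j G = dartsIn A G ≡ᵇ 2 * j

  layer⇒ : ∀ {j G} → layer j G ≡ true → dartsIn A G ≡ 2 * j
  layer⇒ {j} {G} e = ≡ᵇ-true {dartsIn A G} {2 * j} e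

  layerCount : ℕ → ℕ
  layerCount j = sumR d (λ G → ⟦ layer j G ⟧)

  crossing : Graph n → ℕ
  crossing G = weight (λ i j → ⟦ A i ⟧ * ⟦ Aᶜ j ⟧) G

  inside+crossing : ∀ {G} → Regular d G → dartsIn A G + crossing G ≡ count A * d
  inside+crossing {G} R = trans (sym (sum₂-+ _ _)) (trans (sum₂-cong (λ i j → cases (A i) (A j) (G i j))) (set-degree R A))
    where
    cases : ∀ a b g → ⟦ a ⟧ * ⟦ b ⟧ * ⟦ g ⟧ + ⟦ a ⟧ * ⟦ not b ⟧ * ⟦ g ⟧ ≡ ⟦ a ⟧ * ⟦ g ⟧
    cases false b g = refl
    cases true true g = +-identityʳ _
    cases true false g = refl

  outside+crossing : ∀ {G} → Regular d G → dartsIn Aᶜ G + crossing G ≡ count Aᶜ * d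
  outside+crossing {G} R = trans (cong (dartsIn Aᶜ G +_) (sum₂-swap _)) (trans (sym (sum₂-+ _ _))
    (trans (sum₂-cong (λ i j → trans (cong (λ g → ⟦ Aᶜ i ⟧ * ⟦ Aᶜ j ⟧ * ⟦ G i j ⟧ + ⟦ A j ⟧ * ⟦ Aᶜ i ⟧ * ⟦ g ⟧) (symm R j i)) (cases (A i) (A j) (G i j)))) (set-degree R Aᶜ)))
    where
    cases : ∀ a b g → ⟦ not a ⟧ * ⟦ not b ⟧ * ⟦ g ⟧ + ⟦ b ⟧ * ⟦ not a ⟧ * ⟦ g ⟧ ≡ ⟦ not a ⟧ * ⟦ g ⟧
    cases true true g = refl
    cases true false g = refl
    cases false true g = refl
    cases false false g = +-identityʳ _

  private
    η : ℕ
    η = 2 * suc d * d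

    ends : Fin n → Fin n → Fin n → Fin n → ℕ
    ends a x b y = (⟦ A a ⟧ * ⟦ Aᶜ x ⟧) * (⟦ A b ⟧ * ⟦ Aᶜ y ⟧)

    -- The switch exchanges the crossing edges a x and b y for a b and x y.
    u : ℕ → Fin n → Fin n → Fin n → Fin n → Graph n → ℕ
    u j a x b y G = ⟦ layer j G ⟧ * ends a x b y

    layer-ext : ∀ j → Ext (layer j)
    layer-ext j G H e = cong (_≡ᵇ 2 * j) (dartsIn-cong {S = A} {T = A} (λ _ → refl) e)

    u-ext : ∀ j a x b y → Ext (u j a x b y)
    u-ext j a x b y G H e = cong (λ p → ⟦ p ⟧ * ends a x b y) (layer-ext j G H e)

    step : ∀ j a x b y G → Regular d G → Valid G a x b y → u j a x b y G ≤ u (suc j) a x b y (switch a x b y G)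
    step j a x b y G R V with layer j G in eL | A a in eA | A x in eX | A b in eB | A y in eY
    ... | false | _ | _ | _ | _ = z≤n
    ... | true | false | _ | _ | _ = z≤n
    ... | true | true | true | _ | _ = z≤n
    ... | true | true | false | false | _ = z≤n
    ... | true | true | false | true | true = z≤n
    ... | true | true | false | true | false = ≤-reflexive (sym (trans (*-identityʳ _) (⟦⟧-true layer′)))
      where
      open SwitchProps R V using (balance; G′)
      w : Fin n → Fin n → ℕ
      w i j = ⟦ A i ⟧ * ⟦ A j ⟧
      layer′ : layer (suc j) G′ ≡ true
      layer′ = subst (λ k → (k ≡ᵇ 2 * suc j) ≡ true) (sym more) (≡ᵇ-refl (2 * suc j))
        where
        two : ∀ k → 2 * k + 2 ≡ 2 * suc k
        two = solve-∀
        loss : (w a x + w x a) + (w b y + w y b) ≡ 0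
        loss rewrite eA | eB | eX | eY = refl
        gain : (w a b + w b a) + (w x y + w y x) ≡ 2
        gain rewrite eA | eB | eX | eY = refl
        more : dartsIn A G′ ≡ 2 * suc j
        more = begin
          dartsIn A G′ ≡⟨ +-identityʳ _ ⟨
          dartsIn A G′ + 0 ≡⟨ cong (dartsIn A G′ +_) loss ⟨
          dartsIn A G′ + ((w a x + w x a) + (w b y + w y b)) ≡⟨ balance w ⟩
          dartsIn A G + ((w a b + w b a) + (w x y + w y x)) ≡⟨ cong₂ _+_ (layer⇒ {j} {G} eL) gain ⟩
          2 * j + 2 ≡⟨ two j ⟩
          2 * suc j ∎
          where open ≡-Reasoning

    forward : ∀ j X G → Regular d G → X + 2 * j ≤ count A * d →
      ⟦ layer j G ⟧ * (X * (X ∸ η)) ≤ sum₂ (λ a x → sum₂ (λ b y → ⟦ valid G a x b y ⟧ * u j a x b y G))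
    forward j X G R hX = begin
      ⟦ layer j G ⟧ * (X * (X ∸ η)) ≤⟨ ⟦⟧*-mono (layer j G) (λ e → *-mono-≤ (enough e) (∸-monoˡ-≤ η (enough e))) ⟩
      ⟦ layer j G ⟧ * (crossing G * (crossing G ∸ η)) ≡⟨ sum-form ⟨
      sum₂ (λ a x → c a x * (crossing G ∸ η)) ≤⟨ sum₂-mono (λ a x → *-monoʳ-≤ (c a x) (inner a x)) ⟩
      sum₂ (λ a x → c a x * good a x)
        ≡⟨ sum₂-cong (λ a x → trans (sym (sum₂-*ˡ (c a x) _)) (sum₂-cong (λ b y → regroup a x b y))) ⟩
      sum₂ (λ a x → sum₂ (λ b y → ⟦ valid G a x b y ⟧ * u j a x b y G)) ∎
      where
      open ≤-Reasoning
      enough : layer j G ≡ true → X ≤ crossing G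
      enough e = +-cancelˡ-≤ (2 * j) X (crossing G) (≤-trans (≤-reflexive (+-comm (2 * j) X)) (≤-trans hX
        (≤-reflexive (trans (sym (inside+crossing R)) (cong (_+ crossing G) (layer⇒ {j} {G} e))))))
      c : Fin n → Fin n → ℕ
      c a x = ⟦ layer j G ⟧ * ((⟦ A a ⟧ * ⟦ Aᶜ x ⟧) * ⟦ G a x ⟧)
      sum-form : sum₂ (λ a x → c a x * (crossing G ∸ η)) ≡ ⟦ layer j G ⟧ * (crossing G * (crossing G ∸ η))
      sum-form = trans (sum₂-cong (λ a x → lem ⟦ layer j G ⟧ ((⟦ A a ⟧ * ⟦ Aᶜ x ⟧) * ⟦ G a x ⟧) (crossing G ∸ η)))
        (trans (sum₂-*ˡ (⟦ layer j G ⟧ * (crossing G ∸ η)) (λ a x → (⟦ A a ⟧ * ⟦ Aᶜ x ⟧) * ⟦ G a x ⟧))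
          (lem′ ⟦ layer j G ⟧ (crossing G ∸ η) (crossing G)))
        where
        lem : ∀ t w m → t * w * m ≡ t * m * w
        lem = solve-∀
        lem′ : ∀ t m w → t * m * w ≡ t * (w * m)
        lem′ = solve-∀
      H : Graph n
      H b y = (A b ∧ Aᶜ y) ∧ G b y
      P : Fin n → Fin n → Bool
      P a b = G a b ∨ a == b
      good : Fin n → Fin n → ℕ
      good a x = sum₂ (λ b y → ⟦ H b y ⟧ * (⟦ not (P a b) ⟧ * ⟦ not (P x y) ⟧))
      H-sum : ∀ b y → ⟦ H b y ⟧ ≡ (⟦ A b ⟧ * ⟦ Aᶜ y ⟧) * ⟦ G b y ⟧
      H-sum b y = trans (⟦∧⟧ (A b ∧ Aᶜ y) (G b y)) (cong (_* ⟦ G b y ⟧) (⟦∧⟧ (A b) (Aᶜ y)))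
      H≤ : ∀ b y → ⟦ H b y ⟧ ≤ ⟦ G b y ⟧
      H≤ b y = ⟦⟧-mono (λ e → proj₂ (∧-split {A b ∧ Aᶜ y} e))
      inner : ∀ a x → crossing G ∸ η ≤ good a x
      inner a x = m≤n+o⇒m∸n≤o (crossing G) η (begin
        crossing G ≡⟨ sum₂-cong (λ b y → H-sum b y) ⟨
        sum₂ (λ b y → ⟦ H b y ⟧)
          ≤⟨ avoid H (P a) (P x) d (λ b → ≤-trans (sum-mono (H≤ b)) (≤-reflexive (deg R b)))
               (λ y → ≤-trans (sum-mono (λ b → H≤ b y)) (≤-reflexive (columns R y))) ⟩
        good a x + (count (P a) + count (P x)) * d
          ≤⟨ +-monoʳ-≤ (good a x) (*-monoˡ-≤ d (≤-trans (+-mono-≤ (closed-nbhd R a) (closed-nbhd R x)) (≤-reflexive (cong (suc d +_) (sym (+-identityʳ (suc d))))))) ⟩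
        good a x + η ≡⟨ +-comm (good a x) η ⟩
        η + good a x ∎)
      regroup : ∀ a x b y → c a x * (⟦ H b y ⟧ * (⟦ not (P a b) ⟧ * ⟦ not (P x y) ⟧)) ≡ ⟦ valid G a x b y ⟧ * u j a x b y G
      regroup a x b y rewrite valid-factors G a x b y | H-sum b y =
        lem ⟦ layer j G ⟧ (⟦ A a ⟧ * ⟦ Aᶜ x ⟧) ⟦ G a x ⟧ (⟦ A b ⟧ * ⟦ Aᶜ y ⟧) ⟦ G b y ⟧ ⟦ not (P a b) ⟧ ⟦ not (P x y) ⟧
        where
        lem : ∀ t v g w h p q → t * (v * g) * ((w * h) * (p * q)) ≡ (g * h) * (p * q) * (t * (v * w))
        lem = solve-∀

    backward : ∀ j Y G → Regular d G → (layer j G ≡ true → dartsIn Aᶜ G ≤ Y) →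
      sum₂ (λ a x → sum₂ (λ b y → ⟦ valid G a b x y ⟧ * u j a x b y G)) ≤ ⟦ layer j G ⟧ * (2 * j * Y)
    backward j Y G R hY = begin
      sum₂ (λ a x → sum₂ (λ b y → ⟦ valid G a b x y ⟧ * u j a x b y G))
        ≤⟨ sum₂-mono (λ a x → sum₂-mono (λ b y → *-monoˡ-≤ (u j a x b y G) (valid≤edges G a b x y))) ⟩
      sum₂ (λ a x → sum₂ (λ b y → (⟦ G a b ⟧ * ⟦ G x y ⟧) * u j a x b y G))
        ≡⟨ sum₂-cong (λ a x → trans (sum₂-cong (λ b y → lem ⟦ G a b ⟧ ⟦ G x y ⟧ ⟦ layer j G ⟧ ⟦ A a ⟧ ⟦ Aᶜ x ⟧ ⟦ A b ⟧ ⟦ Aᶜ y ⟧))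
             (trans (sum₂-*ˡ ⟦ layer j G ⟧ _) (cong (⟦ layer j G ⟧ *_) (sum₂-product (λ b → ⟦ A a ⟧ * ⟦ A b ⟧ * ⟦ G a b ⟧) (λ y → ⟦ Aᶜ x ⟧ * ⟦ Aᶜ y ⟧ * ⟦ G x y ⟧))))) ⟩
      sum₂ (λ a x → ⟦ layer j G ⟧ * (rowA a * rowᶜ x))
        ≡⟨ trans (sum₂-*ˡ ⟦ layer j G ⟧ _) (cong (⟦ layer j G ⟧ *_) (sum₂-product rowA rowᶜ)) ⟩
      ⟦ layer j G ⟧ * (sum rowA * sum rowᶜ)
        ≡⟨ cong₂ (λ p q → ⟦ layer j G ⟧ * (p * q)) (sum₂-rows (λ a b → ⟦ A a ⟧ * ⟦ A b ⟧ * ⟦ G a b ⟧)) (sum₂-rows (λ x y → ⟦ Aᶜ x ⟧ * ⟦ Aᶜ y ⟧ * ⟦ G x y ⟧)) ⟨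
      ⟦ layer j G ⟧ * (dartsIn A G * dartsIn Aᶜ G)
        ≤⟨ ⟦⟧*-mono (layer j G) (λ e → *-mono-≤ (≤-reflexive (layer⇒ {j} {G} e)) (hY e)) ⟩
      ⟦ layer j G ⟧ * (2 * j * Y) ∎
      where
      open ≤-Reasoning
      rowA rowᶜ : Fin n → ℕ
      rowA a = sum (λ b → ⟦ A a ⟧ * ⟦ A b ⟧ * ⟦ G a b ⟧)
      rowᶜ x = sum (λ y → ⟦ Aᶜ x ⟧ * ⟦ Aᶜ y ⟧ * ⟦ G x y ⟧)
      lem : ∀ g h t a x b y → (g * h) * (t * ((a * x) * (b * y))) ≡ t * ((a * b * g) * (x * y * h))
      lem = solve-∀

  -- There are at least X darts from A to its complement, so at least X(X - 2(d+1)d) pairs of them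
  -- can be switched, the loss accounting for pairs whose new edges would be loops or already
  -- present. Undoing a move picks one of the 2(j+1) darts inside A and one of at most Y darts
  -- inside the complement.
  layer-step : ∀ j X Y → X + 2 * j ≤ count A * d →
    (∀ G → Regular d G → layer (suc j) G ≡ true → dartsIn Aᶜ G ≤ Y) →
    layerCount j * (X * (X ∸ 2 * suc d * d)) ≤ layerCount (suc j) * (2 * suc j * Y)
  layer-step j X Y hX hY = begin
    layerCount j * (X * (X ∸ η)) ≡⟨ sumR-*ʳ d _ _ ⟨
    sumR d (λ G → ⟦ layer j G ⟧ * (X * (X ∸ η))) ≤⟨ sumR-mono d (λ G R → forward j X G R hX) ⟩
    sumR d (λ G → sum₂ (λ a x → sum₂ (λ b y → ⟦ valid G a x b y ⟧ * u j a x b y G)))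
      ≤⟨ moves₄ d (u j) (u (suc j)) (u-ext (suc j)) (step j) ⟩
    sumR d (λ G → sum₂ (λ a x → sum₂ (λ b y → ⟦ valid G a b x y ⟧ * u (suc j) a x b y G)))
      ≤⟨ sumR-mono d (λ G R → backward (suc j) Y G R (hY G R)) ⟩
    sumR d (λ G → ⟦ layer (suc j) G ⟧ * (2 * suc j * Y)) ≡⟨ sumR-*ʳ d _ _ ⟩
    layerCount (suc j) * (2 * suc j * Y) ∎
    where open ≤-Reasoning

  layerCount≤ : ∀ j → layerCount j ≤ sumR {n} d (λ _ → 1)
  layerCount≤ j = sumR-mono d (λ G _ → ⟦⟧≤1 (layer j G))

zero-or-not : ∀ m → m ≡ 0 ⊎ NonZero m
zero-or-not zero = inj₁ refl
zero-or-not (suc m) = inj₂ _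

-- Absorbs an error term that is at most half of the quantity to be bounded.
double-cancel : ∀ {A B C} → 2 * A ≤ B + A → B ≤ C → A ≤ C
double-cancel {A} {B} h h′ = ≤-trans (+-cancelʳ-≤ A A B (≤-trans (≤-reflexive (cong (A +_) (sym (+-identityʳ A)))) h)) h′

-- T moves join x graphs that contain an edge to z graphs that do not; P z − T ≤ e of the possible moves are blocked.
module Gap (D E P q Λ x z T e : ℕ) (2E≤D : 2 * E ≤ D) (2q≤E : 2 * q ≤ E) (T≤ : T ≤ D * x) (≤T : D * x ≤ T + E * x)
  (T≤P : T ≤ P * z) (P≤T : P * z ≤ T + e) (e-bound : D * e ≤ P * q * z + E * e) where

  -- Two absorptions: `E * e` is at most half of `D * e`, which bounds e by a multiple of `P * z`;
  -- then `P * z` is replaced by `D * x + e`, and e is absorbed again.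
  e≤ : .{{NonZero D}} → e ≤ 2 * (E * x)
  e≤ = *-cancelˡ-≤ D (double-cancel {D * e} {D * (2 * (E * x))} (begin
    2 * (D * e) ≤⟨ *-monoʳ-≤ 2 first ⟩
    2 * (P * z * E) ≤⟨ *-monoʳ-≤ 2 (*-monoˡ-≤ E (≤-trans P≤T (+-monoˡ-≤ e T≤))) ⟩
    2 * ((D * x + e) * E) ≡⟨ lem D x e E ⟩
    D * (2 * (E * x)) + 2 * E * e ≤⟨ +-monoʳ-≤ (D * (2 * (E * x))) (*-monoˡ-≤ e 2E≤D) ⟩
    D * (2 * (E * x)) + D * e ∎) ≤-refl)
    where
    open ≤-Reasoning
    lem : ∀ D x e E → 2 * ((D * x + e) * E) ≡ D * (2 * (E * x)) + 2 * E * e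
    lem = solve-∀
    lem′ : ∀ P q z E e → 2 * (P * q * z + E * e) ≡ P * z * (2 * q) + 2 * E * e
    lem′ = solve-∀
    first : D * e ≤ P * z * E
    first = double-cancel {D * e} {P * z * E} (begin
      2 * (D * e) ≤⟨ *-monoʳ-≤ 2 e-bound ⟩
      2 * (P * q * z + E * e) ≡⟨ lem′ P q z E e ⟩
      P * z * (2 * q) + 2 * E * e ≤⟨ +-mono-≤ (*-monoʳ-≤ (P * z) 2q≤E) (*-monoˡ-≤ e 2E≤D) ⟩
      P * z * E + D * e ∎) ≤-refl

  -- With `Sx` and `Sz` the sums of one function over the two families, their means satisfy Sx/x ≤
  -- Sz/z + 4 + 3EΛ/D. The 4 is the change along a move; the rest is the loss from impossible moves,
  -- a fraction of order E/D on either side, where the function can be as large as Λ.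
  upper : ∀ {Sx Sz W W′} → D * Sx ≤ W + E * Sx → W ≤ W′ + 4 * T → W′ ≤ P * Sz → Sx ≤ Λ * x → Sz ≤ Λ * z →
    D * (z * Sx) ≤ D * (x * Sz) + (4 * D + 3 * (E * Λ)) * (x * z)
  upper {Sx} {Sz} {W} {W′} h₁ h₂ h₃ hx hz with zero-or-not D
  ... | inj₁ D≡0 = ≤-trans (≤-reflexive (cong (_* (z * Sx)) D≡0)) z≤n
  ... | inj₂ nz = begin
    D * (z * Sx) ≡⟨ lem₁ (D) z Sx ⟩
    z * (D * Sx) ≤⟨ *-monoʳ-≤ z (≤-trans h₁ (+-monoˡ-≤ (E * Sx) (≤-trans h₂ (+-monoˡ-≤ (4 * T) h₃)))) ⟩
    z * (P * Sz + 4 * T + E * Sx) ≡⟨ lem₂ z P Sz T E Sx ⟩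
    (P * z) * Sz + 4 * T * z + E * Sx * z
      ≤⟨ +-mono-≤ (+-mono-≤ (*-monoˡ-≤ Sz (≤-trans P≤T (+-mono-≤ T≤ (e≤ {{nz}})))) (*-monoˡ-≤ z (*-monoʳ-≤ 4 T≤))) (*-monoˡ-≤ z (*-monoʳ-≤ E hx)) ⟩
    (D * x + 2 * (E * x)) * Sz + 4 * (D * x) * z + E * (Λ * x) * z ≡⟨ lem₃ (D) x E Sz z Λ ⟩
    D * (x * Sz) + 4 * (D * x) * z + E * (Λ * x) * z + 2 * (E * x) * Sz ≤⟨ +-monoʳ-≤ (D * (x * Sz) + 4 * (D * x) * z + E * (Λ * x) * z) (*-monoʳ-≤ (2 * (E * x)) hz) ⟩
    D * (x * Sz) + 4 * (D * x) * z + E * (Λ * x) * z + 2 * (E * x) * (Λ * z) ≡⟨ lem₄ (D) x E Sz z Λ ⟩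
    D * (x * Sz) + (4 * D + 3 * (E * Λ)) * (x * z) ∎
    where
    open ≤-Reasoning
    lem₁ : ∀ D z S → D * (z * S) ≡ z * (D * S)
    lem₁ = solve-∀
    lem₂ : ∀ z P Sz T E Sx → z * (P * Sz + 4 * T + E * Sx) ≡ (P * z) * Sz + 4 * T * z + E * Sx * z
    lem₂ = solve-∀
    lem₃ : ∀ D x E Sz z L → (D * x + 2 * (E * x)) * Sz + 4 * (D * x) * z + E * (L * x) * z ≡ D * (x * Sz) + 4 * (D * x) * z + E * (L * x) * z + 2 * (E * x) * Sz
    lem₃ = solve-∀
    lem₄ : ∀ D x E Sz z L → D * (x * Sz) + 4 * (D * x) * z + E * (L * x) * z + 2 * (E * x) * (L * z) ≡ D * (x * Sz) + (4 * D + 3 * (E * L)) * (x * z)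
    lem₄ = solve-∀

  -- In this direction the total change `I` over all moves replaces the worst case: 4 becomes the
  -- average J/D, which is what makes the interval for the mean one-sided.
  lower : ∀ {Sx Sz W W′ J I} → P * Sz ≤ W′ + Λ * e → W′ ≤ W + I → I ≤ J * x → W ≤ D * Sx → Sz ≤ Λ * z →
    D * (x * Sz) ≤ D * (z * Sx) + (J + 3 * (E * Λ)) * (x * z)
  lower {Sx} {Sz} {W} {W′} {J} {I} h₁ h₂ h₃ h₄ hz with zero-or-not D
  ... | inj₁ D≡0 = ≤-trans (≤-reflexive (cong (_* (x * Sz)) D≡0)) z≤n
  ... | inj₂ nz = begin
    D * (x * Sz) ≡⟨ *-assoc (D) x Sz ⟨
    D * x * Sz ≤⟨ *-monoˡ-≤ Sz ≤T ⟩
    (T + E * x) * Sz ≡⟨ *-distribʳ-+ Sz T (E * x) ⟩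
    T * Sz + E * x * Sz ≤⟨ +-mono-≤ (*-monoˡ-≤ Sz T≤P) (*-monoʳ-≤ (E * x) hz) ⟩
    P * z * Sz + E * x * (Λ * z) ≡⟨ lem₁ P z Sz (E * x * (Λ * z)) ⟩
    z * (P * Sz) + E * x * (Λ * z)
      ≤⟨ +-monoˡ-≤ (E * x * (Λ * z)) (*-monoʳ-≤ z (≤-trans h₁ (+-mono-≤ (≤-trans h₂ (+-mono-≤ h₄ h₃)) (*-monoʳ-≤ Λ (e≤ {{nz}}))))) ⟩
    z * (D * Sx + J * x + Λ * (2 * (E * x))) + E * x * (Λ * z) ≡⟨ lem₂ z (D) Sx J x Λ E ⟩
    D * (z * Sx) + (J + 3 * (E * Λ)) * (x * z) ∎
    where
    open ≤-Reasoning
    lem₁ : ∀ P z S r → P * z * S + r ≡ z * (P * S) + r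
    lem₁ = solve-∀
    lem₂ : ∀ z D S J x L E → z * (D * S + J * x + L * (2 * (E * x))) + E * x * (L * z) ≡ D * (z * S) + (J + 3 * (E * L)) * (x * z)
    lem₂ = solve-∀

-- The exposure martingale

switch-keep : ∀ {n d} {G : Graph n} (R : Regular d G) {a b x y} (V : Valid G a b x y) → ∀ {i j} →
  G i j ≡ true → ¬ (a ≡ i × b ≡ j) → ¬ (b ≡ i × a ≡ j) → ¬ (x ≡ i × y ≡ j) → ¬ (y ≡ i × x ≡ j) →
  switch a b x y G i j ≡ true
switch-keep {G = G} R {a} {b} {x} {y} V {i} {j} e p q r s = ⟦⟧-pos (subst (0 <_) (sym eq) (s≤s z≤n))
  where
  open SwitchProps R V
  zero-at : ∀ k l → ¬ (k ≡ i × l ≡ j) → ⟦ k == i ⟧ * ⟦ l == j ⟧ ≡ 0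
  zero-at k l ne with k == i in e₁ | l == j in e₂
  ... | true | true = ⊥-elim (ne (==⇒≡ e₁ , ==⇒≡ e₂))
  ... | true | false = refl
  ... | false | _ = refl
  eq : ⟦ G′ i j ⟧ ≡ suc (darts a x b y i j)
  eq = trans (sym (+-identityʳ _)) (trans (cong (⟦ G′ i j ⟧ +_) (sym none)) (trans (switch-entry i j) (cong (λ g → ⟦ g ⟧ + darts a x b y i j) e)))
    where
    none : darts a b x y i j ≡ 0
    none rewrite zero-at a b p | zero-at b a q | zero-at x y r | zero-at y x s = refl

switch-avoid : ∀ {n d} {G : Graph n} (R : Regular d G) {a b x y} (V : Valid G a b x y) → ∀ {i j} →
  G i j ≡ false → ¬ (a ≡ i × x ≡ j) → ¬ (x ≡ i × a ≡ j) → ¬ (b ≡ i × y ≡ j) → ¬ (y ≡ i × b ≡ j) →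
  switch a b x y G i j ≡ false
switch-avoid {G = G} R {a} {b} {x} {y} V {i} {j} e p q r s = ⟦⟧-zero (n≤0⇒n≡0 (≤-trans (m≤m+n _ (darts a b x y i j)) (≤-reflexive eq)))
  where
  open SwitchProps R V
  zero-at : ∀ k l → ¬ (k ≡ i × l ≡ j) → ⟦ k == i ⟧ * ⟦ l == j ⟧ ≡ 0
  zero-at k l ne with k == i in e₁ | l == j in e₂
  ... | true | true = ⊥-elim (ne (==⇒≡ e₁ , ==⇒≡ e₂))
  ... | true | false = refl
  ... | false | _ = refl
  eq : ⟦ G′ i j ⟧ + darts a b x y i j ≡ 0
  eq = trans (switch-entry i j) none
    where
    none : ⟦ G i j ⟧ + darts a x b y i j ≡ 0
    none rewrite e | zero-at a x p | zero-at x a q | zero-at b y r | zero-at y b s = refl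

xor-cancel : ∀ s g → s xor (s xor g) ≡ g
xor-cancel true true = refl
xor-cancel true false = refl
xor-cancel false g = refl

square-swap : ∀ {n} (a b x y : Fin n) → square a b x y ≈ square a x b y
square-swap a b x y i j = ∨-comm (pair a b i j ∨ pair x y i j) _
  where
  ∨-comm : ∀ p q → p ∨ q ≡ q ∨ p
  ∨-comm true true = refl
  ∨-comm true false = refl
  ∨-comm false true = refl
  ∨-comm false false = refl

switch-undo : ∀ {n} (a b x y : Fin n) G → switch a x b y (switch a b x y G) ≈ G
switch-undo a b x y G i j = trans (cong (_xor (square a b x y i j xor G i j)) (sym (square-swap a b x y i j))) (xor-cancel (square a b x y i j) (G i j))

moves₂′ : ∀ {n} d (a b : Fin n) (u v : Fin n → Fin n → Graph n → ℕ) → (∀ x y → Ext (v x y)) →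
  (∀ x y G → Regular d G → Valid G a x b y → u x y G ≤ v x y (switch a x b y G)) →
  sumR d (λ G → sum₂ (λ x y → ⟦ valid G a x b y ⟧ * u x y G)) ≤ sumR d (λ G → sum₂ (λ x y → ⟦ valid G a b x y ⟧ * v x y G))
moves₂′ d a b u v ext h = begin
  sumR d (λ G → sum₂ (λ x y → ⟦ valid G a x b y ⟧ * u x y G)) ≡⟨ sumR-sum₂ d _ ⟩
  sum₂ (λ x y → sumR d (λ G → ⟦ valid G a x b y ⟧ * u x y G)) ≤⟨ sum₂-mono (λ x y → move d a x b y (u x y) (v x y) (ext x y) (h x y)) ⟩
  sum₂ (λ x y → sumR d (λ G → ⟦ valid G a b x y ⟧ * v x y G)) ≡⟨ sumR-sum₂ d _ ⟨
  sumR d (λ G → sum₂ (λ x y → ⟦ valid G a b x y ⟧ * v x y G)) ∎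
  where open ≤-Reasoning

⟦⟧*⟦⟧≤ : ∀ p q r {g g′} → (p ≡ true → q ≡ true → r ≡ true × g ≤ g′) → ⟦ p ⟧ * (⟦ q ⟧ * g) ≤ ⟦ r ⟧ * g′
⟦⟧*⟦⟧≤ false q r h = z≤n
⟦⟧*⟦⟧≤ true false r h = z≤n
⟦⟧*⟦⟧≤ true true r {g} h with h refl refl
... | refl , le = ≤-trans (≤-reflexive (*-identityˡ (1 * g))) (*-monoʳ-≤ 1 le)

_⊆_ : ∀ {n} → Graph n → Graph n → Bool
F ⊆ G = every (λ i → every (λ j → not (F i j) ∨ G i j))

⊆-elim : ∀ {n} {F G : Graph n} → F ⊆ G ≡ true → ∀ i j → F i j ≡ true → G i j ≡ true
⊆-elim {F = F} {G} e i j f with every-elim (λ j → not (F i j) ∨ G i j) (every-elim (λ i → every (λ j → not (F i j) ∨ G i j)) e i) j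
... | t rewrite f = t

⊆-intro : ∀ {n} {F G : Graph n} → (∀ i j → F i j ≡ true → G i j ≡ true) → F ⊆ G ≡ true
⊆-intro {F = F} {G} h = every-intro _ (λ i → every-intro _ (λ j → lem (F i j) (G i j) (h i j)))
  where
  lem : ∀ f g → (f ≡ true → g ≡ true) → not f ∨ g ≡ true
  lem true g k = k refl
  lem false g k = refl

⊆-ext : ∀ {n} (F : Graph n) → Ext (F ⊆_)
⊆-ext F G H e = bool-ext (λ p → ⊆-intro {F = F} (λ i j f → trans (sym (e i j)) (⊆-elim {F = F} p i j f)))
  (λ p → ⊆-intro {F = F} (λ i j f → trans (e i j) (⊆-elim {F = F} p i j f)))

-- The Lipschitz condition is deliberately asymmetric. Only pairs related by `same` can raise `h`,
-- and `same≤` makes them rare; for the defect the relation is membership in the same class of an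
-- optimal colouring.
module Exposure {n : ℕ} (d : ℕ) (h : Graph n → ℕ) (h-ext : Ext h) (Λ α : ℕ) (h≤ : ∀ G → h G ≤ Λ)
  (same : Graph n → Fin n → Fin n → Bool) (same≤ : ∀ G a → count (same G a) ≤ α) (same-ext : ∀ a x → Ext (λ G → same G a x))
  (lip : ∀ G → Regular d G → ∀ {a b x y} → Valid G a b x y →
    h (switch a b x y G) ≤ h G + 2 * (⟦ same G a x ⟧ + ⟦ same G b y ⟧)) where

  -- The inverse of a switching is a switching, which bounds a decrease as well. The finer estimate
  -- would refer to `same` at the switched graph and is given up for the constant.
  lip′ : ∀ G → Regular d G → ∀ {a b x y} → Valid G a b x y → h G ≤ h (switch a b x y G) + 4
  lip′ G R {a} {b} {x} {y} V = begin
    h G ≡⟨ h-ext _ _ (switch-undo a b x y G) ⟨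
    h (switch a x b y G′) ≤⟨ lip G′ regular′ valid′ ⟩
    h G′ + 2 * (⟦ same G′ a b ⟧ + ⟦ same G′ x y ⟧) ≤⟨ +-monoʳ-≤ (h G′) (*-monoʳ-≤ 2 (+-mono-≤ (⟦⟧≤1 (same G′ a b)) (⟦⟧≤1 (same G′ x y)))) ⟩
    h G′ + 4 ∎
    where
    open ≤-Reasoning
    open SwitchProps R V

  -- F is the set of edges exposed so far; D is the number of darts still hidden.
  module Stage (F : Graph n) (F-symm : Symm F) (δ̂ D : ℕ) (δ≤ : ∀ a → d ∸ count (F a) ≤ δ̂)
    (D-eq : D + sum₂ (λ i j → ⟦ F i j ⟧) ≡ n * d) where

    δ : Fin n → ℕ
    δ a = d ∸ count (F a)

    -- Two closed neighbourhoods, and one further vertex on each side in `blocked-bound`, contain at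
    -- most 2d + 4 vertices; each of them blocks at most δ̂ hidden darts.
    E : ℕ
    E = (2 * d + 4) * δ̂

    hidden : Graph n → Graph n
    hidden G i j = G i j ∧ not (F i j)

    hidden-split : ∀ {G} → F ⊆ G ≡ true → ∀ i j → ⟦ hidden G i j ⟧ + ⟦ F i j ⟧ ≡ ⟦ G i j ⟧
    hidden-split {G} ω i j with F i j in f | G i j in g
    ... | true | true = refl
    ... | true | false = ⊥-elim (true≢false (⊆-elim {F = F} ω i j f) g)
    ... | false | true = refl
    ... | false | false = refl

    hidden-row : ∀ {G} → Regular d G → F ⊆ G ≡ true → ∀ i → count (hidden G i) ≡ δ i
    hidden-row {G} R ω i = trans (sym (m+n∸n≡m _ (count (F i)))) (cong (_∸ count (F i))
      (trans (sym (sum-+ _ _)) (trans (sum-cong (hidden-split ω i)) (deg R i))))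

    hidden-symm : ∀ {G} → Regular d G → Symm (hidden G)
    hidden-symm R i j = cong₂ (λ p q → p ∧ not q) (symm R i j) (F-symm i j)

    hidden-column : ∀ {G} → Regular d G → F ⊆ G ≡ true → ∀ j → count (λ i → hidden G i j) ≡ δ j
    hidden-column R ω j = trans (sum-cong (λ i → cong ⟦_⟧ (hidden-symm R i j))) (hidden-row R ω j)

    hidden-total : ∀ {G} → Regular d G → F ⊆ G ≡ true → sum₂ (λ i j → ⟦ hidden G i j ⟧) ≡ D
    hidden-total {G} R ω = +-cancelʳ-≡ (sum₂ (λ i j → ⟦ F i j ⟧)) _ D
      (trans (trans (sym (sum₂-+ _ _)) (trans (sum₂-cong (hidden-split ω)) (all-darts R))) (sym D-eq))

    hidden-avoid : ∀ {G} → Regular d G → F ⊆ G ≡ true → ∀ (P Q : Fin n → Bool) → count P + count Q ≤ 2 * d + 4 →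
      D ≤ sum₂ (λ x y → ⟦ hidden G x y ⟧ * (⟦ not (P x) ⟧ * ⟦ not (Q y) ⟧)) + E
    hidden-avoid {G} R ω P Q pq = begin
      D ≡⟨ hidden-total R ω ⟨
      sum₂ (λ x y → ⟦ hidden G x y ⟧)
        ≤⟨ avoid (hidden G) P Q δ̂ (λ x → ≤-trans (≤-reflexive (hidden-row R ω x)) (δ≤ x)) (λ y → ≤-trans (≤-reflexive (hidden-column R ω y)) (δ≤ y)) ⟩
      sum₂ (λ x y → ⟦ hidden G x y ⟧ * (⟦ not (P x) ⟧ * ⟦ not (Q y) ⟧)) + (count P + count Q) * δ̂
        ≤⟨ +-monoʳ-≤ (sum₂ (λ x y → ⟦ hidden G x y ⟧ * (⟦ not (P x) ⟧ * ⟦ not (Q y) ⟧))) (*-monoˡ-≤ δ̂ pq) ⟩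
      sum₂ (λ x y → ⟦ hidden G x y ⟧ * (⟦ not (P x) ⟧ * ⟦ not (Q y) ⟧)) + E ∎
      where open ≤-Reasoning

    module Edge (a b : Fin n) (Fab : F a b ≡ false) (a≢b : a ≢ b) where

      Weight : Set
      Weight = Fin n → Fin n → Graph n → ℕ

      -- Total weight of the switchings that remove, respectively insert, the edge `a b` while all
      -- edges of `F` stay. Both range over the same moves, seen from their two ends.
      fwd bwd : Weight → ℕ
      fwd g = sumR d (λ G → sum₂ (λ x y → ⟦ valid G a b x y ⟧ * (⟦ F ⊆ G ∧ not (F x y) ⟧ * g x y G)))
      bwd g = sumR d (λ G → sum₂ (λ x y → ⟦ valid G a x b y ⟧ * (⟦ F ⊆ G ∧ (not (F a x) ∧ not (F b y)) ⟧ * g x y G)))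

      inX inZ : Graph n → Bool
      inX G = F ⊆ G ∧ G a b
      inZ G = F ⊆ G ∧ not (G a b)

      X Z : (Graph n → ℕ) → ℕ
      X g = sumR d (λ G → ⟦ inX G ⟧ * g G)
      Z g = sumR d (λ G → ⟦ inZ G ⟧ * g G)

      ExtW : Weight → Set
      ExtW g = ∀ x y → Ext (g x y)

      private
        ⊆-keep : ∀ {G} (R : Regular d G) {a b x y} (V : Valid G a b x y) → F ⊆ G ≡ true → F a b ≡ false → F x y ≡ false →
          F ⊆ switch a b x y G ≡ true
        ⊆-keep R V ω fab fxy = ⊆-intro {F = F} (λ i j f → switch-keep R V (⊆-elim {F = F} ω i j f)
          (λ { (refl , refl) → true≢false f fab }) (λ { (refl , refl) → true≢false (trans (F-symm _ _) f) fab })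
          (λ { (refl , refl) → true≢false f fxy }) (λ { (refl , refl) → true≢false (trans (F-symm _ _) f) fxy }))

        ⊆-absent : ∀ {G} → F ⊆ G ≡ true → ∀ {i j} → G i j ≡ false → F i j ≡ false
        ⊆-absent {G} ω {i} {j} g with F i j in f
        ... | false = refl
        ... | true = ⊥-elim (true≢false (⊆-elim {F = F} ω i j f) g)

      fwd≤bwd : ∀ g g′ → ExtW g′ → (∀ x y G → Regular d G → Valid G a b x y → g x y G ≤ g′ x y (switch a b x y G)) → fwd g ≤ bwd g′
      fwd≤bwd g g′ ext le = moves₂ d a b _ _
        (λ x y G H e → cong₂ (λ p q → ⟦ p ∧ (not (F a x) ∧ not (F b y)) ⟧ * q) (⊆-ext F G H e) (ext x y G H e)) step
        where
        step : ∀ x y G → Regular d G → Valid G a b x y → ⟦ F ⊆ G ∧ not (F x y) ⟧ * g x y G ≤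
          ⟦ F ⊆ switch a b x y G ∧ (not (F a x) ∧ not (F b y)) ⟧ * g′ x y (switch a b x y G)
        step x y G R V with F ⊆ G in ω | F x y in fxy
        ... | false | _ = z≤n
        ... | true | true = z≤n
        ... | true | false rewrite ⊆-keep R V ω Fab fxy | ⊆-absent ω (Valid.ax V) | ⊆-absent ω (Valid.by V) = +-monoˡ-≤ 0 (le x y G R V)

      bwd≤fwd : ∀ g g′ → ExtW g′ → (∀ x y G → Regular d G → Valid G a x b y → g x y G ≤ g′ x y (switch a x b y G)) → bwd g ≤ fwd g′
      bwd≤fwd g g′ ext le = moves₂′ d a b _ _
        (λ x y G H e → cong₂ (λ p q → ⟦ p ∧ not (F x y) ⟧ * q) (⊆-ext F G H e) (ext x y G H e)) step
        where
        step : ∀ x y G → Regular d G → Valid G a x b y → ⟦ F ⊆ G ∧ (not (F a x) ∧ not (F b y)) ⟧ * g x y G ≤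
          ⟦ F ⊆ switch a x b y G ∧ not (F x y) ⟧ * g′ x y (switch a x b y G)
        step x y G R V with F ⊆ G in ω | F a x in fax | F b y in fby
        ... | false | _ | _ = z≤n
        ... | true | true | _ = z≤n
        ... | true | false | true = z≤n
        ... | true | false | false rewrite ⊆-keep R V ω fax fby | ⊆-absent ω (Valid.by V) = +-monoˡ-≤ 0 (le x y G R V)

      fwd-upper : ∀ g c → (∀ G → Regular d G → F ⊆ G ≡ true → sum₂ (λ x y → ⟦ hidden G x y ⟧ * g x y G) ≤ c G) → fwd g ≤ X c
      fwd-upper g c le = sumR-mono d (λ G R → begin
        sum₂ (λ x y → ⟦ valid G a b x y ⟧ * (⟦ F ⊆ G ∧ not (F x y) ⟧ * g x y G))
          ≤⟨ sum₂-mono (λ x y → point G x y) ⟩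
        sum₂ (λ x y → ⟦ inX G ⟧ * (⟦ hidden G x y ⟧ * g x y G)) ≡⟨ sum₂-*ˡ ⟦ inX G ⟧ _ ⟩
        ⟦ inX G ⟧ * sum₂ (λ x y → ⟦ hidden G x y ⟧ * g x y G) ≤⟨ ⟦⟧*-mono (inX G) (λ e → le G R (proj₁ (∧-split e))) ⟩
        ⟦ inX G ⟧ * c G ∎)
        where
        open ≤-Reasoning
        point : ∀ G x y → ⟦ valid G a b x y ⟧ * (⟦ F ⊆ G ∧ not (F x y) ⟧ * g x y G) ≤ ⟦ inX G ⟧ * (⟦ hidden G x y ⟧ * g x y G)
        point G x y = ⟦⟧*⟦⟧≤ (valid G a b x y) (F ⊆ G ∧ not (F x y)) (inX G) (λ v w → let V = valid⇒ {G = G} v in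
          ∧-join (proj₁ (∧-split w)) (Valid.ab V) ,
          ≤-reflexive (sym (trans (cong (λ p → ⟦ p ⟧ * g x y G) (∧-join (Valid.xy V) (proj₂ (∧-split {F ⊆ G} w)))) (*-identityˡ _))))

      fwd-≤D : ∀ (g : Graph n → ℕ) → fwd (λ _ _ → g) ≤ D * X g
      fwd-≤D g = ≤-trans (fwd-upper (λ _ _ → g) (λ G → D * g G) (λ G R ω → ≤-reflexive (trans
          (trans (sum₂-cong (λ x y → *-comm ⟦ hidden G x y ⟧ (g G))) (sum₂-*ˡ (g G) _))
          (trans (cong (g G *_) (hidden-total R ω)) (*-comm (g G) D)))))
        (≤-reflexive (trans (sumR-cong d (λ G _ → lem ⟦ inX G ⟧ D (g G))) (sumR-*ˡ d D _)))
        where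
        lem : ∀ p q r → p * (q * r) ≡ q * (p * r)
        lem = solve-∀

      D≤fwd : ∀ (g : Graph n → ℕ) → D * X g ≤ fwd (λ _ _ → g) + E * X g
      D≤fwd g = begin
        D * X g ≡⟨ sumR-*ˡ d D _ ⟨
        sumR d (λ G → D * (⟦ inX G ⟧ * g G)) ≤⟨ sumR-mono d point ⟩
        sumR d (λ G → sum₂ (λ x y → ⟦ valid G a b x y ⟧ * (⟦ F ⊆ G ∧ not (F x y) ⟧ * g G)) + E * (⟦ inX G ⟧ * g G)) ≡⟨ sumR-+ d _ _ ⟩
        fwd (λ _ _ → g) + sumR d (λ G → E * (⟦ inX G ⟧ * g G)) ≡⟨ cong (fwd (λ _ _ → g) +_) (sumR-*ˡ d E _) ⟩
        fwd (λ _ _ → g) + E * X g ∎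
        where
        open ≤-Reasoning
        point : ∀ G → Regular d G → D * (⟦ inX G ⟧ * g G) ≤
          sum₂ (λ x y → ⟦ valid G a b x y ⟧ * (⟦ F ⊆ G ∧ not (F x y) ⟧ * g G)) + E * (⟦ inX G ⟧ * g G)
        point G R with bool-cases (inX G)
        ... | inj₂ e rewrite e = ≤-trans (≤-reflexive (*-zeroʳ D)) z≤n
        ... | inj₁ e = begin
          D * (⟦ inX G ⟧ * g G) ≤⟨ *-monoˡ-≤ (⟦ inX G ⟧ * g G) (hidden-avoid R ω P Q sizes) ⟩
          (S + E) * (⟦ inX G ⟧ * g G) ≡⟨ *-distribʳ-+ (⟦ inX G ⟧ * g G) S E ⟩
          S * (⟦ inX G ⟧ * g G) + E * (⟦ inX G ⟧ * g G)
            ≡⟨ cong (_+ E * (⟦ inX G ⟧ * g G)) (trans (cong (λ p → S * (p * g G)) (⟦⟧-true e)) (trans (lem S (g G)) (trans (sym (sum₂-*ˡ (g G) _)) (sum₂-cong regroup)))) ⟩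
          sum₂ (λ x y → ⟦ valid G a b x y ⟧ * (⟦ F ⊆ G ∧ not (F x y) ⟧ * g G)) + E * (⟦ inX G ⟧ * g G) ∎
          where
          ω : F ⊆ G ≡ true
          ω = proj₁ (∧-split e)
          gab : G a b ≡ true
          gab = proj₂ (∧-split {F ⊆ G} e)
          P Q : Fin n → Bool
          P x = G a x ∨ a == x
          Q y = G b y ∨ b == y
          sizes : count P + count Q ≤ 2 * d + 4
          sizes = ≤-trans (+-mono-≤ (closed-nbhd R a) (closed-nbhd R b)) (≤-trans (m≤m+n (suc d + suc d) 2) (≤-reflexive (lem′ d)))
            where
            lem′ : ∀ d → (1 + d) + (1 + d) + 2 ≡ 2 * d + 4
            lem′ = solve-∀
          S = sum₂ (λ x y → ⟦ hidden G x y ⟧ * (⟦ not (P x) ⟧ * ⟦ not (Q y) ⟧))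
          lem : ∀ s g → s * (1 * g) ≡ g * s
          lem = solve-∀
          regroup : ∀ x y → g G * (⟦ hidden G x y ⟧ * (⟦ not (P x) ⟧ * ⟦ not (Q y) ⟧)) ≡ ⟦ valid G a b x y ⟧ * (⟦ F ⊆ G ∧ not (F x y) ⟧ * g G)
          regroup x y rewrite valid-factors G a b x y | gab | ω | ⟦∧⟧ (G x y) (not (F x y)) =
            lem″ (g G) ⟦ G x y ⟧ ⟦ not (F x y) ⟧ ⟦ not (P x) ⟧ ⟦ not (Q y) ⟧
            where
            lem″ : ∀ g h f p q → g * ((h * f) * (p * q)) ≡ (1 * h) * (p * q) * (f * g)
            lem″ = solve-∀

      near : Graph n → Fin n → Fin n → Bool
      near G y x = G y x ∨ y == x

      -- The pairs x, y for which no switch can insert the edge a b.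
      blocked : Graph n → ℕ
      blocked G = sum₂ (λ x y → (⟦ hidden G a x ⟧ * ⟦ hidden G b y ⟧) * ⟦ near G y x ⟧)

      private
        ends-total : ∀ G → Regular d G → F ⊆ G ≡ true → sum₂ (λ x y → ⟦ hidden G a x ⟧ * ⟦ hidden G b y ⟧) ≡ δ a * δ b
        ends-total G R ω = trans (sum₂-product (λ x → ⟦ hidden G a x ⟧) (λ y → ⟦ hidden G b y ⟧)) (cong₂ _*_ (hidden-row R ω a) (hidden-row R ω b))

      bwd-≤ : ∀ (g : Graph n → ℕ) → bwd (λ _ _ → g) ≤ δ a * δ b * Z g
      bwd-≤ g = begin
        bwd (λ _ _ → g) ≤⟨ sumR-mono d (λ G R → ≤-trans (sum₂-mono (point G))
            (≤-reflexive (trans (sum₂-*ˡ (⟦ inZ G ⟧ * g G) _) refl))) ⟩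
        sumR d (λ G → ⟦ inZ G ⟧ * g G * sum₂ (λ x y → ⟦ hidden G a x ⟧ * ⟦ hidden G b y ⟧))
          ≡⟨ sumR-cong d (λ G R → trans (lem ⟦ inZ G ⟧ (g G) (sum₂ (λ x y → ⟦ hidden G a x ⟧ * ⟦ hidden G b y ⟧)))
               (trans (⟦⟧*-cong (inZ G) (λ e → cong (g G *_) (ends-total G R (proj₁ (∧-split e))))) (lem′ ⟦ inZ G ⟧ (g G) (δ a * δ b)))) ⟩
        sumR d (λ G → δ a * δ b * (⟦ inZ G ⟧ * g G)) ≡⟨ sumR-*ˡ d (δ a * δ b) _ ⟩
        δ a * δ b * Z g ∎
        where
        open ≤-Reasoning
        lem : ∀ p q r → p * q * r ≡ p * (q * r)
        lem = solve-∀
        lem′ : ∀ p q r → p * (q * r) ≡ r * (p * q)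
        lem′ = solve-∀
        point : ∀ G x y → ⟦ valid G a x b y ⟧ * (⟦ F ⊆ G ∧ (not (F a x) ∧ not (F b y)) ⟧ * g G) ≤
          ⟦ inZ G ⟧ * g G * (⟦ hidden G a x ⟧ * ⟦ hidden G b y ⟧)
        point G x y = ≤-trans (⟦⟧*⟦⟧≤ (valid G a x b y) (F ⊆ G ∧ (not (F a x) ∧ not (F b y))) (inZ G) {g′ = g G * (⟦ hidden G a x ⟧ * ⟦ hidden G b y ⟧)}
            (λ v w → let V = valid⇒ {G = G} v ; w′ = ∧-split {F ⊆ G} w ; w″ = ∧-split {not (F a x)} (proj₂ w′) in
              ∧-join (proj₁ w′) (not-true (Valid.ax V)) ,
              ≤-reflexive (sym (trans (cong (g G *_) (cong₂ (λ p q → ⟦ p ⟧ * ⟦ q ⟧) (∧-join (Valid.ab V) (proj₁ w″)) (∧-join (Valid.xy V) (proj₂ w″)))) (*-identityʳ _)))))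
          (≤-reflexive (sym (lem ⟦ inZ G ⟧ (g G) _)))

      ≤bwd : ∀ (g : Graph n → ℕ) c → (∀ G → g G ≤ c) → δ a * δ b * Z g ≤ bwd (λ _ _ → g) + c * Z blocked
      ≤bwd g c g≤c = begin
        δ a * δ b * Z g ≡⟨ sumR-*ˡ d (δ a * δ b) _ ⟨
        sumR d (λ G → δ a * δ b * (⟦ inZ G ⟧ * g G)) ≤⟨ sumR-mono d point ⟩
        sumR d (λ G → sum₂ (move-term G) + c * (⟦ inZ G ⟧ * blocked G)) ≡⟨ sumR-+ d _ _ ⟩
        bwd (λ _ _ → g) + sumR d (λ G → c * (⟦ inZ G ⟧ * blocked G)) ≡⟨ cong (bwd (λ _ _ → g) +_) (sumR-*ˡ d c _) ⟩
        bwd (λ _ _ → g) + c * Z blocked ∎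
        where
        open ≤-Reasoning
        move-term : Graph n → Fin n → Fin n → ℕ
        move-term G x y = ⟦ valid G a x b y ⟧ * (⟦ F ⊆ G ∧ (not (F a x) ∧ not (F b y)) ⟧ * g G)
        point : ∀ G → Regular d G → δ a * δ b * (⟦ inZ G ⟧ * g G) ≤ sum₂ (move-term G) + c * (⟦ inZ G ⟧ * blocked G)
        point G R with bool-cases (inZ G)
        ... | inj₂ e rewrite e = ≤-trans (≤-reflexive (*-zeroʳ (δ a * δ b))) z≤n
        ... | inj₁ e = begin
          δ a * δ b * (⟦ inZ G ⟧ * g G) ≡⟨ cong₂ _*_ (sym (ends-total G R ω)) (trans (cong (λ p → ⟦ p ⟧ * g G) e) (*-identityˡ (g G))) ⟩
          sum₂ (λ x y → ⟦ hidden G a x ⟧ * ⟦ hidden G b y ⟧) * g G ≡⟨ trans (*-comm _ (g G)) (sym (sum₂-*ˡ (g G) _)) ⟩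
          sum₂ (λ x y → g G * (⟦ hidden G a x ⟧ * ⟦ hidden G b y ⟧)) ≤⟨ sum₂-mono split ⟩
          sum₂ (λ x y → move-term G x y + c * ((⟦ hidden G a x ⟧ * ⟦ hidden G b y ⟧) * ⟦ near G y x ⟧))
            ≡⟨ trans (sum₂-+ (move-term G) _) (cong (sum₂ (move-term G) +_) (sum₂-*ˡ c _)) ⟩
          sum₂ (move-term G) + c * blocked G ≡⟨ cong (λ z → sum₂ (move-term G) + c * z) (trans (cong (λ p → ⟦ p ⟧ * blocked G) e) (*-identityˡ _)) ⟨
          sum₂ (move-term G) + c * (⟦ inZ G ⟧ * blocked G) ∎
          where
          ω : F ⊆ G ≡ true
          ω = proj₁ (∧-split e)
          gab : G a b ≡ false
          gab = not-false (proj₂ (∧-split {F ⊆ G} e))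
          split : ∀ x y → g G * (⟦ hidden G a x ⟧ * ⟦ hidden G b y ⟧) ≤ move-term G x y + c * ((⟦ hidden G a x ⟧ * ⟦ hidden G b y ⟧) * ⟦ near G y x ⟧)
          split x y with bool-cases (hidden G a x) | bool-cases (hidden G b y) | bool-cases (near G y x)
          ... | inj₂ p | _ | _ rewrite p = ≤-trans (≤-reflexive (*-zeroʳ (g G))) z≤n
          ... | inj₁ p | inj₂ q | _ rewrite p | q = ≤-trans (≤-reflexive (*-zeroʳ (g G))) z≤n
          ... | inj₁ p | inj₁ q | inj₁ r rewrite p | q | r = ≤-trans (*-monoˡ-≤ 1 (g≤c G)) (m≤n+m _ _)
          ... | inj₁ p | inj₁ q | inj₂ r = ≤-trans (≤-reflexive eq) (m≤m+n _ _)
            where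
            p′ = ∧-split {G a x} p
            q′ = ∧-split {G b y} q
            far : G y x ≡ false × (y == x) ≡ false
            far with G y x | y == x
            ... | false | false = refl , refl
            ... | true | _ = ⊥-elim (true≢false refl r)
            ... | false | true = ⊥-elim (true≢false refl r)
            V : valid G a x b y ≡ true
            V = valid⇐ record { ab = proj₁ p′ ; xy = proj₁ q′ ; ax = gab ; by = trans (symm R x y) (proj₁ far)
                              ; a≢x = a≢b ; b≢y = λ e → ==false⇒≢ (proj₂ far) (sym e) }
            eq : g G * (⟦ hidden G a x ⟧ * ⟦ hidden G b y ⟧) ≡ move-term G x y
            eq rewrite p | q | V | ω | proj₂ p′ | proj₂ q′ = trans (*-identityʳ (g G)) (sym (trans (*-identityˡ (1 * g G)) (*-identityˡ (g G))))

      -- Blocked pairs are rare: most switches of the edge a x destroy the obstruction.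
      blocked-bound : D * Z blocked ≤ Z (λ _ → δ a * δ b * (suc d * δ̂)) + E * Z blocked
      blocked-bound = begin
        D * Z blocked ≡⟨ cong (D *_) split-sum ⟩
        D * sum₂ (λ x y → sumR d (λ G → ⟦ K x y G ⟧)) ≡⟨ sum₂-*ˡ D _ ⟨
        sum₂ (λ x y → D * sumR d (λ G → ⟦ K x y G ⟧)) ≤⟨ sum₂-mono each ⟩
        sum₂ (λ x y → sumR d (λ G → sum₂ (λ u v → ⟦ valid G a u x v ⟧ * ⟦ K′ x y u v G ⟧)) + E * sumR d (λ G → ⟦ K x y G ⟧))
          ≡⟨ trans (sum₂-+ _ _) (cong₂ _+_ (sym (sumR-sum₂ d _)) (trans (sum₂-*ˡ E _) (cong (E *_) (sym split-sum)))) ⟩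
        sumR d (λ G → sum₂ (λ x y → sum₂ (λ u v → ⟦ valid G a u x v ⟧ * ⟦ K′ x y u v G ⟧))) + E * Z blocked
          ≤⟨ +-monoˡ-≤ (E * Z blocked) (sumR-mono d final) ⟩
        Z (λ _ → δ a * δ b * (suc d * δ̂)) + E * Z blocked ∎
        where
        open ≤-Reasoning
        K : Fin n → Fin n → Graph n → Bool
        K x y G = inZ G ∧ ((hidden G a x ∧ hidden G b y) ∧ near G y x)
        -- The second edge must be hidden, and it must avoid b so that `b y` stays present and `a b`
        -- stays absent.
        extra : Fin n → Fin n → Bool
        extra u v = not (F u v) ∧ (not (b == u) ∧ not (b == v))
        -- The trace left when a x, u v become a u, x v. It is counted from b: y is a hidden
        -- neighbour of b, x one of at most d + 1 vertices near y, u a hidden neighbour of a, and v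
        -- one of x.
        K′ : Fin n → Fin n → Fin n → Fin n → Graph n → Bool
        K′ x y u v G = inZ G ∧ ((hidden G a u ∧ hidden G x v) ∧ (hidden G b y ∧ near G y x))
        K-eq : ∀ x y G → ⟦ inZ G ⟧ * ((⟦ hidden G a x ⟧ * ⟦ hidden G b y ⟧) * ⟦ near G y x ⟧) ≡ ⟦ K x y G ⟧
        K-eq x y G = sym (trans (⟦∧⟧ (inZ G) _) (cong (⟦ inZ G ⟧ *_) (trans (⟦∧⟧ (hidden G a x ∧ hidden G b y) _) (cong (_* ⟦ near G y x ⟧) (⟦∧⟧ (hidden G a x) (hidden G b y))))))
        split-sum : Z blocked ≡ sum₂ (λ x y → sumR d (λ G → ⟦ K x y G ⟧))
        split-sum = trans (sumR-cong d (λ G _ → trans (sym (sum₂-*ˡ ⟦ inZ G ⟧ _)) (sum₂-cong (λ x y → K-eq x y G)))) (sumR-sum₂ d _)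
        near-ext : ∀ x y → Ext (λ G → near G y x)
        near-ext x y G H e = cong (_∨ y == x) (e y x)
        hidden-ext : ∀ i j → Ext (λ G → hidden G i j)
        hidden-ext i j G H e = cong (_∧ not (F i j)) (e i j)
        inZ-ext : Ext inZ
        inZ-ext G H e = cong₂ (λ p q → p ∧ not q) (⊆-ext F G H e) (e a b)

        step : ∀ x y u v G → Regular d G → Valid G a x u v → ⟦ K x y G ∧ extra u v ⟧ ≤ ⟦ K′ x y u v (switch a x u v G) ⟧
        step x y u v G R V = ⟦⟧-mono go
          where
          open SwitchProps R V using (G′; valid′)
          open Valid V renaming (ab to ax; xy to uv; ax to au; by to xv; a≢x to a≢u; b≢y to x≢v)
          go : K x y G ∧ extra u v ≡ true → K′ x y u v G′ ≡ true
          go e = ∧-join (∧-join ω′ (not-true gab′)) (∧-join (∧-join (∧-join (Valid.ab valid′) (not-true (⊆-absent ω au))) (∧-join (Valid.xy valid′) (not-true (⊆-absent ω xv)))) (∧-join (∧-join gby′ nfby) near′))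
            where
            e₁ = ∧-split {K x y G} e
            e₂ = ∧-split {inZ G} (proj₁ e₁)
            e₃ = ∧-split {F ⊆ G} (proj₁ e₂)
            e₄ = ∧-split {hidden G a x ∧ hidden G b y} (proj₂ e₂)
            e₅ = ∧-split {hidden G a x} (proj₁ e₄)
            e₆ = ∧-split {not (F u v)} (proj₂ e₁)
            e₇ = ∧-split {not (b == u)} (proj₂ e₆)
            ω = proj₁ e₃
            gab : G a b ≡ false
            gab = not-false (proj₂ e₃)
            nfax = proj₂ (∧-split {G a x} (proj₁ e₅))
            gby = proj₁ (∧-split {G b y} (proj₂ e₅))
            nfby = proj₂ (∧-split {G b y} (proj₂ e₅))
            b≢u : b ≢ u
            b≢u = ==false⇒≢ (not-false (proj₁ e₇))
            b≢v : b ≢ v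
            b≢v = ==false⇒≢ (not-false (proj₂ e₇))
            x≢b : x ≢ b
            x≢b refl = true≢false ax gab
            y≢a : y ≢ a
            y≢a refl = true≢false (trans (symm R a b) gby) gab
            ω′ : F ⊆ G′ ≡ true
            ω′ = ⊆-keep R V ω (not-false nfax) (not-false (proj₁ e₆))
            gab′ : G′ a b ≡ false
            gab′ = switch-avoid R V gab (λ (_ , q) → b≢u (sym q)) (λ (p , _) → a≢u (sym p)) (λ (p , q) → b≢v (sym q)) (λ (_ , q) → x≢b q)
            gby′ : G′ b y ≡ true
            gby′ = switch-keep R V gby (λ (p , _) → a≢b p) (λ (p , _) → x≢b p) (λ (p , _) → b≢u (sym p)) (λ (p , _) → b≢v (sym p))
            near′ : near G′ y x ≡ true
            near′ with ∨-split {G y x} (proj₂ e₄)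
            ... | inj₂ q = ∨-true {G′ y x} (inj₂ q)
            ... | inj₁ q = ∨-true (inj₁ (switch-keep R V q (λ (p , _) → y≢a (sym p)) (λ (p , s) → clash p s) (λ { (refl , refl) → x≢v refl }) (λ { (refl , refl) → true≢false (trans (symm R x y) q) xv })))
              where
              clash : x ≡ y → a ≡ x → ⊥
              clash p s = y≢a (trans (sym p) (sym s))

        each : ∀ x y → D * sumR d (λ G → ⟦ K x y G ⟧) ≤
          sumR d (λ G → sum₂ (λ u v → ⟦ valid G a u x v ⟧ * ⟦ K′ x y u v G ⟧)) + E * sumR d (λ G → ⟦ K x y G ⟧)
        each x y = begin
          D * sumR d (λ G → ⟦ K x y G ⟧) ≡⟨ sumR-*ˡ d D _ ⟨
          sumR d (λ G → D * ⟦ K x y G ⟧) ≤⟨ sumR-mono d point ⟩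
          sumR d (λ G → sum₂ (λ u v → ⟦ valid G a x u v ⟧ * ⟦ K x y G ∧ extra u v ⟧) + E * ⟦ K x y G ⟧) ≡⟨ sumR-+ d _ _ ⟩
          sumR d (λ G → sum₂ (λ u v → ⟦ valid G a x u v ⟧ * ⟦ K x y G ∧ extra u v ⟧)) + sumR d (λ G → E * ⟦ K x y G ⟧)
            ≤⟨ +-mono-≤ (moves₂ d a x (λ u v G → ⟦ K x y G ∧ extra u v ⟧) (λ u v G → ⟦ K′ x y u v G ⟧)
                 (λ u v G H e → cong₂ (λ p q → ⟦ p ∧ q ⟧) (inZ-ext G H e) (cong₂ _∧_ (cong₂ _∧_ (hidden-ext a u G H e) (hidden-ext x v G H e)) (cong₂ _∧_ (hidden-ext b y G H e) (near-ext x y G H e))))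
                 (step x y)) (≤-reflexive (sumR-*ˡ d E _)) ⟩
          sumR d (λ G → sum₂ (λ u v → ⟦ valid G a u x v ⟧ * ⟦ K′ x y u v G ⟧)) + E * sumR d (λ G → ⟦ K x y G ⟧) ∎
          where
          point : ∀ G → Regular d G → D * ⟦ K x y G ⟧ ≤ sum₂ (λ u v → ⟦ valid G a x u v ⟧ * ⟦ K x y G ∧ extra u v ⟧) + E * ⟦ K x y G ⟧
          point G R with bool-cases (K x y G)
          ... | inj₂ e rewrite e = ≤-trans (≤-reflexive (*-zeroʳ D)) z≤n
          ... | inj₁ e rewrite e = begin
            D * 1 ≡⟨ *-identityʳ D ⟩
            D ≤⟨ hidden-avoid R ω P Q sizes ⟩
            sum₂ (λ u v → ⟦ hidden G u v ⟧ * (⟦ not (P u) ⟧ * ⟦ not (Q v) ⟧)) + E ≡⟨ cong₂ _+_ (sum₂-cong regroup) (sym (*-identityʳ E)) ⟩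
            sum₂ (λ u v → ⟦ valid G a x u v ⟧ * ⟦ extra u v ⟧) + E * 1 ∎
            where
            e₁ = ∧-split {inZ G} e
            ω = proj₁ (∧-split {F ⊆ G} (proj₁ e₁))
            gax : G a x ≡ true
            gax = proj₁ (∧-split {G a x} (proj₁ (∧-split {hidden G a x} (proj₁ (∧-split {hidden G a x ∧ hidden G b y} (proj₂ e₁))))))
            P Q : Fin n → Bool
            P u = (G a u ∨ a == u) ∨ b == u
            Q v = (G x v ∨ x == v) ∨ b == v
            sizes : count P + count Q ≤ 2 * d + 4
            sizes = ≤-trans (+-mono-≤ (one a) (one x)) (≤-reflexive (lem d))
              where
              one : ∀ c → count (λ u → (G c u ∨ c == u) ∨ b == u) ≤ suc d + 1
              one c = ≤-trans (count-∨ (λ u → G c u ∨ c == u) (λ u → b == u)) (+-mono-≤ (closed-nbhd R c) (≤-reflexive (count-== b)))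
              lem : ∀ d → (1 + d + 1) + (1 + d + 1) ≡ 2 * d + 4
              lem = solve-∀
            regroup : ∀ u v → ⟦ hidden G u v ⟧ * (⟦ not (P u) ⟧ * ⟦ not (Q v) ⟧) ≡ ⟦ valid G a x u v ⟧ * ⟦ extra u v ⟧
            regroup u v rewrite valid-factors G a x u v | gax | ⟦∧⟧ (G u v) (not (F u v)) | ⟦not∨⟧ (G a u ∨ a == u) (b == u) | ⟦not∨⟧ (G x v ∨ x == v) (b == v)
                | ⟦∧⟧ (not (F u v)) (not (b == u) ∧ not (b == v)) | ⟦∧⟧ (not (b == u)) (not (b == v)) =
              lem ⟦ G u v ⟧ ⟦ not (F u v) ⟧ ⟦ not (G a u ∨ a == u) ⟧ ⟦ not (b == u) ⟧ ⟦ not (G x v ∨ x == v) ⟧ ⟦ not (b == v) ⟧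
              where
              lem : ∀ g f p r q s → (g * f) * ((p * r) * (q * s)) ≡ (1 * g) * (p * q) * (f * (r * s))
              lem = solve-∀

        final : ∀ G → Regular d G → sum₂ (λ x y → sum₂ (λ u v → ⟦ valid G a u x v ⟧ * ⟦ K′ x y u v G ⟧)) ≤ ⟦ inZ G ⟧ * (δ a * δ b * (suc d * δ̂))
        final G R with bool-cases (inZ G)
        ... | inj₂ e = ≤-trans (≤-reflexive (trans (sum₂-cong (λ x y → trans (sum₂-cong (λ u v →
              trans (cong (λ p → ⟦ valid G a u x v ⟧ * ⟦ p ∧ ((hidden G a u ∧ hidden G x v) ∧ (hidden G b y ∧ near G y x)) ⟧) e) (*-zeroʳ ⟦ valid G a u x v ⟧))) zeros)) zeros)) z≤n
          where
          zeros : sum₂ {n} {n} (λ _ _ → 0) ≡ 0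
          zeros = trans (sum₂-*ˡ 0 (λ _ _ → 0)) refl
        ... | inj₁ e = begin
          sum₂ (λ x y → sum₂ (λ u v → ⟦ valid G a u x v ⟧ * ⟦ K′ x y u v G ⟧))
            ≤⟨ sum₂-mono (λ x y → sum₂-mono (λ u v → ≤-trans (⟦⟧*≤ (valid G a u x v) _) (≤-reflexive (factors x y u v)))) ⟩
          sum₂ (λ x y → sum₂ (λ u v → (⟦ hidden G b y ⟧ * ⟦ near G y x ⟧) * (⟦ hidden G a u ⟧ * ⟦ hidden G x v ⟧)))
            ≡⟨ sum₂-cong (λ x y → trans (sum₂-*ˡ (⟦ hidden G b y ⟧ * ⟦ near G y x ⟧) _)
                 (cong (⟦ hidden G b y ⟧ * ⟦ near G y x ⟧ *_) (trans (sum₂-product _ _) (cong₂ _*_ (hidden-row R ω a) (hidden-row R ω x))))) ⟩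
          sum₂ (λ x y → (⟦ hidden G b y ⟧ * ⟦ near G y x ⟧) * (δ a * δ x))
            ≤⟨ sum₂-mono (λ x y → *-monoʳ-≤ (⟦ hidden G b y ⟧ * ⟦ near G y x ⟧) (*-monoʳ-≤ (δ a) (δ≤ x))) ⟩
          sum₂ (λ x y → (⟦ hidden G b y ⟧ * ⟦ near G y x ⟧) * (δ a * δ̂))
            ≡⟨ trans (sum₂-cong (λ x y → *-comm _ (δ a * δ̂))) (sum₂-*ˡ (δ a * δ̂) _) ⟩
          δ a * δ̂ * sum₂ (λ x y → ⟦ hidden G b y ⟧ * ⟦ near G y x ⟧)
            ≡⟨ cong (δ a * δ̂ *_) (trans (sum₂-swap _) (sum₂-rows _)) ⟩
          δ a * δ̂ * sum (λ y → sum (λ x → ⟦ hidden G b y ⟧ * ⟦ near G y x ⟧))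
            ≤⟨ *-monoʳ-≤ (δ a * δ̂) (sum-mono (λ y → ≤-trans (≤-reflexive (sum-*ˡ ⟦ hidden G b y ⟧ _)) (*-monoʳ-≤ ⟦ hidden G b y ⟧ (closed-nbhd R y)))) ⟩
          δ a * δ̂ * sum (λ y → ⟦ hidden G b y ⟧ * suc d) ≡⟨ cong (δ a * δ̂ *_) (trans (sum-*ʳ (suc d) _) (cong (_* suc d) (hidden-row R ω b))) ⟩
          δ a * δ̂ * (δ b * suc d) ≡⟨ lem (δ a) δ̂ (δ b) (suc d) ⟩
          1 * (δ a * δ b * (suc d * δ̂)) ≡⟨ cong (λ p → ⟦ p ⟧ * (δ a * δ b * (suc d * δ̂))) e ⟨
          ⟦ inZ G ⟧ * (δ a * δ b * (suc d * δ̂)) ∎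
          where
          ω : F ⊆ G ≡ true
          ω = proj₁ (∧-split {F ⊆ G} e)
          lem : ∀ p q r s → p * q * (r * s) ≡ 1 * (p * r * (s * q))
          lem = solve-∀
          factors : ∀ x y u v → ⟦ K′ x y u v G ⟧ ≡ (⟦ hidden G b y ⟧ * ⟦ near G y x ⟧) * (⟦ hidden G a u ⟧ * ⟦ hidden G x v ⟧)
          factors x y u v rewrite e | ⟦∧⟧ (hidden G a u ∧ hidden G x v) (hidden G b y ∧ near G y x) | ⟦∧⟧ (hidden G a u) (hidden G x v) | ⟦∧⟧ (hidden G b y) (near G y x) =
            *-comm (⟦ hidden G a u ⟧ * ⟦ hidden G x v ⟧) _

      const₁ : Graph n → ℕ
      const₁ _ = 1

      X-mono : ∀ {g g′ : Graph n → ℕ} → (∀ G → g G ≤ g′ G) → X g ≤ X g′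
      X-mono le = sumR-mono d (λ G _ → *-monoʳ-≤ ⟦ inX G ⟧ (le G))

      Z-mono : ∀ {g g′ : Graph n → ℕ} → (∀ G → g G ≤ g′ G) → Z g ≤ Z g′
      Z-mono le = sumR-mono d (λ G _ → *-monoʳ-≤ ⟦ inZ G ⟧ (le G))

      scaleʳ : ∀ (p : Graph n → Bool) c → sumR d (λ G → ⟦ p G ⟧ * c) ≡ c * sumR d (λ G → ⟦ p G ⟧ * 1)
      scaleʳ p c = trans (sumR-cong d (λ G _ → lem ⟦ p G ⟧ c)) (sumR-*ˡ d c _)
        where
        lem : ∀ p c → p * c ≡ c * (p * 1)
        lem = solve-∀

      fwd-+ : ∀ g g′ → fwd (λ x y G → g x y G + g′ x y G) ≡ fwd g + fwd g′
      fwd-+ g g′ = trans (sumR-cong d (λ G _ → trans (sum₂-cong (λ x y → lem ⟦ valid G a b x y ⟧ ⟦ F ⊆ G ∧ not (F x y) ⟧ (g x y G) (g′ x y G))) (sum₂-+ _ _))) (sumR-+ d _ _)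
        where
        lem : ∀ p q r s → p * (q * (r + s)) ≡ p * (q * r) + p * (q * s)
        lem = solve-∀

      bwd-+4 : bwd (λ _ _ G → h G + 4) ≡ bwd (λ _ _ → h) + 4 * bwd (λ _ _ → const₁)
      bwd-+4 = trans (sumR-cong d (λ G _ → trans (sum₂-cong (λ x y → lem ⟦ valid G a x b y ⟧ ⟦ F ⊆ G ∧ (not (F a x) ∧ not (F b y)) ⟧ (h G)))
          (trans (sum₂-+ _ (λ x y → 4 * unit G x y)) (cong (sum₂ (λ x y → ⟦ valid G a x b y ⟧ * (⟦ F ⊆ G ∧ (not (F a x) ∧ not (F b y)) ⟧ * h G)) +_) (sum₂-*ˡ 4 (unit G))))))
          (trans (sumR-+ d _ (λ G → 4 * sum₂ (unit G))) (cong (bwd (λ _ _ → h) +_) (sumR-*ˡ d 4 (λ G → sum₂ (unit G)))))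
        where
        unit : Graph n → Fin n → Fin n → ℕ
        unit G x y = ⟦ valid G a x b y ⟧ * (⟦ F ⊆ G ∧ (not (F a x) ∧ not (F b y)) ⟧ * 1)
        lem : ∀ p q r → p * (q * (r + 4)) ≡ p * (q * r) + 4 * (p * (q * 1))
        lem = solve-∀

      T : ℕ
      T = fwd (λ _ _ → const₁)

      T≡bwd : T ≡ bwd (λ _ _ → const₁)
      T≡bwd = ≤-antisym (fwd≤bwd _ _ (λ x y G H e → refl) (λ x y G R V → ≤-refl)) (bwd≤fwd _ _ (λ x y G H e → refl) (λ x y G R V → ≤-refl))

      increase : Weight
      increase x y G = 2 * (⟦ same G a x ⟧ + ⟦ same G b y ⟧)

      increase≤4 : fwd increase ≤ 4 * D * X const₁
      increase≤4 = ≤-trans (fwd-upper increase (λ _ → 4 * D) (λ G R ω → ≤-trans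
          (sum₂-mono (λ x y → *-monoʳ-≤ ⟦ hidden G x y ⟧ (*-monoʳ-≤ 2 (+-mono-≤ (⟦⟧≤1 (same G a x)) (⟦⟧≤1 (same G b y))))))
          (≤-reflexive (trans (sum₂-cong (λ x y → *-comm ⟦ hidden G x y ⟧ 4)) (trans (sum₂-*ˡ 4 _) (cong (4 *_) (hidden-total R ω)))))))
        (≤-reflexive (scaleʳ inX (4 * D)))

      -- At most α vertices x are related to a, each with at most δ̂ hidden darts, and the same
      -- holds for y and b; so the sum over all hidden darts does not grow with `D`.
      increase≤α : fwd increase ≤ 4 * (α * δ̂) * X const₁
      increase≤α = ≤-trans (fwd-upper increase (λ _ → 4 * (α * δ̂)) bound) (≤-reflexive (scaleʳ inX (4 * (α * δ̂))))
        where
        open ≤-Reasoning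
        side : ∀ (s : Fin n → Bool) (H : Graph n) → count s ≤ α → (∀ x → count (H x) ≤ δ̂) → sum₂ (λ x y → ⟦ s x ⟧ * ⟦ H x y ⟧) ≤ α * δ̂
        side s H cs rows = begin
          sum₂ (λ x y → ⟦ s x ⟧ * ⟦ H x y ⟧) ≡⟨ trans (sum₂-rows _) (sum-cong (λ x → sum-*ˡ ⟦ s x ⟧ _)) ⟩
          sum (λ x → ⟦ s x ⟧ * count (H x)) ≤⟨ sum-mono (λ x → *-monoʳ-≤ ⟦ s x ⟧ (rows x)) ⟩
          sum (λ x → ⟦ s x ⟧ * δ̂) ≡⟨ sum-*ʳ δ̂ _ ⟩
          count s * δ̂ ≤⟨ *-monoˡ-≤ δ̂ cs ⟩
          α * δ̂ ∎
        bound : ∀ G → Regular d G → F ⊆ G ≡ true → sum₂ (λ x y → ⟦ hidden G x y ⟧ * increase x y G) ≤ 4 * (α * δ̂)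
        bound G R ω = begin
          sum₂ (λ x y → ⟦ hidden G x y ⟧ * increase x y G)
            ≡⟨ trans (sum₂-cong (λ x y → lem ⟦ hidden G x y ⟧ ⟦ same G a x ⟧ ⟦ same G b y ⟧)) (trans (sum₂-*ˡ 2 _) (cong (2 *_) (sum₂-+ _ _))) ⟩
          2 * (sum₂ (λ x y → ⟦ same G a x ⟧ * ⟦ hidden G x y ⟧) + sum₂ (λ x y → ⟦ same G b y ⟧ * ⟦ hidden G x y ⟧))
            ≤⟨ *-monoʳ-≤ 2 (+-mono-≤ (side (same G a) (hidden G) (same≤ G a) (λ x → ≤-trans (≤-reflexive (hidden-row R ω x)) (δ≤ x)))
                 (≤-trans (≤-reflexive (sum₂-swap _)) (side (same G b) (λ y x → hidden G x y) (same≤ G b) (λ y → ≤-trans (≤-reflexive (hidden-column R ω y)) (δ≤ y))))) ⟩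
          2 * (α * δ̂ + α * δ̂) ≡⟨ lem′ (α * δ̂) ⟩
          4 * (α * δ̂) ∎
          where
          lem : ∀ h s t → h * (2 * (s + t)) ≡ 2 * (s * h + t * h)
          lem = solve-∀
          lem′ : ∀ p → 2 * (p + p) ≡ 4 * p
          lem′ = solve-∀

      module _ (2E≤D : 2 * E ≤ D) where

        private
          lem : ∀ d → 2 * (1 + d) + 2 ≡ 2 * d + 4
          lem = solve-∀
          module A = Gap D E (δ a * δ b) (suc d * δ̂) Λ (X const₁) (Z const₁) T (Z blocked) 2E≤D
            (≤-trans (≤-reflexive (sym (*-assoc 2 (suc d) δ̂))) (*-monoˡ-≤ δ̂ (≤-trans (m≤m+n (2 * suc d) 2) (≤-reflexive (lem d)))))
            (fwd-≤D const₁) (D≤fwd const₁) (≤-trans (≤-reflexive T≡bwd) (bwd-≤ const₁))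
            (≤-trans (≤bwd const₁ 1 (λ _ → ≤-refl)) (≤-reflexive (cong₂ _+_ (sym T≡bwd) (*-identityˡ _))))
            (≤-trans blocked-bound (+-monoˡ-≤ (E * Z blocked) (≤-reflexive (scaleʳ inZ (δ a * δ b * (suc d * δ̂))))))
          Xh : X h ≤ Λ * X const₁
          Xh = ≤-trans (X-mono h≤) (≤-reflexive (scaleʳ inX Λ))
          Zh : Z h ≤ Λ * Z const₁
          Zh = ≤-trans (Z-mono h≤) (≤-reflexive (scaleʳ inZ Λ))

        gap-upper : D * (Z const₁ * X h) ≤ D * (X const₁ * Z h) + (4 * D + 3 * (E * Λ)) * (X const₁ * Z const₁)
        gap-upper = A.upper (D≤fwd h)
          (≤-trans (fwd≤bwd (λ _ _ → h) (λ _ _ G → h G + 4) (λ x y G H e → cong (_+ 4) (h-ext G H e)) (λ x y G R V → lip′ G R V))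
            (≤-reflexive (trans bwd-+4 (cong (λ t → bwd (λ _ _ → h) + 4 * t) (sym T≡bwd)))))
          (bwd-≤ h) Xh Zh

        gap-lower : ∀ {J} → fwd increase ≤ J * X const₁ →
          D * (X const₁ * Z h) ≤ D * (Z const₁ * X h) + (J + 3 * (E * Λ)) * (X const₁ * Z const₁)
        gap-lower {J} J≤ = A.lower {J = J} (≤bwd h Λ h≤) (≤-trans (bwd≤fwd′) (≤-reflexive (fwd-+ (λ _ _ → h) increase))) J≤ (fwd-≤D h) Zh
          where
          bwd≤fwd′ : bwd (λ _ _ → h) ≤ fwd (λ x y G → h G + increase x y G)
          bwd≤fwd′ = bwd≤fwd (λ _ _ → h) (λ x y G → h G + increase x y G)
            (λ x y G H e → cong₂ _+_ (h-ext G H e) (cong (2 *_) (cong₂ (λ p q → ⟦ p ⟧ + ⟦ q ⟧) (same-ext a x G H e) (same-ext b y G H e))))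
            (λ x y G R V → ≤-trans (≤-reflexive (sym (h-ext _ _ (switch-undo a x b y G))))
              (lip (switch a x b y G) (SwitchProps.regular′ R V) (SwitchProps.valid′ R V)))

-- (u − v − p)(u − v + q) ≤ 0, with both sides moved so that no subtraction occurs.
squeeze : ∀ {u v q e} → u ≤ v + (q + e) → v ≤ u + q → u * u + 2 * (v * v) + e * v ≤ v * v + 2 * (v * u) + e * u + (q + e) * q
squeeze {u} {v} {q} {e} h₁ h₂ with ≤-total v u
... | inj₁ v≤u = subst (λ u → u * u + 2 * (v * v) + e * v ≤ v * v + 2 * (v * u) + e * u + (q + e) * q) (m+[n∸m]≡n v≤u)
  (≤-trans (m≤m+n _ (r * (q + t))) (≤-reflexive (trans (lem v t e r q) (trans (cong (λ z → 3 * (v * v) + 2 * (v * t) + e * v + t * z + r * q) tr) (trans (lem′ v t e r q) (trans (cong (λ z → 3 * (v * v) + 2 * (v * t) + e * v + q * z + t * e) tr) (lem″ v t e q)))))))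
  where
  t r : ℕ
  t = u ∸ v
  r = q + e ∸ t
  tr : t + r ≡ q + e
  tr = m+[n∸m]≡n (m≤n+o⇒m∸n≤o u v h₁)
  lem : ∀ v t e r q → (v + t) * (v + t) + 2 * (v * v) + e * v + r * (q + t) ≡ 3 * (v * v) + 2 * (v * t) + e * v + t * (t + r) + r * q
  lem = solve-∀
  lem′ : ∀ v t e r q → 3 * (v * v) + 2 * (v * t) + e * v + t * (q + e) + r * q ≡ 3 * (v * v) + 2 * (v * t) + e * v + q * (t + r) + t * e
  lem′ = solve-∀
  lem″ : ∀ v t e q → 3 * (v * v) + 2 * (v * t) + e * v + q * (q + e) + t * e ≡ v * v + 2 * (v * (v + t)) + e * (v + t) + (q + e) * q
  lem″ = solve-∀
... | inj₂ u≤v = subst₂ (λ v q → u * u + 2 * (v * v) + e * v ≤ v * v + 2 * (v * u) + e * u + (q + e) * q) (m+[n∸m]≡n u≤v) (m+[n∸m]≡n t≤q)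
  (≤-trans (m≤m+n _ (2 * (t * r) + r * r + e * r)) (≤-reflexive (lem u t r e)))
  where
  t r : ℕ
  t = v ∸ u
  t≤q : t ≤ q
  t≤q = m≤n+o⇒m∸n≤o v u h₂
  r = q ∸ t
  lem : ∀ u t r e → u * u + 2 * ((u + t) * (u + t)) + e * (u + t) + (2 * (t * r) + r * r + e * r)
    ≡ (u + t) * (u + t) + 2 * ((u + t) * u) + e * u + (t + r + e) * (t + r)
  lem = solve-∀

-- Multiplied by x this is `squeeze` with u = D N s and v = D x S. Cancelling x makes the inequality
-- linear in x, s and Q, so that it can be summed over all darts `a b`; the premise on x ≡ 0 covers
-- the case where x cannot be cancelled.
edge-variance : ∀ {w x s Q S N D B₂ e c} → w * (x * Q) ≤ w * (s * s) + c * (x * x) →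
  D * (N * s) ≤ D * (x * S) + (B₂ + e) * (N * x) → D * (x * S) ≤ D * (N * s) + B₂ * (N * x) → (x ≡ 0 → Q ≡ 0) →
  w * (D * D * (N * N) * Q) + w * ((2 * (D * D * S) + e * (D * N)) * (x * S))
    ≤ w * (D * D * (S * S) * x) + w * ((2 * (D * D * S) + e * (D * N)) * (N * s)) + w * ((B₂ + e) * B₂ * (N * N) * x) + D * D * (N * N) * (c * x)
edge-variance {w} {zero} {s} {Q} {S} {N} {D} {B₂} {e} {c} h₁ h₂ h₃ h₀ rewrite h₀ refl =
  ≤-trans (≤-reflexive (lem w (D * D * (N * N)) (2 * (D * D * S) + e * (D * N)))) z≤n
  where
  lem : ∀ w p q → w * (p * 0) + w * (q * 0) ≡ 0
  lem = solve-∀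
edge-variance {w} {x@(suc _)} {s} {Q} {S} {N} {D} {B₂} {e} {c} h₁ h₂ h₃ h₀ = *-cancelˡ-≤ x (begin
  x * (w * (D * D * (N * N) * Q) + w * (κ * (x * S))) ≡⟨ lem₁ x w D N Q κ S ⟩
  D * D * (N * N) * (w * (x * Q)) + w * (κ * (x * x * S)) ≤⟨ +-monoˡ-≤ (w * (κ * (x * x * S))) (*-monoʳ-≤ (D * D * (N * N)) h₁) ⟩
  D * D * (N * N) * (w * (s * s) + c * (x * x)) + w * (κ * (x * x * S)) ≡⟨ lem₂ x w D N s S c e ⟩
  w * (u * u + 2 * (v * v) + (e * N * x) * v) + D * D * (N * N) * (c * (x * x))
    ≤⟨ +-monoˡ-≤ (D * D * (N * N) * (c * (x * x))) (*-monoʳ-≤ w (squeeze {u} {v} {B₂ * (N * x)} {e * N * x} (≤-trans h₂ (≤-reflexive (cong (v +_) (lem₃ B₂ e N x)))) h₃)) ⟩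
  w * (v * v + 2 * (v * u) + (e * N * x) * u + (B₂ * (N * x) + e * N * x) * (B₂ * (N * x))) + D * D * (N * N) * (c * (x * x)) ≡⟨ lem₄ x w D N s S c e B₂ ⟩
  x * (w * (D * D * (S * S) * x) + w * (κ * (N * s)) + w * ((B₂ + e) * B₂ * (N * N) * x) + D * D * (N * N) * (c * x)) ∎)
  where
  open ≤-Reasoning
  κ u v : ℕ
  κ = 2 * (D * D * S) + e * (D * N)
  u = D * (N * s)
  v = D * (x * S)
  lem₁ : ∀ x w D N Q κ S → x * (w * (D * D * (N * N) * Q) + w * (κ * (x * S))) ≡ D * D * (N * N) * (w * (x * Q)) + w * (κ * (x * x * S))
  lem₁ = solve-∀
  lem₂ : ∀ x w D N s S c e → D * D * (N * N) * (w * (s * s) + c * (x * x)) + w * ((2 * (D * D * S) + e * (D * N)) * (x * x * S))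
    ≡ w * ((D * (N * s)) * (D * (N * s)) + 2 * ((D * (x * S)) * (D * (x * S))) + (e * N * x) * (D * (x * S))) + D * D * (N * N) * (c * (x * x))
  lem₂ = solve-∀
  lem₃ : ∀ B e N x → (B + e) * (N * x) ≡ B * (N * x) + e * N * x
  lem₃ = solve-∀
  lem₄ : ∀ x w D N s S c e B → w * ((D * (x * S)) * (D * (x * S)) + 2 * ((D * (x * S)) * (D * (N * s))) + (e * N * x) * (D * (N * s)) + (B * (N * x) + e * N * x) * (B * (N * x))) + D * D * (N * N) * (c * (x * x))
    ≡ x * (w * (D * D * (S * S) * x) + w * ((2 * (D * D * S) + e * (D * N)) * (N * s)) + w * ((B + e) * B * (N * N) * x) + D * D * (N * N) * (c * x))
  lem₄ = solve-∀

insert : ∀ {n} → Fin n → Fin n → Graph n → Graph n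
insert a b F i j = pair a b i j ∨ F i j

module Variance {n : ℕ} (d : ℕ) (h : Graph n → ℕ) (h-ext : Ext h) (Λ α : ℕ) (h≤ : ∀ G → h G ≤ Λ)
  (same : Graph n → Fin n → Fin n → Bool) (same≤ : ∀ G a → count (same G a) ≤ α) (same-ext : ∀ a x → Ext (λ G → same G a x))
  (lip : ∀ G → Regular d G → ∀ {a b x y} → Valid G a b x y →
    h (switch a b x y G) ≤ h G + 2 * (⟦ same G a x ⟧ + ⟦ same G b y ⟧)) where

  open Exposure d h h-ext Λ α h≤ same same≤ same-ext lip using (module Stage)

  over : Graph n → (Graph n → ℕ) → ℕ
  over F g = sumR d (λ G → ⟦ F ⊆ G ⟧ * g G)

  N S Q : Graph n → ℕ
  N F = over F (λ _ → 1)
  S F = over F h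
  Q F = over F (λ G → h G * h G)

  -- For a uniform regular graph containing `F`, the variance of `h` is at most c / w.
  record Bounded (w c : ℕ) (F : Graph n) : Set where
    constructor bounded
    field variance : w * (N F * Q F) ≤ w * (S F * S F) + c * (N F * N F)

  open Bounded public

  record Exposed (δ̂ D : ℕ) (F : Graph n) : Set where
    field
      F-symm : Symm F
      δ≤ : ∀ a → d ∸ count (F a) ≤ δ̂
      D-eq : D + sum₂ (λ i j → ⟦ F i j ⟧) ≡ n * d

  module Step {δ̂ D} {F} (X : Exposed δ̂ D F) where
    open Exposed X
    open Stage F F-symm δ̂ D δ≤ D-eq public

    overEdge : Fin n → Fin n → (Graph n → ℕ) → ℕ
    overEdge a b g = sumR d (λ G → ⟦ F ⊆ G ⟧ * (⟦ hidden G a b ⟧ * g G))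

    -- The next edge is given by a uniformly random hidden dart: each graph containing `F` has
    -- exactly `D` of them.
    overEdge-sum : ∀ g → sum₂ (λ a b → overEdge a b g) ≡ D * over F g
    overEdge-sum g = trans (sym (sumR-sum₂ d _)) (trans (sumR-cong d (λ G R →
        trans (sum₂-cong (λ a b → lem ⟦ F ⊆ G ⟧ ⟦ hidden G a b ⟧ (g G))) (trans (sum₂-*ˡ (⟦ F ⊆ G ⟧ * g G) (λ a b → ⟦ hidden G a b ⟧))
          (trans (lem′ ⟦ F ⊆ G ⟧ (g G) _) (trans (⟦⟧*-cong (F ⊆ G) (λ ω → cong (g G *_) (hidden-total R ω))) (lem″ ⟦ F ⊆ G ⟧ (g G) D))))))
      (sumR-*ˡ d D _))
      where
      lem : ∀ p q r → p * (q * r) ≡ p * r * q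
      lem = solve-∀
      lem′ : ∀ p q r → p * q * r ≡ p * (q * r)
      lem′ = solve-∀
      lem″ : ∀ p q r → p * (q * r) ≡ r * (p * q)
      lem″ = solve-∀

    overEdge-insert : ∀ {a b} → F a b ≡ false → ∀ g → overEdge a b g ≡ over (insert a b F) g
    overEdge-insert {a} {b} Fab g = sumR-cong d (λ G R → trans (sym (*-assoc ⟦ F ⊆ G ⟧ _ _)) (cong (_* g G)
      (trans (sym (⟦∧⟧ (F ⊆ G) (hidden G a b))) (cong ⟦_⟧ (bool-ext
        (λ e → let s = ∧-split {F ⊆ G} e in ⊆-intro {F = insert a b F} (λ i j f → contains G R (proj₁ s) (proj₁ (∧-split {G a b} (proj₂ s))) i j f))
        (λ e → ∧-join (⊆-intro {F = F} (λ i j f → ⊆-elim {F = insert a b F} e i j (∨-true {pair a b i j} (inj₂ f))))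
          (∧-join (⊆-elim {F = insert a b F} e a b (∨-true (inj₁ (pair-self a b)))) (not-true Fab))))))))
      where
      contains : ∀ G → Regular d G → F ⊆ G ≡ true → G a b ≡ true → ∀ i j → insert a b F i j ≡ true → G i j ≡ true
      contains G R ω g i j f with ∨-split {pair a b i j} f
      ... | inj₂ q = ⊆-elim {F = F} ω i j q
      ... | inj₁ q with ∨-split {a == i ∧ b == j} q
      ...   | inj₁ p = subst₂ (λ i j → G i j ≡ true) (==⇒≡ (proj₁ (∧-split p))) (==⇒≡ (proj₂ (∧-split {a == i} p))) g
      ...   | inj₂ p = subst₂ (λ i j → G i j ≡ true) (==⇒≡ (proj₁ (∧-split p))) (==⇒≡ (proj₂ (∧-split {b == i} p))) (trans (symm R b a) g)

    overEdge-zero : ∀ {a b} → F a b ≡ true ⊎ a ≡ b → ∀ g → overEdge a b g ≡ 0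
    overEdge-zero {a} {b} e g = n≤0⇒n≡0 (≤-trans (sumR-mono d (λ G R → ≤-reflexive (trans (cong (λ p → ⟦ F ⊆ G ⟧ * (⟦ p ⟧ * g G)) (none R e)) (*-zeroʳ ⟦ F ⊆ G ⟧))))
        (≤-reflexive (sumR-*ˡ d 0 (λ _ → 0))))
      where
      none : ∀ {G} → Regular d G → F a b ≡ true ⊎ a ≡ b → hidden G a b ≡ false
      none {G} R (inj₁ f) rewrite f with G a b
      ... | true = refl
      ... | false = refl
      none R (inj₂ refl) rewrite irr R a = refl

    module _ (2E≤D : 2 * E ≤ D) (J : ℕ) (J≤4D : J ≤ 4 * D) (J-choice : J ≡ 4 * D ⊎ J ≡ 4 * (α * δ̂)) where

      B₁ B₂ e : ℕ
      B₁ = 4 * D + 3 * (E * Λ)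
      B₂ = J + 3 * (E * Λ)
      e = 4 * D ∸ J

      B₂+e≡B₁ : B₂ + e ≡ B₁
      B₂+e≡B₁ = trans (lem J (3 * (E * Λ)) e) (cong (_+ 3 * (E * Λ)) (m+[n∸m]≡n J≤4D))
        where
        lem : ∀ a b c → (a + b) + c ≡ (a + c) + b
        lem = solve-∀

      module _ (w : ℕ) (c : Fin n → Fin n → ℕ) (IH : ∀ a b → F a b ≡ false → a ≢ b → Bounded w (c a b) (insert a b F)) where

        private
          κ : ℕ
          κ = 2 * (D * D * S F) + e * (D * N F)

          x s q : Fin n → Fin n → ℕ
          x a b = overEdge a b (λ _ → 1)
          s a b = overEdge a b h
          q a b = overEdge a b (λ G → h G * h G)

          left right : Fin n → Fin n → ℕ
          left a b = w * (D * D * (N F * N F) * q a b) + w * (κ * (x a b * S F))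
          right a b = w * (D * D * (S F * S F) * x a b) + w * (κ * (N F * s a b)) + w * ((B₂ + e) * B₂ * (N F * N F) * x a b) + D * D * (N F * N F) * (c a b * x a b)

          q≤ : ∀ a b → q a b ≤ Λ * Λ * x a b
          q≤ a b = ≤-trans (sumR-mono d (λ G _ → ≤-trans (*-monoʳ-≤ ⟦ F ⊆ G ⟧ (*-monoʳ-≤ ⟦ hidden G a b ⟧ (*-mono-≤ (h≤ G) (h≤ G))))
              (≤-reflexive (lem ⟦ F ⊆ G ⟧ ⟦ hidden G a b ⟧ (Λ * Λ))))) (≤-reflexive (sumR-*ˡ d (Λ * Λ) _))
            where
            lem : ∀ p r l → p * (r * l) ≡ l * (p * (r * 1))
            lem = solve-∀

          each : ∀ a b → left a b ≤ right a b
          each a b with bool-cases (F a b) | a ≟ b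
          ... | inj₁ f | _ rewrite overEdge-zero (inj₁ f) (λ _ → 1) | overEdge-zero (inj₁ f) (λ G → h G * h G) = ≤-trans (≤-reflexive (lem w (D * D * (N F * N F)) κ)) z≤n
            where
            lem : ∀ w p q → w * (p * 0) + w * (q * 0) ≡ 0
            lem = solve-∀
          ... | inj₂ f | yes a≡b rewrite overEdge-zero (inj₂ a≡b) (λ _ → 1) | overEdge-zero (inj₂ a≡b) (λ G → h G * h G) = ≤-trans (≤-reflexive (lem w (D * D * (N F * N F)) κ)) z≤n
            where
            lem : ∀ w p q → w * (p * 0) + w * (q * 0) ≡ 0
            lem = solve-∀
          ... | inj₂ f | no a≢b = edge-variance {w} {x a b} {s a b} {q a b} {S F} {N F} {D} {B₂} {e} {c a b}
                (subst (λ _ → w * (x a b * q a b) ≤ w * (s a b * s a b) + c a b * (x a b * x a b)) f claim) up low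
                (λ x≡0 → n≤0⇒n≡0 (≤-trans (q≤ a b) (≤-reflexive (trans (cong (Λ * Λ *_) x≡0) (*-zeroʳ (Λ * Λ))))))
            where
            module E′ = Edge a b f a≢b
            claim : w * (x a b * q a b) ≤ w * (s a b * s a b) + c a b * (x a b * x a b)
            claim = ≤-trans (≤-reflexive (cong₂ (λ p r → w * (p * r)) (overEdge-insert f _) (overEdge-insert f _))) (≤-trans (variance (IH a b f a≢b))
              (≤-reflexive (sym (cong₂ (λ p r → w * (r * r) + c a b * (p * p)) (overEdge-insert f (λ _ → 1)) (overEdge-insert f h)))))
            X≡ : ∀ g → overEdge a b g ≡ E′.X g
            X≡ g = sumR-cong d (λ G R → trans (sym (*-assoc ⟦ F ⊆ G ⟧ _ _)) (cong (_* g G) (trans (sym (⟦∧⟧ (F ⊆ G) (hidden G a b)))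
              (cong (λ z → ⟦ F ⊆ G ∧ z ⟧) (lem (G a b) f)))))
              where
              lem : ∀ g {z} → z ≡ false → g ∧ not z ≡ g
              lem true refl = refl
              lem false refl = refl
            total : ∀ g → over F g ≡ overEdge a b g + E′.Z g
            total g = trans (sumR-cong d (λ G R → point (F ⊆ G) (G a b) (g G))) (trans (sumR-+ d _ _) (cong (_+ E′.Z g) (sym (X≡ g))))
              where
              point : ∀ f p g → ⟦ f ⟧ * g ≡ ⟦ f ∧ p ⟧ * g + ⟦ f ∧ not p ⟧ * g
              point false p g = refl
              point true true g = sym (+-identityʳ _)
              point true false g = refl
            z sz : ℕ
            z = E′.Z (λ _ → 1)
            sz = E′.Z h
            up : D * (N F * s a b) ≤ D * (x a b * S F) + (B₂ + e) * (N F * x a b)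
            up = begin
              D * (N F * s a b) ≡⟨ cong (λ t → D * (t * s a b)) (total (λ _ → 1)) ⟩
              D * ((x a b + z) * s a b) ≡⟨ lem D (x a b) z (s a b) ⟩
              D * (x a b * s a b) + D * (z * s a b)
                ≤⟨ +-monoʳ-≤ (D * (x a b * s a b)) (subst₂ (λ p r → D * (z * p) ≤ D * (r * sz) + B₁ * (r * z)) (sym (X≡ h)) (sym (X≡ (λ _ → 1))) (E′.gap-upper 2E≤D)) ⟩
              D * (x a b * s a b) + (D * (x a b * sz) + B₁ * (x a b * z)) ≡⟨ lem′ D (x a b) (s a b) sz (B₁ * (x a b * z)) ⟩
              D * (x a b * (s a b + sz)) + B₁ * (x a b * z) ≤⟨ +-mono-≤ (≤-reflexive (cong (λ t → D * (x a b * t)) (sym (total h)))) (*-monoʳ-≤ B₁ (≤-trans (*-monoʳ-≤ (x a b) z≤N) (≤-reflexive (*-comm (x a b) (N F))))) ⟩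
              D * (x a b * S F) + B₁ * (N F * x a b) ≡⟨ cong (λ t → D * (x a b * S F) + t * (N F * x a b)) B₂+e≡B₁ ⟨
              D * (x a b * S F) + (B₂ + e) * (N F * x a b) ∎
              where
              open ≤-Reasoning
              z≤N : z ≤ N F
              z≤N = ≤-trans (m≤n+m z (x a b)) (≤-reflexive (sym (total (λ _ → 1))))
              lem : ∀ D x z s → D * ((x + z) * s) ≡ D * (x * s) + D * (z * s)
              lem = solve-∀
              lem′ : ∀ D x s t r → D * (x * s) + (D * (x * t) + r) ≡ D * (x * (s + t)) + r
              lem′ = solve-∀
            low : D * (x a b * S F) ≤ D * (N F * s a b) + B₂ * (N F * x a b)
            low = begin
              D * (x a b * S F) ≡⟨ cong (λ t → D * (x a b * t)) (total h) ⟩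
              D * (x a b * (s a b + sz)) ≡⟨ lem D (x a b) (s a b) sz ⟩
              D * (x a b * s a b) + D * (x a b * sz)
                ≤⟨ +-monoʳ-≤ (D * (x a b * s a b)) (subst₂ (λ p r → D * (r * sz) ≤ D * (z * p) + B₂ * (r * z)) (sym (X≡ h)) (sym (X≡ (λ _ → 1))) (E′.gap-lower 2E≤D {J} J-bound)) ⟩
              D * (x a b * s a b) + (D * (z * s a b) + B₂ * (x a b * z)) ≡⟨ lem′ D (x a b) z (s a b) (B₂ * (x a b * z)) ⟩
              D * ((x a b + z) * s a b) + B₂ * (x a b * z) ≤⟨ +-mono-≤ (≤-reflexive (cong (λ t → D * (t * s a b)) (sym (total (λ _ → 1))))) (*-monoʳ-≤ B₂ (≤-trans (*-monoʳ-≤ (x a b) z≤N) (≤-reflexive (*-comm (x a b) (N F))))) ⟩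
              D * (N F * s a b) + B₂ * (N F * x a b) ∎
              where
              open ≤-Reasoning
              z≤N : z ≤ N F
              z≤N = ≤-trans (m≤n+m z (x a b)) (≤-reflexive (sym (total (λ _ → 1))))
              J-bound : E′.fwd E′.increase ≤ J * E′.X E′.const₁
              J-bound = choose J-choice
                where
                choose : J ≡ 4 * D ⊎ J ≡ 4 * (α * δ̂) → E′.fwd E′.increase ≤ J * E′.X E′.const₁
                choose (inj₁ r) = ≤-trans E′.increase≤4 (≤-reflexive (cong (_* E′.X E′.const₁) (sym r)))
                choose (inj₂ r) = ≤-trans E′.increase≤α (≤-reflexive (cong (_* E′.X E′.const₁) (sym r)))
              lem : ∀ D x s t → D * (x * (s + t)) ≡ D * (x * s) + D * (x * t)
              lem = solve-∀
              lem′ : ∀ D x z s r → D * (x * s) + (D * (z * s) + r) ≡ D * ((x + z) * s) + r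
              lem′ = solve-∀

          pull : ∀ w p (f : Fin n → Fin n → ℕ) → sum₂ (λ a b → w * (p * f a b)) ≡ w * (p * sum₂ f)
          pull w p f = trans (sum₂-*ˡ w _) (cong (w *_) (sum₂-*ˡ p f))

          left-sum : sum₂ left ≡ w * (D * D * (N F * N F) * (D * Q F)) + w * (κ * (D * N F * S F))
          left-sum = trans (sum₂-+ _ _) (cong₂ _+_ (trans (pull w (D * D * (N F * N F)) q) (cong (λ t → w * (D * D * (N F * N F) * t)) (overEdge-sum _)))
            (trans (sum₂-cong (λ a b → cong (λ t → w * (κ * t)) (*-comm (x a b) (S F)))) (trans (trans (sum₂-cong (λ a b → cong (w *_) (sym (*-assoc κ (S F) (x a b))))) (pull w (κ * S F) x))
              (trans (cong (λ t → w * (κ * S F * t)) (overEdge-sum (λ _ → 1))) (lem w κ (S F) (D * N F))))))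
            where
            lem : ∀ w k s t → w * (k * s * t) ≡ w * (k * (t * s))
            lem = solve-∀

          right-sum : sum₂ right ≡ w * (D * D * (S F * S F) * (D * N F)) + w * (κ * N F * (D * S F)) + w * ((B₂ + e) * B₂ * (N F * N F) * (D * N F)) + D * D * (N F * N F) * sum₂ (λ a b → c a b * x a b)
          right-sum = trans (sum₂-+ _ _) (cong₂ _+_ (trans (sum₂-+ _ _) (cong₂ _+_ (trans (sum₂-+ _ _) (cong₂ _+_
            (trans (pull w (D * D * (S F * S F)) x) (cong (λ t → w * (D * D * (S F * S F) * t)) (overEdge-sum _)))
            (trans (sum₂-cong (λ a b → cong (w *_) (sym (*-assoc κ (N F) (s a b))))) (trans (pull w (κ * N F) s) (cong (λ t → w * (κ * N F * t)) (overEdge-sum _))))))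
            (trans (pull w ((B₂ + e) * B₂ * (N F * N F)) x) (cong (λ t → w * ((B₂ + e) * B₂ * (N F * N F) * t)) (overEdge-sum _))))) (sum₂-*ˡ (D * D * (N F * N F)) _))

        -- The law of total variance for exposing one random hidden dart. Summed over all darts, the
        -- terms with κ agree on the two sides because Σ x = D N and Σ s = D S; this is the
        -- martingale property. What remains is B₁B₂ / D² for the variance of the conditional mean,
        -- plus the average of the conditional variances.
        variance-step : {{NonZero D}} → D * D * (w * (N F * Q F)) ≤ D * D * (w * (S F * S F)) + w * (B₁ * B₂) * (N F * N F) + D * N F * sum₂ (λ a b → c a b * x a b)
        variance-step {{nzD}} with zero-or-not (N F)
        ... | inj₁ N≡0 = ≤-trans (≤-reflexive (trans (cong (λ t → D * D * (w * (t * Q F))) N≡0) (lem D w))) z≤n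
          where
          lem : ∀ D w → D * D * (w * 0) ≡ 0
          lem = solve-∀
        ... | inj₂ nz = *-cancelˡ-≤ (D * N F) {{m*n≢0 D (N F) {{nzD}} {{nz}}}} (+-cancelʳ-≤ (w * (κ * (D * N F * S F))) _ _ (begin
          D * N F * (D * D * (w * (N F * Q F))) + w * (κ * (D * N F * S F)) ≡⟨ cong (_+ w * (κ * (D * N F * S F))) (lem₁ D (N F) w (Q F)) ⟩
          w * (D * D * (N F * N F) * (D * Q F)) + w * (κ * (D * N F * S F)) ≡⟨ left-sum ⟨
          sum₂ left ≤⟨ sum₂-mono each ⟩
          sum₂ right ≡⟨ right-sum ⟩
          w * (D * D * (S F * S F) * (D * N F)) + w * (κ * N F * (D * S F)) + w * ((B₂ + e) * B₂ * (N F * N F) * (D * N F)) + D * D * (N F * N F) * C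
            ≡⟨ cong (λ t → w * (D * D * (S F * S F) * (D * N F)) + w * (κ * N F * (D * S F)) + w * (t * B₂ * (N F * N F) * (D * N F)) + D * D * (N F * N F) * C) B₂+e≡B₁ ⟩
          w * (D * D * (S F * S F) * (D * N F)) + w * (κ * N F * (D * S F)) + w * (B₁ * B₂ * (N F * N F) * (D * N F)) + D * D * (N F * N F) * C
            ≡⟨ lem₂ D (N F) w (S F) κ B₁ B₂ C ⟩
          D * N F * (D * D * (w * (S F * S F)) + w * (B₁ * B₂) * (N F * N F) + D * N F * C) + w * (κ * (D * N F * S F)) ∎))
          where
          open ≤-Reasoning
          C : ℕ
          C = sum₂ (λ a b → c a b * x a b)
          lem₁ : ∀ D N w Q → D * N * (D * D * (w * (N * Q))) ≡ w * (D * D * (N * N) * (D * Q))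
          lem₁ = solve-∀
          lem₂ : ∀ D N w S κ B₁ B₂ C → w * (D * D * (S * S) * (D * N)) + w * (κ * N * (D * S)) + w * (B₁ * B₂ * (N * N) * (D * N)) + D * D * (N * N) * C
            ≡ D * N * (D * D * (w * (S * S)) + w * (B₁ * B₂) * (N * N) + D * N * C) + w * (κ * (D * N * S))
          lem₂ = solve-∀

-- Falling factorials and the phases of the exposure

fall : ℕ → ℕ → ℕ
fall x zero = 1
fall x (suc k) = x * fall (x ∸ 1) k

fall-step : ∀ k x → x * fall (x ∸ 1) k ≡ fall x k * (x ∸ k)
fall-step zero x = *-comm x 1
fall-step (suc k) zero = refl
fall-step (suc k) (suc x) = trans (cong (suc x *_) (fall-step k x)) (sym (*-assoc (suc x) (fall x k) (x ∸ k)))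

fall-mono : ∀ k {x y} → x ≤ y → fall x k ≤ fall y k
fall-mono zero h = ≤-refl
fall-mono (suc k) h = *-mono-≤ h (fall-mono k (∸-monoˡ-≤ 1 h))

fall-pos : ∀ k {x} → k ≤ x → 1 ≤ fall x k
fall-pos zero h = ≤-refl
fall-pos (suc k) {suc x} (s≤s h) = *-mono-≤ {1} {suc x} (s≤s z≤n) (fall-pos k h)

fall≤^ : ∀ k x → fall x k ≤ x ^ k
fall≤^ zero x = ≤-refl
fall≤^ (suc k) x = *-monoʳ-≤ x (≤-trans (fall-mono k (m∸n≤m x 1)) (fall≤^ k x))

-- Lowering the argument by one loses the fraction k / x of a falling factorial: by `fall-step` this
-- is an equality for k ≤ x, and for k > x the left side vanishes.
fall-loss : ∀ k x → k * fall x k ≤ x * (fall x k ∸ fall (x ∸ 1) k)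
fall-loss k x = ≤-trans (m+n≤o⇒m≤o∸n (k * fall x k) total) (≤-reflexive (sym (*-distribˡ-∸ x (fall x k) (fall (x ∸ 1) k))))
  where
  total : k * fall x k + x * fall (x ∸ 1) k ≤ x * fall x k
  total with k ≤? x
  ... | yes k≤x = ≤-reflexive (trans (cong (k * fall x k +_) (trans (fall-step k x) (*-comm (fall x k) _))) (trans (sym (*-distribʳ-+ (fall x k) k (x ∸ k))) (cong (_* fall x k) (m+[n∸m]≡n k≤x))))
  ... | no k≰x = ≤-trans (≤-reflexive (cong₂ _+_ (trans (cong (k *_) zero-fall) (*-zeroʳ k)) (trans (fall-step k x) (cong (_* (x ∸ k)) zero-fall)))) z≤n
    where
    fall-zero : ∀ k x → x < k → fall x k ≡ 0
    fall-zero (suc k) zero h = refl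
    fall-zero (suc k) (suc x) (s≤s h) = trans (cong (suc x *_) (fall-zero k x h)) (*-zeroʳ (suc x))
    zero-fall : fall x k ≡ 0
    zero-fall = fall-zero k x (≰⇒> k≰x)

-- Chosen so that `window (D ∸ 2)` over `window D` is (D - 12) / D, the factor by which exposing one
-- edge, that is two darts, shrinks `potential` on average. The number 12 is twice the order 6 of
-- the falling factorial.
window : ℕ → ℕ
window D = D * (D ∸ 2) * (D ∸ 4) * (D ∸ 6) * (D ∸ 8) * (D ∸ 10)

window-step : ∀ D → window (2 + D) * (D ∸ 10) ≡ (2 + D) * window D
window-step D = lem (2 + D) D (D ∸ 2) (D ∸ 4) (D ∸ 6) (D ∸ 8) (D ∸ 10)
  where
  lem : ∀ a b c d e f g → a * b * c * d * e * f * g ≡ a * (b * c * d * e * f * g)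
  lem = solve-∀

window-mono : ∀ {C D} → C ≤ D → window C ≤ window D
window-mono h = *-mono-≤ (*-mono-≤ (*-mono-≤ (*-mono-≤ (*-mono-≤ h (∸-monoˡ-≤ 2 h)) (∸-monoˡ-≤ 4 h)) (∸-monoˡ-≤ 6 h)) (∸-monoˡ-≤ 8 h)) (∸-monoˡ-≤ 10 h)

-- Majorises A(1 + 1/2 + ... + 1/i): each quotient is replaced by its integer part plus one.
harmonic : ℕ → ℕ → ℕ
harmonic A zero = 0
harmonic A (suc i) = harmonic A i + suc (A div suc i)

harmonic-mono : ∀ A {i j} → i ≤ j → harmonic A i ≤ harmonic A j
harmonic-mono A {zero} z≤n = z≤n
harmonic-mono A {suc i} {suc j} (s≤s h) with m≤n⇒m<n∨m≡n h
... | inj₁ i<j = ≤-trans (harmonic-mono A {suc i} {j} i<j) (m≤m+n (harmonic A j) _)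
... | inj₂ refl = ≤-refl

<suc-div : ∀ A i → A ≤ suc (A div suc i) * suc i
<suc-div A i = begin
  A ≡⟨ m≡m%n+[m/n]*n A (suc i) ⟩
  A mod suc i + A div suc i * suc i ≤⟨ +-monoˡ-≤ (A div suc i * suc i) (<⇒≤ (m%n<n A (suc i))) ⟩
  suc i + A div suc i * suc i ∎
  where open ≤-Reasoning

sumR-pos : ∀ {n} d (φ : Graph n → ℕ) → 0 < sumR d φ → ∃ λ G → Regular d G × 0 < φ G
sumR-pos {n} d φ p = positive p
  where
  opaque
    unfolding sumR sumG
    positive : 0 < sumR d φ → ∃ λ G → Regular d G × 0 < φ G
    positive p with sum-pos _ p
    ... | k , q with isRegular d (lookup (allAdj n) k) in e
    ...   | true = lookup (allAdj n) k , regular⇒ _ e , ≤-trans q (≤-reflexive (*-identityˡ _))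

module Phases {n : ℕ} (d : ℕ) (h : Graph n → ℕ) (h-ext : Ext h) (Λ α : ℕ) (h≤ : ∀ G → h G ≤ Λ)
  (same : Graph n → Fin n → Fin n → Bool) (same≤ : ∀ G a → count (same G a) ≤ α) (same-ext : ∀ a x → Ext (λ G → same G a x))
  (lip : ∀ G → Regular d G → ∀ {a b x y} → Valid G a b x y →
    h (switch a b x y G) ≤ h G + 2 * (⟦ same G a x ⟧ + ⟦ same G b y ⟧))
  (range : ∀ F G H → F ⊆ G ≡ true → F ⊆ H ≡ true → h G ≤ h H + sum₂ (λ i j → ⟦ G i j ∧ not (F i j) ⟧)) where

  open Variance d h h-ext Λ α h≤ same same≤ same-ext lip public

  insert-entry : ∀ {F : Graph n} {a b} → Symm F → F a b ≡ false → a ≢ b → ∀ i j →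
    ⟦ insert a b F i j ⟧ ≡ ⟦ F i j ⟧ + (⟦ a == i ⟧ * ⟦ b == j ⟧ + ⟦ b == i ⟧ * ⟦ a == j ⟧)
  insert-entry {F} {a} {b} sy f a≢b i j with a == i in e₁ | b == j in e₂ | b == i in e₃ | a == j in e₄
  ... | true | _ | true | _ = ⊥-elim (a≢b (trans (==⇒≡ e₁) (sym (==⇒≡ e₃))))
  ... | true | true | false | _ rewrite sym (==⇒≡ e₁) | sym (==⇒≡ e₂) | f = refl
  ... | true | false | false | _ = sym (+-identityʳ _)
  ... | false | _ | true | true rewrite sym (==⇒≡ e₃) | sym (==⇒≡ e₄) | sy b a | f = refl
  ... | false | _ | true | false = sym (+-identityʳ _)
  ... | false | _ | false | _ = sym (+-identityʳ _)

  insert-row : ∀ {F : Graph n} {a b} → Symm F → F a b ≡ false → a ≢ b → ∀ k → count (insert a b F k) ≡ count (F k) + (⟦ a == k ⟧ + ⟦ b == k ⟧)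
  insert-row {F} {a} {b} sy f a≢b k = trans (sum-cong (insert-entry sy f a≢b k)) (trans (sum-+ _ _) (cong (count (F k) +_)
    (trans (sum-+ _ _) (cong₂ _+_ (trans (sum-*ˡ ⟦ a == k ⟧ _) (trans (cong (⟦ a == k ⟧ *_) (count-== b)) (*-identityʳ ⟦ a == k ⟧))) (trans (sum-*ˡ ⟦ b == k ⟧ _) (trans (cong (⟦ b == k ⟧ *_) (count-== a)) (*-identityʳ ⟦ b == k ⟧)))))))

  insert-exposed : ∀ {δ̂ D F a b} → Exposed δ̂ (2 + D) F → F a b ≡ false → a ≢ b → Exposed δ̂ D (insert a b F)
  insert-exposed {δ̂} {D} {F} {a} {b} X f a≢b = record
    { F-symm = λ i j → cong₂ _∨_ (pair-symm a b i j) (F-symm i j)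
    ; δ≤ = λ k → ≤-trans (∸-monoʳ-≤ d (≤-trans (m≤m+n (count (F k)) (⟦ a == k ⟧ + ⟦ b == k ⟧)) (≤-reflexive (sym (insert-row F-symm f a≢b k))))) (δ≤ k)
    ; D-eq = trans (cong (D +_) (trans (sum₂-rows _) (trans (sum-cong (insert-row F-symm f a≢b)) (trans (sum-+ _ _) (cong₂ _+_ (sym (sum₂-rows _)) two)))))
        (trans (lem D (sum₂ (λ i j → ⟦ F i j ⟧))) D-eq) }
    where
    open Exposed X
    two : sum (λ k → ⟦ a == k ⟧ + ⟦ b == k ⟧) ≡ 2
    two = trans (sum-+ _ _) (cong₂ _+_ (count-== a) (count-== b))
    lem : ∀ D s → D + (s + 2) ≡ 2 + D + s
    lem = solve-∀

  trivial : ∀ F → N F * Q F ≤ Λ * Λ * (N F * N F)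
  trivial F = ≤-trans (*-monoʳ-≤ (N F) (≤-trans (sumR-mono d (λ G _ → ≤-trans (*-monoʳ-≤ ⟦ F ⊆ G ⟧ (*-mono-≤ (h≤ G) (h≤ G))) (≤-reflexive (lem ⟦ F ⊆ G ⟧ (Λ * Λ)))))
      (≤-reflexive (sumR-*ˡ d (Λ * Λ) _)))) (≤-reflexive (lem′ (N F) (Λ * Λ)))
    where
    lem : ∀ p q → p * q ≡ q * (p * 1)
    lem = solve-∀
    lem′ : ∀ p q → p * (q * p) ≡ q * (p * p)
    lem′ = solve-∀

  -- With D hidden darts left, h takes values in an interval of length 2 D.
  late : ∀ {δ̂ D F} R → Exposed δ̂ D F → Bounded R (R * (2 * D * (2 * D))) F
  late {δ̂} {D} {F} R X with zero-or-not (N F)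
  ... | inj₁ N≡0 = bounded (≤-trans (≤-reflexive (trans (cong (λ t → R * (t * Q F)) N≡0) (*-zeroʳ R))) z≤n)
  ... | inj₂ nz with sumR-pos d (λ G → ⟦ F ⊆ G ⟧ * 1) (>-nonZero⁻¹ (N F) {{nz}})
  ...   | G₀ , R₀ , p₀ = bounded (begin
    R * (N F * Q F) ≤⟨ *-monoʳ-≤ R core ⟩
    R * (S F * S F + 2 * D * (2 * D) * (N F * N F)) ≡⟨ lem R (S F) (2 * D * (2 * D)) (N F) ⟩
    R * (S F * S F) + R * (2 * D * (2 * D)) * (N F * N F) ∎)
    where
    open ≤-Reasoning
    open Step X using (hidden-total)
    lem : ∀ R S c N → R * (S * S + c * (N * N)) ≡ R * (S * S) + R * c * (N * N)
    lem = solve-∀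
    ω₀ : F ⊆ G₀ ≡ true
    ω₀ = ⟦⟧-pos (≤-trans p₀ (≤-reflexive (*-identityʳ _)))
    -- The value at one graph, lowered by D, serves as base point in place of the minimum; hence the
    -- length 2D of the interval.
    m : ℕ
    m = h G₀ ∸ D
    r : Graph n → ℕ
    r G = h G ∸ m
    near : ∀ {G H} → Regular d G → F ⊆ G ≡ true → F ⊆ H ≡ true → h G ≤ h H + D
    near {G} {H} RG ωG ωH = ≤-trans (range F G H ωG ωH) (≤-reflexive (cong (h H +_) (hidden-total RG ωG)))
    shift : ∀ G → Regular d G → F ⊆ G ≡ true → h G ≡ m + r G
    shift G RG ω = sym (m+[n∸m]≡n (m≤n+o⇒m∸n≤o (h G₀) D (≤-trans (near R₀ ω₀ ω) (≤-reflexive (+-comm (h G) D)))))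
    r≤ : ∀ G → Regular d G → F ⊆ G ≡ true → r G ≤ 2 * D
    r≤ G RG ω = m≤n+o⇒m∸n≤o (h G) m (≤-trans (near RG ω ω₀) (≤-trans (+-monoˡ-≤ D (m≤n+m∸n (h G₀) D)) (≤-reflexive (lem′ D m))))
      where
      lem′ : ∀ D m → D + m + D ≡ m + 2 * D
      lem′ = solve-∀
    S₁ S₂ : ℕ
    S₁ = over F r
    S₂ = over F (λ G → r G * r G)
    S-shift : S F ≡ m * N F + S₁
    S-shift = trans (sumR-cong d (λ G RG → trans (⟦⟧*-cong (F ⊆ G) (λ ω → shift G RG ω)) (lem′ ⟦ F ⊆ G ⟧ m (r G)))) (trans (sumR-+ d _ _) (cong (_+ S₁) (sumR-*ˡ d m _)))
      where
      lem′ : ∀ p m r → p * (m + r) ≡ m * (p * 1) + p * r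
      lem′ = solve-∀
    Q-shift : Q F ≡ m * m * N F + 2 * m * S₁ + S₂
    Q-shift = trans (sumR-cong d (λ G RG → trans (⟦⟧*-cong (F ⊆ G) (λ ω → cong (λ t → t * t) (shift G RG ω))) (lem′ ⟦ F ⊆ G ⟧ m (r G))))
      (trans (sumR-+ d _ _) (cong (_+ S₂) (trans (sumR-+ d _ _) (cong₂ _+_ (sumR-*ˡ d (m * m) _) (sumR-*ˡ d (2 * m) _)))))
      where
      lem′ : ∀ p m r → p * ((m + r) * (m + r)) ≡ m * m * (p * 1) + 2 * m * (p * r) + p * (r * r)
      lem′ = solve-∀
    S₂≤ : S₂ ≤ 2 * D * (2 * D) * N F
    S₂≤ = ≤-trans (sumR-mono d (λ G RG → ≤-trans (⟦⟧*-mono (F ⊆ G) (λ ω → *-mono-≤ (r≤ G RG ω) (r≤ G RG ω))) (≤-reflexive (lem′ ⟦ F ⊆ G ⟧ (2 * D * (2 * D)))))) (≤-reflexive (sumR-*ˡ d (2 * D * (2 * D)) _))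
      where
      lem′ : ∀ p q → p * q ≡ q * (p * 1)
      lem′ = solve-∀
    core : N F * Q F ≤ S F * S F + 2 * D * (2 * D) * (N F * N F)
    core = begin
      N F * Q F ≡⟨ cong (N F *_) Q-shift ⟩
      N F * (m * m * N F + 2 * m * S₁ + S₂) ≤⟨ *-monoʳ-≤ (N F) (+-monoʳ-≤ (m * m * N F + 2 * m * S₁) S₂≤) ⟩
      N F * (m * m * N F + 2 * m * S₁ + 2 * D * (2 * D) * N F) ≤⟨ m≤m+n _ (S₁ * S₁) ⟩
      N F * (m * m * N F + 2 * m * S₁ + 2 * D * (2 * D) * N F) + S₁ * S₁ ≡⟨ lem′ (N F) m S₁ (2 * D * (2 * D)) ⟩
      (m * N F + S₁) * (m * N F + S₁) + 2 * D * (2 * D) * (N F * N F) ≡⟨ cong (λ t → t * t + 2 * D * (2 * D) * (N F * N F)) S-shift ⟨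
      S F * S F + 2 * D * (2 * D) * (N F * N F) ∎
      where
      lem′ : ∀ N m s c → N * (m * m * N + 2 * m * s + c * N) + s * s ≡ (m * N + s) * (m * N + s) + c * (N * N)
      lem′ = solve-∀

  -- R times a bound for (4D + 3y)(J + 3y) / D with y = EΛ: the product 4D·J uses J ≤ 4αδ̂, the
  -- mixed term 3y·J uses J ≤ 4D, and ρD covers 9y². One more division by D makes the contribution
  -- of a step rate / D.
  rate : ℕ → ℕ → ℕ → ℕ
  rate R δ̂ ρ = R * (16 * (α * δ̂) + 24 * ((2 * d + 4) * δ̂ * Λ) + ρ)

  increment : ∀ R δ̂ ρ D₀ D → let E = (2 * d + 4) * δ̂ ; J = (4 * D) ⊓ (4 * (α * δ̂)) in
    9 * (E * Λ * (E * Λ)) ≤ ρ * D₀ → D₀ ≤ D → R * ((4 * D + 3 * (E * Λ)) * (J + 3 * (E * Λ))) ≤ rate R δ̂ ρ * D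
  increment R δ̂ ρ D₀ D h₉ D₀≤D = begin
    R * ((4 * D + 3 * y) * (J + 3 * y)) ≡⟨ cong (R *_) (lem₁ D y J) ⟩
    R * (4 * D * J + 3 * y * J + 12 * D * y + 9 * (y * y))
      ≤⟨ *-monoʳ-≤ R (+-mono-≤ (+-monoˡ-≤ (12 * D * y) (+-mono-≤ (*-monoʳ-≤ (4 * D) (m⊓n≤n (4 * D) (4 * (α * δ̂)))) (*-monoʳ-≤ (3 * y) (m⊓n≤m (4 * D) (4 * (α * δ̂)))))) (≤-trans h₉ (*-monoʳ-≤ ρ D₀≤D))) ⟩
    R * (4 * D * (4 * (α * δ̂)) + 3 * y * (4 * D) + 12 * D * y + ρ * D) ≡⟨ lem₂ R D (α * δ̂) y ρ ⟩
    rate R δ̂ ρ * D ∎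
    where
    open ≤-Reasoning
    y J : ℕ
    y = (2 * d + 4) * δ̂ * Λ
    J = (4 * D) ⊓ (4 * (α * δ̂))
    lem₁ : ∀ D y J → (4 * D + 3 * y) * (J + 3 * y) ≡ 4 * D * J + 3 * y * J + 12 * D * y + 9 * (y * y)
    lem₁ = solve-∀
    lem₂ : ∀ R D a y ρ → R * (4 * D * (4 * a) + 3 * y * (4 * D) + 12 * D * y + ρ * D) ≡ R * (16 * a + 24 * y + ρ) * D
    lem₂ = solve-∀

  J-cases : ∀ D δ̂ → (4 * D) ⊓ (4 * (α * δ̂)) ≡ 4 * D ⊎ (4 * D) ⊓ (4 * (α * δ̂)) ≡ 4 * (α * δ̂)
  J-cases D δ̂ = ⊓-sel (4 * D) (4 * (α * δ̂))

  -- The final phase. While at least `D₁` darts are hidden each step contributes about A / D, whence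
  -- a harmonic sum; below `D₁` the range of `h` alone gives the bound.
  module Sparse (R δ̂ ρ D₁ : ℕ) (2≤D₁ : 2 ≤ D₁) (2E≤D₁ : 2 * ((2 * d + 4) * δ̂) ≤ D₁)
    (9E≤ : 9 * ((2 * d + 4) * δ̂ * Λ * ((2 * d + 4) * δ̂ * Λ)) ≤ ρ * D₁) where

    A : ℕ
    A = rate R δ̂ ρ

    bound : ℕ → ℕ
    bound D = R * (2 * D₁ * (2 * D₁)) + harmonic A D

    sparse : ∀ D {F} → Exposed δ̂ D F → Bounded R (bound D) F
    sparse D {F} X with D₁ ≤? D
    ... | no D₁≰D = bounded (≤-trans (variance (late R X)) (+-monoʳ-≤ (R * (S F * S F)) (*-monoˡ-≤ (N F * N F)
          (≤-trans (*-monoʳ-≤ R (*-mono-≤ (*-monoʳ-≤ 2 D≤) (*-monoʳ-≤ 2 D≤))) (m≤m+n _ (harmonic A D))))))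
      where
      D≤ : D ≤ D₁
      D≤ = <⇒≤ (≰⇒> D₁≰D)
    sparse zero X | yes D₁≤D with ≤-trans 2≤D₁ D₁≤D
    ... | ()
    sparse (suc zero) X | yes D₁≤D with ≤-trans 2≤D₁ D₁≤D
    ... | s≤s ()
    sparse D@(suc (suc D′)) {F} X | yes D₁≤D = bounded (*-cancelˡ-≤ (D * D) (begin
      D * D * (R * (N F * Q F))
        ≤⟨ variance-step (≤-trans 2E≤D₁ D₁≤D) ((4 * D) ⊓ (4 * (α * δ̂))) (m⊓n≤m _ _) (J-cases D δ̂) R (λ _ _ → bound D′) (λ a b f a≢b → sparse D′ (insert-exposed X f a≢b)) ⟩
      D * D * (R * (S F * S F)) + R * (B₁′ * B₂′) * (N F * N F) + D * N F * sum₂ (λ a b → bound D′ * overEdge a b (λ _ → 1))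
        ≤⟨ +-mono-≤ (+-monoʳ-≤ (D * D * (R * (S F * S F))) (*-monoˡ-≤ (N F * N F) (≤-trans (increment R δ̂ ρ D₁ D 9E≤ D₁≤D) (*-monoˡ-≤ D (<suc-div A (suc D′))))))
             (≤-reflexive (cong (D * N F *_) (trans (sum₂-*ˡ (bound D′) _) (cong (bound D′ *_) (overEdge-sum _))))) ⟩
      D * D * (R * (S F * S F)) + (suc (A div D) * D * D) * (N F * N F) + D * N F * (bound D′ * (D * N F)) ≡⟨ lem D R (S F) (suc (A div D)) (N F) (bound D′) ⟩
      D * D * (R * (S F * S F) + (bound D′ + suc (A div D)) * (N F * N F))
        ≤⟨ *-monoʳ-≤ (D * D) (+-monoʳ-≤ (R * (S F * S F)) (*-monoˡ-≤ (N F * N F) (≤-trans (≤-reflexive (+-assoc (R * (2 * D₁ * (2 * D₁))) _ _)) (+-monoʳ-≤ (R * (2 * D₁ * (2 * D₁))) (+-monoˡ-≤ (suc (A div D)) (harmonic-mono A (n≤1+n D′))))))) ⟩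
      D * D * (R * (S F * S F) + bound D * (N F * N F)) ∎))
      where
      open ≤-Reasoning
      open Step X
      B₁′ B₂′ : ℕ
      B₁′ = 4 * D + 3 * (E * Λ)
      B₂′ = (4 * D) ⊓ (4 * (α * δ̂)) + 3 * (E * Λ)
      lem : ∀ D R S t N b → D * D * (R * (S * S)) + t * D * D * (N * N) + D * N * (b * (D * N)) ≡ D * D * (R * (S * S) + (b + t) * (N * N))
      lem = solve-∀

  -- It vanishes exactly when no vertex has more than five hidden darts. Otherwise it is at least 1,
  -- so Markov's inequality applies to it.
  potential : Graph n → ℕ
  potential F = sum (λ v → fall (d ∸ count (F v)) 6)

  -- Exposing a random edge multiplies the potential by 1 − 12 / D on average.
  potential-step : ∀ {δ̂ D F} (X : Exposed δ̂ D F) →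
    sum₂ (λ a b → potential (insert a b F) * Step.overEdge X a b (λ _ → 1)) + 12 * (potential F * N F) ≤ D * (potential F * N F)
  potential-step {δ̂} {D} {F} X = begin
    sum₂ (λ a b → potential (insert a b F) * overEdge a b (λ _ → 1)) + 12 * (potential F * N F)
      ≡⟨ cong₂ _+_ expand (trans (cong (12 *_) scale) (sym (sumR-*ˡ d 12 _))) ⟩
    sumR d (λ G → ⟦ F ⊆ G ⟧ * sum (T G)) + sumR d (λ G → 12 * (⟦ F ⊆ G ⟧ * potential F)) ≡⟨ sumR-+ d _ _ ⟨
    sumR d (λ G → ⟦ F ⊆ G ⟧ * sum (T G) + 12 * (⟦ F ⊆ G ⟧ * potential F)) ≤⟨ sumR-mono d point ⟩
    sumR d (λ G → D * (⟦ F ⊆ G ⟧ * potential F)) ≡⟨ trans (sumR-*ˡ d D _) (cong (D *_) (sym scale)) ⟩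
    D * (potential F * N F) ∎
    where
    open ≤-Reasoning
    open Exposed X
    open Step X
    f : Fin n → ℕ
    f v = fall (δ v) 6
    T : Graph n → Fin n → ℕ
    T G v = sum₂ (λ a b → ⟦ hidden G a b ⟧ * fall (d ∸ count (insert a b F v)) 6)
    scale : potential F * N F ≡ sumR d (λ G → ⟦ F ⊆ G ⟧ * potential F)
    scale = trans (sym (sumR-*ˡ d (potential F) _)) (sumR-cong d (λ G _ → lem (potential F) ⟦ F ⊆ G ⟧))
      where
      lem : ∀ p q → p * (q * 1) ≡ q * p
      lem = solve-∀
    expand : sum₂ (λ a b → potential (insert a b F) * overEdge a b (λ _ → 1)) ≡ sumR d (λ G → ⟦ F ⊆ G ⟧ * sum (T G))
    expand = trans (sum₂-cong (λ a b → sym (sumR-*ˡ d (potential (insert a b F)) _))) (trans (sym (sumR-sum₂ d _)) (sumR-cong d (λ G _ →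
        trans (sum₂-cong (λ a b → lem (potential (insert a b F)) ⟦ F ⊆ G ⟧ ⟦ hidden G a b ⟧)) (trans (sum₂-*ˡ ⟦ F ⊆ G ⟧ _) (cong (⟦ F ⊆ G ⟧ *_) (exchange G))))))
      where
      lem : ∀ p q r → p * (q * (r * 1)) ≡ q * (r * p)
      lem = solve-∀
      exchange : ∀ G → sum₂ (λ a b → ⟦ hidden G a b ⟧ * potential (insert a b F)) ≡ sum (T G)
      exchange G = trans (sum₂-cong (λ a b → sym (sum-*ˡ ⟦ hidden G a b ⟧ _))) (trans (sum₂-rows _)
        (trans (sum-cong (λ a → sum-comm (λ b v → ⟦ hidden G a b ⟧ * fall (d ∸ count (insert a b F v)) 6))) (trans (sum-comm (λ a v → sum (λ b → ⟦ hidden G a b ⟧ * fall (d ∸ count (insert a b F v)) 6))) (sum-cong (λ v → sym (sum₂-rows _))))))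
    point : ∀ G → Regular d G → ⟦ F ⊆ G ⟧ * sum (T G) + 12 * (⟦ F ⊆ G ⟧ * potential F) ≤ D * (⟦ F ⊆ G ⟧ * potential F)
    point G R with bool-cases (F ⊆ G)
    ... | inj₂ ω rewrite ω = z≤n
    ... | inj₁ ω rewrite ω | *-identityˡ (sum (T G)) | *-identityˡ (potential F) = ≤-trans (≤-reflexive (trans (cong (sum (T G) +_) (sym (sum-*ˡ 12 f))) (sym (sum-+ (T G) (λ v → 12 * f v)))))
          (≤-trans (sum-mono at) (≤-reflexive (sum-*ˡ D f)))
      where
      at : ∀ v → T G v + 12 * f v ≤ D * f v
      at v = begin
        T G v + 12 * f v ≡⟨ cong (T G v +_) (lem₀ (f v)) ⟩
        T G v + 2 * (6 * f v) ≤⟨ +-monoʳ-≤ (T G v) (*-monoʳ-≤ 2 (fall-loss 6 (δ v))) ⟩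
        T G v + 2 * (δ v * Δ) ≡⟨ cong (T G v +_) (trans (lem₁ (δ v) Δ) (sym both)) ⟩
        T G v + sum₂ (λ a b → Δ * (⟦ a == v ⟧ * ⟦ hidden G a b ⟧ + ⟦ b == v ⟧ * ⟦ hidden G a b ⟧)) ≡⟨ sum₂-+ _ _ ⟨
        sum₂ (λ a b → ⟦ hidden G a b ⟧ * fall (d ∸ count (insert a b F v)) 6 + Δ * (⟦ a == v ⟧ * ⟦ hidden G a b ⟧ + ⟦ b == v ⟧ * ⟦ hidden G a b ⟧)) ≤⟨ sum₂-mono entry ⟩
        sum₂ (λ a b → f v * ⟦ hidden G a b ⟧) ≡⟨ trans (sum₂-*ˡ (f v) _) (trans (cong (f v *_) (hidden-total R ω)) (*-comm (f v) D)) ⟩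
        D * f v ∎
        where
        Δ : ℕ
        Δ = f v ∸ fall (δ v ∸ 1) 6
        lem₀ : ∀ p → 12 * p ≡ 2 * (6 * p)
        lem₀ = solve-∀
        lem₁ : ∀ p q → 2 * (p * q) ≡ q * (p + p)
        lem₁ = solve-∀
        row : ∀ (H : Graph n) → sum₂ (λ a b → ⟦ a == v ⟧ * ⟦ H a b ⟧) ≡ count (H v)
        row H = trans (sum₂-cong (λ a b → cong (λ p → ⟦ p ⟧ * ⟦ H a b ⟧) (==-sym a v))) (weight-row v H)
        both : sum₂ (λ a b → Δ * (⟦ a == v ⟧ * ⟦ hidden G a b ⟧ + ⟦ b == v ⟧ * ⟦ hidden G a b ⟧)) ≡ Δ * (δ v + δ v)
        both = trans (sum₂-*ˡ Δ _) (cong (Δ *_) (trans (sum₂-+ _ _) (cong₂ _+_ (trans (row (hidden G)) (hidden-row R ω v))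
          (trans (sum₂-swap _) (trans (row (λ b a → hidden G a b)) (hidden-column R ω v))))))
        entry : ∀ a b → ⟦ hidden G a b ⟧ * fall (d ∸ count (insert a b F v)) 6 + Δ * (⟦ a == v ⟧ * ⟦ hidden G a b ⟧ + ⟦ b == v ⟧ * ⟦ hidden G a b ⟧) ≤ f v * ⟦ hidden G a b ⟧
        entry a b with bool-cases (hidden G a b)
        ... | inj₂ e rewrite e | *-zeroʳ ⟦ a == v ⟧ | *-zeroʳ ⟦ b == v ⟧ | *-zeroʳ Δ = z≤n
        ... | inj₁ e rewrite insert-row F-symm (not-false (proj₂ (∧-split {G a b} e))) (λ { refl → true≢false (proj₁ (∧-split {G a b} e)) (irr R a) }) v
            | sym (∸-+-assoc d (count (F v)) (⟦ a == v ⟧ + ⟦ b == v ⟧)) = ≤-trans (≤-reflexive (cong (λ p → ⟦ p ⟧ * fall (δ v ∸ (⟦ a == v ⟧ + ⟦ b == v ⟧)) 6 + Δ * (⟦ a == v ⟧ * ⟦ p ⟧ + ⟦ b == v ⟧ * ⟦ p ⟧)) e))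
              (≤-trans (go (a == v) (b == v) (λ p q → true≢false (proj₁ (∧-split {G a b} e)) (trans (cong (λ t → G t b) (trans (==⇒≡ p) (sym (==⇒≡ q)))) (irr R b)))) (≤-reflexive (sym (trans (cong (λ p → f v * ⟦ p ⟧) e) (*-identityʳ (f v))))))
          where
          one : 1 * fall (δ v ∸ 1) 6 + Δ * 1 ≤ f v
          one = ≤-reflexive (trans (cong₂ _+_ (*-identityˡ _) (*-identityʳ Δ)) (m+[n∸m]≡n (fall-mono 6 (m∸n≤m (δ v) 1))))
          go : ∀ p q → (p ≡ true → q ≡ true → ⊥) → 1 * fall (δ v ∸ (⟦ p ⟧ + ⟦ q ⟧)) 6 + Δ * (⟦ p ⟧ * 1 + ⟦ q ⟧ * 1) ≤ f v
          go true true c = ⊥-elim (c refl refl)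
          go true false c = one
          go false true c = one
          go false false c = ≤-reflexive (trans (cong₂ _+_ (*-identityˡ _) (*-zeroʳ Δ)) (+-identityʳ _))

  -- With hidden degrees up to d the error `E` is of order d², affordable only while about d⁴ darts
  -- are hidden. By then it is unlikely that some vertex still has six hidden darts, and with at
  -- most five the error is of order d and `Sparse` can go on.
  module Dense (R ρ D₀ ρ₁ D₁ : ℕ) (2≤D₁ : 2 ≤ D₁) (2E≤D₁ : 2 * ((2 * d + 4) * 5) ≤ D₁)
    (9E₁≤ : 9 * ((2 * d + 4) * 5 * Λ * ((2 * d + 4) * 5 * Λ)) ≤ ρ₁ * D₁) (11≤D₀ : 11 ≤ D₀)
    (2E≤D₀ : 2 * ((2 * d + 4) * d) ≤ D₀) (9E₀≤ : 9 * ((2 * d + 4) * d * Λ * ((2 * d + 4) * d * Λ)) ≤ ρ * D₀) where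

    open Sparse R 5 ρ₁ D₁ 2≤D₁ 2E≤D₁ 9E₁≤ public

    A₀ U : ℕ
    A₀ = rate R d ρ
    U = window (suc D₀) * (R * (Λ * Λ))

    total : ℕ → ℕ
    total D = bound (suc D₀) + harmonic A₀ D

    -- If the potential is zero, all hidden degrees are at most 5 and `sparse` applies. If not, the
    -- trivial bound Λ² is charged to the potential, which is at least 1.
    dense-base : ∀ D {F} → D ≤ suc D₀ → Exposed d D F → Bounded (window D * R) (window D * total D + U * potential F) F
    dense-base D {F} D≤ X with zero-or-not (potential F)
    ... | inj₁ P≡0 = bounded (begin
      window D * R * (N F * Q F) ≡⟨ *-assoc (window D) R _ ⟩
      window D * (R * (N F * Q F)) ≤⟨ *-monoʳ-≤ (window D) (variance (sparse D X′)) ⟩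
      window D * (R * (S F * S F) + bound D * (N F * N F)) ≤⟨ *-monoʳ-≤ (window D) (+-monoʳ-≤ (R * (S F * S F)) (*-monoˡ-≤ (N F * N F) bound≤)) ⟩
      window D * (R * (S F * S F) + total D * (N F * N F)) ≡⟨ lem (window D) R (S F * S F) (total D) (N F * N F) ⟩
      window D * R * (S F * S F) + window D * total D * (N F * N F) ≤⟨ +-monoʳ-≤ (window D * R * (S F * S F)) (*-monoˡ-≤ (N F * N F) (m≤m+n (window D * total D) (U * potential F))) ⟩
      window D * R * (S F * S F) + (window D * total D + U * potential F) * (N F * N F) ∎)
      where
      open ≤-Reasoning
      lem : ∀ w R s t m → w * (R * s + t * m) ≡ w * R * s + w * t * m
      lem = solve-∀
      bound≤ : bound D ≤ total D
      bound≤ = ≤-trans (+-monoʳ-≤ (R * (2 * D₁ * (2 * D₁))) (harmonic-mono A D≤)) (m≤m+n (bound (suc D₀)) (harmonic A₀ D))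
      X′ : Exposed 5 D F
      X′ = record { F-symm = Exposed.F-symm X ; D-eq = Exposed.D-eq X ; δ≤ = small }
        where
        small : ∀ v → d ∸ count (F v) ≤ 5
        small v with d ∸ count (F v) ≤? 5
        ... | yes p = p
        ... | no ¬p = ⊥-elim (1+n≰n (≤-trans (fall-pos 6 (≰⇒> ¬p)) (≤-trans (sum-term (λ v → fall (d ∸ count (F v)) 6) v) (≤-reflexive P≡0))))
    ... | inj₂ nz = bounded (begin
      window D * R * (N F * Q F) ≤⟨ *-monoʳ-≤ (window D * R) (trivial F) ⟩
      window D * R * (Λ * Λ * (N F * N F)) ≡⟨ lem (window D) R (Λ * Λ) (N F * N F) ⟩
      window D * (R * (Λ * Λ)) * 1 * (N F * N F) ≤⟨ *-monoˡ-≤ (N F * N F) (*-mono-≤ (*-monoˡ-≤ (R * (Λ * Λ)) (window-mono D≤)) (>-nonZero⁻¹ (potential F) {{nz}})) ⟩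
      U * potential F * (N F * N F) ≤⟨ *-monoˡ-≤ (N F * N F) (m≤n+m (U * potential F) (window D * total D)) ⟩
      (window D * total D + U * potential F) * (N F * N F) ≤⟨ m≤n+m _ (window D * R * (S F * S F)) ⟩
      window D * R * (S F * S F) + (window D * total D + U * potential F) * (N F * N F) ∎)
      where
      open ≤-Reasoning
      lem : ∀ w R l m → w * R * (l * m) ≡ w * (R * l) * 1 * m
      lem = solve-∀

    -- Scaling the whole bound by `window D` lets the charge `U * potential F` keep its coefficient
    -- through the recursion: on average the potential shrinks at least as fast as `window`.
    dense : ∀ D {F} → Exposed d D F → Bounded (window D * R) (window D * total D + U * potential F) F
    dense zero X = dense-base zero z≤n X
    dense (suc zero) X = dense-base 1 (s≤s z≤n) X
    dense D@(suc (suc D′)) {F} X with D₀ ≤? D′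
    ... | no ¬p = dense-base D (s≤s (≰⇒> ¬p)) X
    ... | yes D₀≤D′ = bounded (*-cancelˡ-≤ (D * (D′ ∸ 10)) {{m*n≢0 D (D′ ∸ 10) {{_}} {{>-nonZero (m<n⇒0<n∸m (≤-trans 11≤D₀ D₀≤D′))}}}} (begin
      D * (D′ ∸ 10) * (window D * R * NQ) ≡⟨ lem₁ D (D′ ∸ 10) (window D) R NQ ⟩
      D * R * NQ * (window D * (D′ ∸ 10)) ≡⟨ cong (D * R * NQ *_) (window-step D′) ⟩
      D * R * NQ * (D * window D′) ≡⟨ lem₂ D R NQ (window D′) ⟩
      D * D * (window D′ * R * NQ)
        ≤⟨ variance-step (≤-trans 2E≤D₀ D₀≤D) ((4 * D) ⊓ (4 * (α * d))) (m⊓n≤m _ _) (J-cases D d) (window D′ * R) c (λ a b f a≢b → dense D′ (insert-exposed X f a≢b)) ⟩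
      D * D * (window D′ * R * SS) + window D′ * R * (B₁′ * B₂′) * NN + D * N F * sum₂ (λ a b → c a b * overEdge a b (λ _ → 1))
        ≤⟨ +-mono-≤ (+-monoʳ-≤ (D * D * (window D′ * R * SS)) (*-monoˡ-≤ NN (≤-trans (≤-reflexive (*-assoc (window D′) R _)) (*-monoʳ-≤ (window D′) (≤-trans (increment R d ρ D₀ D 9E₀≤ D₀≤D) (*-monoˡ-≤ D (<suc-div A₀ (suc D′))))))))
             (*-monoʳ-≤ (D * N F) c-sum) ⟩
      D * D * (window D′ * R * SS) + window D′ * (t * D * D) * NN + D * N F * (window D′ * total D′ * (D * N F) + U * ((D′ ∸ 10) * (potential F * N F)))
        ≡⟨ lem₃ D (window D′) R SS t (N F) (total D′) U (D′ ∸ 10) (potential F) ⟩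
      D * (D * window D′ * (R * SS + (total D′ + t) * NN) + U * (D′ ∸ 10) * potential F * NN)
        ≡⟨ cong (λ z → D * (z * (R * SS + (total D′ + t) * NN) + U * (D′ ∸ 10) * potential F * NN)) (window-step D′) ⟨
      D * (window D * (D′ ∸ 10) * (R * SS + (total D′ + t) * NN) + U * (D′ ∸ 10) * potential F * NN) ≡⟨ lem₄ D (window D) (D′ ∸ 10) R SS (total D′ + t) NN U (potential F) ⟩
      D * (D′ ∸ 10) * (window D * R * SS + (window D * (total D′ + t) + U * potential F) * NN)
        ≤⟨ *-monoʳ-≤ (D * (D′ ∸ 10)) (+-monoʳ-≤ (window D * R * SS) (*-monoˡ-≤ NN (+-monoˡ-≤ (U * potential F) (*-monoʳ-≤ (window D) grow)))) ⟩
      D * (D′ ∸ 10) * (window D * R * SS + (window D * total D + U * potential F) * NN) ∎))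
      where
      open ≤-Reasoning
      open Step X
      NQ SS NN t B₁′ B₂′ : ℕ
      NQ = N F * Q F
      SS = S F * S F
      NN = N F * N F
      t = suc (A₀ div D)
      B₁′ = 4 * D + 3 * (E * Λ)
      B₂′ = (4 * D) ⊓ (4 * (α * d)) + 3 * (E * Λ)
      D₀≤D : D₀ ≤ D
      D₀≤D = ≤-trans D₀≤D′ (≤-trans (n≤1+n D′) (n≤1+n (suc D′)))
      c : Fin n → Fin n → ℕ
      c a b = window D′ * total D′ + U * potential (insert a b F)
      grow : total D′ + t ≤ total D
      grow = ≤-trans (≤-reflexive (+-assoc (bound (suc D₀)) _ t)) (+-monoʳ-≤ (bound (suc D₀)) (+-monoˡ-≤ t (harmonic-mono A₀ (n≤1+n D′))))
      c-sum : sum₂ (λ a b → c a b * overEdge a b (λ _ → 1)) ≤ window D′ * total D′ * (D * N F) + U * ((D′ ∸ 10) * (potential F * N F))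
      c-sum = begin
        sum₂ (λ a b → c a b * overEdge a b (λ _ → 1))
          ≡⟨ trans (sum₂-cong (λ a b → lem (window D′ * total D′) U (potential (insert a b F)) (overEdge a b (λ _ → 1)))) (trans (sum₂-+ _ _) (cong₂ _+_ (trans (sum₂-*ˡ (window D′ * total D′) _) (cong (window D′ * total D′ *_) (overEdge-sum _))) (sum₂-*ˡ U _))) ⟩
        window D′ * total D′ * (D * N F) + U * sum₂ (λ a b → potential (insert a b F) * overEdge a b (λ _ → 1))
          ≤⟨ +-monoʳ-≤ (window D′ * total D′ * (D * N F)) (*-monoʳ-≤ U (≤-trans (m+n≤o⇒m≤o∸n _ (potential-step X)) (≤-reflexive (sym (*-distribʳ-∸ (potential F * N F) D 12))))) ⟩
        window D′ * total D′ * (D * N F) + U * ((D′ ∸ 10) * (potential F * N F)) ∎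
        where
        lem : ∀ p U q x → (p + U * q) * x ≡ p * x + U * (q * x)
        lem = solve-∀
      lem₁ : ∀ D e w R q → D * e * (w * R * q) ≡ D * R * q * (w * e)
      lem₁ = solve-∀
      lem₂ : ∀ D R q w → D * R * q * (D * w) ≡ D * D * (w * R * q)
      lem₂ = solve-∀
      lem₃ : ∀ D w R S t N b U e P → D * D * (w * R * S) + w * (t * D * D) * (N * N) + D * N * (w * b * (D * N) + U * (e * (P * N)))
        ≡ D * (D * w * (R * S + (b + t) * (N * N)) + U * e * P * (N * N))
      lem₃ = solve-∀
      lem₄ : ∀ D w e R S t N U P → D * (w * e * (R * S + t * N) + U * e * P * N) ≡ D * e * (w * R * S + (w * t + U * P) * N)
      lem₄ = solve-∀

-- From the variance to the probabilities of defect zero and of large defect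

module Concentration {n : ℕ} (d : ℕ) (h : Graph n → ℕ) (h-ext : Ext h) (Λ α : ℕ) (h≤ : ∀ G → h G ≤ Λ)
  (same : Graph n → Fin n → Fin n → Bool) (same≤ : ∀ G a → count (same G a) ≤ α) (same-ext : ∀ a x → Ext (λ G → same G a x))
  (lip : ∀ G → Regular d G → ∀ {a b x y} → Valid G a b x y →
    h (switch a b x y G) ≤ h G + 2 * (⟦ same G a x ⟧ + ⟦ same G b y ⟧))
  (range : ∀ F G H → F ⊆ G ≡ true → F ⊆ H ≡ true → h G ≤ h H + sum₂ (λ i j → ⟦ G i j ∧ not (F i j) ⟧)) where

  open Phases d h h-ext Λ α h≤ same same≤ same-ext lip range

  total# low high : ℕ
  total# = sumR {n} d (λ _ → 1)
  low = sumR d (λ G → ⟦ h G ≡ᵇ 0 ⟧)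
  high = sumR d (λ G → ⟦ atLeast Λ (h G) ⟧)

  private
    positive : Graph n → ℕ
    positive G = ⟦ not (h G ≡ᵇ 0) ⟧

    Sh Qh Ph : ℕ
    Sh = sumR d h
    Qh = sumR d (λ G → h G * h G)
    Ph = sumR d positive

    -- The inequality 2xy ≤ x² + y², with indicators on the right that vanish together with x or y;
    -- `cauchy` then involves only the graphs with positive `h`.
    two-products : ∀ x y → 2 * (x * y) ≤ ⟦ not (y ≡ᵇ 0) ⟧ * (x * x) + ⟦ not (x ≡ᵇ 0) ⟧ * (y * y)
    two-products zero y = z≤n
    two-products (suc x) zero = ≤-trans (≤-reflexive (cong (2 *_) (*-zeroʳ (suc x)))) z≤n
    two-products x@(suc _) y@(suc _) with ≤-total x y
    ... | inj₁ x≤y = subst (λ y → 2 * (x * y) ≤ 1 * (x * x) + 1 * (y * y)) (m+[n∸m]≡n x≤y) (≤-trans (m≤m+n _ ((y ∸ x) * (y ∸ x))) (≤-reflexive (lem x (y ∸ x))))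
      where
      lem : ∀ x t → 2 * (x * (x + t)) + t * t ≡ 1 * (x * x) + 1 * ((x + t) * (x + t))
      lem = solve-∀
    ... | inj₂ y≤x = subst (λ x → 2 * (x * y) ≤ 1 * (x * x) + 1 * (y * y)) (m+[n∸m]≡n y≤x) (≤-trans (m≤m+n _ ((x ∸ y) * (x ∸ y))) (≤-reflexive (lem y (x ∸ y))))
      where
      lem : ∀ y t → 2 * ((y + t) * y) + t * t ≡ 1 * ((y + t) * (y + t)) + 1 * (y * y)
      lem = solve-∀

    cauchy : Sh * Sh ≤ Ph * Qh
    cauchy = *-cancelˡ-≤ 2 (begin
      2 * (Sh * Sh) ≡⟨ trans (sym (*-assoc 2 Sh Sh)) (sym (sumR-*ˡ d (2 * Sh) h)) ⟩
      sumR d (λ G → 2 * Sh * h G) ≤⟨ sumR-mono d (λ G _ → inner G) ⟩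
      sumR d (λ G → Ph * (h G * h G) + Qh * positive G) ≡⟨ trans (sumR-+ d _ _) (cong₂ _+_ (sumR-*ˡ d Ph _) (sumR-*ˡ d Qh _)) ⟩
      Ph * Qh + Qh * Ph ≡⟨ lem Ph Qh ⟩
      2 * (Ph * Qh) ∎)
      where
      open ≤-Reasoning
      lem : ∀ p q → p * q + q * p ≡ 2 * (p * q)
      lem = solve-∀
      inner : ∀ G → 2 * Sh * h G ≤ Ph * (h G * h G) + Qh * positive G
      inner G = begin
        2 * Sh * h G ≡⟨ trans (lem₁ Sh (h G)) (sym (sumR-*ˡ d (2 * h G) h)) ⟩
        sumR d (λ H → 2 * h G * h H) ≤⟨ sumR-mono d (λ H _ → ≤-trans (≤-reflexive (*-assoc 2 (h G) (h H))) (≤-trans (two-products (h G) (h H)) (≤-reflexive (cong (_+ positive G * (h H * h H)) (*-comm (positive H) _))))) ⟩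
        sumR d (λ H → h G * h G * positive H + positive G * (h H * h H)) ≡⟨ trans (sumR-+ d _ _) (cong₂ _+_ (sumR-*ˡ d (h G * h G) _) (sumR-*ˡ d (positive G) _)) ⟩
        h G * h G * Ph + positive G * Qh ≡⟨ cong₂ _+_ (*-comm (h G * h G) Ph) (*-comm (positive G) Qh) ⟩
        Ph * (h G * h G) + Qh * positive G ∎
        where
        lem₁ : ∀ s h → 2 * s * h ≡ 2 * h * s
        lem₁ = solve-∀

    empty : Graph n
    empty _ _ = false

    over-empty : ∀ g → over empty g ≡ sumR d g
    over-empty g = sumR-cong d (λ G _ → trans (cong (λ p → ⟦ p ⟧ * g G) (⊆-intro {F = empty} {G = G} (λ _ _ ()))) (*-identityˡ (g G)))

    count-empty : count {n} (λ _ → false) ≡ 0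
    count-empty = sum-zero {n} {λ _ → 0} (λ _ → refl)

    empty-exposed : Exposed d (n * d) empty
    empty-exposed = record
      { F-symm = λ _ _ → refl
      ; δ≤ = λ a → m∸n≤m d (count (empty a))
      ; D-eq = trans (cong (n * d +_) (trans (sum₂-rows {n} {n} (λ _ _ → 0)) (sum-zero {n} (λ _ → count-empty)))) (+-identityʳ _) }

  -- By Cauchy-Schwarz the square of the first moment is at most Pr[h > 0] times the second moment.
  -- Subtracting, Pr[h = 0] times the second moment is at most the variance, and the second moment
  -- is at least Λ² Pr[h ≥ Λ]. The mean never has to be located.
  concentrate : ∀ v → total# * Qh ≤ Sh * Sh + v * (total# * total#) → low * (high * (Λ * Λ)) ≤ v * (total# * total#)
  concentrate v hyp = ≤-trans (*-monoʳ-≤ low high≤) (+-cancelˡ-≤ (Ph * Qh) (low * Qh) (v * (total# * total#)) (begin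
    Ph * Qh + low * Qh ≡⟨ *-distribʳ-+ Qh Ph low ⟨
    (Ph + low) * Qh ≡⟨ cong (_* Qh) split ⟩
    total# * Qh ≤⟨ hyp ⟩
    Sh * Sh + v * (total# * total#) ≤⟨ +-monoˡ-≤ (v * (total# * total#)) cauchy ⟩
    Ph * Qh + v * (total# * total#) ∎))
    where
    open ≤-Reasoning
    split : Ph + low ≡ total#
    split = trans (sym (sumR-+ d positive (λ G → ⟦ h G ≡ᵇ 0 ⟧))) (sumR-cong d (λ G _ → trans (+-comm (positive G) _) (⟦not⟧ (h G ≡ᵇ 0))))
    high≤ : high * (Λ * Λ) ≤ Qh
    high≤ = ≤-trans (≤-reflexive (sym (sumR-*ʳ d (Λ * Λ) _))) (sumR-mono d (λ G _ → point G))
      where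
      point : ∀ G → ⟦ atLeast Λ (h G) ⟧ * (Λ * Λ) ≤ h G * h G
      point G with atLeast Λ (h G) in e
      ... | false = z≤n
      ... | true = ≤-trans (≤-reflexive (*-identityˡ _)) (*-mono-≤ (atLeast⇒ e) (atLeast⇒ e))

  module _ (R ρ D₀ ρ₁ D₁ v₁ v₂ : ℕ) (2≤D₁ : 2 ≤ D₁) (2E≤D₁ : 2 * ((2 * d + 4) * 5) ≤ D₁)
    (9E₁≤ : 9 * ((2 * d + 4) * 5 * Λ * ((2 * d + 4) * 5 * Λ)) ≤ ρ₁ * D₁) (11≤D₀ : 11 ≤ D₀)
    (2E≤D₀ : 2 * ((2 * d + 4) * d) ≤ D₀) (9E₀≤ : 9 * ((2 * d + 4) * d * Λ * ((2 * d + 4) * d * Λ)) ≤ ρ * D₀)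
    (11≤nd : 11 ≤ n * d) {{R≢0 : NonZero R}}
    (total≤ : R * (2 * D₁ * (2 * D₁)) + harmonic (rate R 5 ρ₁) (suc D₀) + harmonic (rate R d ρ) (n * d) ≤ R * v₁)
    (tail≤ : window (suc D₀) * (Λ * Λ) * (n * d ^ 6) ≤ window (n * d) * v₂) where

    open Dense R ρ D₀ ρ₁ D₁ 2≤D₁ 2E≤D₁ 9E₁≤ 11≤D₀ 2E≤D₀ 9E₀≤ using (dense; total; U)

    concentration : low * (high * (Λ * Λ)) ≤ (v₁ + v₂) * (total# * total#)
    concentration = concentrate (v₁ + v₂) (*-cancelˡ-≤ (window (n * d) * R) {{m*n≢0 _ R {{>-nonZero window-pos}}}} (begin
      window (n * d) * R * (total# * Qh) ≡⟨ cong₂ (λ p q → window (n * d) * R * (p * q)) (over-empty (λ _ → 1)) (over-empty (λ G → h G * h G)) ⟨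
      window (n * d) * R * (N empty * Q empty) ≤⟨ variance (dense (n * d) empty-exposed) ⟩
      window (n * d) * R * (S empty * S empty) + (window (n * d) * total (n * d) + U * potential empty) * (N empty * N empty)
        ≡⟨ cong₂ (λ p q → window (n * d) * R * (q * q) + (window (n * d) * total (n * d) + U * potential empty) * (p * p)) (over-empty (λ _ → 1)) (over-empty h) ⟩
      window (n * d) * R * (Sh * Sh) + (window (n * d) * total (n * d) + U * potential empty) * (total# * total#)
        ≤⟨ +-monoʳ-≤ (window (n * d) * R * (Sh * Sh)) (*-monoˡ-≤ (total# * total#) (+-mono-≤ (*-monoʳ-≤ (window (n * d)) total≤) U≤)) ⟩
      window (n * d) * R * (Sh * Sh) + (window (n * d) * (R * v₁) + R * (window (n * d) * v₂)) * (total# * total#) ≡⟨ lem (window (n * d)) R (Sh * Sh) v₁ v₂ (total# * total#) ⟩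
      window (n * d) * R * (Sh * Sh + (v₁ + v₂) * (total# * total#)) ∎))
      where
      open ≤-Reasoning
      lem : ∀ w R S a b t → w * R * S + (w * (R * a) + R * (w * b)) * t ≡ w * R * (S + (a + b) * t)
      lem = solve-∀
      window-pos : 0 < window (n * d)
      window-pos = ≤-trans (s≤s z≤n) (window-mono 11≤nd)
      potential≤ : potential empty ≤ n * d ^ 6
      potential≤ = sum-bound (λ v → ≤-trans (fall-mono 6 (m∸n≤m d (count (empty v)))) (fall≤^ 6 d))
      U≤ : U * potential empty ≤ R * (window (n * d) * v₂)
      U≤ = ≤-trans (*-monoʳ-≤ U potential≤) (≤-trans (≤-reflexive (lem′ (window (suc D₀)) R (Λ * Λ) (n * d ^ 6))) (*-monoʳ-≤ R tail≤))
        where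
        lem′ : ∀ w R l p → w * (R * l) * p ≡ R * (w * l * p)
        lem′ = solve-∀

-- Colourings

Proper : ∀ {n k} → Graph n → (Fin n → Fin k) → Set
Proper G c = ∀ i j → G i j ≡ true → c i ≢ c j

any-elim : ∀ {A : Set} (p : A → Bool) xs → any p xs ≡ true → ∃ λ x → p x ≡ true
any-elim p (x ∷ xs) e with p x in q
... | true = x , q
... | false = any-elim p xs e

any-intro : ∀ {A : Set} (p : A → Bool) xs i → p (lookup xs i) ≡ true → any p xs ≡ true
any-intro p (x ∷ xs) fzero e rewrite e = refl
any-intro p (x ∷ xs) (fsuc i) e = ∨-true {p x} (inj₂ (any-intro p xs i e))

isProper⇒ : ∀ {n k} (G : Graph n) (c : Fin n → Fin k) → isProper G c ≡ true → Proper G c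
isProper⇒ G c e i j g c≡ = true≢false (∧-join g (trans (cong (_== c j) c≡) (==-refl (c j))))
  (not-false (all-elim _ (λ j → j) (all-elim (λ i → all (λ j → not (G i j ∧ ⌊ c i ≟ c j ⌋)) (allFin _)) (λ i → i) e i) j))

isProper⇐ : ∀ {n k} (G : Graph n) (c : Fin n → Fin k) → Proper G c → isProper G c ≡ true
isProper⇐ G c p = all-intro _ (λ i → i) (λ i → all-intro _ (λ j → j) (λ j → lem i j))
  where
  lem : ∀ i j → not (G i j ∧ (c i == c j)) ≡ true
  lem i j with G i j in g | c i ≟ c j
  ... | false | _ = refl
  ... | true | no _ = refl
  ... | true | yes e = ⊥-elim (p i j g e)

tabulate-any : ∀ {n m} (f : Fin n → Fin m) i → Any (_≡ f i) (tabulate f)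
tabulate-any f fzero = here refl
tabulate-any f (fsuc i) = there (tabulate-any (f ∘ fsuc) i)

colouring-index : ∀ {n k} (c : Fin n → Fin k) → ∃ λ i → lookup (funs (allFin k) n) i ≗ c
colouring-index {n} {k} c = FunctionSpace.funs-index _≡_ refl (allFin k) (tabulate-any (λ j → j)) c

colourable⇒ : ∀ {n} k (G : Graph n) → colourable k G ≡ true → ∃ λ (c : Fin n → Fin k) → Proper G c
colourable⇒ {n} k G e with any-elim (isProper G) (funs (allFin k) n) e
... | c , p = c , isProper⇒ G c p

colourable⇐ : ∀ {n k} (G : Graph n) (c : Fin n → Fin k) → Proper G c → colourable k G ≡ true
colourable⇐ {n} {k} G c p with colouring-index c
... | i , e = any-intro (isProper G) (funs (allFin k) n) i (isProper⇐ G _ (λ u v g q → p u v g (trans (sym (e u)) (trans q (e v)))))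

colourable-mono : ∀ {n k m} (G : Graph n) → k ≤ m → colourable k G ≡ true → colourable m G ≡ true
colourable-mono {k = k} {m} G k≤m e with colourable⇒ k G e
... | c , p = colourable⇐ G (λ v → fromℕ< (≤-trans (toℕ<n (c v)) k≤m)) (λ i j g q → p i j g (toℕ-injective
  (trans (sym (toℕ-fromℕ< _)) (trans (cong toℕ q) (toℕ-fromℕ< _)))))

colourable-n : ∀ {n} (G : Graph n) → (∀ i → G i i ≡ false) → colourable n G ≡ true
colourable-n G ir = colourable⇐ G (λ i → i) (λ { i .i g refl → true≢false g (ir i) })

-- The search list is generalised to an interval starting at `s`, as the recursion of
-- `firstColourable` moves its start.
first-spec : ∀ {n} (G : Graph n) s (f : ℕ → ℕ) → (∀ i → f i ≡ s + i) → ∀ m → (∃ λ i → i < m × colourable (s + i) G ≡ true) →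
  let r = firstColourable G (applyUpTo f m) in colourable r G ≡ true × (∀ k → s ≤ k → colourable k G ≡ true → r ≤ k)
first-spec G s f h zero (i , () , _)
first-spec G s f h (suc m) (i , i<m , e) with colourable (f 0) G in q
... | true = q , λ k s≤k _ → ≤-trans (≤-reflexive (trans (h 0) (+-identityʳ s))) s≤k
... | false with i
...   | zero = ⊥-elim (true≢false e (trans (cong (λ z → colourable z G) (sym (h 0))) q))
...   | suc i′ with first-spec G (suc s) (f ∘ suc) (λ j → trans (h (suc j)) (+-suc s j)) m (i′ , ≤-pred i<m , trans (cong (λ z → colourable z G) (sym (+-suc s i′))) e)
...     | p , least = p , λ k s≤k c → least k (≤∧≢⇒< s≤k (λ s≡k → true≢false c (trans (cong (λ z → colourable z G) (trans (sym s≡k) (sym (trans (h 0) (+-identityʳ s))))) q))) c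

χIn-intro : ∀ {n} (G : Graph n) → (∀ i → G i i ≡ false) → ∀ t → colourable t G ≡ false → colourable (2 + t) G ≡ true → χIn (suc t) G ≡ true
χIn-intro {n} G ir t no-t yes-t with first-spec G 0 (λ i → i) (λ _ → refl) (suc n) (n , ≤-refl , colourable-n G ir)
... | p , least with m≤n⇒m<n∨m≡n (least (2 + t) z≤n yes-t)
...   | inj₂ e = ∨-true {χ G ≡ᵇ suc t} (inj₂ (subst (λ r → (r ≡ᵇ 2 + t) ≡ true) (sym e) (≡ᵇ-refl (2 + t))))
...   | inj₁ r<2+t = ∨-true (inj₁ (subst (λ r → (r ≡ᵇ suc t) ≡ true) (sym (≤-antisym (≤-pred r<2+t) (≰⇒> (λ r≤t → true≢false (colourable-mono G r≤t p) no-t)))) (≡ᵇ-refl (suc t))))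

mono : ∀ {n k} → (Fin n → Fin k) → Graph n → ℕ
mono c = weight (λ i j → ⟦ c i == c j ⟧)

module Defect {n : ℕ} (t d Λ α : ℕ) where

  Colouring : Set
  Colouring = Fin n → Fin t

  balanced : Colouring → Bool
  balanced c = every (λ v → atLeast (count (λ x → c v == c x)) α)

  -- The classes of a best colouring are stored with its value. Ties are settled by the order of the
  -- list, so both depend on the graph only up to pointwise equality.
  record Best : Set where
    constructor best
    field
      value : ℕ
      twins : Fin n → Fin n → Bool
  open Best

  improves : Colouring → Graph n → Best → Bool
  improves c G r = balanced c ∧ atLeast (suc (mono c G)) (value r)

  search : List Colouring → Graph n → Best
  search [] G = best Λ (λ _ _ → false)
  search (c ∷ cs) G = if improves c G (search cs G) then best (mono c G) (λ i j → c i == c j)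
    else search cs G

  search-ext : ∀ cs {G H} → G ≈ H → value (search cs G) ≡ value (search cs H) × (∀ i j → twins (search cs G) i j ≡ twins (search cs H) i j)
  search-ext [] e = refl , λ _ _ → refl
  search-ext (c ∷ cs) {G} {H} e with search-ext cs e
  ... | v , w with cong₂ (λ p q → balanced c ∧ atLeast (suc p) q) (weight-cong {w = λ i j → ⟦ c i == c j ⟧} (λ _ _ → refl) e) v
  ...   | e′ with improves c G (search cs G) | improves c H (search cs H)
  search-ext (c ∷ cs) e | v , w | refl | true | true = weight-cong {w = λ i j → ⟦ c i == c j ⟧} (λ _ _ → refl) e , λ _ _ → refl
  search-ext (c ∷ cs) e | v , w | refl | false | false = v , w

  head≤ : ∀ c cs G → balanced c ≡ true → value (search (c ∷ cs) G) ≤ mono c G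
  head≤ c cs G b with suc (mono c G) ≤? value (search cs G)
  ... | yes p rewrite b = ≤-refl
  ... | no ¬p rewrite b = ≤-pred (≰⇒> ¬p)

  tail≤ : ∀ c cs G → value (search (c ∷ cs) G) ≤ value (search cs G)
  tail≤ c cs G with balanced c | suc (mono c G) ≤? value (search cs G)
  ... | true | yes p = ≤-trans (n≤1+n _) p
  ... | true | no ¬p = ≤-refl
  ... | false | _ = ≤-refl

  search-≤ : ∀ cs G → value (search cs G) ≤ Λ × (∀ i → balanced (lookup cs i) ≡ true → value (search cs G) ≤ mono (lookup cs i) G)
  search-≤ [] G = ≤-refl , λ ()
  search-≤ (c ∷ cs) G = ≤-trans (tail≤ c cs G) (proj₁ (search-≤ cs G)) ,
    λ { fzero b → head≤ c cs G b ; (fsuc i) b → ≤-trans (tail≤ c cs G) (proj₂ (search-≤ cs G) i b) }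

  Witness : ∀ cs G → Set
  Witness cs G = ∃ λ c → value (search cs G) ≡ mono c G × (∀ i j → twins (search cs G) i j ≡ (c i == c j)) × balanced c ≡ true × (∀ H → value (search cs H) ≤ mono c H)

  -- Either the value is the cap Λ and there are no twins, or one colouring attains the value at `G`
  -- and bounds it from above at every graph. The last clause yields both the Lipschitz and the
  -- range estimate.
  search-witness : ∀ cs G → (value (search cs G) ≡ Λ × (∀ i j → twins (search cs G) i j ≡ false)) ⊎ Witness cs G
  search-witness [] G = inj₁ (refl , λ _ _ → refl)
  search-witness (c ∷ cs) G with improves c G (search cs G) in e
  ... | true = inj₂ (c , refl , (λ _ _ → refl) , proj₁ (∧-split e) , λ H → head≤ c cs H (proj₁ (∧-split e)))
  ... | false with search-witness cs G
  ...   | inj₁ w = inj₁ w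
  ...   | inj₂ (c′ , v , w , b , u) = inj₂ (c′ , v , w , b , λ H → ≤-trans (tail≤ c cs H) (u H))

  colourings : List Colouring
  colourings = funs (allFin t) n

  -- The least number of monochromatic darts over colourings with classes of size at most α, truncated at Λ.
  defect : Graph n → ℕ
  defect G = value (search colourings G)

  same : Graph n → Fin n → Fin n → Bool
  same G = twins (search colourings G)

  defect-ext : Ext defect
  defect-ext G H e = proj₁ (search-ext colourings e)

  same-ext : ∀ a x → Ext (λ G → same G a x)
  same-ext a x G H e = proj₂ (search-ext colourings e) a x

  defect≤Λ : ∀ G → defect G ≤ Λ
  defect≤Λ G = proj₁ (search-≤ colourings G)

  same≤ : ∀ G a → count (same G a) ≤ α
  same≤ G a with search-witness colourings G
  ... | inj₁ (_ , w) = ≤-trans (≤-reflexive (sum-zero (λ x → cong ⟦_⟧ (w a x)))) z≤n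
  ... | inj₂ (c , _ , w , b , _) = ≤-trans (≤-reflexive (sum-cong (λ x → cong ⟦_⟧ (w a x)))) (atLeast⇒ (every-elim _ b a))

  -- A best colouring of `G` still competes after the switch; only an inserted edge inside one of
  -- its classes costs anything, namely two darts.
  defect-lip : ∀ G → Regular d G → ∀ {a b x y} → Valid G a b x y → defect (switch a b x y G) ≤ defect G + 2 * (⟦ same G a x ⟧ + ⟦ same G b y ⟧)
  defect-lip G R {a} {b} {x} {y} V with search-witness colourings G
  ... | inj₁ (v , _) = ≤-trans (defect≤Λ _) (≤-trans (≤-reflexive (sym v)) (m≤m+n _ _))
  ... | inj₂ (c , v , w , _ , u) rewrite w a x | w b y = begin
    defect (switch a b x y G) ≤⟨ u _ ⟩
    mono c (switch a b x y G) ≤⟨ m≤m+n _ _ ⟩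
    mono c (switch a b x y G) + ((eq a b + eq b a) + (eq x y + eq y x)) ≡⟨ SwitchProps.balance R V eq ⟩
    mono c G + ((eq a x + eq x a) + (eq b y + eq y b)) ≡⟨ cong₂ _+_ (sym v) (trans (cong₂ (λ p q → (eq a x + p) + (eq b y + q)) (cong ⟦_⟧ (==-sym (c x) (c a))) (cong ⟦_⟧ (==-sym (c y) (c b)))) (lem (eq a x) (eq b y))) ⟩
    defect G + 2 * (eq a x + eq b y) ∎
    where
    open ≤-Reasoning
    eq : Fin n → Fin n → ℕ
    eq i j = ⟦ c i == c j ⟧
    lem : ∀ p q → (p + p) + (q + q) ≡ 2 * (p + q)
    lem = solve-∀

  -- A best colouring of `H` is tried on `G`: darts of `F` count equally in both graphs, and each
  -- other dart of `G` costs at most one.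
  defect-range : ∀ F G H → F ⊆ G ≡ true → F ⊆ H ≡ true → defect G ≤ defect H + sum₂ (λ i j → ⟦ G i j ∧ not (F i j) ⟧)
  defect-range F G H ωG ωH with search-witness colourings H
  ... | inj₁ (v , _) = ≤-trans (defect≤Λ _) (≤-trans (≤-reflexive (sym v)) (m≤m+n _ _))
  ... | inj₂ (c , v , _ , _ , u) = ≤-trans (u G) (≤-trans (sum₂-mono (λ i j → point (c i == c j) (F i j) (G i j) (H i j) (⊆-elim {F = F} ωH i j)))
      (≤-reflexive (trans (sum₂-+ _ _) (cong (_+ sum₂ (λ i j → ⟦ G i j ∧ not (F i j) ⟧)) (sym v)))))
    where
    point : ∀ p f g k → (f ≡ true → k ≡ true) → ⟦ p ⟧ * ⟦ g ⟧ ≤ ⟦ p ⟧ * ⟦ k ⟧ + ⟦ g ∧ not f ⟧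
    point p f false k i = ≤-trans (≤-reflexive (*-zeroʳ ⟦ p ⟧)) z≤n
    point p true true k i rewrite i refl = m≤m+n _ _
    point p false true k i = ≤-trans (≤-trans (≤-reflexive (*-identityʳ ⟦ p ⟧)) (⟦⟧≤1 p)) (m≤n+m 1 _)

  defect-zero : ∀ G (c : Colouring) → Proper G c → (∀ v → count (λ x → c v == c x) ≤ α) → defect G ≡ 0
  defect-zero G c p b with colouring-index c
  ... | i , e = n≤0⇒n≡0 (≤-trans (proj₂ (search-≤ colourings G) i bal) (≤-reflexive none))
    where
    c′ : Colouring
    c′ = lookup colourings i
    bal : balanced c′ ≡ true
    bal = every-intro _ (λ v → atLeast⇐ (≤-trans (≤-reflexive (sum-cong (λ x → cong₂ (λ p q → ⟦ p == q ⟧) (e v) (e x)))) (b v)))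
    none : mono c′ G ≡ 0
    none = trans (sum₂-rows _) (sum-zero (λ i → sum-zero (λ j → point i j)))
      where
      point : ∀ i j → ⟦ c′ i == c′ j ⟧ * ⟦ G i j ⟧ ≡ 0
      point i j with G i j in g
      ... | false = *-zeroʳ ⟦ c′ i == c′ j ⟧
      ... | true rewrite e i | e j | ≢⇒== (p i j g) = refl

  defect-small : ∀ G → atLeast Λ (defect G) ≡ false → ∃ λ (c : Colouring) → mono c G < Λ
  defect-small G e with search-witness colourings G
  ... | inj₁ (v , _) = ⊥-elim (true≢false (atLeast⇐ (≤-reflexive (sym v))) e)
  ... | inj₂ (c , v , _) with Λ ≤? mono c G
  ...   | no ¬p = c , ≰⇒> ¬p
  ...   | yes p = ⊥-elim (true≢false (atLeast⇐ (≤-trans p (≤-reflexive (sym v)))) e)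

-- Repairing a colouring with one additional colour

module Extend {n t : ℕ} (G : Graph n) (G-symm : Symm G) (G-irr : ∀ i → G i i ≡ false) (c : Fin n → Fin t) (U : Fin n → Bool)
  (covers : ∀ i j → G i j ≡ true → c i ≡ c j → U i ≡ true) where

  -- A hit vertex may come to clash with a new colour and then needs the extra one. That is harmless
  -- unless two such vertices are adjacent, which can happen only in the frontier; its colours are
  -- the ones to avoid.
  hit frontier : (Fin n → Bool) → Fin n → Bool
  hit W v = not (U v) ∧ some (λ u → W u ∧ G u v)
  frontier W v = hit W v ∧ some (λ v′ → hit W v′ ∧ G v v′)

  obstacles : (Fin n → Bool) → Fin n → ℕ
  obstacles W u = count (λ v → G u v ∧ frontier W v) + count (λ v → W v ∧ G u v)

  hit-intro : ∀ {W u v} → U v ≡ false → W u ≡ true → G u v ≡ true → hit W v ≡ true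
  hit-intro {W} {u} {v} nv wu g = ∧-join (not-true nv) (some-intro (λ u → W u ∧ G u v) u (∧-join wu g))

  frontier-intro : ∀ {W u v v′ u′} → W u ≡ true → W u′ ≡ true → U v ≡ false → U v′ ≡ false →
    G u v ≡ true → G v v′ ≡ true → G u′ v′ ≡ true → frontier W v ≡ true
  frontier-intro {W} {v′ = v′} wu wu′ nv nv′ uv vv′ u′v′ =
    ∧-join (hit-intro {W} nv wu uv) (some-intro (λ v′ → hit W v′ ∧ G _ v′) v′ (∧-join (hit-intro {W} nv′ wu′ u′v′) vv′))

  -- `outer` makes the vertices outside `U` that clash with ι an independent set, so one new colour
  -- serves them all.
  record Recolouring (W : Fin n → Bool) (ι : Fin n → Fin t) : Set where
    field
      inner : ∀ u u′ → W u ≡ true → W u′ ≡ true → G u u′ ≡ true → ι u ≢ ι u′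
      outer : ∀ u v v′ u′ → W u ≡ true → W u′ ≡ true → U v ≡ false → U v′ ≡ false →
        G u v ≡ true → G v v′ ≡ true → G u′ v′ ≡ true → c v ≡ ι u → c v′ ≢ ι u′
  open Recolouring

  module _ (free : ∀ W → (∀ u → W u ≡ true → U u ≡ true) → 0 < count W → ∃ λ u → W u ≡ true × obstacles W u < t) where

    -- Greedy colouring in a degeneracy order: a vertex with fewer than t obstacles is taken out,
    -- the rest is recoloured, and the vertex receives a colour that none of its obstacles uses. The
    -- obstacles are counted in the larger set `W`, so they cover the clashes with all vertices
    -- treated before.
    recolour : ∀ m W → count W ≤ m → (∀ u → W u ≡ true → U u ≡ true) → ∃ (Recolouring W)
    recolour m W h W⊆U with count W in eq
    ... | zero = c , record { inner = λ u _ wu → ⊥-elim (none u wu) ; outer = λ u _ _ _ wu → ⊥-elim (none u wu) }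
      where
      none : ∀ u → W u ≡ true → ⊥
      none u wu = 1+n≰n (≤-trans (≤-reflexive (sym (⟦⟧-true wu))) (≤-trans (sum-term (λ i → ⟦ W i ⟧) u) (≤-reflexive eq)))
    recolour (suc m) W (s≤s h) W⊆U | suc k with free W W⊆U (subst (0 <_) (sym eq) (s≤s z≤n))
    ... | u₀ , wu₀ , few with recolour m W′ smaller (λ u w → W⊆U u (proj₁ (∧-split w)))
      where
      W′ : Fin n → Bool
      W′ u = W u ∧ not (u₀ == u)
      smaller : count W′ ≤ m
      smaller = ≤-trans (+-cancelˡ-≤ 1 (count W′) k (≤-trans (≤-reflexive split) (≤-reflexive eq))) h
        where
        point : ∀ u → ⟦ u₀ == u ⟧ * ⟦ W u ⟧ + ⟦ W′ u ⟧ ≡ ⟦ W u ⟧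
        point u with u₀ == u | W u
        ... | true | true = refl
        ... | true | false = refl
        ... | false | true = refl
        ... | false | false = refl
        split : 1 + count W′ ≡ count W
        split = trans (cong (_+ count W′) (sym (trans (sum-δ u₀ (λ u → ⟦ W u ⟧)) (⟦⟧-true wu₀)))) (trans (sym (sum-+ _ _)) (sum-cong point))
    ...   | ι , good = ι′ , record { inner = inner′ ; outer = outer′ }
      where
      used : Fin t → ℕ
      used i = sum (λ v → ⟦ G u₀ v ∧ frontier W v ⟧ * ⟦ c v == i ⟧) + sum (λ v → ⟦ W v ∧ G u₀ v ⟧ * ⟦ ι v == i ⟧)
      used-total : sum used ≡ obstacles W u₀
      used-total = trans (sum-+ _ _) (cong₂ _+_ (side (λ v → G u₀ v ∧ frontier W v) c) (side (λ v → W v ∧ G u₀ v) ι))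
        where
        side : ∀ (p : Fin n → Bool) (f : Fin n → Fin t) → sum (λ i → sum (λ v → ⟦ p v ⟧ * ⟦ f v == i ⟧)) ≡ count p
        side p f = trans (sum-comm (λ i v → ⟦ p v ⟧ * ⟦ f v == i ⟧)) (sum-cong (λ v → trans (sum-*ˡ ⟦ p v ⟧ _) (trans (cong (⟦ p v ⟧ *_) (count-== (f v))) (*-identityʳ _))))
      pick : ∃ λ i → used i ≡ 0
      pick = sum-small used (≤-trans (s≤s (≤-reflexive used-total)) few)
      new : Fin t
      new = proj₁ pick
      unused : ∀ (p : Fin n → Bool) (f : Fin n → Fin t) → sum (λ v → ⟦ p v ⟧ * ⟦ f v == new ⟧) ≡ 0 → ∀ v → p v ≡ true → f v ≢ new
      unused p f z v pv fv = 1+n≰n (≤-trans (≤-reflexive (sym (trans (cong₂ (λ a b → ⟦ a ⟧ * ⟦ b ⟧) pv (trans (cong (_== new) fv) (==-refl new))) refl)))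
        (≤-trans (sum-term (λ v → ⟦ p v ⟧ * ⟦ f v == new ⟧) v) (≤-reflexive z)))
      unused-c : ∀ v → G u₀ v ≡ true → frontier W v ≡ true → c v ≢ new
      unused-c v g f = unused (λ v → G u₀ v ∧ frontier W v) c (m+n≡0⇒m≡0 _ (proj₂ pick)) v (∧-join g f)
      unused-ι : ∀ v → W v ≡ true → G u₀ v ≡ true → ι v ≢ new
      unused-ι v w g = unused (λ v → W v ∧ G u₀ v) ι (m+n≡0⇒n≡0 (sum (λ v → ⟦ G u₀ v ∧ frontier W v ⟧ * ⟦ c v == new ⟧)) (proj₂ pick)) v (∧-join w g)
      ι′ : Fin n → Fin t
      ι′ u = if u₀ == u then new else ι u
      at : ∀ u → (u₀ ≡ u × ι′ u ≡ new) ⊎ ((u₀ == u) ≡ false × ι′ u ≡ ι u)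
      at u with u₀ ≟ u
      ... | yes p = inj₁ (p , refl)
      ... | no _ = inj₂ (refl , refl)
      inner′ : ∀ u u′ → W u ≡ true → W u′ ≡ true → G u u′ ≡ true → ι′ u ≢ ι′ u′
      inner′ u u′ w w′ g e with at u | at u′
      ... | inj₁ (refl , _) | inj₁ (refl , _) = true≢false g (G-irr u)
      ... | inj₁ (refl , a) | inj₂ (_ , b) = unused-ι u′ w′ g (trans (sym b) (trans (sym e) a))
      ... | inj₂ (_ , a) | inj₁ (refl , b) = unused-ι u w (trans (G-symm u′ u) g) (trans (sym a) (trans e b))
      ... | inj₂ (p , a) | inj₂ (q , b) = inner good u u′ (∧-join w (not-true p)) (∧-join w′ (not-true q)) g (trans (sym a) (trans e b))
      outer′ : ∀ u v v′ u′ → W u ≡ true → W u′ ≡ true → U v ≡ false → U v′ ≡ false → G u v ≡ true → G v v′ ≡ true → G u′ v′ ≡ true → c v ≡ ι′ u → c v′ ≢ ι′ u′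
      outer′ u v v′ u′ w w′ nv nv′ uv vv′ u′v′ e e′ with at u | at u′
      ... | inj₁ (refl , a) | _ = unused-c v uv (frontier-intro w w′ nv nv′ uv vv′ u′v′) (trans e a)
      ... | inj₂ _ | inj₁ (refl , b) = unused-c v′ u′v′ (frontier-intro w′ w nv′ nv u′v′ (trans (G-symm v′ v) vv′) uv) (trans e′ b)
      ... | inj₂ (p , a) | inj₂ (q , b) = outer good u v v′ u′ (∧-join w (not-true p)) (∧-join w′ (not-true q)) nv nv′ uv vv′ u′v′ (trans e a) (trans e′ b)

    -- U is recoloured by ι, the neighbours that clash with it receive the new colour.
    extend : colourable (suc t) G ≡ true
    extend with recolour n U (count≤ U) (λ _ w → w)
    ... | ι , good = colourable⇐ G col proper
      where
      R : Fin n → Bool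
      R v = some (λ u → U u ∧ (G u v ∧ (c v == ι u)))
      col : Fin n → Fin (suc t)
      col v = if U v then inject₁ (ι v) else (if R v then fromℕ t else inject₁ (c v))
      R-false : ∀ {u v} → R v ≡ false → U u ≡ true → G u v ≡ true → c v ≡ ι u → ⊥
      R-false {u} {v} r uu g e = true≢false (some-intro (λ u → U u ∧ (G u v ∧ (c v == ι u))) u (∧-join uu (∧-join g (trans (cong (_== ι u) e) (==-refl (ι u)))))) r
      proper : Proper G col
      proper i j g e with U i in ui | U j in uj
      ... | true | true = inner good i j ui uj g (inject₁-injective e)
      ... | true | false with R j in rj
      ...   | true = fromℕ≢inject₁ (sym e)
      ...   | false = R-false rj ui g (inject₁-injective (sym e))
      proper i j g e | false | true with R i in ri
      ...   | true = fromℕ≢inject₁ e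
      ...   | false = R-false ri uj (trans (G-symm j i) g) (inject₁-injective e)
      proper i j g e | false | false with R i in ri | R j in rj
      ...   | true | false = fromℕ≢inject₁ e
      ...   | false | true = fromℕ≢inject₁ (sym e)
      ...   | false | false = true≢false (covers i j g (inject₁-injective e)) ui
      ...   | true | true with some-elim _ ri | some-elim _ rj
      ...     | u , p | u′ , p′ = outer good u i j u′ (proj₁ q) (proj₁ q′) ui uj (proj₁ s) g (proj₁ s′) (==⇒≡ (proj₂ s)) (==⇒≡ (proj₂ s′))
        where
        q = ∧-split {U u} p
        q′ = ∧-split {U u′} p′
        s = ∧-split {G u i} (proj₂ q)
        s′ = ∧-split {G u′ j} (proj₂ q′)

take : ∀ {n} → ℕ → (Fin n → Bool) → Fin n → Bool
take zero p _ = false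
take (suc k) p fzero = p fzero
take (suc k) p (fsuc i) = take (if p fzero then k else suc k) (p ∘ fsuc) i

take⊆ : ∀ {n} k (p : Fin n → Bool) i → take k p i ≡ true → p i ≡ true
take⊆ (suc k) p fzero e = e
take⊆ (suc k) p (fsuc i) e = take⊆ (if p fzero then k else suc k) (p ∘ fsuc) i e

opaque
  unfolding sum
  count-take : ∀ {n} k (p : Fin n → Bool) → count (take k p) ≡ k ⊓ count p
  count-take {zero} k p = sym (⊓-zeroʳ k)
  count-take {suc n} zero p = sum-zero {suc n} {λ _ → 0} (λ _ → refl)
  count-take {suc n} (suc k) p with p fzero
  ... | true = cong suc (count-take k (p ∘ fsuc))
  ... | false = count-take (suc k) (p ∘ fsuc)

count-two : ∀ {n} (p : Fin n → Bool) i j → i ≢ j → p i ≡ true → p j ≡ true → 2 ≤ count p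
count-two p i j ne pi pj = ≤-trans (≤-reflexive (sym (cong₂ _+_ (count-== i) (count-== j)))) (≤-trans (≤-reflexive (sym (sum-+ _ _))) (sum-mono point))
  where
  point : ∀ k → ⟦ i == k ⟧ + ⟦ j == k ⟧ ≤ ⟦ p k ⟧
  point k with i ≟ k | j ≟ k
  ... | yes refl | yes e = ⊥-elim (ne (sym e))
  ... | yes refl | no _ = ≤-reflexive (sym (⟦⟧-true pi))
  ... | no _ | yes refl = ≤-reflexive (sym (⟦⟧-true pj))
  ... | no _ | no _ = z≤n

find-small : ∀ {n} (W : Fin n → Bool) (f : Fin n → ℕ) k → ¬ (∀ u → W u ≡ true → k ≤ f u) → ∃ λ u → W u ≡ true × f u < k
find-small W f k h with bool-cases (some (λ u → W u ∧ not (atLeast k (f u))))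
... | inj₁ e with some-elim _ e
...   | u , p = u , proj₁ (∧-split p) , ≰⇒> (λ q → true≢false (atLeast⇐ q) (not-false (proj₂ (∧-split {W u} p))))
find-small W f k h | inj₂ e = ⊥-elim (h (λ u w → atLeast⇒ (go u w (some-false _ e u))))
  where
  go : ∀ u → W u ≡ true → (W u ∧ not (atLeast k (f u))) ≡ false → atLeast k (f u) ≡ true
  go u w q with atLeast k (f u)
  ... | true = refl
  ... | false = ⊥-elim (true≢false (∧-join w refl) q)

module Structure {n t d : ℕ} (G : Graph n) (R : Regular d G) (c : Fin n → Fin t) (U : Fin n → Bool)
  (covers : ∀ i j → G i j ≡ true → c i ≡ c j → U i ≡ true) where

  open Extend G (symm R) (irr R) c U covers public

  inside : (Fin n → Bool) → Fin n → ℕ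
  inside K v = count (λ w → K w ∧ G v w)

  dartsIn-rows : ∀ K → dartsIn K G ≡ sum (λ v → ⟦ K v ⟧ * inside K v)
  dartsIn-rows K = trans (sum₂-rows _) (sum-cong (λ v → trans (sum-cong (λ w → trans (*-assoc ⟦ K v ⟧ _ _) (cong (⟦ K v ⟧ *_) (sym (⟦∧⟧ (K w) (G v w)))))) (sum-*ˡ ⟦ K v ⟧ _)))

  U-disjoint : ∀ {u v} → U u ≡ true → U v ≡ false → u ≢ v
  U-disjoint p q refl = true≢false p q

  -- If every vertex of W has three obstacles, then W, three obstacles of each of its vertices and the paths
  -- behind them span a subgraph with average degree more than 2.
  module Few (W : Fin n → Bool) (W⊆U : ∀ u → W u ≡ true → U u ≡ true) (three : ∀ u → W u ≡ true → 3 ≤ obstacles W u) where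

    bad : Fin n → Fin n → Bool
    bad u v = (G u v ∧ frontier W v) ∨ (W v ∧ G u v)

    chosen : Fin n → Fin n → Bool
    chosen u = take 3 (bad u)

    behind : Fin n → Fin n → Bool
    behind v v′ = hit W v′ ∧ G v v′

    X₁ X₂ K : Fin n → Bool
    X₁ v = some (λ u → W u ∧ chosen u v)
    X₂ v′ = some (λ v → (X₁ v ∧ not (U v)) ∧ take 1 (behind v) v′)
    K v = W v ∨ (X₁ v ∨ X₂ v)

    chosen-count : ∀ u → W u ≡ true → count (chosen u) ≡ 3
    chosen-count u wu = trans (count-take 3 (bad u)) (m≤n⇒m⊓n≡m (≤-trans (three u wu) (≤-trans (≤-reflexive (sym (sum-+ _ _))) (sum-mono point))))
      where
      point : ∀ v → ⟦ G u v ∧ frontier W v ⟧ + ⟦ W v ∧ G u v ⟧ ≤ ⟦ bad u v ⟧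
      point v with bool-cases (W v)
      ... | inj₁ w rewrite w | W⊆U v w with G u v
      ...   | true = ≤-refl
      ...   | false = ≤-refl
      point v | inj₂ w rewrite w with G u v ∧ frontier W v
      ...   | true = ≤-refl
      ...   | false = ≤-refl

    K-size : count K ≤ 7 * count W
    K-size = ≤-trans (count-∨ W (λ v → X₁ v ∨ X₂ v)) (≤-trans (+-monoʳ-≤ (count W) (≤-trans (count-∨ X₁ X₂) (+-mono-≤ X₁≤ X₂≤))) (≤-reflexive (lem (count W))))
      where
      lem : ∀ r → r + (r * 3 + r * 3) ≡ 7 * r
      lem = solve-∀
      scaled : ∀ (p q : Fin n → Bool) k (f : Fin n → Fin n → Bool) → (∀ u → p u ≡ true → q u ≡ true) → (∀ u → count (f u) ≤ k) →
        count (λ v → some (λ u → p u ∧ f u v)) ≤ count q * k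
      scaled p q k f pq h = ≤-trans (count-some (λ u v → p u ∧ f u v)) (≤-trans (sum-mono each) (≤-reflexive (sum-*ʳ k _)))
        where
        each : ∀ u → count (λ v → p u ∧ f u v) ≤ ⟦ q u ⟧ * k
        each u with bool-cases (p u)
        ... | inj₁ e rewrite e | pq u e = ≤-trans (h u) (≤-reflexive (sym (*-identityˡ k)))
        ... | inj₂ e rewrite e = ≤-trans (≤-reflexive (sum-zero {n} {λ _ → 0} (λ _ → refl))) z≤n
      X₁≤ : count X₁ ≤ count W * 3
      X₁≤ = scaled W W 3 chosen (λ _ e → e) (λ u → ≤-trans (≤-reflexive (count-take 3 (bad u))) (m⊓n≤m 3 _))
      X₂≤ : count X₂ ≤ count W * 3
      X₂≤ = ≤-trans (scaled (λ v → X₁ v ∧ not (U v)) X₁ 1 (λ v → take 1 (behind v)) (λ _ e → proj₁ (∧-split e)) (λ v → ≤-trans (≤-reflexive (count-take 1 (behind v))) (m⊓n≤m 1 _)))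
        (≤-trans (≤-reflexive (*-identityʳ _)) X₁≤)

    in-W : ∀ {v} → W v ≡ true → K v ≡ true
    in-W w = ∨-true (inj₁ w)
    in-X₁ : ∀ {v} → X₁ v ≡ true → K v ≡ true
    in-X₁ {v} x = ∨-true {W v} (inj₂ (∨-true (inj₁ x)))
    in-X₂ : ∀ {v} → X₂ v ≡ true → K v ≡ true
    in-X₂ {v} x = ∨-true {W v} (inj₂ (∨-true {X₁ v} (inj₂ x)))

    two-neighbours : ∀ {v p q} → p ≢ q → K p ≡ true → K q ≡ true → G v p ≡ true → G v q ≡ true → 2 ≤ inside K v
    two-neighbours {v} {p} {q} ne kp kq gp gq = count-two (λ w → K w ∧ G v w) p q ne (∧-join kp gp) (∧-join kq gq)

    -- Inside `K` a vertex of `W` sees its three chosen obstacles, a vertex of `X₁` outside `W` sees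
    -- its origin in `W` and the vertex selected behind it, and a vertex of `X₂` sees a vertex of
    -- `W` and one of `X₁`.
    degree≥ : ∀ v → 2 * ⟦ K v ⟧ + ⟦ W v ⟧ ≤ ⟦ K v ⟧ * inside K v
    degree≥ v with bool-cases (W v)
    ... | inj₁ w rewrite w = ≤-trans (≤-reflexive (sym (chosen-count v w))) (≤-trans (count-mono (λ x e → ∧-join (in-X₁ (some-intro (λ u → W u ∧ chosen u x) v (∧-join w e))) (adjacent x e))) (≤-reflexive (sym (*-identityˡ _))))
      where
      adjacent : ∀ x → chosen v x ≡ true → G v x ≡ true
      adjacent x e with ∨-split {G v x ∧ frontier W x} (take⊆ 3 (bad v) x e)
      ... | inj₁ q = proj₁ (∧-split q)
      ... | inj₂ q = proj₂ (∧-split {W x} q)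
    ... | inj₂ nw with bool-cases (X₁ v) | bool-cases (X₂ v)
    ...   | inj₁ x | _ = ≤-trans (≤-reflexive (cong₂ (λ p q → 2 * ⟦ p ⟧ + ⟦ q ⟧) (in-X₁ x) nw)) (≤-trans two (≤-reflexive (sym (trans (cong (λ p → ⟦ p ⟧ * inside K v) (in-X₁ x)) (*-identityˡ _)))))
      where
      two : 2 ≤ inside K v
      two with some-elim _ x
      ... | u , e with ∧-split {W u} e
      ...   | wu , ch with ∨-split {G u v ∧ frontier W v} (take⊆ 3 (bad u) v ch)
      ...     | inj₂ q = ⊥-elim (true≢false (proj₁ (∧-split q)) nw)
      ...     | inj₁ q with ∧-split {G u v} q
      ...       | guv , fv with ∧-split {hit W v} fv
      ...         | hv , sv with some-elim _ sv
      ...           | v′ , bv = two-neighbours (U-disjoint (W⊆U u wu) (not-false (proj₁ (∧-split (proj₁ (∧-split bw))))))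
                        (in-W wu) (in-X₂ (some-intro (λ v → (X₁ v ∧ not (U v)) ∧ take 1 (behind v) w) v (∧-join (∧-join x (proj₁ (∧-split hv))) tw)))
                        (trans (symm R v u) guv) (proj₂ (∧-split {hit W w} bw))
        where
        -- The frontier provides some vertex v′ behind v, but `K` contains only the one selected by
        -- `take 1`; v′ merely shows that the selection is not empty.
        found : ∃ λ w → 0 < ⟦ take 1 (behind v) w ⟧
        found = sum-pos _ (subst (0 <_) (sym (count-take 1 (behind v))) (⊓-pres-m< (s≤s z≤n) (≤-trans (≤-reflexive (sym (⟦⟧-true bv))) (sum-term (λ i → ⟦ behind v i ⟧) v′))))
        w : Fin n
        w = proj₁ found
        tw : take 1 (behind v) w ≡ true
        tw = ⟦⟧-pos (proj₂ found)
        bw : behind v w ≡ true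
        bw = take⊆ 1 (behind v) w tw
    ...   | inj₂ nx | inj₁ x = ≤-trans (≤-reflexive (cong₂ (λ p q → 2 * ⟦ p ⟧ + ⟦ q ⟧) (in-X₂ x) nw)) (≤-trans two (≤-reflexive (sym (trans (cong (λ p → ⟦ p ⟧ * inside K v) (in-X₂ x)) (*-identityˡ _)))))
      where
      two : 2 ≤ inside K v
      two with some-elim _ x
      ... | v₀ , e with ∧-split {X₁ v₀ ∧ not (U v₀)} e
      ...   | e₁ , tk with ∧-split {X₁ v₀} e₁ | ∧-split {hit W v} (take⊆ 1 (behind v₀) v tk)
      ...     | x₀ , nu₀ | hv , g with some-elim _ (proj₂ (∧-split {not (U v)} hv))
      ...       | u , q with ∧-split {W u} q
      ...         | wu , guv = two-neighbours (U-disjoint (W⊆U u wu) (not-false nu₀)) (in-W wu) (in-X₁ x₀) (trans (symm R v u) guv) (trans (symm R v v₀) g)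
    degree≥ v | inj₂ nw | inj₂ nx | inj₂ nx′ rewrite nw | nx | nx′ = z≤n

    -- Three neighbours at vertices of `W` and two elsewhere give 2|K| + |W| darts, and |W| is at
    -- least |K| / 7.
    dense : 15 * count K ≤ 7 * dartsIn K G
    dense = ≤-trans (≤-reflexive (lem₁ (count K))) (≤-trans (+-monoʳ-≤ (14 * count K) K-size) (≤-trans (≤-reflexive (lem₂ (count K) (count W))) (*-monoʳ-≤ 7 total)))
      where
      lem₁ : ∀ k → 15 * k ≡ 14 * k + k
      lem₁ = solve-∀
      lem₂ : ∀ k w → 14 * k + 7 * w ≡ 7 * (2 * k + w)
      lem₂ = solve-∀
      total : 2 * count K + count W ≤ dartsIn K G
      total = ≤-trans (≤-reflexive (trans (cong (_+ count W) (sym (sum-*ˡ 2 _))) (sym (sum-+ _ _)))) (≤-trans (sum-mono degree≥) (≤-reflexive (sym (dartsIn-rows K))))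

    nonempty : 0 < count W → 0 < count K
    nonempty p = ≤-trans p (count-mono (λ _ w → in-W w))

  outerBoundary : (Fin n → Bool) → Fin n → Bool
  outerBoundary W v = not (W v) ∧ some (λ u → W u ∧ G u v)

  -- With many colours it suffices to bound the average number of obstacles over `W`, since some
  -- vertex does not exceed the average.
  module Many (W : Fin n → Bool) (W⊆U : ∀ u → W u ≡ true → U u ≡ true) where

    back : Fin n → ℕ
    back v = count (λ u → W u ∧ G u v)

    frontier⊆ : ∀ v → frontier W v ≡ true → outerBoundary W v ≡ true
    frontier⊆ v f = ∧-join (lem (proj₁ h)) (proj₂ h)
      where
      h = ∧-split {not (U v)} (proj₁ (∧-split {hit W v} f))
      lem : not (U v) ≡ true → not (W v) ≡ true
      lem e with W v in w
      ... | false = refl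
      ... | true = ⊥-elim (true≢false (W⊆U v w) (not-false e))

    -- The hit neighbour that puts a vertex into the frontier lies in the frontier itself, so each
    -- frontier vertex has a dart inside the outer boundary.
    frontier≤ : count (frontier W) ≤ dartsIn (outerBoundary W) G
    frontier≤ = ≤-trans (sum-mono point) (≤-reflexive (sym (dartsIn-rows (outerBoundary W))))
      where
      point : ∀ v → ⟦ frontier W v ⟧ ≤ ⟦ outerBoundary W v ⟧ * inside (outerBoundary W) v
      point v with bool-cases (frontier W v)
      ... | inj₂ e rewrite e = z≤n
      ... | inj₁ e with some-elim _ (proj₂ (∧-split {hit W v} e))
      ...   | v′ , q = ≤-trans (⟦⟧≤1 (frontier W v)) (≤-trans (≤-trans (≤-reflexive (sym (⟦⟧-true adj))) (sum-term (λ w → ⟦ outerBoundary W w ∧ G v w ⟧) v′))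
              (≤-reflexive (sym (trans (cong (λ p → ⟦ p ⟧ * inside (outerBoundary W) v) (frontier⊆ v e)) (*-identityˡ _)))))
        where
        q′ = ∧-split {hit W v′} q
        f′ : frontier W v′ ≡ true
        f′ = ∧-join (proj₁ q′) (some-intro (λ w → hit W w ∧ G v′ w) v (∧-join (proj₁ (∧-split {hit W v} e)) (trans (symm R v′ v) (proj₂ q′))))
        adj : outerBoundary W v′ ∧ G v v′ ≡ true
        adj = ∧-join (frontier⊆ v′ f′) (proj₂ q′)

    union-darts : ∀ (Y : Fin n → Bool) → (∀ v → Y v ≡ true → W v ≡ false) → 2 * sum (λ v → ⟦ Y v ⟧ * back v) ≤ dartsIn (λ v → W v ∨ Y v) G
    union-darts Y disj = ≤-trans (≤-reflexive (trans (cong (sum (λ v → ⟦ Y v ⟧ * back v) +_) (+-identityʳ _)) (sym (cong₂ _+_ one (trans (sum₂-swap _) (trans (sum₂-cong (λ j i → cong (λ g → ⟦ W i ⟧ * ⟦ Y j ⟧ * ⟦ g ⟧) (symm R i j))) (trans (sum₂-cong (λ j i → cong (_* ⟦ G j i ⟧) (*-comm ⟦ W i ⟧ ⟦ Y j ⟧))) one)))))))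
        (≤-trans (≤-reflexive (sym (sum₂-+ _ _))) (sum₂-mono (λ i j → point i j)))
      where
      one : sum₂ (λ i j → ⟦ Y i ⟧ * ⟦ W j ⟧ * ⟦ G i j ⟧) ≡ sum (λ v → ⟦ Y v ⟧ * back v)
      one = trans (sum₂-rows _) (sum-cong (λ i → trans (sum-cong (λ j → trans (*-assoc ⟦ Y i ⟧ _ _) (cong (⟦ Y i ⟧ *_) (trans (sym (⟦∧⟧ (W j) (G i j))) (cong (λ g → ⟦ W j ∧ g ⟧) (symm R i j)))))) (sum-*ˡ ⟦ Y i ⟧ _)))
      point : ∀ i j → ⟦ Y i ⟧ * ⟦ W j ⟧ * ⟦ G i j ⟧ + ⟦ W i ⟧ * ⟦ Y j ⟧ * ⟦ G i j ⟧ ≤ ⟦ W i ∨ Y i ⟧ * ⟦ W j ∨ Y j ⟧ * ⟦ G i j ⟧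
      point i j with W i in wi | Y i in yi | W j in wj | Y j in yj | G i j
      ... | true | true | _ | _ | _ = ⊥-elim (true≢false wi (disj i yi))
      ... | _ | _ | true | true | _ = ⊥-elim (true≢false wj (disj j yj))
      ... | true | false | true | false | g = z≤n
      ... | true | false | false | true | g = ≤-refl
      ... | true | false | false | false | g = z≤n
      ... | false | true | true | false | g = ≤-reflexive (+-identityʳ _)
      ... | false | true | false | true | g = z≤n
      ... | false | true | false | false | g = z≤n
      ... | false | false | _ | _ | g = z≤n

    module _ (0<r : 0 < count W) (48≤t : 48 ≤ t)
      (sparse : ∀ A → 0 < count A → count A ≤ 2 * count W → dartsIn A G < 12 * count A)
      (few : 24 * dartsIn (outerBoundary W) G < t * count W) where

      private
        r : ℕ
        r = count W

        high : Fin n → Bool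
        high v = frontier W v ∧ atLeast 12 (back v)

        frontier-outside : ∀ v → frontier W v ≡ true → W v ≡ false
        frontier-outside v e = not-false (proj₁ (∧-split (frontier⊆ v e)))

        -- Otherwise r such vertices, each with twelve neighbours in `W`, would together with `W`
        -- form a set of at most 2r vertices with 24r darts.
        high-few : count high ≤ r
        high-few with count high ≤? r
        ... | yes p = p
        ... | no ¬p = ⊥-elim (<⇒≱ (sparse A (≤-trans 0<r (count-mono (λ _ w → ∨-true (inj₁ w)))) A≤) (begin
          12 * count A ≤⟨ *-monoʳ-≤ 12 A≤ ⟩
          12 * (2 * r) ≡⟨ lem r ⟩
          2 * (r * 12) ≡⟨ cong (λ z → 2 * (z * 12)) (sym Y-size) ⟩
          2 * (count Y * 12) ≡⟨ cong (2 *_) (sum-*ʳ 12 _) ⟨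
          2 * sum (λ v → ⟦ Y v ⟧ * 12) ≤⟨ *-monoʳ-≤ 2 (sum-mono (λ v → ⟦⟧*-mono (Y v) (λ y → atLeast⇒ (proj₂ (∧-split {frontier W v} (take⊆ r high v y)))))) ⟩
          2 * sum (λ v → ⟦ Y v ⟧ * back v) ≤⟨ union-darts Y (λ v y → frontier-outside v (proj₁ (∧-split (take⊆ r high v y)))) ⟩
          dartsIn A G ∎))
          where
          open ≤-Reasoning
          Y A : Fin n → Bool
          Y = take r high
          A v = W v ∨ Y v
          Y-size : count Y ≡ r
          Y-size = trans (count-take r high) (m≤n⇒m⊓n≡m (<⇒≤ (≰⇒> ¬p)))
          A≤ : count A ≤ 2 * r
          A≤ = ≤-trans (count-∨ W Y) (≤-reflexive (trans (cong (r +_) Y-size) (cong (r +_) (sym (+-identityʳ r)))))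
          lem : ∀ r → 12 * (2 * r) ≡ 2 * (r * 12)
          lem = solve-∀

        high-sum : sum (λ v → ⟦ high v ⟧ * back v) ≤ 12 * r
        high-sum = *-cancelˡ-≤ 2 (begin
          2 * sum (λ v → ⟦ high v ⟧ * back v) ≤⟨ union-darts high (λ v e → frontier-outside v (proj₁ (∧-split e))) ⟩
          dartsIn A G ≤⟨ <⇒≤ (sparse A (≤-trans 0<r (count-mono (λ _ w → ∨-true (inj₁ w)))) A≤) ⟩
          12 * count A ≤⟨ *-monoʳ-≤ 12 A≤ ⟩
          12 * (2 * r) ≡⟨ lem r ⟩
          2 * (12 * r) ∎)
          where
          open ≤-Reasoning
          A : Fin n → Bool
          A v = W v ∨ high v
          A≤ : count A ≤ 2 * r
          A≤ = ≤-trans (count-∨ W high) (≤-trans (+-monoʳ-≤ r high-few) (≤-reflexive (cong (r +_) (sym (+-identityʳ r)))))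
          lem : ∀ r → 12 * (2 * r) ≡ 2 * (12 * r)
          lem = solve-∀

        -- Edges between `W` and the frontier are counted from the frontier: a vertex with fewer
        -- than twelve neighbours in `W` is charged 12, and the others are few and covered by
        -- `high-sum`.
        obstacle-sum : sum (λ u → ⟦ W u ⟧ * obstacles W u) ≤ 24 * r + 12 * dartsIn (outerBoundary W) G
        obstacle-sum = begin
          sum (λ u → ⟦ W u ⟧ * obstacles W u) ≡⟨ trans (sum-cong (λ u → *-distribˡ-+ ⟦ W u ⟧ _ _)) (sum-+ _ _) ⟩
          sum (λ u → ⟦ W u ⟧ * count (λ v → G u v ∧ frontier W v)) + sum (λ u → ⟦ W u ⟧ * inside W u)
            ≡⟨ cong₂ _+_ exchange (sym (dartsIn-rows W)) ⟩
          sum (λ v → ⟦ frontier W v ⟧ * back v) + dartsIn W G ≤⟨ +-mono-≤ (sum-mono cases) (<⇒≤ (sparse W 0<r (m≤m+n r _))) ⟩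
          sum (λ v → ⟦ high v ⟧ * back v + 12 * ⟦ frontier W v ⟧) + 12 * r ≡⟨ cong (_+ 12 * r) (trans (sum-+ _ _) (cong (sum (λ v → ⟦ high v ⟧ * back v) +_) (sum-*ˡ 12 _))) ⟩
          sum (λ v → ⟦ high v ⟧ * back v) + 12 * count (frontier W) + 12 * r ≤⟨ +-monoˡ-≤ (12 * r) (+-mono-≤ high-sum (*-monoʳ-≤ 12 frontier≤)) ⟩
          12 * r + 12 * dartsIn (outerBoundary W) G + 12 * r ≡⟨ lem r (dartsIn (outerBoundary W) G) ⟩
          24 * r + 12 * dartsIn (outerBoundary W) G ∎
          where
          open ≤-Reasoning
          lem : ∀ r b → 12 * r + 12 * b + 12 * r ≡ 24 * r + 12 * b
          lem = solve-∀
          exchange : sum (λ u → ⟦ W u ⟧ * count (λ v → G u v ∧ frontier W v)) ≡ sum (λ v → ⟦ frontier W v ⟧ * back v)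
          exchange = trans (sum-cong (λ u → sym (sum-*ˡ ⟦ W u ⟧ _))) (trans (sum-comm (λ u v → ⟦ W u ⟧ * ⟦ G u v ∧ frontier W v ⟧)) (sum-cong (λ v → trans (sum-cong (λ u → point u v)) (sum-*ˡ ⟦ frontier W v ⟧ _))))
            where
            point : ∀ u v → ⟦ W u ⟧ * ⟦ G u v ∧ frontier W v ⟧ ≡ ⟦ frontier W v ⟧ * ⟦ W u ∧ G u v ⟧
            point u v rewrite ⟦∧⟧ (G u v) (frontier W v) | ⟦∧⟧ (W u) (G u v) = lem′ ⟦ W u ⟧ ⟦ G u v ⟧ ⟦ frontier W v ⟧
              where
              lem′ : ∀ a b c → a * (b * c) ≡ c * (a * b)
              lem′ = solve-∀
          cases : ∀ v → ⟦ frontier W v ⟧ * back v ≤ ⟦ high v ⟧ * back v + 12 * ⟦ frontier W v ⟧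
          cases v with frontier W v
          ... | false = z≤n
          ... | true with 12 ≤? back v
          ...   | yes _ = m≤m+n _ _
          ...   | no ¬p = ≤-trans (≤-reflexive (*-identityˡ _)) (<⇒≤ (≰⇒> ¬p))

      many-free : ∃ λ u → W u ≡ true × obstacles W u < t
      many-free = find-small W (obstacles W) t (λ all → <⇒≱ few (+-cancelˡ-≤ (t * r) (t * r) (24 * B) (begin
        t * r + t * r ≡⟨ lem (t * r) ⟩
        2 * (t * r) ≤⟨ *-monoʳ-≤ 2 (≤-trans (≤-reflexive (trans (*-comm t r) (sym (sum-*ʳ t _)))) (≤-trans (sum-mono (λ u → ⟦⟧*-mono (W u) (all u))) obstacle-sum)) ⟩
        2 * (24 * r + 12 * B) ≡⟨ lem′ r B ⟩
        48 * r + 24 * B ≤⟨ +-monoˡ-≤ (24 * B) (*-monoˡ-≤ r 48≤t) ⟩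
        t * r + 24 * B ∎)))
        where
        open ≤-Reasoning
        B : ℕ
        B = dartsIn (outerBoundary W) G
        lem : ∀ a → a + a ≡ 2 * a
        lem = solve-∀
        lem′ : ∀ r b → 2 * (24 * r + 12 * b) ≡ 48 * r + 24 * b
        lem′ = solve-∀

-- Small dense sets are rare

-- The bound (1 + 1/m)^j ≤ m / (m - j) with denominators cleared.
^-bernoulli : ∀ m j → j ≤ m → suc m ^ j * (m ∸ j) ≤ m ^ j * m
^-bernoulli m zero h = ≤-refl
^-bernoulli m (suc j) h = begin
  suc m * suc m ^ j * (m ∸ suc j) ≡⟨ lem (suc m) (suc m ^ j) (m ∸ suc j) ⟩
  suc m ^ j * (suc m * (m ∸ suc j)) ≤⟨ *-monoʳ-≤ (suc m ^ j) step ⟩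
  suc m ^ j * (m * (m ∸ j)) ≡⟨ lem′ (suc m ^ j) m (m ∸ j) ⟩
  m * (suc m ^ j * (m ∸ j)) ≤⟨ *-monoʳ-≤ m (^-bernoulli m j (≤-trans (n≤1+n j) h)) ⟩
  m * (m ^ j * m) ≡⟨ *-assoc m (m ^ j) m ⟨
  m * m ^ j * m ∎
  where
  open ≤-Reasoning
  lem : ∀ a b c → a * b * c ≡ b * (a * c)
  lem = solve-∀
  lem′ : ∀ a b c → a * (b * c) ≡ b * (a * c)
  lem′ = solve-∀
  lem″ : ∀ m → m + m * 1 ≡ 2 * m
  lem″ = solve-∀
  step : suc m * (m ∸ suc j) ≤ m * (m ∸ j)
  step = ≤-trans (+-monoˡ-≤ (m * (m ∸ suc j)) (m∸n≤m m (suc j))) (≤-reflexive (trans (sym (*-suc m (m ∸ suc j))) (cong (m *_) (sym (+-∸-assoc 1 h)))))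

^-suc-half : ∀ m j → 2 ≤ m → j ≤ ⌈ m /2⌉ → suc m ^ j ≤ 3 * m ^ j
^-suc-half m j 2≤m h = *-cancelʳ-≤ (suc m ^ j) (3 * m ^ j) m {{>-nonZero (≤-trans (s≤s z≤n) 2≤m)}} (begin
  suc m ^ j * m ≤⟨ *-monoʳ-≤ (suc m ^ j) third ⟩
  suc m ^ j * (3 * (m ∸ j)) ≡⟨ lem (suc m ^ j) (m ∸ j) ⟩
  3 * (suc m ^ j * (m ∸ j)) ≤⟨ *-monoʳ-≤ 3 (^-bernoulli m j (≤-trans h (⌈n/2⌉≤n m))) ⟩
  3 * (m ^ j * m) ≡⟨ *-assoc 3 (m ^ j) m ⟨
  3 * m ^ j * m ∎)
  where
  open ≤-Reasoning
  lem : ∀ a b → a * (3 * b) ≡ 3 * (a * b)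
  lem = solve-∀
  halves : ∀ m → 2 ≤ m → ⌈ m /2⌉ ≤ 2 * ⌊ m /2⌋
  halves (suc (suc zero)) _ = s≤s z≤n
  halves (suc (suc (suc zero))) _ = ≤-refl
  halves (suc (suc m@(suc (suc _)))) _ = ≤-trans (s≤s (halves m (s≤s (s≤s z≤n)))) (≤-trans (n≤1+n _) (≤-reflexive (sym (*-suc 2 ⌊ m /2⌋))))
  halves (suc zero) (s≤s ())
  third : m ≤ 3 * (m ∸ j)
  third = begin
    m ≡⟨ trans (⌊n/2⌋+⌈n/2⌉≡n m) refl ⟨
    ⌊ m /2⌋ + ⌈ m /2⌉ ≤⟨ +-monoʳ-≤ ⌊ m /2⌋ (halves m 2≤m) ⟩
    3 * ⌊ m /2⌋ ≤⟨ *-monoʳ-≤ 3 (≤-trans (≤-reflexive (trans (sym (m+n∸n≡m ⌊ m /2⌋ ⌈ m /2⌉)) (cong (_∸ ⌈ m /2⌉) (⌊n/2⌋+⌈n/2⌉≡n m)))) (∸-monoʳ-≤ m h)) ⟩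
    3 * (m ∸ j) ∎

-- A weak Stirling bound, with 9 in place of e: (1 + 1/m)^m is split into two powers with exponents
-- about m/2, each at most 3.
^≤factorial : ∀ m → m ^ m ≤ 9 ^ m * m !
^≤factorial zero = ≤-refl
^≤factorial (suc m) = begin
  suc m * suc m ^ m ≤⟨ *-monoʳ-≤ (suc m) (≤-trans (ratio m) (*-monoʳ-≤ 9 (^≤factorial m))) ⟩
  suc m * (9 * (9 ^ m * m !)) ≡⟨ lem (suc m) (9 ^ m) (m !) ⟩
  9 ^ suc m * suc m ! ∎
  where
  open ≤-Reasoning
  lem : ∀ s p f → s * (9 * (p * f)) ≡ 9 * p * (s * f)
  lem = solve-∀
  ratio : ∀ m → suc m ^ m ≤ 9 * m ^ m
  ratio zero = s≤s z≤n
  ratio (suc zero) = s≤s (s≤s z≤n)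
  ratio m@(suc (suc _)) = begin
    suc m ^ m ≡⟨ cong (suc m ^_) (⌊n/2⌋+⌈n/2⌉≡n m) ⟨
    suc m ^ (⌊ m /2⌋ + ⌈ m /2⌉) ≡⟨ ^-distribˡ-+-* (suc m) ⌊ m /2⌋ ⌈ m /2⌉ ⟩
    suc m ^ ⌊ m /2⌋ * suc m ^ ⌈ m /2⌉ ≤⟨ *-mono-≤ (^-suc-half m ⌊ m /2⌋ (s≤s (s≤s z≤n)) (⌊n/2⌋≤⌈n/2⌉ m)) (^-suc-half m ⌈ m /2⌉ (s≤s (s≤s z≤n)) ≤-refl) ⟩
    3 * m ^ ⌊ m /2⌋ * (3 * m ^ ⌈ m /2⌉) ≡⟨ lem′ (m ^ ⌊ m /2⌋) (m ^ ⌈ m /2⌉) ⟩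
    9 * (m ^ ⌊ m /2⌋ * m ^ ⌈ m /2⌉) ≡⟨ cong (9 *_) (trans (sym (^-distribˡ-+-* m ⌊ m /2⌋ ⌈ m /2⌉)) (cong (m ^_) (⌊n/2⌋+⌈n/2⌉≡n m))) ⟩
    9 * m ^ m ∎
    where
    lem′ : ∀ p q → 3 * p * (3 * q) ≡ 9 * (p * q)
    lem′ = solve-∀

sets : (n : ℕ) → List (Fin n → Bool)
sets n = funs (true ∷ false ∷ []) n

set-index : ∀ {n} (A : Fin n → Bool) → ∃ λ k → lookup (sets n) k ≗ A
set-index = Rows.funs-index _ (λ { true → here refl ; false → there (here refl) })

count-cong : ∀ {n} {p q : Fin n → Bool} → p ≗ q → count p ≡ count q
count-cong h = sum-cong (λ i → cong ⟦_⟧ (h i))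

opaque
  unfolding sum
  count-◂ : ∀ {n} b (f : Fin n → Bool) → count (b ◂ f) ≡ ⟦ b ⟧ + count f
  count-◂ b f = refl

  sum-two : ∀ (ψ : Bool → ℕ) → sumₗ (true ∷ false ∷ []) ψ ≡ ψ true + ψ false
  sum-two ψ = cong (ψ true +_) (+-identityʳ _)

  sets-zero : ∀ (ψ : (Fin 0 → Bool) → ℕ) {c} → (∀ f → ψ f ≤ c) → sumₗ (sets 0) ψ ≤ c
  sets-zero ψ h = ≤-trans (≤-reflexive (+-identityʳ _)) (h _)

sets-suc : ∀ {n} (φ : (Fin (suc n) → Bool) → ℕ) → Rows.Resp φ → sumₗ (sets (suc n)) φ ≡ sumₗ (sets n) (λ f → φ (true ◂ f)) + sumₗ (sets n) (λ f → φ (false ◂ f))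
sets-suc {n} φ e = trans (Rows.sumₗ-funs _ φ e) (sum-two (λ b → sumₗ (sets n) (λ f → φ (b ◂ f))))

sizeCount : ℕ → ℕ → ℕ
sizeCount n r = sumₗ (sets n) (λ A → ⟦ count A ≡ᵇ r ⟧)

size-suc : ∀ n r → sizeCount (suc n) r ≡ sumₗ (sets n) (λ A → ⟦ suc (count A) ≡ᵇ r ⟧) + sizeCount n r
size-suc n r = trans (sets-suc (λ A → ⟦ count A ≡ᵇ r ⟧) (λ f g e → cong (λ k → ⟦ k ≡ᵇ r ⟧) (count-cong e)))
  (cong₂ _+_ (sum-cong (λ k → cong (λ c → ⟦ c ≡ᵇ r ⟧) (count-◂ true (lookup (sets n) k)))) (sum-cong (λ k → cong (λ c → ⟦ c ≡ᵇ r ⟧) (count-◂ false (lookup (sets n) k)))))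

^-suc≥ : ∀ n r → suc r * n ^ r + n ^ suc r ≤ suc n ^ suc r
^-suc≥ n zero = ≤-reflexive (lem n)
  where
  lem : ∀ n → 1 * 1 + n * 1 ≡ (1 + n) * 1
  lem = solve-∀
^-suc≥ n (suc r) = begin
  suc (suc r) * (n * n ^ r) + n * (n * n ^ r) ≡⟨ lem n r (n ^ r) ⟩
  n * n ^ r + n * (suc r * n ^ r + n * n ^ r) ≤⟨ +-mono-≤ (≤-trans (m≤n+m (n ^ suc r) (suc r * n ^ r)) (^-suc≥ n r)) (*-monoʳ-≤ n (^-suc≥ n r)) ⟩
  suc n ^ suc r + n * suc n ^ suc r ∎
  where
  open ≤-Reasoning
  lem : ∀ n r p → (2 + r) * (n * p) + n * (n * p) ≡ n * p + n * ((1 + r) * p + n * p)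
  lem = solve-∀

size-bound : ∀ n r → sizeCount n r * r ! ≤ n ^ r
size-bound zero zero = ≤-trans (≤-reflexive (*-identityʳ _)) (sets-zero (λ A → ⟦ count A ≡ᵇ 0 ⟧) (λ f → ⟦⟧≤1 (count f ≡ᵇ 0)))
size-bound zero (suc r) = ≤-trans (≤-reflexive (cong (_* suc r !) (n≤0⇒n≡0 (sets-zero (λ A → ⟦ count A ≡ᵇ suc r ⟧) {0} (λ f → ≤-reflexive (cong (λ k → ⟦ k ≡ᵇ suc r ⟧) (n≤0⇒n≡0 (count≤ f)))))))) z≤n
size-bound (suc n) zero = ≤-trans (≤-reflexive (trans (*-identityʳ _) (trans (size-suc n 0) (cong (_+ sizeCount n 0) (sum-zero {f = λ k → ⟦ suc (count (lookup (sets n) k)) ≡ᵇ 0 ⟧} (λ _ → refl)))))) (≤-trans (≤-reflexive (sym (*-identityʳ _))) (size-bound n zero))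
size-bound (suc n) (suc r) = begin
  sizeCount (suc n) (suc r) * suc r ! ≡⟨ cong (_* suc r !) (size-suc n (suc r)) ⟩
  (sizeCount n r + sizeCount n (suc r)) * suc r ! ≡⟨ lem (sizeCount n r) (sizeCount n (suc r)) (suc r) (r !) ⟩
  suc r * (sizeCount n r * r !) + sizeCount n (suc r) * suc r ! ≤⟨ +-mono-≤ (*-monoʳ-≤ (suc r) (size-bound n r)) (size-bound n (suc r)) ⟩
  suc r * n ^ r + n ^ suc r ≤⟨ ^-suc≥ n r ⟩
  suc n ^ suc r ∎
  where
  open ≤-Reasoning
  lem : ∀ a b s f → (a + b) * (s * f) ≡ s * (a * f) + b * (s * f)
  lem = solve-∀

-- A union bound over nonempty sets of at most κ vertices. There are at most n^r / r! sets of size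
-- r, so a probability of at most r! / (nQ)^r for each leaves Q^(-r) in total.
module Exceptional {n : ℕ} (d : ℕ) (P : (Fin n → Bool) → Graph n → Bool) (P-ext : ∀ {A B} G → A ≗ B → P A G ≡ P B G) where

  exceptional : ℕ → Graph n → Bool
  exceptional κ G = any (λ A → atLeast 1 (count A) ∧ (atLeast (count A) κ ∧ P A G)) (sets n)

  unexceptional : ∀ κ G → exceptional κ G ≡ false → ∀ A → 0 < count A → count A ≤ κ → P A G ≡ false
  unexceptional κ G e A p q with bool-cases (P A G)
  ... | inj₂ r = r
  ... | inj₁ r with set-index A
  ...   | k , eq = ⊥-elim (true≢false (any-intro _ (sets n) k (∧-join (atLeast⇐ (≤-trans p (≤-reflexive (sym (count-cong eq))))) (∧-join (atLeast⇐ (≤-trans (≤-reflexive (count-cong eq)) q)) (trans (P-ext G eq) r)))) e)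

  ofSize : ℕ → ℕ
  ofSize r = sumₗ (sets n) (λ A → ⟦ count A ≡ᵇ r ⟧ * sumR d (λ G → ⟦ P A G ⟧))

  ofSizes : ℕ → ℕ
  ofSizes zero = 0
  ofSizes (suc κ) = ofSizes κ + ofSize (suc κ)

  exceptional≤ : ∀ κ → sumR d (λ G → ⟦ exceptional κ G ⟧) ≤ ofSizes κ
  exceptional≤ κ = ≤-trans (sumR-mono d (λ G _ → ≤-trans (point G) (≤-reflexive refl))) (≤-trans (≤-reflexive (sumR-sum d _)) (≤-trans (sum-mono (λ k → each κ (lookup (sets n) k))) (≤-reflexive (collect κ))))
    where
    point : ∀ G → ⟦ exceptional κ G ⟧ ≤ sumₗ (sets n) (λ A → ⟦ atLeast 1 (count A) ∧ (atLeast (count A) κ ∧ P A G) ⟧)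
    point G = any≤ (sets n)
      where
      any≤ : ∀ {p : (Fin n → Bool) → Bool} xs → ⟦ any p xs ⟧ ≤ sumₗ xs (λ x → ⟦ p x ⟧)
      any≤ {p} xs with any p xs in e
      ... | false = z≤n
      ... | true = go xs e
        where
        opaque
          unfolding sum
          go : ∀ xs → any p xs ≡ true → 1 ≤ sumₗ xs (λ x → ⟦ p x ⟧)
          go (x ∷ xs) e with p x
          ... | true = s≤s z≤n
          ... | false = go xs e
    sizes : ℕ → (Fin n → Bool) → ℕ
    sizes zero A = 0
    sizes (suc κ) A = sizes κ A + ⟦ count A ≡ᵇ suc κ ⟧ * sumR d (λ G → ⟦ P A G ⟧)
    collect : ∀ κ → sumₗ (sets n) (sizes κ) ≡ ofSizes κ
    collect zero = sum-zero (λ _ → refl)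
    collect (suc κ) = trans (sum-+ _ _) (cong (_+ ofSize (suc κ)) (collect κ))
    each : ∀ κ A → sumR d (λ G → ⟦ atLeast 1 (count A) ∧ (atLeast (count A) κ ∧ P A G) ⟧) ≤ sizes κ A
    each zero A = ≤-trans (sumR-mono d (λ G _ → none)) (≤-trans (≤-reflexive (sumR-*ˡ d 0 (λ _ → 0))) z≤n)
      where
      none : ∀ {q} → ⟦ atLeast 1 (count A) ∧ (atLeast (count A) 0 ∧ q) ⟧ ≤ 0
      none {q} with 1 ≤? count A | count A ≤? 0
      ... | yes p | yes p′ = ⊥-elim (<⇒≱ p p′)
      ... | yes p | no _ = z≤n
      ... | no _ | _ = z≤n
    each (suc κ) A with count A ≡ᵇ suc κ in e
    ... | true = ≤-trans (sumR-mono d (λ G _ → ⟦⟧-mono (λ q → proj₂ (∧-split {atLeast (count A) (suc κ)} (proj₂ (∧-split {atLeast 1 (count A)} q)))))) (≤-trans (≤-reflexive (sym (*-identityˡ _))) (m≤n+m _ (sizes κ A)))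
    ... | false = ≤-trans (sumR-mono d (λ G _ → ⟦⟧-mono (λ q → let s = ∧-split {atLeast 1 (count A)} q ; s′ = ∧-split {atLeast (count A) (suc κ)} (proj₂ s) in
          ∧-join (proj₁ s) (∧-join (atLeast⇐ (≤-pred (≤∧≢⇒< (atLeast⇒ (proj₁ s′)) (λ c → true≢false (trans (cong (_≡ᵇ suc κ) c) (≡ᵇ-refl (suc κ))) e)))) (proj₂ s′))))) (≤-trans (each κ A) (m≤m+n (sizes κ A) 0))

  module _ (Q κ : ℕ) {{n≢0 : NonZero n}} (2≤Q : 2 ≤ Q)
    (rare : ∀ A → 0 < count A → count A ≤ κ → sumR d (λ G → ⟦ P A G ⟧) * (n ^ count A * Q ^ count A) ≤ sumR {n} d (λ _ → 1) * count A !) where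

    private
      N : ℕ
      N = sumR {n} d (λ _ → 1)

    size-rare : ∀ r → 0 < r → r ≤ κ → ofSize r * Q ^ r ≤ N
    size-rare r 0<r r≤κ = *-cancelʳ-≤ (ofSize r * Q ^ r) N (n ^ r) {{m^n≢0 n r}} (begin
      ofSize r * Q ^ r * n ^ r ≡⟨ trans (lem (ofSize r) (Q ^ r) (n ^ r)) (sym (sum-*ʳ (n ^ r * Q ^ r) _)) ⟩
      sumₗ (sets n) (λ A → ⟦ count A ≡ᵇ r ⟧ * sumR d (λ G → ⟦ P A G ⟧) * (n ^ r * Q ^ r)) ≤⟨ sum-mono (λ k → each (lookup (sets n) k)) ⟩
      sumₗ (sets n) (λ A → ⟦ count A ≡ᵇ r ⟧ * (N * r !)) ≡⟨ trans (sum-*ʳ (N * r !) _) (lem′ (sizeCount n r) N (r !)) ⟩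
      N * (sizeCount n r * r !) ≤⟨ *-monoʳ-≤ N (size-bound n r) ⟩
      N * n ^ r ∎)
      where
      open ≤-Reasoning
      lem : ∀ a b c → a * b * c ≡ a * (c * b)
      lem = solve-∀
      lem′ : ∀ a b c → a * (b * c) ≡ b * (a * c)
      lem′ = solve-∀
      each : ∀ A → ⟦ count A ≡ᵇ r ⟧ * sumR d (λ G → ⟦ P A G ⟧) * (n ^ r * Q ^ r) ≤ ⟦ count A ≡ᵇ r ⟧ * (N * r !)
      each A with count A ≡ᵇ r in e
      ... | false = z≤n
      ... | true with ≡ᵇ-true {count A} {r} e
      ...   | refl = ≤-trans (≤-reflexive (cong (_* (n ^ r * Q ^ r)) (*-identityˡ (sumR d (λ G → ⟦ P A G ⟧))))) (≤-trans (rare A 0<r r≤κ) (≤-reflexive (sym (*-identityˡ _))))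

    -- The geometric series, in the form Σ ≤ (2N / Q)(1 - 2^(-j)); it suffices to compare Q with 2.
    ofSizes-rare : ∀ j → j ≤ κ → Q * ofSizes j * 2 ^ j + 2 * N ≤ 2 * N * 2 ^ j
    ofSizes-rare zero _ = ≤-reflexive (lem Q N)
      where
      lem : ∀ Q N → Q * 0 * 1 + 2 * N ≡ 2 * N * 1
      lem = solve-∀
    ofSizes-rare (suc j) h = begin
      Q * (ofSizes j + ofSize (suc j)) * (2 * 2 ^ j) + 2 * N ≡⟨ lem Q (ofSizes j) (ofSize (suc j)) (2 ^ j) N ⟩
      2 * (Q * ofSizes j * 2 ^ j) + 2 * (ofSize (suc j) * (Q * 2 ^ j)) + 2 * N
        ≤⟨ +-monoˡ-≤ (2 * N) (+-monoʳ-≤ (2 * (Q * ofSizes j * 2 ^ j)) (*-monoʳ-≤ 2 (≤-trans (*-monoʳ-≤ (ofSize (suc j)) (*-monoʳ-≤ Q (^-monoˡ-≤ j 2≤Q))) (size-rare (suc j) (s≤s z≤n) h)))) ⟩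
      2 * (Q * ofSizes j * 2 ^ j) + 2 * N + 2 * N ≡⟨ lem′ (Q * ofSizes j * 2 ^ j) N ⟩
      2 * (Q * ofSizes j * 2 ^ j + 2 * N) ≤⟨ *-monoʳ-≤ 2 (ofSizes-rare j (≤-trans (n≤1+n j) h)) ⟩
      2 * (2 * N * 2 ^ j) ≡⟨ lem″ N (2 ^ j) ⟩
      2 * N * (2 * 2 ^ j) ∎
      where
      open ≤-Reasoning
      lem : ∀ Q a b p N → Q * (a + b) * (2 * p) + 2 * N ≡ 2 * (Q * a * p) + 2 * (b * (Q * p)) + 2 * N
      lem = solve-∀
      lem′ : ∀ a N → 2 * a + 2 * N + 2 * N ≡ 2 * (a + 2 * N)
      lem′ = solve-∀
      lem″ : ∀ N p → 2 * (2 * N * p) ≡ 2 * N * (2 * p)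
      lem″ = solve-∀

    exceptional-rare : Q * sumR d (λ G → ⟦ exceptional κ G ⟧) ≤ 2 * N
    exceptional-rare = ≤-trans (*-monoʳ-≤ Q (exceptional≤ κ)) (*-cancelʳ-≤ (Q * ofSizes κ) (2 * N) (2 ^ κ) {{m^n≢0 2 κ}} (≤-trans (m≤m+n _ (2 * N)) (ofSizes-rare κ ≤-refl)))

tail⇒rare : ∀ {T N b k r n Q} {{_ : NonZero n}} → T * (k ! * n ^ k) ≤ N * b ^ k → b ^ k * (n ^ r * Q ^ r) ≤ r ! * (k ! * n ^ k) →
  T * (n ^ r * Q ^ r) ≤ N * r !
tail⇒rare {T} {N} {b} {k} {r} {n} {Q} h₁ h₂ = *-cancelʳ-≤ (T * (n ^ r * Q ^ r)) (N * r !) (k ! * n ^ k) {{m*n≢0 (k !) (n ^ k) {{k !≢0}} {{m^n≢0 n k}}}} (begin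
  T * (n ^ r * Q ^ r) * (k ! * n ^ k) ≡⟨ lem T (n ^ r * Q ^ r) (k ! * n ^ k) ⟩
  T * (k ! * n ^ k) * (n ^ r * Q ^ r) ≤⟨ *-monoˡ-≤ (n ^ r * Q ^ r) h₁ ⟩
  N * b ^ k * (n ^ r * Q ^ r) ≡⟨ *-assoc N (b ^ k) _ ⟩
  N * (b ^ k * (n ^ r * Q ^ r)) ≤⟨ *-monoʳ-≤ N h₂ ⟩
  N * (r ! * (k ! * n ^ k)) ≡⟨ *-assoc N (r !) _ ⟨
  N * r ! * (k ! * n ^ k) ∎)
  where
  open ≤-Reasoning
  lem : ∀ a b c → a * b * c ≡ a * c * b
  lem = solve-∀

*^-distrib : ∀ a b k → (a * b) ^ k ≡ a ^ k * b ^ k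
*^-distrib a b zero = refl
*^-distrib a b (suc k) = trans (cong (a * b *_) (*^-distrib a b k)) (lem a b (a ^ k) (b ^ k))
  where
  lem : ∀ a b p q → a * b * (p * q) ≡ a * p * (b * q)
  lem = solve-∀

1≤factorial : ∀ r → 1 ≤ r !
1≤factorial r = >-nonZero⁻¹ (r !) {{r !≢0}}

-- r sets of size one each contribute a factor n Q, absorbed by the k-th powers.
absorb : ∀ {b n Q r τ} .{{_ : NonZero r}} → (9 * b) ^ τ * (n * Q) ≤ (τ * r * n) ^ τ → b ^ (τ * r) * (n ^ r * Q ^ r) ≤ r ! * ((τ * r) ! * n ^ (τ * r))
absorb {b} {n} {Q} {r} {τ} h = ≤-trans (*-cancelˡ-≤ (9 ^ k) {{m^n≢0 9 k}} (begin
  9 ^ k * (b ^ k * (n ^ r * Q ^ r)) ≡⟨ trans (sym (*-assoc (9 ^ k) _ _)) (cong₂ _*_ (trans (sym (*^-distrib 9 b k)) (sym (^-*-assoc (9 * b) τ r))) (sym (*^-distrib n Q r))) ⟩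
  ((9 * b) ^ τ) ^ r * (n * Q) ^ r ≡⟨ *^-distrib ((9 * b) ^ τ) (n * Q) r ⟨
  ((9 * b) ^ τ * (n * Q)) ^ r ≤⟨ ^-monoˡ-≤ r h ⟩
  ((τ * r * n) ^ τ) ^ r ≡⟨ trans (^-*-assoc (τ * r * n) τ r) (*^-distrib (τ * r) n k) ⟩
  k ^ k * n ^ k ≤⟨ *-monoˡ-≤ (n ^ k) (^≤factorial k) ⟩
  9 ^ k * k ! * n ^ k ≡⟨ *-assoc (9 ^ k) (k !) (n ^ k) ⟩
  9 ^ k * (k ! * n ^ k) ∎)) (≤-trans (≤-reflexive (sym (*-identityˡ _))) (*-monoˡ-≤ _ (1≤factorial r)))
  where
  open ≤-Reasoning
  k : ℕ
  k = τ * r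

opaque
  unfolding sum₂ sum
  even-total : ∀ {n} (f : Fin n → Fin n → ℕ) → (∀ i j → f i j ≡ f j i) → (∀ i → f i i ≡ 0) → ∃ λ e → sum₂ f ≡ 2 * e
  even-total {zero} f sy ir = 0 , refl
  even-total {suc n} f sy ir with even-total (λ i j → f (fsuc i) (fsuc j)) (λ i j → sy _ _) (λ i → ir _)
  ... | e , q = s + e , trans (cong₂ _+_ (cong (_+ s) (ir fzero)) (trans (sum-+ (λ i → f (fsuc i) fzero) _) (cong₂ _+_ (sum-cong (λ i → sy (fsuc i) fzero)) q))) (lem s e)
    where
    s : ℕ
    s = sum (λ j → f fzero (fsuc j))
    lem : ∀ s e → s + (s + 2 * e) ≡ 2 * (s + e)
    lem = solve-∀

dartsIn-even : ∀ {n d} {G : Graph n} → Regular d G → ∀ A → ∃ λ e → dartsIn A G ≡ 2 * e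
dartsIn-even {G = G} R A = even-total _ (λ i j → cong₂ (λ p g → p * ⟦ g ⟧) (*-comm ⟦ A i ⟧ ⟦ A j ⟧) (symm R i j)) (λ i → trans (cong (λ g → ⟦ A i ⟧ * ⟦ A i ⟧ * ⟦ g ⟧) (irr R i)) (*-zeroʳ (⟦ A i ⟧ * ⟦ A i ⟧)))

clashing : ∀ {n t} → Graph n → (Fin n → Fin t) → Fin n → Bool
clashing G c v = some (λ w → G v w ∧ (c v == c w))

clashing-covers : ∀ {n t} (G : Graph n) (c : Fin n → Fin t) i j → G i j ≡ true → c i ≡ c j → clashing G c i ≡ true
clashing-covers G c i j g e = some-intro (λ w → G i w ∧ (c i == c w)) j (∧-join g (trans (cong (_== c j) e) (==-refl (c j))))

clashing≤ : ∀ {n t} (G : Graph n) (c : Fin n → Fin t) → count (clashing G c) ≤ mono c G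
clashing≤ G c = ≤-trans (sum-mono (λ v → ≤-trans (some≤ (λ w → G v w ∧ (c v == c w))) (≤-reflexive (sum-cong (λ w → trans (⟦∧⟧ (G v w) (c v == c w)) (*-comm ⟦ G v w ⟧ _)))))) (≤-reflexive (sym (sum₂-rows _)))

module Colour {n : ℕ} (d Λ Q : ℕ) {{n≢0 : NonZero n}} {{d≢0 : NonZero d}} (2≤Q : 2 ≤ Q) where

  private
    N : ℕ
    N = sumR {n} d (λ _ → 1)

    none : count {n} (λ _ → false) ≡ 0
    none = sum-zero {n} {λ _ → 0} (λ _ → refl)

    module Fixed (A : Fin n → Bool) (room : 2 * (count A + 2 * suc d) ≤ n) where
      open SparseSets {n} d (count A) (λ _ → false) (λ _ → A) (λ _ _ _ → refl) (λ _ _ _ _ → refl) (λ _ _ → ≤-refl)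
        (≤-trans (≤-reflexive (cong (λ z → 2 * (z + 2 * suc d)) (trans (cong (λ z → count A + z + z) none) (trans (+-identityʳ _) (+-identityʳ _))))) room) public

    room-for : ∀ {κ} → 2 * (κ + 2 * suc d) ≤ n → ∀ (A : Fin n → Bool) → count A ≤ κ → 2 * (count A + 2 * suc d) ≤ n
    room-for h A le = ≤-trans (*-monoʳ-≤ 2 (+-monoˡ-≤ (2 * suc d) le)) h

    heavy : ℕ → ℕ → (Fin n → Bool) → Graph n → Bool
    heavy p q A G = atLeast (p * count A) (q * dartsIn A G)

    heavy-ext : ∀ p q {A B} G → A ≗ B → heavy p q A G ≡ heavy p q B G
    heavy-ext p q G e = cong₂ (λ a b → atLeast (p * a) (q * b)) (count-cong e) (dartsIn-cong e (λ _ _ → refl))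

  module Dense₁₅ = Exceptional {n} d (heavy 15 7) (heavy-ext 15 7)
  module Dense₁₂ = Exceptional {n} d (heavy 12 1) (heavy-ext 12 1)

  -- Such a set spans e edges with 15r ≤ 14e, hence at least r + ⌈r/14⌉. Against the roughly n^r
  -- sets of that size only the excess ⌈r/14⌉ gains powers of n, so each of these factors n must
  -- absorb fourteen factors of order d²Q and one factor r.
  dense₁₅-rare : ∀ κ → 2 * (κ + 2 * suc d) ≤ n → κ * (729 * (d * d) * Q) ^ 14 ≤ n → Q * sumR d (λ G → ⟦ Dense₁₅.exceptional κ G ⟧) ≤ 2 * N
  dense₁₅-rare κ room h = Dense₁₅.exceptional-rare Q κ 2≤Q rare
    where
    rare : ∀ A → 0 < count A → count A ≤ κ → sumR d (λ G → ⟦ heavy 15 7 A G ⟧) * (n ^ count A * Q ^ count A) ≤ N * count A !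
    rare A 0<r r≤κ = ≤-trans (*-monoˡ-≤ (n ^ r * Q ^ r) (sumR-mono d (λ G R → ⟦⟧-mono (λ e → atLeast⇐ (edges G R (atLeast⇒ e))))))
      (tail⇒rare {T = T.tailCount k} {N} {r * r * d} {k} {r} {n} {Q} (T.tail-bound k) numeric)
      where
      module T = Fixed A (room-for room A r≤κ)
      r g k : ℕ
      r = count A
      -- The quotient r / 14 rounded up: even a set with fewer than fourteen vertices has at least
      -- one excess edge.
      g = (r + 13) div 14
      k = r + g
      r≤14g : r ≤ 14 * g
      r≤14g = +-cancelʳ-≤ 13 r (14 * g) (begin
        r + 13 ≡⟨ m≡m%n+[m/n]*n (r + 13) 14 ⟩
        (r + 13) mod 14 + g * 14 ≤⟨ +-monoˡ-≤ (g * 14) (≤-pred (m%n<n (r + 13) 14)) ⟩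
        13 + g * 14 ≡⟨ trans (+-comm 13 (g * 14)) (cong (_+ 13) (*-comm g 14)) ⟩
        14 * g + 13 ∎)
        where open ≤-Reasoning
      g≤ : ∀ {e} → r ≤ 14 * e → g ≤ e
      g≤ {e} le = ≤-pred (*-cancelʳ-< 14 g (suc e) (begin-strict
        g * 14 ≤⟨ ≤-trans (m≤n+m (g * 14) _) (≤-reflexive (sym (m≡m%n+[m/n]*n (r + 13) 14))) ⟩
        r + 13 ≤⟨ +-monoˡ-≤ 13 le ⟩
        14 * e + 13 <⟨ ≤-reflexive (trans (sym (+-suc (14 * e) 13)) (lem e)) ⟩
        suc e * 14 ∎))
        where
        open ≤-Reasoning
        lem : ∀ e → 14 * e + 14 ≡ (1 + e) * 14
        lem = solve-∀
      g≤r : g ≤ r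
      g≤r = g≤ {r} (m≤m+n r (13 * r))
      edges : ∀ G → Regular d G → 15 * r ≤ 7 * dartsIn A G → 2 * k ≤ dartsIn A G
      edges G R le with dartsIn-even R A
      ... | e , eq rewrite eq = *-monoʳ-≤ 2 (≤-trans (+-monoʳ-≤ r (g≤ excess)) (≤-reflexive (m+[n∸m]≡n r≤e)))
        where
        15r≤14e : 15 * r ≤ 14 * e
        15r≤14e = ≤-trans le (≤-reflexive (lem e))
          where
          lem : ∀ e → 7 * (2 * e) ≡ 14 * e
          lem = solve-∀
        r≤e : r ≤ e
        r≤e = *-cancelˡ-≤ 14 (≤-trans (*-monoˡ-≤ r (n≤1+n 14)) 15r≤14e)
        excess : r ≤ 14 * (e ∸ r)
        excess = ≤-trans (m+n≤o⇒m≤o∸n r (≤-trans (≤-reflexive (lem r)) 15r≤14e)) (≤-reflexive (sym (*-distribˡ-∸ 14 e r)))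
          where
          lem : ∀ r → r + 14 * r ≡ 15 * r
          lem = solve-∀
      numeric : (r * r * d) ^ k * (n ^ r * Q ^ r) ≤ r ! * (k ! * n ^ k)
      numeric = *-cancelˡ-≤ (9 ^ r * 9 ^ k) {{m*n≢0 (9 ^ r) (9 ^ k) {{m^n≢0 9 r}} {{m^n≢0 9 k}}}} (begin
        9 ^ r * 9 ^ k * ((r * r * d) ^ k * (n ^ r * Q ^ r)) ≡⟨ expand ⟩
        r ^ r * r ^ k * n ^ r * (r ^ g * (9 ^ r * 9 ^ k * d ^ k * Q ^ r)) ≤⟨ *-monoʳ-≤ (r ^ r * r ^ k * n ^ r) small ⟩
        r ^ r * r ^ k * n ^ r * n ^ g ≡⟨ trans (*-assoc (r ^ r * r ^ k) _ _) (cong (r ^ r * r ^ k *_) (sym (^-distribˡ-+-* n r g))) ⟩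
        r ^ r * r ^ k * n ^ k ≤⟨ *-monoˡ-≤ (n ^ k) (*-mono-≤ (^≤factorial r) (≤-trans (^-monoˡ-≤ k (m≤m+n r g)) (^≤factorial k))) ⟩
        9 ^ r * r ! * (9 ^ k * k !) * n ^ k ≡⟨ lem (9 ^ r) (r !) (9 ^ k) (k !) (n ^ k) ⟩
        9 ^ r * 9 ^ k * (r ! * (k ! * n ^ k)) ∎)
        where
        open ≤-Reasoning
        lem : ∀ a b c e f → a * b * (c * e) * f ≡ a * c * (b * (e * f))
        lem = solve-∀
        expand : 9 ^ r * 9 ^ k * ((r * r * d) ^ k * (n ^ r * Q ^ r)) ≡ r ^ r * r ^ k * n ^ r * (r ^ g * (9 ^ r * 9 ^ k * d ^ k * Q ^ r))
        expand = trans (cong (λ z → 9 ^ r * 9 ^ k * (z * (n ^ r * Q ^ r))) (trans (*^-distrib (r * r) d k) (cong (_* d ^ k) (trans (*^-distrib r r k) (cong (_* r ^ k) (^-distribˡ-+-* r r g))))))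
          (lem′ (9 ^ r) (9 ^ k) (r ^ r) (r ^ g) (r ^ k) (d ^ k) (n ^ r) (Q ^ r))
          where
          lem′ : ∀ a b p q s e m x → a * b * ((p * q * s) * e * (m * x)) ≡ p * s * m * (q * (a * b * e * x))
          lem′ = solve-∀
        small : r ^ g * (9 ^ r * 9 ^ k * d ^ k * Q ^ r) ≤ n ^ g
        small = begin
          r ^ g * (9 ^ r * 9 ^ k * d ^ k * Q ^ r)
            ≤⟨ *-monoʳ-≤ (r ^ g) (*-monoˡ-≤ (Q ^ r) (*-mono-≤ (*-monoʳ-≤ (9 ^ r) (^-monoʳ-≤ 9 (+-monoʳ-≤ r g≤r))) (^-monoʳ-≤ d (+-monoʳ-≤ r g≤r)))) ⟩
          r ^ g * (9 ^ r * 9 ^ (r + r) * d ^ (r + r) * Q ^ r) ≡⟨ cong (r ^ g *_) collect ⟩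
          r ^ g * (729 * (d * d) * Q) ^ r ≤⟨ *-monoʳ-≤ (r ^ g) (≤-trans (^-monoʳ-≤ _ {{nz}} r≤14g) (≤-reflexive (sym (^-*-assoc _ 14 g)))) ⟩
          r ^ g * ((729 * (d * d) * Q) ^ 14) ^ g ≡⟨ *^-distrib r _ g ⟨
          (r * (729 * (d * d) * Q) ^ 14) ^ g ≤⟨ ^-monoˡ-≤ g (≤-trans (*-monoˡ-≤ _ r≤κ) h) ⟩
          n ^ g ∎
          where
          nz : NonZero (729 * (d * d) * Q)
          nz = m*n≢0 (729 * (d * d)) Q {{m*n≢0 729 (d * d) {{_}} {{m*n≢0 d d}}}} {{>-nonZero (≤-trans (s≤s z≤n) 2≤Q)}}
          collect : 9 ^ r * 9 ^ (r + r) * d ^ (r + r) * Q ^ r ≡ (729 * (d * d) * Q) ^ r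
          collect = trans (cong₂ (λ a b → 9 ^ r * a * b * Q ^ r) (trans (^-distribˡ-+-* 9 r r) (sym (*^-distrib 9 9 r))) (trans (^-distribˡ-+-* d r r) (sym (*^-distrib d d r))))
            (sym (trans (*^-distrib (729 * (d * d)) Q r) (cong (_* Q ^ r) (trans (*^-distrib 729 (d * d) r) (cong (_* (d * d) ^ r) (*^-distrib 9 81 r))))))

  -- Six edges per vertex gain n^6 where the choice of the set costs n; the remaining n^5 is
  -- compared with (κd)^6.
  dense₁₂-rare : ∀ κ → 2 * (κ + 2 * suc d) ≤ n → (9 * κ * d) ^ 6 * Q ≤ n ^ 5 → Q * sumR d (λ G → ⟦ Dense₁₂.exceptional κ G ⟧) ≤ 2 * N
  dense₁₂-rare κ room h = Dense₁₂.exceptional-rare Q κ 2≤Q rare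
    where
    rare : ∀ A → 0 < count A → count A ≤ κ → sumR d (λ G → ⟦ heavy 12 1 A G ⟧) * (n ^ count A * Q ^ count A) ≤ N * count A !
    rare A 0<r r≤κ = ≤-trans (*-monoˡ-≤ (n ^ r * Q ^ r) (sumR-mono d (λ G R → ⟦⟧-mono (λ e → atLeast⇐ (≤-trans (≤-reflexive (sym (*-assoc 2 6 r))) (≤-trans (atLeast⇒ e) (≤-reflexive (*-identityˡ _))))))))
      (tail⇒rare {T = T.tailCount (6 * r)} {N} {r * r * d} {6 * r} {r} {n} {Q} (T.tail-bound (6 * r)) (absorb {r * r * d} {n} {Q} {r} {6} {{>-nonZero 0<r}} numeric))
      where
      module T = Fixed A (room-for room A r≤κ)
      open ≤-Reasoning
      r : ℕ
      r = count A
      numeric : (9 * (r * r * d)) ^ 6 * (n * Q) ≤ (6 * r * n) ^ 6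
      numeric = begin
        (9 * (r * r * d)) ^ 6 * (n * Q) ≡⟨ lem r d n Q ⟩
        r ^ 6 * n * ((9 * r * d) ^ 6 * Q) ≤⟨ *-monoʳ-≤ (r ^ 6 * n) (≤-trans (*-monoˡ-≤ Q (^-monoˡ-≤ 6 (*-monoˡ-≤ d (*-monoʳ-≤ 9 r≤κ)))) h) ⟩
        r ^ 6 * n * n ^ 5 ≡⟨ lem′ r n ⟩
        (r * n) ^ 6 ≤⟨ ^-monoˡ-≤ 6 (*-monoˡ-≤ n (m≤n*m r 6)) ⟩
        (6 * r * n) ^ 6 ∎
        where
        base : ∀ r d → 9 * (r * r * d) ≡ r * (9 * r * d)
        base = solve-∀
        arrange : ∀ p q n Q → p * q * (n * Q) ≡ p * n * (q * Q)
        arrange = solve-∀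
        lem : ∀ r d n Q → (9 * (r * r * d)) ^ 6 * (n * Q) ≡ r ^ 6 * n * ((9 * r * d) ^ 6 * Q)
        lem r d n Q = trans (cong (λ z → z * (n * Q)) (trans (cong (_^ 6) (base r d)) (*^-distrib r (9 * r * d) 6))) (arrange (r ^ 6) ((9 * r * d) ^ 6) n Q)
        lem′ : ∀ r n → r ^ 6 * n * n ^ 5 ≡ (r * n) ^ 6
        lem′ r n = trans (*-assoc (r ^ 6) n (n ^ 5)) (sym (*^-distrib r n 6))

  boundary : (Fin n → Bool) → Graph n → Fin n → Bool
  boundary W G v = not (W v) ∧ some (λ u → W u ∧ G u v)

  crowded : ℕ → (Fin n → Bool) → Graph n → Bool
  crowded τ W G = atLeast (2 * (τ * count W)) (dartsIn (boundary W G) G)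

  crowded-ext : ∀ τ {A B} G → A ≗ B → crowded τ A G ≡ crowded τ B G
  crowded-ext τ G e = cong₂ (λ a b → atLeast (2 * (τ * a)) b) (count-cong e)
    (dartsIn-cong (λ v → cong₂ (λ p q → not p ∧ q) (e v) (some-cong (λ u → cong (_∧ G u v) (e u)))) (λ _ _ → refl))

  module Crowded (τ : ℕ) = Exceptional {n} d (crowded τ) (crowded-ext τ)

  -- The outer boundary is determined by the rows of `W`, so switchings away from `W` leave it fixed
  -- and the tail bound holds with β = rd. A gain of 2^τ per vertex of `W` pays for the choice of
  -- `W`.
  crowded-rare : ∀ τ κ → 2 * (κ * d + κ + κ + 2 * suc d) ≤ n → 18 * (d * d * d) * κ ≤ τ * n → n * Q ≤ 2 ^ τ →
    Q * sumR d (λ G → ⟦ Crowded.exceptional τ κ G ⟧) ≤ 2 * N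
  crowded-rare τ κ room h h′ = Crowded.exceptional-rare τ Q κ 2≤Q rare
    where
    rare : ∀ A → 0 < count A → count A ≤ κ → sumR d (λ G → ⟦ crowded τ A G ⟧) * (n ^ count A * Q ^ count A) ≤ N * count A !
    rare A 0<r r≤κ = tail⇒rare {T = T.tailCount (τ * r)} {N} {β * β * d} {τ * r} {r} {n} {Q} (T.tail-bound (τ * r)) (absorb {β * β * d} {n} {Q} {r} {τ} {{>-nonZero 0<r}} numeric)
      where
      r β : ℕ
      r = count A
      β = r * d
      row : ∀ (G H : Graph n) → (∀ i → A i ≡ true → ∀ j → G i j ≡ H i j) → ∀ u v → A u ∧ G u v ≡ A u ∧ H u v
      row G H e u v with A u in au
      ... | true = e u au v
      ... | false = refl
      module T = SparseSets {n} d β A (boundary A) (λ G v e → not-false (proj₁ (∧-split e)))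
        (λ G H e v → cong (not (A v) ∧_) (some-cong (λ u → row G H e u v)))
        (λ G R → ≤-trans (count-mono (λ v e → proj₂ (∧-split {not (A v)} e))) (≤-trans (count-some (λ u v → A u ∧ G u v))
          (≤-trans (sum-mono (λ u → ≤-reflexive (trans (sum-cong (λ v → ⟦∧⟧ (A u) (G u v))) (trans (sum-*ˡ ⟦ A u ⟧ _) (cong (⟦ A u ⟧ *_) (deg R u)))))) (≤-reflexive (sum-*ʳ d _)))))
        (≤-trans (*-monoʳ-≤ 2 (+-monoˡ-≤ (2 * suc d) (+-mono-≤ (+-mono-≤ (*-monoˡ-≤ d r≤κ) r≤κ) r≤κ))) room)
      open ≤-Reasoning
      numeric : (9 * (β * β * d)) ^ τ * (n * Q) ≤ (τ * r * n) ^ τ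
      numeric = begin
        (9 * (β * β * d)) ^ τ * (n * Q) ≤⟨ *-monoʳ-≤ ((9 * (β * β * d)) ^ τ) h′ ⟩
        (9 * (β * β * d)) ^ τ * 2 ^ τ ≡⟨ *^-distrib (9 * (β * β * d)) 2 τ ⟨
        (9 * (β * β * d) * 2) ^ τ ≤⟨ ^-monoˡ-≤ τ (≤-trans (≤-reflexive (lem r d)) (≤-trans (*-monoʳ-≤ r (≤-trans (*-monoʳ-≤ (18 * (d * d * d)) r≤κ) h)) (≤-reflexive (lem′ r τ n)))) ⟩
        (τ * r * n) ^ τ ∎
        where
        lem : ∀ r d → 9 * (r * d * (r * d) * d) * 2 ≡ r * (18 * (d * d * d) * r)
        lem = solve-∀
        lem′ : ∀ r τ n → r * (τ * n) ≡ τ * r * n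
        lem′ = solve-∀

  extend-few : ∀ {t} (G : Graph n) → Regular d G → (c : Fin n → Fin t) → mono c G < Λ → 3 ≤ t →
    Dense₁₅.exceptional (7 * Λ) G ≡ false → colourable (suc t) G ≡ true
  extend-few {t} G R c small 3≤t ok = extend (λ W W⊆U 0<W → let (u , wu , lt) = find-small W (obstacles W) 3 (contra W W⊆U 0<W) in u , wu , ≤-trans lt 3≤t)
    where
    open Structure G R c (clashing G c) (clashing-covers G c)
    contra : ∀ W → (∀ u → W u ≡ true → clashing G c u ≡ true) → 0 < count W → ¬ (∀ u → W u ≡ true → 3 ≤ obstacles W u)
    contra W W⊆U 0<W three = true≢false (atLeast⇐ dense) (Dense₁₅.unexceptional (7 * Λ) G ok K (nonempty 0<W)
        (≤-trans K-size (*-monoʳ-≤ 7 (≤-trans (count-mono W⊆U) (≤-trans (clashing≤ G c) (<⇒≤ small))))))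
      where open Few W W⊆U three

  extend-many : ∀ {t} τ (G : Graph n) → Regular d G → (c : Fin n → Fin t) → mono c G < Λ → 48 ≤ t → 48 * τ ≤ t →
    Dense₁₂.exceptional (2 * Λ) G ≡ false → Crowded.exceptional τ Λ G ≡ false → colourable (suc t) G ≡ true
  extend-many {t} τ G R c small 48≤t τ≤t ok ok′ = extend (λ W W⊆U 0<W → Many.many-free W W⊆U 0<W 48≤t (sparse W W⊆U) (few W W⊆U 0<W))
    where
    open Structure G R c (clashing G c) (clashing-covers G c)
    W≤Λ : ∀ W → (∀ u → W u ≡ true → clashing G c u ≡ true) → count W ≤ Λ
    W≤Λ W W⊆U = ≤-trans (count-mono W⊆U) (≤-trans (clashing≤ G c) (<⇒≤ small))
    below : ∀ {k m} → atLeast k m ≡ false → m < k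
    below {k} {m} e with k ≤? m
    ... | no ¬p = ≰⇒> ¬p
    sparse : ∀ W → (∀ u → W u ≡ true → clashing G c u ≡ true) → ∀ A → 0 < count A → count A ≤ 2 * count W → dartsIn A G < 12 * count A
    sparse W W⊆U A 0<A A≤ = ≤-trans (s≤s (≤-reflexive (sym (*-identityˡ (dartsIn A G))))) (below (Dense₁₂.unexceptional (2 * Λ) G ok A 0<A (≤-trans A≤ (*-monoʳ-≤ 2 (W≤Λ W W⊆U)))))
    few : ∀ W → (∀ u → W u ≡ true → clashing G c u ≡ true) → 0 < count W → 24 * dartsIn (outerBoundary W) G < t * count W
    few W W⊆U 0<W = ≤-trans (*-monoʳ-< 24 (below (Crowded.unexceptional τ Λ G ok′ W 0<W (W≤Λ W W⊆U)))) (≤-trans (≤-reflexive (lem τ (count W))) (*-monoˡ-≤ (count W) τ≤t))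
      where
      lem : ∀ τ r → 24 * (2 * (τ * r)) ≡ 48 * τ * r
      lem = solve-∀

-- Large independent sets and two-colourability are rare

chain : ∀ (f : ℕ → ℕ) ρ lo m → (∀ j → lo ≤ j → j < lo + m → ρ * f j ≤ f (suc j)) → f lo * ρ ^ m ≤ f (lo + m)
chain f ρ lo zero h = ≤-reflexive (trans (*-identityʳ _) (cong f (sym (+-identityʳ lo))))
chain f ρ lo (suc m) h = begin
  f lo * (ρ * ρ ^ m) ≡⟨ lem (f lo) ρ (ρ ^ m) ⟩
  ρ * (f lo * ρ ^ m) ≤⟨ *-monoʳ-≤ ρ (chain f ρ lo m (λ j p q → h j p (≤-trans q (+-monoʳ-≤ lo (n≤1+n m))))) ⟩
  ρ * f (lo + m) ≤⟨ h (lo + m) (m≤m+n lo m) (≤-reflexive (sym (+-suc lo m))) ⟩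
  f (suc (lo + m)) ≡⟨ cong f (+-suc lo m) ⟨
  f (lo + suc m) ∎
  where
  open ≤-Reasoning
  lem : ∀ a b c → a * (b * c) ≡ b * (a * c)
  lem = solve-∀

-- Bernoulli's inequality: b/a ≥ 1 + 1/c implies (b/a)^m ≥ 1 + m/c.
bernoulli : ∀ {a b} c m → a ≤ b → suc c * a ≤ c * b → a ^ m * (c + m) ≤ c * b ^ m
bernoulli c zero a≤b h = ≤-reflexive (trans (*-identityˡ _) (trans (+-identityʳ c) (sym (*-identityʳ c))))
bernoulli {a} {b} c (suc m) a≤b h = begin
  a * a ^ m * (c + suc m) ≡⟨ lem a (a ^ m) c m ⟩
  a ^ m * (suc c * a + m * a) ≤⟨ *-monoʳ-≤ (a ^ m) (+-mono-≤ h (*-monoʳ-≤ m a≤b)) ⟩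
  a ^ m * (c * b + m * b) ≡⟨ lem′ (a ^ m) b c m ⟩
  b * (a ^ m * (c + m)) ≤⟨ *-monoʳ-≤ b (bernoulli c m a≤b h) ⟩
  b * (c * b ^ m) ≡⟨ lem″ b c (b ^ m) ⟩
  c * (b * b ^ m) ∎
  where
  open ≤-Reasoning
  lem : ∀ a p c m → a * p * (c + (1 + m)) ≡ p * ((1 + c) * a + m * a)
  lem = solve-∀
  lem′ : ∀ p b c m → p * (c * b + m * b) ≡ b * (p * (c + m))
  lem′ = solve-∀
  lem″ : ∀ b c p → b * (c * p) ≡ c * (b * p)
  lem″ = solve-∀

outgrow : ∀ {a b B N Q} c ν {{_ : NonZero a}} {{_ : NonZero c}} → a ≤ b → suc c * a ≤ c * b → c * (a * Q) ≤ ν → B * b ^ ν ≤ a ^ ν * a * N → Q * B ≤ N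
outgrow {a} {b} {B} {N} {Q} c ν {{a≢0}} {{c≢0}} a≤b h hν h′ = *-cancelˡ-≤ (c * (a * a ^ ν)) {{m*n≢0 c (a * a ^ ν) {{c≢0}} {{m*n≢0 a (a ^ ν) {{a≢0}} {{m^n≢0 a ν}}}}}} (begin
  c * (a * a ^ ν) * (Q * B) ≡⟨ lem c a (a ^ ν) Q B ⟩
  a ^ ν * (c * (a * Q)) * B ≤⟨ *-monoˡ-≤ B (*-monoʳ-≤ (a ^ ν) (≤-trans hν (m≤n+m ν c))) ⟩
  a ^ ν * (c + ν) * B ≤⟨ *-monoˡ-≤ B (bernoulli c ν a≤b h) ⟩
  c * b ^ ν * B ≡⟨ trans (*-assoc c _ B) (cong (c *_) (*-comm _ B)) ⟩
  c * (B * b ^ ν) ≤⟨ *-monoʳ-≤ c h′ ⟩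
  c * (a ^ ν * a * N) ≡⟨ lem′ c (a ^ ν) a N ⟩
  c * (a * a ^ ν) * N ∎)
  where
  open ≤-Reasoning
  lem : ∀ c a p Q B → c * (a * p) * (Q * B) ≡ p * (c * (a * Q)) * B
  lem = solve-∀
  lem′ : ∀ c p a N → c * (p * a * N) ≡ c * (a * p) * N
  lem′ = solve-∀

sum-classes : ∀ {n t} (c : Fin n → Fin t) → sum (λ i → count (λ v → i == c v)) ≡ n
sum-classes {n} c = trans (sum-comm (λ i v → ⟦ i == c v ⟧)) (trans (sum-cong (λ v → trans (sum-cong (λ i → cong ⟦_⟧ (==-sym i (c v)))) (count-== (c v))))
  (trans (sum-const n 1) (*-identityʳ n)))

module IndependentSets {n : ℕ} (d Q : ℕ) {{n≢0 : NonZero n}} {{d≢0 : NonZero d}} where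

  private
    N : ℕ
    N = sumR {n} d (λ _ → 1)

  class-independent : ∀ {t} {G : Graph n} (c : Fin n → Fin t) → Proper G c → ∀ i → dartsIn (λ v → i == c v) G ≡ 0
  class-independent {G = G} c p i = trans (sum₂-rows _) (sum-zero (λ x → sum-zero (λ y → point x y)))
    where
    point : ∀ x y → ⟦ i == c x ⟧ * ⟦ i == c y ⟧ * ⟦ G x y ⟧ ≡ 0
    point x y with i == c x in ex | i == c y in ey | G x y in g
    ... | false | _ | _ = refl
    ... | true | false | _ = refl
    ... | true | true | false = refl
    ... | true | true | true = ⊥-elim (p x y g (trans (sym (==⇒≡ ex)) (==⇒≡ ey)))

  module Large (a : ℕ) where

    event : (Fin n → Bool) → Graph n → Bool
    event A G = (count A ≡ᵇ a) ∧ (dartsIn A G ≡ᵇ 0)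

    event-ext : ∀ {A B} G → A ≗ B → event A G ≡ event B G
    event-ext G e = cong₂ (λ p q → (p ≡ᵇ a) ∧ (q ≡ᵇ 0)) (count-cong e) (dartsIn-cong e (λ _ _ → refl))

    open Exceptional {n} d event event-ext public

    -- As long as at most m ≤ w edges lie inside A, at least 2w darts leave A, and each layer is at
    -- least twice the previous one. After m doublings the independent case has probability at most
    -- 2^(-m) ≤ (nQ)^(-a).
    independent-rare : ∀ w m s → 2 ≤ Q → 0 < a → 4 * w ≤ a * d → 2 * suc d * d ≤ w → m ≤ w → 2 * m * (n * d) ≤ w * w → n * Q ≤ 2 ^ s → s * a ≤ m →
      Q * sumR d (λ G → ⟦ exceptional a G ⟧) ≤ 2 * N
    independent-rare w m s 2≤Q 0<a 4w≤ η≤w m≤w 2mnd≤ nQ≤ sa≤m = exceptional-rare Q a 2≤Q rare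
      where
      rare : ∀ A → 0 < count A → count A ≤ a → sumR d (λ G → ⟦ event A G ⟧) * (n ^ count A * Q ^ count A) ≤ N * count A !
      rare A 0<r r≤a with count A ≡ᵇ a in e
      ... | false = ≤-trans (≤-reflexive (cong (_* (n ^ count A * Q ^ count A)) (n≤0⇒n≡0 (≤-reflexive (sumR-*ˡ d 0 (λ _ → 0)))))) z≤n
      ... | true with ≡ᵇ-true {count A} {a} e
      ...   | refl = begin
        layerCount 0 * (n ^ count A * Q ^ count A) ≡⟨ cong (layerCount 0 *_) (*^-distrib n Q (count A)) ⟨
        layerCount 0 * (n * Q) ^ count A ≤⟨ *-monoʳ-≤ (layerCount 0) (≤-trans (^-monoˡ-≤ (count A) nQ≤) (≤-trans (≤-reflexive (^-*-assoc 2 s (count A))) (^-monoʳ-≤ 2 sa≤m))) ⟩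
        layerCount 0 * 2 ^ m ≤⟨ chain layerCount 2 0 m double ⟩
        layerCount m ≤⟨ layerCount≤ m ⟩
        N ≡⟨ *-identityʳ N ⟨
        N * 1 ≤⟨ *-monoʳ-≤ N (1≤factorial (count A)) ⟩
        N * count A ! ∎
        where
        open ≤-Reasoning
        open Independent {n} d A
        double : ∀ j → 0 ≤ j → j < m → 2 * layerCount j ≤ layerCount (suc j)
        double j _ j<m = *-cancelʳ-≤ (2 * layerCount j) (layerCount (suc j)) (2 * suc j * (n * d)) {{m*n≢0 (2 * suc j) (n * d) {{_}} {{m*n≢0 n d}}}} (begin
          2 * layerCount j * (2 * suc j * (n * d)) ≤⟨ *-monoʳ-≤ (2 * layerCount j) (*-monoˡ-≤ (n * d) (*-monoʳ-≤ 2 j<m)) ⟩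
          2 * layerCount j * (2 * m * (n * d)) ≤⟨ *-monoʳ-≤ (2 * layerCount j) 2mnd≤ ⟩
          2 * layerCount j * (w * w) ≡⟨ lem (layerCount j) w ⟩
          layerCount j * (2 * w * w) ≤⟨ *-monoʳ-≤ (layerCount j) (*-monoʳ-≤ (2 * w) (≤-trans (≤-reflexive (sym (trans (cong (_∸ w) (lem′ w)) (m+n∸n≡m w w)))) (∸-monoʳ-≤ (2 * w) η≤w))) ⟩
          layerCount j * (2 * w * (2 * w ∸ 2 * suc d * d))
            ≤⟨ layer-step j (2 * w) (n * d) (≤-trans (+-monoʳ-≤ (2 * w) (*-monoʳ-≤ 2 (≤-trans (<⇒≤ j<m) m≤w))) (≤-trans (≤-reflexive (lem″ w)) 4w≤))
                 (λ G R _ → ≤-trans (sum₂-mono (λ x y → ≤-trans (*-monoˡ-≤ ⟦ G x y ⟧ (*-mono-≤ (⟦⟧≤1 (Aᶜ x)) (⟦⟧≤1 (Aᶜ y)))) (≤-reflexive (*-identityˡ _)))) (≤-reflexive (all-darts R))) ⟩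
          layerCount (suc j) * (2 * suc j * (n * d)) ∎)
          where
          lem : ∀ l w → 2 * l * (w * w) ≡ l * (2 * w * w)
          lem = solve-∀
          lem′ : ∀ w → 2 * w ≡ w + w
          lem′ = solve-∀
          lem″ : ∀ w → 2 * w + 2 * w ≡ 4 * w
          lem″ = solve-∀

    independent-small : ∀ G → 0 < a → exceptional a G ≡ false → ∀ A → dartsIn A G ≡ 0 → count A < a
    independent-small G 0<a ok A ind with a ≤? count A
    ... | no ¬p = ≰⇒> ¬p
    ... | yes p = ⊥-elim (true≢false (∧-join (trans (cong (_≡ᵇ a) size) (≡ᵇ-refl a)) (cong (_≡ᵇ 0) ind′)) (unexceptional a G ok B (≤-trans 0<a (≤-reflexive (sym size))) (≤-reflexive size)))
      where
      B : Fin n → Bool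
      B = take a A
      size : count B ≡ a
      size = trans (count-take a A) (m≤n⇒m⊓n≡m p)
      ind′ : dartsIn B G ≡ 0
      ind′ = n≤0⇒n≡0 (≤-trans (sum₂-mono (λ x y → *-monoˡ-≤ ⟦ G x y ⟧ (*-mono-≤ (⟦⟧-mono (take⊆ a A x)) (⟦⟧-mono (take⊆ a A y))))) (≤-reflexive ind))

    classes-small : ∀ {t} G → 0 < a → exceptional a G ≡ false → (c : Fin n → Fin t) → Proper G c → ∀ v → count (λ x → c v == c x) ≤ a
    classes-small G 0<a ok c p v = <⇒≤ (independent-small G 0<a ok (λ x → c v == c x) (class-independent c p (c v)))

    not-colourable : ∀ t G → 0 < a → t * a ≤ n → exceptional a G ≡ false → colourable t G ≡ false
    not-colourable t G 0<a ta≤n ok with bool-cases (colourable t G)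
    ... | inj₂ e = e
    ... | inj₁ e with colourable⇒ t G e
    ...   | c , p = ⊥-elim (<⇒≱ (few t c (λ i → independent-small G 0<a ok _ (class-independent c p i))) ta≤n)
      where
      few : ∀ t (c : Fin n → Fin t) → (∀ i → count (λ v → i == c v) < a) → n < t * a
      few zero c h = ⊥-elim (none c)
        where
        none : (Fin n → Fin 0) → ⊥
        none c with sum-pos {n} (λ _ → 1) (≤-trans (>-nonZero⁻¹ n) (≤-reflexive (sym (trans (sum-const n 1) (*-identityʳ n)))))
        ... | v , _ with c v
        ...   | ()
      few (suc t) c h = begin-strict
        n ≡⟨ sum-classes c ⟨
        sum (λ i → count (λ v → i == c v)) ≤⟨ sum-bound (λ i → ≤-pred (≤-trans (h i) (≤-reflexive (sym (suc-pred a {{>-nonZero 0<a}}))))) ⟩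
        suc t * pred a <⟨ *-monoʳ-< (suc t) (≤-reflexive (suc-pred a {{>-nonZero 0<a}})) ⟩
        suc t * a ∎
        where open ≤-Reasoning

  -- The union bound over 2^n bipartitions, n being about 16ν, requires a gain above 65536 for each
  -- unit of ν. The first 4ν layers of a half provide 120 · 24 · 8 · 3 = 69120; degree 3 is the
  -- least favourable case.
  module Bipartite (ν : ℕ) {{ν≢0 : NonZero ν}} (3≤d : 3 ≤ d) (16ν≤n : 16 * ν ≤ n) (n≤ : n ≤ 16 * ν + 16) (η≤ν : 6 * (2 * suc d * d) ≤ ν) where

    module Half (A : Fin n → Bool) (half : count A ≡ count (λ v → not (A v))) where
      open Independent {n} d A

      8ν≤ : 8 * ν ≤ count A
      8ν≤ = *-cancelˡ-≤ 2 (≤-trans (≤-reflexive (sym (*-assoc 2 8 ν))) (≤-trans 16ν≤n (≤-reflexive (sym (begin-equality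
        2 * count A ≡⟨ cong (λ z → count A + z) (trans (+-identityʳ _) half) ⟩
        count A + count Aᶜ ≡⟨ sum-+ _ _ ⟨
        sum (λ v → ⟦ A v ⟧ + ⟦ not (A v) ⟧) ≡⟨ sum-cong (λ v → ⟦not⟧ (A v)) ⟩
        sum {n} (λ _ → 1) ≡⟨ trans (sum-const n 1) (*-identityʳ n) ⟩
        n ∎)))))
        where open ≤-Reasoning

      equal-sides : ∀ {G} → Regular d G → dartsIn Aᶜ G ≡ dartsIn A G
      equal-sides {G} R = +-cancelʳ-≡ (crossing G) _ _ (trans (outside+crossing R) (trans (cong (_* d) (sym half)) (sym (inside+crossing R))))

      -- For iν ≤ j < (i+1)ν at least kν darts cross and at most 2(i+1)ν lie on either side, so
      -- consecutive layers differ by a factor of nearly (k / (2(i+1)))². The extra `k` in the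
      -- hypothesis pays for adjacent and equal pairs, through 6η ≤ ν.
      block : ∀ ρ i k → k + 2 * suc i ≡ 24 → 24 * (ρ * (suc i * suc i)) + k ≤ 6 * (k * k) → layerCount (i * ν) * ρ ^ ν ≤ layerCount (suc i * ν)
      block ρ i k k≡ ineq = ≤-trans (chain layerCount ρ (i * ν) ν ratio) (≤-reflexive (cong layerCount (+-comm (i * ν) ν)))
        where
        ratio : ∀ j → i * ν ≤ j → j < i * ν + ν → ρ * layerCount j ≤ layerCount (suc j)
        ratio j _ j< = *-cancelʳ-≤ (ρ * layerCount j) (layerCount (suc j)) (2 * suc j * (2 * suc j)) (begin
          ρ * layerCount j * (2 * suc j * (2 * suc j)) ≤⟨ *-monoʳ-≤ (ρ * layerCount j) (*-mono-≤ (*-monoʳ-≤ 2 j≤) (*-monoʳ-≤ 2 j≤)) ⟩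
          ρ * layerCount j * (2 * (suc i * ν) * (2 * (suc i * ν))) ≡⟨ lem ρ (layerCount j) (suc i) ν ⟩
          layerCount j * (4 * (ρ * (suc i * suc i)) * (ν * ν)) ≤⟨ *-monoʳ-≤ (layerCount j) enough ⟩
          layerCount j * (k * ν * (k * ν ∸ 2 * suc d * d)) ≤⟨ layer-step j (k * ν) (2 * suc j) room (λ G R e → ≤-reflexive (trans (equal-sides R) (layer⇒ {suc j} {G} e))) ⟩
          layerCount (suc j) * (2 * suc j * (2 * suc j)) ∎)
          where
          open ≤-Reasoning
          j≤ : suc j ≤ suc i * ν
          j≤ = ≤-trans j< (≤-reflexive (+-comm (i * ν) ν))
          lem : ∀ ρ l s ν → ρ * l * (2 * (s * ν) * (2 * (s * ν))) ≡ l * (4 * (ρ * (s * s)) * (ν * ν))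
          lem = solve-∀
          room : k * ν + 2 * j ≤ count A * d
          room = begin
            k * ν + 2 * j ≤⟨ +-monoʳ-≤ (k * ν) (*-monoʳ-≤ 2 (≤-trans (n≤1+n j) j≤)) ⟩
            k * ν + 2 * (suc i * ν) ≡⟨ lem₁ k (suc i) ν ⟩
            (k + 2 * suc i) * ν ≡⟨ trans (cong (_* ν) k≡) (lem₂ ν) ⟩
            8 * ν * 3 ≤⟨ *-mono-≤ 8ν≤ 3≤d ⟩
            count A * d ∎
            where
            lem₁ : ∀ k s ν → k * ν + 2 * (s * ν) ≡ (k + 2 * s) * ν
            lem₁ = solve-∀
            lem₂ : ∀ ν → 24 * ν ≡ 8 * ν * 3
            lem₂ = solve-∀
          enough : 4 * (ρ * (suc i * suc i)) * (ν * ν) ≤ k * ν * (k * ν ∸ 2 * suc d * d)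
          enough = *-cancelˡ-≤ 6 (+-cancelʳ-≤ (k * (ν * ν)) _ _ (begin
            6 * (4 * (ρ * (suc i * suc i)) * (ν * ν)) + k * (ν * ν) ≡⟨ lem₁ (ρ * (suc i * suc i)) (ν * ν) k ⟩
            (24 * (ρ * (suc i * suc i)) + k) * (ν * ν) ≤⟨ *-monoˡ-≤ (ν * ν) ineq ⟩
            6 * (k * k) * (ν * ν) ≡⟨ lem₂ k ν ⟩
            k * ν * (6 * (k * ν)) ≤⟨ *-monoʳ-≤ (k * ν) (≤-trans (*-monoʳ-≤ 6 (m≤n+m∸n (k * ν) η)) (≤-reflexive (*-distribˡ-+ 6 η _))) ⟩
            k * ν * (6 * η + 6 * (k * ν ∸ η)) ≤⟨ *-monoʳ-≤ (k * ν) (+-monoˡ-≤ (6 * (k * ν ∸ η)) η≤ν) ⟩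
            k * ν * (ν + 6 * (k * ν ∸ η)) ≡⟨ lem₃ k ν (k * ν ∸ η) ⟩
            6 * (k * ν * (k * ν ∸ η)) + k * (ν * ν) ∎))
            where
            η : ℕ
            η = 2 * suc d * d
            lem₁ : ∀ r m k → 6 * (4 * r * m) + k * m ≡ (24 * r + k) * m
            lem₁ = solve-∀
            lem₂ : ∀ k ν → 6 * (k * k) * (ν * ν) ≡ k * ν * (6 * (k * ν))
            lem₂ = solve-∀
            lem₃ : ∀ k ν x → k * ν * (ν + 6 * x) ≡ 6 * (k * ν * x) + k * (ν * ν)
            lem₃ = solve-∀

      half-rare : layerCount 0 * 69120 ^ ν ≤ N
      half-rare = begin
        layerCount 0 * 69120 ^ ν ≡⟨ cong (layerCount 0 *_) (trans (*^-distrib (120 * 24 * 8) 3 ν) (cong (_* 3 ^ ν) (trans (*^-distrib (120 * 24) 8 ν) (cong (_* 8 ^ ν) (*^-distrib 120 24 ν))))) ⟩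
        layerCount 0 * (120 ^ ν * 24 ^ ν * 8 ^ ν * 3 ^ ν) ≡⟨ lem (layerCount 0) (120 ^ ν) (24 ^ ν) (8 ^ ν) (3 ^ ν) ⟩
        layerCount 0 * 120 ^ ν * 24 ^ ν * 8 ^ ν * 3 ^ ν ≤⟨ *-monoˡ-≤ (3 ^ ν) (*-monoˡ-≤ (8 ^ ν) (*-monoˡ-≤ (24 ^ ν) (block 120 0 22 refl (le _ _ refl)))) ⟩
        layerCount (1 * ν) * 24 ^ ν * 8 ^ ν * 3 ^ ν ≤⟨ *-monoˡ-≤ (3 ^ ν) (*-monoˡ-≤ (8 ^ ν) (block 24 1 20 refl (le _ _ refl))) ⟩
        layerCount (2 * ν) * 8 ^ ν * 3 ^ ν ≤⟨ *-monoˡ-≤ (3 ^ ν) (block 8 2 18 refl (le _ _ refl)) ⟩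
        layerCount (3 * ν) * 3 ^ ν ≤⟨ block 3 3 16 refl (le _ _ refl) ⟩
        layerCount (4 * ν) ≤⟨ layerCount≤ (4 * ν) ⟩
        N ∎
        where
        open ≤-Reasoning
        le : ∀ m n → atLeast m n ≡ true → m ≤ n
        le m n e = atLeast⇒ e
        lem : ∀ l a b c e → l * (a * b * c * e) ≡ l * a * b * c * e
        lem = solve-∀

    sides : (Fin n → Bool) → Graph n → Bool
    sides A G = (dartsIn A G ≡ᵇ 0) ∧ (dartsIn (λ v → not (A v)) G ≡ᵇ 0)

    -- If both sides are independent, all darts cross, and counting them from each side shows that
    -- the sides have equal size. Hence only halves matter.
    sides-rare : ∀ A → sumR d (λ G → ⟦ sides A G ⟧) * 69120 ^ ν ≤ N
    sides-rare A with count A Data.Nat.≟ count (λ v → not (A v))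
    ... | yes half = ≤-trans (*-monoˡ-≤ (69120 ^ ν) (sumR-mono d (λ G R → ⟦⟧-mono (λ e → proj₁ (∧-split {dartsIn A G ≡ᵇ 0} e))))) (Half.half-rare A half)
    ... | no ¬half = ≤-trans (*-monoˡ-≤ (69120 ^ ν) (≤-trans (sumR-mono d (λ G R → ≤-reflexive (⟦⟧-false (impossible G R)))) (≤-reflexive (sumR-*ˡ d 0 (λ _ → 0))))) z≤n
      where
      open Independent {n} d A
      impossible : ∀ G → Regular d G → sides A G ≡ false
      impossible G R with bool-cases (sides A G)
      ... | inj₂ e = e
      ... | inj₁ e = ⊥-elim (¬half (*-cancelʳ-≡ (count A) (count Aᶜ) d (trans (sym (inside+crossing R)) (trans (cong (_+ crossing G) (trans (≡ᵇ-true {dartsIn A G} (proj₁ s)) (sym (≡ᵇ-true {dartsIn Aᶜ G} (proj₂ s))))) (outside+crossing R)))))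
        where s = ∧-split {dartsIn A G ≡ᵇ 0} e

    bipartite-sides : ∀ G → colourable 2 G ≡ true → ∃ λ k → sides (lookup (sets n) k) G ≡ true
    bipartite-sides G e with colourable⇒ 2 G e
    ... | c , p with set-index (λ v → fzero == c v)
    ...   | k , eq = k , ∧-join (cong (_≡ᵇ 0) (trans (dartsIn-cong eq (λ _ _ → refl)) (class-independent c p fzero)))
            (cong (_≡ᵇ 0) (trans (dartsIn-cong (λ v → trans (cong not (eq v)) (other (c v))) (λ _ _ → refl)) (class-independent c p (fsuc fzero))))
      where
      other : ∀ (i : Fin 2) → not (fzero == i) ≡ (fsuc fzero == i)
      other fzero = refl
      other (fsuc fzero) = refl

    sets-total : ∀ m → sumₗ (sets m) (λ _ → 1) ≤ 2 ^ m
    sets-total zero = sets-zero (λ _ → 1) (λ _ → ≤-refl)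
    sets-total (suc m) = ≤-trans (≤-reflexive (sets-suc {m} (λ _ → 1) (λ _ _ _ → refl))) (≤-trans (+-mono-≤ (sets-total m) (sets-total m)) (≤-reflexive (cong (2 ^ m +_) (sym (+-identityʳ _)))))

    bipartite-count : sumR d (λ G → ⟦ colourable 2 G ⟧) * 69120 ^ ν ≤ 2 ^ n * N
    bipartite-count = begin
      sumR d (λ G → ⟦ colourable 2 G ⟧) * 69120 ^ ν ≤⟨ *-monoˡ-≤ (69120 ^ ν) (≤-trans (sumR-mono d (λ G _ → cover G)) (≤-reflexive (sumR-sum d _))) ⟩
      sumₗ (sets n) (λ A → sumR d (λ G → ⟦ sides A G ⟧)) * 69120 ^ ν ≡⟨ sum-*ʳ (69120 ^ ν) _ ⟨
      sumₗ (sets n) (λ A → sumR d (λ G → ⟦ sides A G ⟧) * 69120 ^ ν) ≤⟨ sum-mono (λ k → ≤-trans (sides-rare (lookup (sets n) k)) (≤-reflexive (sym (*-identityˡ N)))) ⟩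
      sumₗ (sets n) (λ _ → 1 * N) ≡⟨ sum-*ʳ N _ ⟩
      sumₗ (sets n) (λ _ → 1) * N ≤⟨ *-monoˡ-≤ N (sets-total n) ⟩
      2 ^ n * N ∎
      where
      open ≤-Reasoning
      cover : ∀ G → ⟦ colourable 2 G ⟧ ≤ sumₗ (sets n) (λ A → ⟦ sides A G ⟧)
      cover G with colourable 2 G in e
      ... | false = z≤n
      ... | true with bipartite-sides G e
      ...   | k , q = ≤-trans (≤-reflexive (sym (⟦⟧-true q))) (sum-term (λ k → ⟦ sides (lookup (sets n) k) G ⟧) k)

    -- The ratio 69120 / 65536 exceeds 20 / 19, whence the 19; the factor 65536 in the hypothesis
    -- compensates n ≤ 16ν + 16.
    bipartite-rare : 19 * (65536 * Q) ≤ ν → Q * sumR d (λ G → ⟦ colourable 2 G ⟧) ≤ N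
    bipartite-rare h = outgrow {65536} {69120} {sumR d (λ G → ⟦ colourable 2 G ⟧)} {N} {Q} 19 ν (atLeast⇒ refl) (atLeast⇒ refl) h (≤-trans bipartite-count (*-monoˡ-≤ N (≤-trans (^-monoʳ-≤ 2 n≤)
      (≤-reflexive (trans (^-distribˡ-+-* 2 (16 * ν) 16) (cong (_* 65536) (sym (^-*-assoc 2 16 ν))))))))

-- Existence of regular graphs

matrix-index : ∀ {n} (G : Graph n) → ∃ λ k → lookup (allAdj n) k ≈ G
matrix-index {n} G = Matrices.funs-index _ (λ r → Any.map (λ {r′} e j → e j) (Rows.funs-any _ (λ { true → here refl ; false → there (here refl) }) r)) G

opaque
  unfolding sumR sumG
  sumR-hit : ∀ {n} d (φ : Graph n → ℕ) → Ext φ → ∀ G → Regular d G → φ G ≤ sumR d φ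
  sumR-hit {n} d φ ext G R with matrix-index G
  ... | k , e = ≤-trans (≤-reflexive (sym (trans (cong₂ (λ p q → ⟦ p ⟧ * q) (trans (isRegular-ext d _ G e) (regular⇐ R)) (ext _ G e)) (*-identityˡ (φ G)))))
      (sum-term (λ k → ⟦ isRegular d (lookup (allAdj n) k) ⟧ * φ (lookup (allAdj n) k)) k)

  sumR-list : ∀ {n} d (φ : Graph n → ℕ) → sumR d φ ≡ sumₗ (regularGraphs n d) φ
  sumR-list {n} d φ = sym (sumₗ-bfilter (isRegular d) (allAdj n) φ)

below : (ℕ → ℕ) → ℕ → ℕ
below f zero = 0
below f (suc n) = below f n + f n

below-cong : ∀ {f g} n → (∀ i → i < n → f i ≡ g i) → below f n ≡ below g n
below-cong zero h = refl
below-cong (suc n) h = cong₂ _+_ (below-cong n (λ i p → h i (≤-trans p (n≤1+n n)))) (h n ≤-refl)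

below-first : ∀ f n → below f (suc n) ≡ f 0 + below (f ∘ suc) n
below-first f zero = +-comm 0 (f 0)
below-first f (suc n) = trans (cong (_+ f (suc n)) (below-first f n)) (+-assoc (f 0) _ _)

opaque
  unfolding sum
  sum-below : ∀ {n} (f : ℕ → ℕ) → sum {n} (λ j → f (toℕ j)) ≡ below f n
  sum-below {zero} f = refl
  sum-below {suc n} f = trans (cong (f 0 +_) (sum-below {n} (λ i → f (suc i)))) (sym (below-first f n))

-- The connection set of a circulant graph on L + 1 vertices: letter i decides the difference i + 1,
-- and the mirror condition identifies a difference k with L + 1 - k.
record Palindrome (L s : ℕ) : Set where
  field
    word : ℕ → Bool
    mirror : ∀ i j → suc (i + j) ≡ L → word i ≡ word j
    weight≡ : below (λ i → ⟦ word i ⟧) L ≡ s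
open Palindrome

wrap : ∀ {L s} b → Palindrome L s → Palindrome (2 + L) (⟦ b ⟧ + s + ⟦ b ⟧)
wrap {L} {s} b p = record { word = w ; mirror = m ; weight≡ = trans (below-first (λ i → ⟦ w i ⟧) (suc L)) (trans (cong (⟦ b ⟧ +_) (cong₂ _+_ inner last)) (sym (+-assoc ⟦ b ⟧ s ⟦ b ⟧))) }
  where
  w : ℕ → Bool
  w zero = b
  w (suc i) = if i ≡ᵇ L then b else word p i
  inner : below (λ i → ⟦ w (suc i) ⟧) L ≡ s
  inner = trans (below-cong L (λ i i<L → cong (λ c → ⟦ if c then b else word p i ⟧) (off i i<L))) (weight≡ p)
    where
    off : ∀ i → i < L → (i ≡ᵇ L) ≡ false
    off i i<L with i ≡ᵇ L in e
    ... | false = refl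
    ... | true = ⊥-elim (<⇒≢ i<L (≡ᵇ-true e))
  last : ⟦ w (suc L) ⟧ ≡ ⟦ b ⟧
  last rewrite ≡ᵇ-refl L = refl
  m : ∀ i j → suc (i + j) ≡ 2 + L → w i ≡ w j
  m zero zero e = refl
  m zero (suc j) e rewrite suc-injective (suc-injective e) | ≡ᵇ-refl L = refl
  m (suc i) zero e rewrite trans (sym (+-identityʳ i)) (suc-injective (suc-injective e)) | ≡ᵇ-refl L = refl
  m (suc i) (suc j) e with i ≡ᵇ L in p₁ | j ≡ᵇ L in p₂
  ... | true | true = refl
  ... | true | false = ⊥-elim (m+1+n≢m i (trans (suc-injective (suc-injective e)) (sym (≡ᵇ-true p₁))))
  ... | false | true = ⊥-elim (m+1+n≢m j (trans (+-suc j i) (trans (cong suc (+-comm j i)) (trans (sym (+-suc i j)) (trans (suc-injective (suc-injective e)) (sym (≡ᵇ-true p₂)))))))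
  ... | false | false = mirror p i j (trans (sym (+-suc i j)) (suc-injective (suc-injective e)))

-- Letters come in mirror pairs except for a middle one, which exists only in odd length. This is
-- where the parity of dn enters.
palindrome : ∀ L s → s ≤ L → (∃ λ k → s ≡ 2 * k) ⊎ (∃ λ k → L ≡ suc (2 * k)) → Palindrome L s
palindrome zero zero _ _ = record { word = λ _ → false ; mirror = λ _ _ _ → refl ; weight≡ = refl }
palindrome (suc zero) zero _ _ = record { word = λ _ → false ; mirror = λ _ _ _ → refl ; weight≡ = refl }
palindrome (suc zero) (suc zero) _ _ = record { word = λ _ → true ; mirror = λ _ _ _ → refl ; weight≡ = refl }
palindrome (suc zero) (suc (suc s)) (s≤s ()) _
palindrome (suc (suc L)) zero _ _ = subst (Palindrome (2 + L)) refl (wrap false (palindrome L 0 z≤n (inj₁ (0 , refl))))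
palindrome (suc (suc L)) (suc zero) _ (inj₁ (suc k , e)) with trans (suc-injective e) (+-suc k (k + 0))
... | ()
palindrome (suc (suc L)) (suc zero) _ (inj₂ (suc k , e)) = wrap false (palindrome L 1 (≤-trans (s≤s z≤n) (≤-reflexive (sym L≡))) (inj₂ (k , L≡)))
  where
  L≡ : L ≡ suc (2 * k)
  L≡ = trans (suc-injective (suc-injective e)) (+-suc k (k + 0))
palindrome (suc (suc L)) (suc (suc s)) (s≤s (s≤s h)) c = subst (Palindrome (2 + L)) (trans (cong suc (+-comm s 1)) refl) (wrap true (palindrome L s h (parity c)))
  where
  parity : (∃ λ k → suc (suc s) ≡ 2 * k) ⊎ (∃ λ k → suc (suc L) ≡ suc (2 * k)) → (∃ λ k → s ≡ 2 * k) ⊎ (∃ λ k → L ≡ suc (2 * k))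
  parity (inj₁ (suc k , e)) = inj₁ (k , suc-injective (trans (suc-injective e) (+-suc k (k + 0))))
  parity (inj₂ (suc k , e)) = inj₂ (k , trans (suc-injective (suc-injective e)) (+-suc k (k + 0)))

module Circulant {L d : ℕ} (p : Palindrome L d) where

  step : ℕ → Bool
  step zero = false
  step (suc k) = word p k

  circulant : Graph (suc L)
  circulant i j = step ∣ toℕ i - toℕ j ∣

  row : ℕ → ℕ
  row i = below (λ j → ⟦ step ∣ i - j ∣ ⟧) (suc L)

  -- The next row gains `word p i` at its front and loses its last entry, which is the mirror image
  -- of that letter.
  row≡ : ∀ i → i ≤ L → row i ≡ d
  row≡ zero _ = trans (below-first _ L) (weight≡ p)
  row≡ (suc i) i<L = begin
    row (suc i) ≡⟨ below-first _ L ⟩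
    ⟦ word p i ⟧ + below (λ j → ⟦ step ∣ i - j ∣ ⟧) L ≡⟨ +-comm ⟦ word p i ⟧ _ ⟩
    below (λ j → ⟦ step ∣ i - j ∣ ⟧) L + ⟦ word p i ⟧ ≡⟨ cong (λ b → below (λ j → ⟦ step ∣ i - j ∣ ⟧) L + ⟦ b ⟧) same ⟩
    row i ≡⟨ row≡ i (<⇒≤ i<L) ⟩
    d ∎
    where
    open ≡-Reasoning
    same : word p i ≡ step ∣ i - L ∣
    same = trans (mirror p i (L ∸ suc i) (m+[n∸m]≡n i<L)) (sym (cong step (trans (m≤n⇒∣m-n∣≡n∸m (<⇒≤ i<L)) (+-∸-assoc 1 i<L))))

  circulant-regular : Regular d circulant
  circulant-regular = record
    { symm = λ i j → cong step (∣-∣-comm (toℕ i) (toℕ j))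
    ; irr = λ i → cong step (∣n-n∣≡0 (toℕ i))
    ; deg = λ i → trans (sum-below (λ j → ⟦ step ∣ toℕ i - j ∣ ⟧)) (row≡ (toℕ i) (≤-pred (toℕ<n i))) }

regular-exists : ∀ {n d} → d < n → 2 ∣ d * n → 0 < sumR {n} d (λ _ → 1)
regular-exists {suc L} {d} (s≤s d≤L) (divides q e) = sumR-hit d (λ _ → 1) (λ _ _ _ → refl) circulant circulant-regular
  where
  halve : ∀ m → (∃ λ k → m ≡ 2 * k) ⊎ (∃ λ k → m ≡ suc (2 * k))
  halve zero = inj₁ (0 , refl)
  halve (suc m) with halve m
  ... | inj₁ (k , e) = inj₂ (k , cong suc e)
  ... | inj₂ (k , e) = inj₁ (suc k , trans (cong suc e) (cong suc (sym (+-suc k (k + 0)))))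
  parity : (∃ λ k → d ≡ 2 * k) ⊎ (∃ λ k → L ≡ suc (2 * k))
  parity with halve d | halve L
  ... | inj₁ x | _ = inj₁ x
  ... | inj₂ _ | inj₂ y = inj₂ y
  ... | inj₂ (k , dk) | inj₁ (l , Ll) = ⊥-elim (even≢odd q (l + k + 2 * (k * l)) (trans (*-comm 2 q) (trans (sym e) (trans (cong₂ (λ d L → d * suc L) dk Ll) (lem k l)))))
    where
    lem : ∀ k l → suc (2 * k) * suc (2 * l) ≡ suc (2 * (l + k + 2 * (k * l)))
    lem = solve-∀
  open Circulant (palindrome L d d≤L parity)

least : ∀ (P : ℕ → Set) → (∀ k → Dec (P k)) → ∀ m → P m → ∃ λ k → P k × (∀ j → j < k → ¬ P j)
least P dec m pm = go 0 m (λ _ ()) (subst P (sym (+-identityʳ m)) pm)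
  where
  go : ∀ s m → (∀ j → j < s → ¬ P j) → P (m + s) → ∃ λ k → P k × (∀ j → j < k → ¬ P j)
  go s m none pm with dec s
  ... | yes ps = s , ps , none
  go s zero none pm | no ¬ps = ⊥-elim (¬ps pm)
  go s (suc m) none pm | no ¬ps = go (suc s) m extended (subst P (sym (+-suc m s)) pm)
    where
    extended : ∀ j → j < suc s → ¬ P j
    extended j (s≤s j≤s) with m≤n⇒m<n∨m≡n j≤s
    ... | inj₁ j<s = none j j<s
    ... | inj₂ refl = ¬ps

-- The two-point argument

module TwoPoint {n : ℕ} (d e : ℕ) {{n≢0 : NonZero n}} {{d≢0 : NonZero d}} {{e≢0 : NonZero e}} (0<N : 0 < sumR {n} d (λ _ → 1)) where

  N : ℕ
  N = sumR {n} d (λ _ → 1)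

  prob : (Graph n → Bool) → ℕ
  prob P = sumR d (λ G → ⟦ P G ⟧)

  C : ℕ → ℕ
  C k = prob (colourable k)

  prob-mono : ∀ {P P′ : Graph n → Bool} → (∀ G → Regular d G → P G ≡ true → P′ G ≡ true) → prob P ≤ prob P′
  prob-mono h = sumR-mono d (λ G R → ⟦⟧-mono (h G R))

  C-mono : ∀ {j k} → j ≤ k → C j ≤ C k
  C-mono h = prob-mono (λ G _ → colourable-mono G h)

  prob-cover : ∀ {P P₁ P₂ : Graph n → Bool} → (∀ G → Regular d G → P₁ G ≡ false → P₂ G ≡ false → P G ≡ false) → prob P ≤ prob P₁ + prob P₂
  prob-cover {P} {P₁} {P₂} h = ≤-trans (sumR-mono d point) (≤-reflexive (sumR-+ d _ _))
    where
    point : ∀ G → Regular d G → ⟦ P G ⟧ ≤ ⟦ P₁ G ⟧ + ⟦ P₂ G ⟧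
    point G R with P₁ G in e₁ | P₂ G in e₂
    ... | true | _ = ≤-trans (⟦⟧≤1 (P G)) (s≤s z≤n)
    ... | false | true = ⟦⟧≤1 (P G)
    ... | false | false = ≤-reflexive (⟦⟧-false (h G R e₁ e₂))

  Frequent : ℕ → Set
  Frequent t = N ≤ 3 * e * C t

  -- For the least frequent value, fewer colours suffice with probability below 1 / (3e) by
  -- minimality, and more than one extra colour is needed with probability at most 2 / (3e) by
  -- `extends`. The premise `rare` places that value above t₀, where `extends` applies.
  module _ (t₀ : ℕ) (rare : 3 * e * C t₀ < N) (extends : ∀ t → t₀ < t → Frequent t → 3 * e * prob (λ G → not (colourable (suc t) G)) ≤ 2 * N) where

    two-point : ∃ λ t → e * prob (λ G → not (χIn t G)) ≤ N
    two-point with least Frequent (λ k → N ≤? 3 * e * C k) n frequent-n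
      where
      frequent-n : Frequent n
      frequent-n = ≤-trans (sumR-mono d (λ G R → ≤-reflexive (sym (⟦⟧-true (colourable-n G (irr R)))))) (m≤n*m (C n) (3 * e) {{m*n≢0 3 e}})
    ... | t , freq , smallest with t₀ <? t
    ...   | no ¬p = ⊥-elim (<⇒≱ rare (≤-trans freq (*-monoʳ-≤ (3 * e) (C-mono (≮⇒≥ ¬p)))))
    two-point | suc t , freq , smallest | yes t₀<t = suc t , *-cancelˡ-≤ 3 (begin
      3 * (e * prob (λ G → not (χIn (suc t) G))) ≡⟨ *-assoc 3 e _ ⟨
      3 * e * prob (λ G → not (χIn (suc t) G)) ≤⟨ *-monoʳ-≤ (3 * e) (prob-cover {P₁ = colourable t} {P₂ = λ G → not (colourable (2 + t) G)} cover) ⟩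
      3 * e * (C t + prob (λ G → not (colourable (2 + t) G))) ≡⟨ *-distribˡ-+ (3 * e) (C t) _ ⟩
      3 * e * C t + 3 * e * prob (λ G → not (colourable (2 + t) G)) ≤⟨ +-mono-≤ (<⇒≤ (≰⇒> (smallest t ≤-refl))) (extends (suc t) t₀<t freq) ⟩
      3 * N ∎)
      where
      open ≤-Reasoning
      cover : ∀ G → Regular d G → colourable t G ≡ false → not (colourable (2 + t) G) ≡ false → not (χIn (suc t) G) ≡ false
      cover G R no-t yes-t = cong not (χIn-intro G (irr R) t no-t (not-true⁻ yes-t))
        where
        not-true⁻ : ∀ {b} → not b ≡ false → b ≡ true
        not-true⁻ {true} _ = refl

  -- Chebyshev: 6 e low ≥ N and variance at most Λ² / (72 e²) leave at most N / (12 e) graphs with large defect.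
  chebyshev : ∀ {low high v Λ} {{_ : NonZero Λ}} → low * (high * (Λ * Λ)) ≤ v * (N * N) → N ≤ 6 * e * low → 72 * (e * e) * v ≤ Λ * Λ → 12 * e * high ≤ N
  chebyshev {low} {high} {v} {Λ} {{Λ≢0}} h hl hv = *-cancelˡ-≤ (N * (Λ * Λ)) {{m*n≢0 N (Λ * Λ) {{>-nonZero 0<N}} {{m*n≢0 Λ Λ}}}} (begin
    N * (Λ * Λ) * (12 * e * high) ≤⟨ *-monoˡ-≤ (12 * e * high) (*-monoˡ-≤ (Λ * Λ) hl) ⟩
    6 * e * low * (Λ * Λ) * (12 * e * high) ≡⟨ lem e low high (Λ * Λ) ⟩
    72 * (e * e) * (low * (high * (Λ * Λ))) ≤⟨ *-monoʳ-≤ (72 * (e * e)) h ⟩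
    72 * (e * e) * (v * (N * N)) ≡⟨ *-assoc (72 * (e * e)) v _ ⟨
    72 * (e * e) * v * (N * N) ≤⟨ *-monoˡ-≤ (N * N) hv ⟩
    Λ * Λ * (N * N) ≡⟨ lem′ (Λ * Λ) N ⟩
    N * (Λ * Λ) * N ∎)
    where
    open ≤-Reasoning
    lem : ∀ e l h m → 6 * e * l * m * (12 * e * h) ≡ 72 * (e * e) * (l * (h * m))
    lem = solve-∀
    lem′ : ∀ l N → l * (N * N) ≡ N * l * N
    lem′ = solve-∀

  module WithColours (Λ α v : ℕ) {{Λ≢0 : NonZero Λ}} (small-v : 72 * (e * e) * v ≤ Λ * Λ) where

    module At (t : ℕ) where
      open Defect {n} t d Λ α public
      low high : ℕ
      low = prob (λ G → defect G ≡ᵇ 0)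
      high = prob (λ G → atLeast Λ (defect G))

    module _ (conc : ∀ t → At.low t * (At.high t * (Λ * Λ)) ≤ v * (N * N)) where

      Q : ℕ
      Q = 12 * e

      2≤Q : 2 ≤ Q
      2≤Q = ≤-trans (m≤m+n 2 10) (m≤m*n 12 e)

      open Colour {n} d Λ Q 2≤Q

      defect-high : ∀ t → N ≤ 6 * e * At.low t → Q * At.high t ≤ N
      defect-high t hl = chebyshev {v = v} (conc t) hl small-v

      not-colourable′ : ∀ {b} → b ≡ true → not b ≡ false
      not-colourable′ refl = refl

      -- As n ≤ α, every proper t-colouring has defect zero, so `low` is at least C t. Excluding two
      -- colours leaves t ≥ 3, which `extend-few` needs.
      few-colours : (∀ (c : ℕ) → n ≤ α) → 12 * e * C 2 ≤ N → Q * prob (Dense₁₅.exceptional (7 * Λ)) ≤ 2 * N → ∃ λ t → e * prob (λ G → not (χIn t G)) ≤ N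
      few-colours n≤α bip exc = two-point 2 rare extends
        where
        open ≤-Reasoning
        quarter : ∀ x → 12 * e * x ≡ 4 * (3 * e * x)
        quarter x = lem e x
          where
          lem : ∀ e x → 12 * e * x ≡ 4 * (3 * e * x)
          lem = solve-∀
        rare : 3 * e * C 2 < N
        rare with N ≤? 3 * e * C 2
        ... | no ¬p = ≰⇒> ¬p
        ... | yes p = ⊥-elim (<⇒≱ (*-monoˡ-< N {{>-nonZero 0<N}} (s≤s (s≤s (z≤n {2})))) (≤-trans (*-monoʳ-≤ 4 p) (≤-trans (≤-reflexive (sym (quarter (C 2)))) (≤-trans bip (≤-reflexive (sym (*-identityˡ N)))))))
        extends : ∀ t → 2 < t → Frequent t → 3 * e * prob (λ G → not (colourable (suc t) G)) ≤ 2 * N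
        extends t 2<t freq = *-cancelˡ-≤ 4 (begin
          4 * (3 * e * bad) ≡⟨ quarter bad ⟨
          Q * bad ≤⟨ *-monoʳ-≤ Q (prob-cover {P₁ = Dense₁₅.exceptional (7 * Λ)} {P₂ = λ G → atLeast Λ (defect G)} cover) ⟩
          Q * (prob (Dense₁₅.exceptional (7 * Λ)) + high) ≡⟨ *-distribˡ-+ Q _ high ⟩
          Q * prob (Dense₁₅.exceptional (7 * Λ)) + Q * high ≤⟨ +-mono-≤ exc (defect-high t enough) ⟩
          2 * N + N ≤⟨ m≤m+n _ (5 * N) ⟩
          2 * N + N + 5 * N ≡⟨ lem N ⟩
          4 * (2 * N) ∎)
          where
          open At t
          bad : ℕ
          bad = prob (λ G → not (colourable (suc t) G))
          lem : ∀ N → 2 * N + N + 5 * N ≡ 4 * (2 * N)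
          lem = solve-∀
          cover : ∀ G → Regular d G → Dense₁₅.exceptional (7 * Λ) G ≡ false → atLeast Λ (defect G) ≡ false → not (colourable (suc t) G) ≡ false
          cover G R e₁ e₂ with defect-small G e₂
          ... | c , m = not-colourable′ (extend-few G R c m 2<t e₁)
          enough : N ≤ 6 * e * low
          enough = ≤-trans freq (*-mono-≤ (*-monoˡ-≤ e (m≤m+n 3 3)) (prob-mono (λ G R q → let (c , p) = colourable⇒ t G q in
            cong (_≡ᵇ 0) (defect-zero G c p (λ v → ≤-trans (count≤ _) (n≤α 0))))))

      -- Large independent sets are excluded for two purposes: without them no graph is
      -- t₀-colourable, and every proper colouring has classes of size at most α. The latter leaves
      -- `low` at least half of the frequency 1 / (3e).
      many-colours : ∀ t₀ τ → 0 < α → t₀ * α ≤ n → 48 ≤ suc t₀ → 48 * τ ≤ suc t₀ →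
        (let open IndependentSets {n} d Q in Q * prob (Large.exceptional α α) ≤ 2 * N) →
        Q * prob (Dense₁₂.exceptional (2 * Λ)) ≤ 2 * N → Q * prob (Crowded.exceptional τ Λ) ≤ 2 * N → ∃ λ t → e * prob (λ G → not (χIn t G)) ≤ N
      many-colours t₀ τ 0<α t₀α≤n 48≤ τ≤ excα exc₁₂ exc = two-point t₀ rare extends
        where
        open ≤-Reasoning
        module I = IndependentSets.Large {n} d Q α
        quarter : ∀ e x → 12 * e * x ≡ 4 * (3 * e * x)
        quarter = solve-∀
        rare : 3 * e * C t₀ < N
        rare with N ≤? 3 * e * C t₀
        ... | no ¬p = ≰⇒> ¬p
        ... | yes p = ⊥-elim (<⇒≱ (*-monoˡ-< N {{>-nonZero 0<N}} (s≤s (s≤s (s≤s (z≤n {1}))))) (≤-trans (*-monoʳ-≤ 4 p) (≤-trans (≤-reflexive (sym (quarter e (C t₀)))) (≤-trans (*-monoʳ-≤ Q (prob-mono cover)) excα))))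
          where
          cover : ∀ G → Regular d G → colourable t₀ G ≡ true → I.exceptional α G ≡ true
          cover G R q with I.exceptional α G in x
          ... | true = refl
          ... | false = ⊥-elim (true≢false q (I.not-colourable t₀ G 0<α t₀α≤n x))
        extends : ∀ t → t₀ < t → Frequent t → 3 * e * prob (λ G → not (colourable (suc t) G)) ≤ 2 * N
        extends t t₀<t freq = *-cancelˡ-≤ 4 (begin
          4 * (3 * e * bad) ≡⟨ quarter e bad ⟨
          Q * bad ≤⟨ *-monoʳ-≤ Q (≤-trans (prob-cover {P₁ = Dense₁₂.exceptional (2 * Λ)} {P₂ = λ G → Crowded.exceptional τ Λ G ∨ atLeast Λ (defect G)} cover)
              (+-monoʳ-≤ (prob (Dense₁₂.exceptional (2 * Λ))) (prob-cover {P₁ = Crowded.exceptional τ Λ} {P₂ = λ G → atLeast Λ (defect G)} (λ G _ p q → trans (cong₂ _∨_ p q) refl)))) ⟩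
          Q * (prob (Dense₁₂.exceptional (2 * Λ)) + (prob (Crowded.exceptional τ Λ) + high)) ≡⟨ lem Q (prob (Dense₁₂.exceptional (2 * Λ))) (prob (Crowded.exceptional τ Λ)) high ⟩
          Q * prob (Dense₁₂.exceptional (2 * Λ)) + Q * prob (Crowded.exceptional τ Λ) + Q * high ≤⟨ +-mono-≤ (+-mono-≤ exc₁₂ exc) (defect-high t enough) ⟩
          2 * N + 2 * N + N ≤⟨ m≤m+n _ (3 * N) ⟩
          2 * N + 2 * N + N + 3 * N ≡⟨ lem′ N ⟩
          4 * (2 * N) ∎)
          where
          open At t
          bad : ℕ
          bad = prob (λ G → not (colourable (suc t) G))
          lem : ∀ q a b c → q * (a + (b + c)) ≡ q * a + q * b + q * c
          lem = solve-∀
          lem′ : ∀ N → 2 * N + 2 * N + N + 3 * N ≡ 4 * (2 * N)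
          lem′ = solve-∀
          cover : ∀ G → Regular d G → Dense₁₂.exceptional (2 * Λ) G ≡ false → Crowded.exceptional τ Λ G ∨ atLeast Λ (defect G) ≡ false → not (colourable (suc t) G) ≡ false
          cover G R e₁ e₂ with Crowded.exceptional τ Λ G in e₃
          ... | false with defect-small G e₂
          ...   | c , m = not-colourable′ (extend-many τ G R c m (≤-trans 48≤ t₀<t) (≤-trans τ≤ t₀<t) e₁ e₃)
          enough : N ≤ 6 * e * low
          enough = *-cancelˡ-≤ 2 (+-cancelʳ-≤ (2 * N) _ _ (begin
            2 * N + 2 * N ≡⟨ lem₁ N ⟩
            4 * N ≤⟨ *-monoʳ-≤ 4 freq ⟩
            4 * (3 * e * C t) ≡⟨ quarter e (C t) ⟨
            Q * C t ≤⟨ *-monoʳ-≤ Q (prob-cover {P₁ = λ G → defect G ≡ᵇ 0} {P₂ = I.exceptional α} cover′) ⟩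
            Q * (low + prob (I.exceptional α)) ≡⟨ *-distribˡ-+ Q low _ ⟩
            Q * low + Q * prob (I.exceptional α) ≤⟨ +-monoʳ-≤ (Q * low) excα ⟩
            Q * low + 2 * N ≡⟨ cong (_+ 2 * N) (lem₂ e low) ⟩
            2 * (6 * e * low) + 2 * N ∎))
            where
            lem₁ : ∀ N → 2 * N + 2 * N ≡ 4 * N
            lem₁ = solve-∀
            lem₂ : ∀ e l → 12 * e * l ≡ 2 * (6 * e * l)
            lem₂ = solve-∀
            cover′ : ∀ G → Regular d G → (defect G ≡ᵇ 0) ≡ false → I.exceptional α G ≡ false → colourable t G ≡ false
            cover′ G R z x with bool-cases (colourable t G)
            ... | inj₂ q = q
            ... | inj₁ q with colourable⇒ t G q
            ...   | c , p = ⊥-elim (true≢false (cong (_≡ᵇ 0) (defect-zero G c p (I.classes-small G 0<α x c p))) z)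

-- Numerical estimates

^-cancel-≤ : ∀ k {x y} {{_ : NonZero k}} → x ^ k ≤ y ^ k → x ≤ y
^-cancel-≤ k {x} {y} h with x ≤? y
... | yes p = p
... | no ¬p = ⊥-elim (<⇒≱ (^-monoˡ-< k (≰⇒> ¬p)) h)

quotients : ∀ A j k → harmonic A (j + k) ≤ harmonic A j + (k + k * (A div suc j))
quotients A j zero = ≤-reflexive (trans (cong (harmonic A) (+-identityʳ j)) (sym (+-identityʳ _)))
quotients A j (suc k) = begin
  harmonic A (j + suc k) ≡⟨ cong (harmonic A) (+-suc j k) ⟩
  harmonic A (j + k) + suc (A div suc (j + k)) ≤⟨ +-mono-≤ (quotients A j k) (s≤s (/-monoʳ-≤ A (s≤s (m≤m+n j k)))) ⟩
  harmonic A j + (k + k * (A div suc j)) + suc (A div suc j) ≡⟨ lem (harmonic A j) k (A div suc j) ⟩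
  harmonic A j + (suc k + suc k * (A div suc j)) ∎
  where
  open ≤-Reasoning
  lem : ∀ h k q → h + (k + k * q) + (1 + q) ≡ h + ((1 + k) + (1 + k) * q)
  lem = solve-∀

-- Each of the m dyadic blocks contributes at most A, apart from one unit of rounding per term.
harmonic≤ : ∀ A m D → D < 2 ^ m → harmonic A D ≤ D + A * m
harmonic≤ A zero zero _ = z≤n
harmonic≤ A zero (suc D) (s≤s ())
harmonic≤ A (suc m) D h with D <? 2 ^ m
... | yes p = ≤-trans (harmonic≤ A m D p) (+-monoʳ-≤ D (*-monoʳ-≤ A (n≤1+n m)))
... | no ¬p = begin
  harmonic A D ≡⟨ cong (harmonic A) j+k ⟨
  harmonic A (j + k) ≤⟨ quotients A j k ⟩
  harmonic A j + (k + k * (A div suc j)) ≤⟨ +-mono-≤ (harmonic≤ A m j (≤-reflexive j≡)) (+-monoʳ-≤ k (≤-trans (*-monoˡ-≤ (A div suc j) k≤) (≤-trans (≤-reflexive (*-comm (suc j) _)) (m/n*n≤m A (suc j))))) ⟩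
  j + A * m + (k + A) ≡⟨ lem j A m k ⟩
  j + k + A * suc m ≡⟨ cong (_+ A * suc m) j+k ⟩
  D + A * suc m ∎
  where
  open ≤-Reasoning
  j k : ℕ
  j = pred (2 ^ m)
  k = D ∸ j
  j≡ : suc j ≡ 2 ^ m
  j≡ = suc-pred (2 ^ m) {{m^n≢0 2 m}}
  j+k : j + k ≡ D
  j+k = m+[n∸m]≡n (≤-trans (≤-trans (n≤1+n j) (≤-reflexive j≡)) (≮⇒≥ ¬p))
  k≤ : k ≤ suc j
  k≤ = m≤n+o⇒m∸n≤o D j (≤-pred (≤-trans h (≤-reflexive (trans (cong (2 *_) (sym j≡)) (lem′ j)))))
    where
    lem′ : ∀ j → 2 * (1 + j) ≡ 1 + (j + (1 + j))
    lem′ = solve-∀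
  lem : ∀ j A m k → j + A * m + (k + A) ≡ j + k + A * (1 + m)
  lem = solve-∀

window≤ : ∀ D → window D ≤ D ^ 6
window≤ D = ≤-trans (*-mono-≤ (*-mono-≤ (*-mono-≤ (*-mono-≤ (*-monoʳ-≤ D (m∸n≤m D 2)) (m∸n≤m D 4)) (m∸n≤m D 6)) (m∸n≤m D 8)) (m∸n≤m D 10)) (≤-reflexive (lem D))
  where
  lem : ∀ D → D * D * D * D * D * D ≡ D * (D * (D * (D * (D * (D * 1)))))
  lem = solve-∀

≤window : ∀ D → 20 ≤ D → D ^ 6 ≤ 64 * window D
≤window D h = ≤-trans (≤-reflexive (lem D)) (≤-trans (*-mono-≤ (*-mono-≤ (*-mono-≤ (*-mono-≤ (*-mono-≤ (m≤n*m D 2) (half 2 (m≤m+n 4 16))) (half 4 (m≤m+n 8 12))) (half 6 (m≤m+n 12 8))) (half 8 (m≤m+n 16 4))) (half 10 ≤-refl))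
    (≤-reflexive (lem′ D (D ∸ 2) (D ∸ 4) (D ∸ 6) (D ∸ 8) (D ∸ 10))))
  where
  lem : ∀ D → D * (D * (D * (D * (D * (D * 1))))) ≡ D * D * D * D * D * D
  lem = solve-∀
  lem′ : ∀ a b c d e f → 2 * a * (2 * b) * (2 * c) * (2 * d) * (2 * e) * (2 * f) ≡ 64 * (a * b * c * d * e * f)
  lem′ = solve-∀
  half : ∀ k → 2 * k ≤ 20 → D ≤ 2 * (D ∸ k)
  half k k≤ = +-cancelʳ-≤ (2 * k) D (2 * (D ∸ k)) (begin
    D + 2 * k ≤⟨ +-monoʳ-≤ D (≤-trans k≤ h) ⟩
    D + D ≡⟨ cong (D +_) (+-identityʳ D) ⟨
    2 * D ≡⟨ cong (2 *_) (m∸n+n≡m (≤-trans (m≤m+n k (k + 0)) (≤-trans k≤ h))) ⟨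
    2 * (D ∸ k + k) ≡⟨ *-distribˡ-+ 2 (D ∸ k) k ⟩
    2 * (D ∸ k) + 2 * k ∎)
    where open ≤-Reasoning

-- ℓ plays the role of log n and r that of √n. The exponent 400 is generous, so that after the roots
-- taken below every power of ℓ that occurs is still absorbed; constants and e² are absorbed by a
-- single factor ℓ.
module Numbers {n d ℓ r e : ℕ} {{e≢0 : NonZero e}} (3≤d : 3 ≤ d) (d⁵≤n : d ^ 5 ≤ n) (n≤r² : n ≤ r ^ 2) (r²≤4n : r ^ 2 ≤ 4 * n)
  (large : 576000 * (e * e) ≤ ℓ) (ℓ^≤n : ℓ ^ 400 ≤ n) (n≤2^ℓ : n ≤ 2 ^ ℓ) where

  open ≤-Reasoning

  constant : ∀ {c} → c ≤ 576000 → c ≤ ℓ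
  constant h = ≤-trans h (≤-trans (m≤m*n 576000 (e * e) {{m*n≢0 e e}}) large)

  instance
    ℓ≢0 : NonZero ℓ
    ℓ≢0 = >-nonZero (constant (s≤s z≤n))
    n≢0 : NonZero n
    n≢0 = >-nonZero (≤-trans (>-nonZero⁻¹ (ℓ ^ 400) {{m^n≢0 ℓ 400}}) ℓ^≤n)
    d≢0 : NonZero d
    d≢0 = >-nonZero (≤-trans (s≤s z≤n) 3≤d)
    r≢0 : NonZero r
    r≢0 = nonzero r n≤r²
      where
      nonzero : ∀ r → n ≤ r ^ 2 → NonZero r
      nonzero zero h = ⊥-elim (<⇒≱ (>-nonZero⁻¹ n) h)
      nonzero (suc r) h = _

  12e≤ℓ : 12 * e ≤ ℓ
  12e≤ℓ = ≤-trans (*-mono-≤ (m≤m+n 12 575988) (m≤m*n e e)) large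

  raise : ∀ x c k → c ≤ ℓ → x * c * ℓ ^ k ≤ x * ℓ ^ suc k
  raise x c k h = ≤-trans (≤-reflexive (*-assoc x c (ℓ ^ k))) (*-monoʳ-≤ x (*-monoˡ-≤ (ℓ ^ k) h))

  power : ∀ k → k ≤ 400 → ℓ ^ k ≤ n
  power k h = ≤-trans (^-monoʳ-≤ ℓ h) ℓ^≤n

  d²⁰ : d ^ 20 ≤ n ^ 4
  d²⁰ = ≤-trans (≤-reflexive (sym (^-*-assoc d 5 4))) (^-monoˡ-≤ 4 d⁵≤n)

  -- From d⁵ ≤ n the power d⁴ is at most n^(4/5); the remaining n^(1/5) exceeds ℓ^50. Taking fifth
  -- powers avoids roots.
  d⁴-small : d ^ 4 * ℓ ^ 50 ≤ n
  d⁴-small = ^-cancel-≤ 5 (begin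
    (d ^ 4 * ℓ ^ 50) ^ 5 ≡⟨ trans (*^-distrib (d ^ 4) (ℓ ^ 50) 5) (cong₂ _*_ (^-*-assoc d 4 5) (^-*-assoc ℓ 50 5)) ⟩
    d ^ 20 * ℓ ^ 250 ≤⟨ *-mono-≤ d²⁰ (power 250 (m≤m+n 250 150)) ⟩
    n ^ 4 * n ≡⟨ *-comm (n ^ 4) n ⟩
    n ^ 5 ∎)

  r-small : r * ℓ ^ 150 ≤ n
  r-small = ^-cancel-≤ 2 (begin
    (r * ℓ ^ 150) ^ 2 ≡⟨ trans (*^-distrib r (ℓ ^ 150) 2) (cong (r ^ 2 *_) (^-*-assoc ℓ 150 2)) ⟩
    r ^ 2 * ℓ ^ 300 ≤⟨ *-monoˡ-≤ (ℓ ^ 300) (≤-trans r²≤4n (≤-reflexive (*-comm 4 n))) ⟩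
    n * 4 * ℓ ^ 300 ≤⟨ raise n 4 300 (constant (m≤m+n 4 575996)) ⟩
    n * ℓ ^ 301 ≤⟨ *-monoʳ-≤ n (≤-trans (power 301 (m≤m+n 301 99)) (≤-reflexive (sym (*-identityʳ n)))) ⟩
    n ^ 2 ∎)

  d²r-small : d ^ 2 * r * ℓ ^ 20 ≤ n
  d²r-small = ^-cancel-≤ 10 (begin
    (d ^ 2 * r * ℓ ^ 20) ^ 10
      ≡⟨ trans (*^-distrib (d ^ 2 * r) (ℓ ^ 20) 10) (cong₂ _*_ (trans (*^-distrib (d ^ 2) r 10) (cong₂ _*_ (^-*-assoc d 2 10) (sym (^-*-assoc r 2 5)))) (^-*-assoc ℓ 20 10)) ⟩
    d ^ 20 * (r ^ 2) ^ 5 * ℓ ^ 200 ≤⟨ *-monoˡ-≤ (ℓ ^ 200) (*-mono-≤ d²⁰ (≤-trans (^-monoˡ-≤ 5 r²≤4n) (≤-reflexive (trans (*^-distrib 4 n 5) (*-comm 1024 (n ^ 5)))))) ⟩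
    n ^ 4 * (n ^ 5 * 1024) * ℓ ^ 200 ≡⟨ cong (_* ℓ ^ 200) (*-assoc (n ^ 4) (n ^ 5) 1024) ⟨
    n ^ 4 * n ^ 5 * 1024 * ℓ ^ 200 ≤⟨ raise (n ^ 4 * n ^ 5) 1024 200 (constant (m≤m+n 1024 574976)) ⟩
    n ^ 4 * n ^ 5 * ℓ ^ 201 ≤⟨ *-monoʳ-≤ (n ^ 4 * n ^ 5) (power 201 (m≤m+n 201 199)) ⟩
    n ^ 4 * n ^ 5 * n ≡⟨ trans (cong (_* n) (sym (^-distribˡ-+-* n 4 5))) (*-comm (n ^ 9) n) ⟩
    n ^ 10 ∎)

  1≤ℓ^ : ∀ k → 1 ≤ ℓ ^ k
  1≤ℓ^ k = >-nonZero⁻¹ (ℓ ^ k) {{m^n≢0 ℓ k}}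

  d⁴≤n : d ^ 4 ≤ n
  d⁴≤n = ≤-trans (≤-trans (≤-reflexive (sym (*-identityʳ _))) (*-monoʳ-≤ (d ^ 4) (1≤ℓ^ 50))) d⁴-small

  d²≤r : d ^ 2 ≤ r
  d²≤r = ^-cancel-≤ 2 (≤-trans (≤-reflexive (^-*-assoc d 2 2)) (≤-trans d⁴≤n n≤r²))

  d≤n : d ≤ n
  d≤n = ≤-trans (≤-trans (≤-reflexive (sym (*-identityʳ d))) (^-monoʳ-≤ d (s≤s (z≤n {3})))) d⁴≤n

  -- Each ρ equals 9(EΛ)² / D for the bound 4d² or 20d on `E`. The factor ℓ² in `D₀` and `D₁` brings
  -- ρ down to order r²ℓ⁶, so that even after another factor ℓ from the harmonic sum it stays below
  -- Λ² = r²ℓ⁸.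
  Λ D₀ D₁ ρ₀ ρ₁ : ℕ
  Λ = r * ℓ ^ 4
  D₀ = 2 * ℓ ^ 2 * d ^ 4
  D₁ = 2 * ℓ ^ 2 * d ^ 2
  ρ₀ = 72 * (r ^ 2 * ℓ ^ 6)
  ρ₁ = 1800 * (r ^ 2 * ℓ ^ 6)

  2d+4≤ : 2 * d + 4 ≤ 4 * d
  2d+4≤ = ≤-trans (+-monoʳ-≤ (2 * d) (≤-trans (m≤m+n 4 2) (*-monoʳ-≤ 2 3≤d))) (≤-reflexive (lem d))
    where
    lem : ∀ d → 2 * d + 2 * d ≡ 4 * d
    lem = solve-∀

  1≤d^ : ∀ k → 1 ≤ d ^ k
  1≤d^ k = >-nonZero⁻¹ (d ^ k) {{m^n≢0 d k}}

  E₀ : (2 * d + 4) * d ≤ 4 * d ^ 2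
  E₀ = ≤-trans (*-monoˡ-≤ d 2d+4≤) (≤-reflexive (lem d))
    where
    lem : ∀ d → 4 * d * d ≡ 4 * (d * (d * 1))
    lem = solve-∀

  E₁ : (2 * d + 4) * 5 ≤ 20 * d
  E₁ = ≤-trans (*-monoˡ-≤ 5 2d+4≤) (≤-reflexive (lem d))
    where
    lem : ∀ d → 4 * d * 5 ≡ 20 * d
    lem = solve-∀

  20≤ℓ² : 20 ≤ ℓ ^ 2
  20≤ℓ² = ≤-trans (constant (m≤m+n 20 575980)) (≤-trans (≤-reflexive (sym (*-identityʳ ℓ))) (^-monoʳ-≤ ℓ (s≤s (z≤n {1}))))

  2≤D₁ : 2 ≤ D₁
  2≤D₁ = *-mono-≤ (*-monoʳ-≤ 2 (1≤ℓ^ 2)) (1≤d^ 2)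

  2E₁≤D₁ : 2 * ((2 * d + 4) * 5) ≤ D₁
  2E₁≤D₁ = begin
    2 * ((2 * d + 4) * 5) ≤⟨ *-monoʳ-≤ 2 E₁ ⟩
    2 * (20 * d) ≡⟨ *-assoc 2 20 d ⟨
    2 * 20 * d ≤⟨ *-mono-≤ (*-monoʳ-≤ 2 20≤ℓ²) (≤-trans (≤-reflexive (sym (*-identityʳ d))) (^-monoʳ-≤ d (s≤s (z≤n {1})))) ⟩
    D₁ ∎

  11≤D₀ : 11 ≤ D₀
  11≤D₀ = ≤-trans (m≤m+n 11 29) (*-mono-≤ (*-monoʳ-≤ 2 20≤ℓ²) (1≤d^ 4))

  2E₀≤D₀ : 2 * ((2 * d + 4) * d) ≤ D₀
  2E₀≤D₀ = begin
    2 * ((2 * d + 4) * d) ≤⟨ *-monoʳ-≤ 2 E₀ ⟩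
    2 * (4 * d ^ 2) ≡⟨ *-assoc 2 4 (d ^ 2) ⟨
    2 * 4 * d ^ 2 ≤⟨ *-mono-≤ (*-monoʳ-≤ 2 (≤-trans (m≤m+n 4 16) 20≤ℓ²)) (^-monoʳ-≤ d (s≤s (s≤s (z≤n {2})))) ⟩
    D₀ ∎

  9E₁≤ : 9 * ((2 * d + 4) * 5 * Λ * ((2 * d + 4) * 5 * Λ)) ≤ ρ₁ * D₁
  9E₁≤ = ≤-trans (*-monoʳ-≤ 9 (*-mono-≤ (*-monoˡ-≤ Λ E₁) (*-monoˡ-≤ Λ E₁))) (≤-reflexive (lem d r ℓ))
    where
    lem : ∀ d r l → 9 * (20 * d * (r * (l * (l * (l * (l * 1))))) * (20 * d * (r * (l * (l * (l * (l * 1)))))))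
      ≡ 1800 * (r * (r * 1) * (l * (l * (l * (l * (l * (l * 1))))))) * (2 * (l * (l * 1)) * (d * (d * 1)))
    lem = solve-∀

  9E₀≤ : 9 * ((2 * d + 4) * d * Λ * ((2 * d + 4) * d * Λ)) ≤ ρ₀ * D₀
  9E₀≤ = ≤-trans (*-monoʳ-≤ 9 (*-mono-≤ (*-monoˡ-≤ Λ E₀) (*-monoˡ-≤ Λ E₀))) (≤-reflexive (lem d r ℓ))
    where
    lem : ∀ d r l → 9 * (4 * (d * (d * 1)) * (r * (l * (l * (l * (l * 1))))) * (4 * (d * (d * 1)) * (r * (l * (l * (l * (l * 1)))))))
      ≡ 72 * (r * (r * 1) * (l * (l * (l * (l * (l * (l * 1))))))) * (2 * (l * (l * 1)) * (d * (d * (d * (d * 1)))))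
    lem = solve-∀

  D₀-small : suc D₀ ≤ 4 * ℓ ^ 2 * d ^ 4
  D₀-small = ≤-trans (+-monoˡ-≤ D₀ {1} {D₀} (≤-trans (s≤s z≤n) 11≤D₀)) (≤-reflexive (lem (ℓ ^ 2) (d ^ 4)))
    where
    lem : ∀ l d → 2 * l * d + 2 * l * d ≡ 4 * l * d
    lem = solve-∀

  D₀ℓ-small : suc D₀ * ℓ ^ 40 ≤ n
  D₀ℓ-small = begin
    suc D₀ * ℓ ^ 40 ≤⟨ *-monoˡ-≤ (ℓ ^ 40) (≤-trans D₀-small (*-monoˡ-≤ (d ^ 4) (*-monoˡ-≤ (ℓ ^ 2) (constant (m≤m+n 4 575996))))) ⟩
    ℓ ^ 3 * d ^ 4 * ℓ ^ 40 ≡⟨ trans (cong (_* ℓ ^ 40) (*-comm (ℓ ^ 3) (d ^ 4))) (trans (*-assoc (d ^ 4) _ _) (cong (d ^ 4 *_) (sym (^-distribˡ-+-* ℓ 3 40)))) ⟩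
    d ^ 4 * ℓ ^ 43 ≤⟨ *-monoʳ-≤ (d ^ 4) (^-monoʳ-≤ ℓ (m≤m+n 43 7)) ⟩
    d ^ 4 * ℓ ^ 50 ≤⟨ d⁴-small ⟩
    n ∎

  suc-D₀≤n : suc D₀ ≤ n
  suc-D₀≤n = ≤-trans (≤-trans (≤-reflexive (sym (*-identityʳ _))) (*-monoʳ-≤ (suc D₀) (1≤ℓ^ 40))) D₀ℓ-small

  20≤n : 20 ≤ n
  20≤n = ≤-trans 20≤ℓ² (power 2 (m≤m+n 2 398))

  20≤nd : 20 ≤ n * d
  20≤nd = ≤-trans 20≤n (m≤m*n n d)

  -- Five of the six factors D₀ are paid by d^20 ≤ n^4 up to ℓ^15. The sixth is smaller than n by
  -- ℓ^40 and absorbs all powers of ℓ, including those of Λ²; this is why the potential is of order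
  -- six.
  window-ratio : window (suc D₀) * (Λ * Λ) * (n * d ^ 6) ≤ window (n * d) * n
  window-ratio = *-cancelˡ-≤ 64 (begin
    64 * (window (suc D₀) * (Λ * Λ) * (n * d ^ 6)) ≤⟨ *-monoʳ-≤ 64 (*-monoˡ-≤ (n * d ^ 6) (*-monoˡ-≤ (Λ * Λ) (window≤ (suc D₀)))) ⟩
    64 * (suc D₀ * suc D₀ ^ 5 * (Λ * Λ) * (n * d ^ 6)) ≡⟨ lem₁ (suc D₀) (suc D₀ ^ 5) r (ℓ ^ 4) n (d ^ 6) ⟩
    suc D₀ ^ 5 * (64 * (r * (r * 1)) * (ℓ ^ 4 * ℓ ^ 4) * suc D₀) * (n * d ^ 6) ≤⟨ *-monoˡ-≤ (n * d ^ 6) core ⟩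
    n ^ 6 * (n * d ^ 6) ≡⟨ trans (*-comm (n ^ 6) _) (trans (*-assoc n _ _) (cong (n *_) (trans (*-comm (d ^ 6) _) (sym (*^-distrib n d 6))))) ⟩
    n * (n * d) ^ 6 ≤⟨ *-monoʳ-≤ n (≤window (n * d) 20≤nd) ⟩
    n * (64 * window (n * d)) ≡⟨ lem₂ n (window (n * d)) ⟩
    64 * (window (n * d) * n) ∎)
    where
    lem₁ : ∀ x p r l n q → 64 * (x * p * (r * l * (r * l)) * (n * q)) ≡ p * (64 * (r * (r * 1)) * (l * l) * x) * (n * q)
    lem₁ = solve-∀
    lem₂ : ∀ n w → n * (64 * w) ≡ 64 * (w * n)
    lem₂ = solve-∀
    fifth : suc D₀ ^ 5 ≤ n ^ 4 * ℓ ^ 15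
    fifth = begin
      suc D₀ ^ 5 ≤⟨ ^-monoˡ-≤ 5 (≤-trans D₀-small (≤-trans (*-monoˡ-≤ (d ^ 4) (*-monoˡ-≤ (ℓ ^ 2) (constant (m≤m+n 4 575996)))) (≤-reflexive (*-comm (ℓ ^ 3) (d ^ 4))))) ⟩
      (d ^ 4 * ℓ ^ 3) ^ 5 ≡⟨ trans (*^-distrib (d ^ 4) (ℓ ^ 3) 5) (cong₂ _*_ (^-*-assoc d 4 5) (^-*-assoc ℓ 3 5)) ⟩
      d ^ 20 * ℓ ^ 15 ≤⟨ *-monoˡ-≤ (ℓ ^ 15) d²⁰ ⟩
      n ^ 4 * ℓ ^ 15 ∎
    core : suc D₀ ^ 5 * (64 * (r * (r * 1)) * (ℓ ^ 4 * ℓ ^ 4) * suc D₀) ≤ n ^ 6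
    core = begin
      suc D₀ ^ 5 * (64 * (r * (r * 1)) * (ℓ ^ 4 * ℓ ^ 4) * suc D₀)
        ≤⟨ *-mono-≤ fifth (*-monoˡ-≤ (suc D₀) (*-mono-≤ (≤-trans (*-monoʳ-≤ 64 r²≤4n) (≤-trans (≤-reflexive (sym (*-assoc 64 4 n))) (*-monoˡ-≤ n (constant (m≤m+n 256 575744))))) (≤-reflexive (sym (^-distribˡ-+-* ℓ 4 4))))) ⟩
      n ^ 4 * ℓ ^ 15 * (ℓ * n * ℓ ^ 8 * suc D₀) ≡⟨ lem₃ (n ^ 4) (ℓ ^ 15) ℓ n (ℓ ^ 8) (suc D₀) ⟩
      n ^ 4 * n * (suc D₀ * (ℓ ^ 15 * (ℓ * ℓ ^ 8))) ≡⟨ cong (λ z → n ^ 4 * n * (suc D₀ * z)) (sym (^-distribˡ-+-* ℓ 15 9)) ⟩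
      n ^ 4 * n * (suc D₀ * ℓ ^ 24) ≤⟨ *-monoʳ-≤ (n ^ 4 * n) (≤-trans (*-monoʳ-≤ (suc D₀) (^-monoʳ-≤ ℓ (m≤m+n 24 16))) D₀ℓ-small) ⟩
      n ^ 4 * n * n ≡⟨ trans (*-comm (n ^ 4 * n) n) (cong (n *_) (*-comm (n ^ 4) n)) ⟩
      n ^ 6 ∎
      where
      lem₃ : ∀ p q l n s x → p * q * (l * n * s * x) ≡ p * n * (x * (q * (l * s)))
      lem₃ = solve-∀

  -- In this order: the last `D₁` hidden darts, the rounding in two harmonic sums, and the rates of
  -- both phases times the number 2ℓ + 1 of dyadic scales below nd.
  v : ℕ → ℕ
  v α = 2 * D₁ * (2 * D₁) + 2 * n + (96 * (α * d) + 576 * (d ^ 2 * Λ) + 1872 * (r ^ 2 * ℓ ^ 6)) * (2 * ℓ + 1)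

  -- The scale R is d here: rounding costs at most one unit for each of nd terms in either sum, and
  -- dividing by d leaves 2n.
  total≤ : ∀ α → let rate = λ δ̂ ρ → d * (16 * (α * δ̂) + 24 * ((2 * d + 4) * δ̂ * Λ) + ρ) in
    d * (2 * D₁ * (2 * D₁)) + harmonic (rate 5 ρ₁) (suc D₀) + harmonic (rate d ρ₀) (n * d) ≤ d * v α
  total≤ α = begin
    d * (2 * D₁ * (2 * D₁)) + harmonic a₅ (suc D₀) + harmonic a₀ (n * d)
      ≤⟨ +-mono-≤ (+-monoʳ-≤ (d * (2 * D₁ * (2 * D₁))) (≤-trans (harmonic≤ a₅ m (suc D₀) (exceeds (≤-trans suc-D₀≤n (m≤m*n n d)))) (+-monoˡ-≤ (a₅ * m) (≤-trans suc-D₀≤n (m≤m*n n d))))) (harmonic≤ a₀ m (n * d) (exceeds ≤-refl)) ⟩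
    d * (2 * D₁ * (2 * D₁)) + (n * d + a₅ * m) + (n * d + a₀ * m) ≡⟨ lem₁ d (2 * D₁ * (2 * D₁)) n (16 * (α * 5) + 24 * ((2 * d + 4) * 5 * Λ) + ρ₁) (16 * (α * d) + 24 * ((2 * d + 4) * d * Λ) + ρ₀) m ⟩
    d * (2 * D₁ * (2 * D₁) + 2 * n + ((16 * (α * 5) + 24 * ((2 * d + 4) * 5 * Λ) + ρ₁) + (16 * (α * d) + 24 * ((2 * d + 4) * d * Λ) + ρ₀)) * m)
      ≤⟨ *-monoʳ-≤ d (+-monoʳ-≤ (2 * D₁ * (2 * D₁) + 2 * n) (*-monoˡ-≤ m rates)) ⟩
    d * v α ∎
    where
    m a₅ a₀ : ℕ
    m = 2 * ℓ + 1
    a₅ = d * (16 * (α * 5) + 24 * ((2 * d + 4) * 5 * Λ) + ρ₁)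
    a₀ = d * (16 * (α * d) + 24 * ((2 * d + 4) * d * Λ) + ρ₀)
    exceeds : ∀ {x} → x ≤ n * d → x < 2 ^ m
    exceeds h = ≤-trans (s≤s (≤-trans h (*-mono-≤ n≤2^ℓ (≤-trans d≤n n≤2^ℓ)))) (≤-trans (+-monoˡ-≤ (2 ^ ℓ * 2 ^ ℓ) (*-mono-≤ (>-nonZero⁻¹ (2 ^ ℓ) {{m^n≢0 2 ℓ}}) (>-nonZero⁻¹ (2 ^ ℓ) {{m^n≢0 2 ℓ}})))
      (≤-reflexive (trans (lem (2 ^ ℓ)) (trans (cong (_* 2) (trans (sym (^-distribˡ-+-* 2 ℓ ℓ)) (cong (2 ^_) (cong (ℓ +_) (sym (+-identityʳ ℓ)))))) (sym (^-distribˡ-+-* 2 (2 * ℓ) 1))))))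
      where
      lem : ∀ p → p * p + p * p ≡ p * p * 2
      lem = solve-∀
    lem₁ : ∀ d x n a b m → d * x + (n * d + d * a * m) + (n * d + d * b * m) ≡ d * (x + 2 * n + (a + b) * m)
    lem₁ = solve-∀
    rates : (16 * (α * 5) + 24 * ((2 * d + 4) * 5 * Λ) + ρ₁) + (16 * (α * d) + 24 * ((2 * d + 4) * d * Λ) + ρ₀) ≤ 96 * (α * d) + 576 * (d ^ 2 * Λ) + 1872 * (r ^ 2 * ℓ ^ 6)
    rates = begin
      (16 * (α * 5) + 24 * ((2 * d + 4) * 5 * Λ) + ρ₁) + (16 * (α * d) + 24 * ((2 * d + 4) * d * Λ) + ρ₀)
        ≤⟨ +-mono-≤ (+-monoˡ-≤ ρ₁ (+-mono-≤ (≤-trans (≤-reflexive (lem₂ α)) (*-monoʳ-≤ 80 (m≤m*n α d))) (*-monoʳ-≤ 24 (*-monoˡ-≤ Λ (≤-trans E₁ (*-monoʳ-≤ 20 (≤-trans (≤-reflexive (sym (*-identityʳ d))) (^-monoʳ-≤ d (s≤s (z≤n {1}))))))))))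
             (+-monoˡ-≤ ρ₀ (+-monoʳ-≤ (16 * (α * d)) (*-monoʳ-≤ 24 (*-monoˡ-≤ Λ E₀)))) ⟩
      (80 * (α * d) + 24 * (20 * d ^ 2 * Λ) + ρ₁) + (16 * (α * d) + 24 * (4 * d ^ 2 * Λ) + ρ₀) ≡⟨ lem₃ (α * d) (d ^ 2) Λ (r ^ 2 * ℓ ^ 6) ⟩
      96 * (α * d) + 576 * (d ^ 2 * Λ) + 1872 * (r ^ 2 * ℓ ^ 6) ∎
      where
      lem₂ : ∀ a → 16 * (a * 5) ≡ 80 * a
      lem₂ = solve-∀
      lem₃ : ∀ a d l p → (80 * a + 24 * (20 * d * l) + 1800 * p) + (16 * a + 24 * (4 * d * l) + 72 * p) ≡ 96 * a + 576 * (d * l) + 1872 * p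
      lem₃ = solve-∀

  -- The 72 comes from `chebyshev` and 8000 rounds up the sum of the coefficients in `bound`; their
  -- product is the 576000 in the lower bound for ℓ.
  v-small : ∀ α → α * d ≤ n * ℓ ^ 3 → 72 * (e * e) * (v α + n) ≤ Λ * Λ
  v-small α αd≤ = begin
    72 * (e * e) * (v α + n) ≤⟨ *-monoʳ-≤ (72 * (e * e)) bound ⟩
    72 * (e * e) * (8000 * P) ≡⟨ lem₁ (e * e) P ⟩
    576000 * (e * e) * P ≤⟨ *-monoˡ-≤ P large ⟩
    ℓ * P ≡⟨ lem₂ r ℓ (ℓ ^ 3) ⟩
    Λ * Λ ∎
    where
    P : ℕ
    P = r ^ 2 * ℓ ^ 7
    lem₁ : ∀ e P → 72 * e * (8000 * P) ≡ 576000 * e * P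
    lem₁ = solve-∀
    lem₂ : ∀ r l c → l * (r * (r * 1) * (l * (l * (l * (l * c))))) ≡ r * (l * c) * (r * (l * (l * (l * (l * 1)))))
    lem₂ = solve-∀
    up : ∀ k x → x ≤ r ^ 2 * ℓ ^ k → k ≤ 7 → x ≤ P
    up k x h k≤ = ≤-trans h (*-monoʳ-≤ (r ^ 2) (^-monoʳ-≤ ℓ k≤))
    n≤P : n ≤ P
    n≤P = up 0 n (≤-trans n≤r² (≤-reflexive (sym (*-identityʳ _)))) z≤n
    bound : v α + n ≤ 8000 * P
    bound = begin
      v α + n ≡⟨ lem₃ (ℓ ^ 2) (d ^ 2) n (96 * (α * d) + 576 * (d ^ 2 * Λ) + 1872 * (r ^ 2 * ℓ ^ 6)) (2 * ℓ + 1) ⟩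
      16 * (d ^ 2 * d ^ 2 * (ℓ ^ 2 * ℓ ^ 2)) + 3 * n + (96 * (α * d) + 576 * (d ^ 2 * Λ) + 1872 * (r ^ 2 * ℓ ^ 6)) * (2 * ℓ + 1)
        ≤⟨ +-monoʳ-≤ (16 * (d ^ 2 * d ^ 2 * (ℓ ^ 2 * ℓ ^ 2)) + 3 * n) (*-monoʳ-≤ (96 * (α * d) + 576 * (d ^ 2 * Λ) + 1872 * (r ^ 2 * ℓ ^ 6)) (≤-trans (+-monoʳ-≤ (2 * ℓ) (constant (s≤s z≤n))) (≤-reflexive (lem₄ ℓ)))) ⟩
      16 * (d ^ 2 * d ^ 2 * (ℓ ^ 2 * ℓ ^ 2)) + 3 * n + (96 * (α * d) + 576 * (d ^ 2 * Λ) + 1872 * (r ^ 2 * ℓ ^ 6)) * (3 * ℓ)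
        ≡⟨ lem₅ (d ^ 2 * d ^ 2 * (ℓ ^ 2 * ℓ ^ 2)) n (α * d) (d ^ 2 * Λ) (r ^ 2 * ℓ ^ 6) ℓ ⟩
      16 * (d ^ 2 * d ^ 2 * (ℓ ^ 2 * ℓ ^ 2)) + 3 * n + 288 * (α * d * ℓ) + 1728 * (d ^ 2 * Λ * ℓ) + 5616 * (r ^ 2 * ℓ ^ 6 * ℓ)
        ≤⟨ +-mono-≤ (+-mono-≤ (+-mono-≤ (+-mono-≤ (*-monoʳ-≤ 16 t₁) (*-monoʳ-≤ 3 n≤P)) (*-monoʳ-≤ 288 t₂)) (*-monoʳ-≤ 1728 t₃)) (*-monoʳ-≤ 5616 t₄) ⟩
      16 * P + 3 * P + 288 * P + 1728 * P + 5616 * P ≤⟨ m≤m+n _ (349 * P) ⟩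
      16 * P + 3 * P + 288 * P + 1728 * P + 5616 * P + 349 * P ≡⟨ lem₆ P ⟩
      8000 * P ∎
      where
      lem₃ : ∀ l d n a m → 2 * (2 * l * d) * (2 * (2 * l * d)) + 2 * n + a * m + n ≡ 16 * (d * d * (l * l)) + 3 * n + a * m
      lem₃ = solve-∀
      lem₄ : ∀ l → 2 * l + l ≡ 3 * l
      lem₄ = solve-∀
      lem₅ : ∀ x n a b c l → 16 * x + 3 * n + (96 * a + 576 * b + 1872 * c) * (3 * l) ≡ 16 * x + 3 * n + 288 * (a * l) + 1728 * (b * l) + 5616 * (c * l)
      lem₅ = solve-∀
      lem₆ : ∀ P → 16 * P + 3 * P + 288 * P + 1728 * P + 5616 * P + 349 * P ≡ 8000 * P
      lem₆ = solve-∀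
      t₁ : d ^ 2 * d ^ 2 * (ℓ ^ 2 * ℓ ^ 2) ≤ P
      t₁ = up 4 _ (*-mono-≤ (≤-trans (*-mono-≤ d²≤r d²≤r) (≤-reflexive (cong (r *_) (sym (*-identityʳ r))))) (≤-reflexive (sym (^-distribˡ-+-* ℓ 2 2)))) (m≤m+n 4 3)
      t₂ : α * d * ℓ ≤ P
      t₂ = up 4 _ (≤-trans (*-monoˡ-≤ ℓ αd≤) (≤-trans (≤-reflexive (trans (*-assoc n (ℓ ^ 3) ℓ) (cong (n *_) (*-comm (ℓ ^ 3) ℓ)))) (*-monoˡ-≤ (ℓ ^ 4) n≤r²))) (m≤m+n 4 3)
      t₃ : d ^ 2 * Λ * ℓ ≤ P
      t₃ = up 5 _ (≤-trans (*-monoˡ-≤ ℓ (*-monoˡ-≤ Λ d²≤r)) (≤-reflexive (lem₇ r (ℓ ^ 4) ℓ))) (m≤m+n 5 2)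
        where
        lem₇ : ∀ r p l → r * (r * p) * l ≡ r * (r * 1) * (l * p)
        lem₇ = solve-∀
      t₄ : r ^ 2 * ℓ ^ 6 * ℓ ≤ P
      t₄ = ≤-reflexive (trans (*-assoc (r ^ 2) _ ℓ) (cong (r ^ 2 *_) (*-comm (ℓ ^ 6) ℓ)))

  concentrated : ∀ α t → let open Defect {n} t d Λ α in
    sumR d (λ G → ⟦ defect G ≡ᵇ 0 ⟧) * (sumR d (λ G → ⟦ atLeast Λ (defect G) ⟧) * (Λ * Λ)) ≤ (v α + n) * (sumR {n} d (λ _ → 1) * sumR {n} d (λ _ → 1))
  concentrated α t = concentration d ρ₀ D₀ ρ₁ D₁ (v α) n 2≤D₁ 2E₁≤D₁ 9E₁≤ 11≤D₀ 2E₀≤D₀ 9E₀≤ (≤-trans (m≤m+n 11 9) 20≤nd) (total≤ α) window-ratio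
    where
    open Defect {n} t d Λ α
    open Concentration {n} d defect defect-ext Λ α defect≤Λ same same≤ same-ext defect-lip defect-range

<div : ∀ m q {{_ : NonZero q}} → m < suc (m div q) * q
<div m q = ≤-trans (s≤s (≤-reflexive (m≡m%n+[m/n]*n m q))) (+-monoˡ-≤ ((m div q) * q) (m%n<n m q))

≤div : ∀ {x} m q {{_ : NonZero q}} → x * q ≤ m → x ≤ m div q
≤div {x} m q h = ≤-pred (*-cancelʳ-< q x (suc (m div q)) (≤-<-trans h (<div m q)))

-- The two ranges of the degree

module Regimes {n d ℓ r e : ℕ} {{e≢0 : NonZero e}} (3≤d : 3 ≤ d) (d⁵≤n : d ^ 5 ≤ n) (n≤r² : n ≤ r ^ 2) (r²≤4n : r ^ 2 ≤ 4 * n)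
  (large : 576000 * (e * e) ≤ ℓ) (ℓ^≤n : ℓ ^ 400 ≤ n) (n≤2^ℓ : n ≤ 2 ^ ℓ) (0<N : 0 < sumR {n} d (λ _ → 1)) where

  open Numbers {n} {d} {ℓ} {r} {e} 3≤d d⁵≤n n≤r² r²≤4n large ℓ^≤n n≤2^ℓ
  open TwoPoint {n} d e 0<N
  open ≤-Reasoning

  instance
    Λ≢0 : NonZero Λ
    Λ≢0 = m*n≢0 r (ℓ ^ 4) {{r≢0}} {{m^n≢0 ℓ 4}}

  scale : ∀ c → c ≤ 576000 → ∀ x → c * x ≤ ℓ * x
  scale c h x = *-monoˡ-≤ x (constant h)

  -- This is d²Λ, which dominates d², Λ and Λd; all conditions of the type `room` thus reduce to
  -- `c * X ≤ n`.
  X : ℕ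
  X = d ^ 2 * r * ℓ ^ 4

  X≤n : ∀ {c} → c ≤ 576000 → c * X ≤ n
  X≤n {c} h = begin
    c * X ≤⟨ *-monoˡ-≤ X (constant h) ⟩
    ℓ * X ≡⟨ lem ℓ (d ^ 2 * r) (ℓ ^ 4) ⟩
    d ^ 2 * r * ℓ ^ 5 ≤⟨ *-monoʳ-≤ (d ^ 2 * r) (^-monoʳ-≤ ℓ (m≤m+n 5 15)) ⟩
    d ^ 2 * r * ℓ ^ 20 ≤⟨ d²r-small ⟩
    n ∎
    where
    lem : ∀ l p q → l * (p * q) ≡ p * (l * q)
    lem = solve-∀

  d≤d² : d ≤ d ^ 2
  d≤d² = ≤-trans (≤-reflexive (sym (*-identityʳ d))) (^-monoʳ-≤ d (s≤s (z≤n {1})))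

  d²≤X : d ^ 2 ≤ X
  d²≤X = ≤-trans (m≤m*n (d ^ 2) Λ) (≤-reflexive (sym (*-assoc (d ^ 2) r (ℓ ^ 4))))

  Λd≤X : Λ * d ≤ X
  Λd≤X = ≤-trans (*-monoʳ-≤ Λ d≤d²) (≤-reflexive (trans (*-comm Λ (d ^ 2)) (sym (*-assoc (d ^ 2) r (ℓ ^ 4)))))

  Λ≤X : Λ ≤ X
  Λ≤X = ≤-trans (m≤m*n Λ d) Λd≤X

  suc-d≤ : suc d ≤ 2 * X
  suc-d≤ = ≤-trans (+-mono-≤ (≤-trans (1≤d^ 2) d²≤X) (≤-trans d≤d² d²≤X)) (≤-reflexive (cong (X +_) (sym (+-identityʳ X))))

  suc-d*d≤ : suc d * d ≤ 2 * X
  suc-d*d≤ = ≤-trans (+-mono-≤ (≤-trans d≤d² d²≤X) (≤-trans (≤-reflexive (cong (d *_) (sym (*-identityʳ d)))) d²≤X)) (≤-reflexive (cong (X +_) (sym (+-identityʳ X))))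

  room : ∀ k → k ≤ 7 → 2 * (k * Λ + 2 * suc d) ≤ n
  room k h = ≤-trans (*-monoʳ-≤ 2 (+-mono-≤ (*-mono-≤ h Λ≤X) (*-monoʳ-≤ 2 suc-d≤))) (≤-trans (≤-reflexive (lem X)) (X≤n (m≤m+n 22 575978)))
    where
    lem : ∀ X → 2 * (7 * X + 2 * (2 * X)) ≡ 22 * X
    lem = solve-∀

  2≤12e : 2 ≤ 12 * e
  2≤12e = ≤-trans (m≤m+n 2 10) (m≤m*n 12 e)

  open Colour {n} d Λ (12 * e) 2≤12e

  -- For such d the trivial choice α = n is within the allowance αd ≤ nℓ³, and the power (d²Q)^14 in
  -- `dense₁₅-rare` is a power of ℓ.
  few-degrees : d ≤ ℓ ^ 3 → ∃ λ t → e * prob (λ G → not (χIn t G)) ≤ N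
  few-degrees d≤ℓ³ = WithColours.few-colours Λ n (v n + n) (v-small n (*-monoʳ-≤ n d≤ℓ³)) (concentrated n) (λ _ → ≤-refl)
      (bipartite-rare (≤div n 16 (begin
        19 * (65536 * (12 * e)) * 16 ≡⟨ lem (12 * e) ⟩
        4864 * 4096 * (12 * e) ≤⟨ *-mono-≤ (*-mono-≤ (constant (m≤m+n 4864 571136)) (constant (m≤m+n 4096 571904))) 12e≤ℓ ⟩
        ℓ * ℓ * ℓ ≡⟨ lem′ ℓ ⟩
        ℓ ^ 3 ≤⟨ power 3 (m≤m+n 3 397) ⟩
        n ∎)))
      (dense₁₅-rare (7 * Λ) (room 7 ≤-refl) numeric)
    where
    lem : ∀ q → 19 * (65536 * q) * 16 ≡ 4864 * 4096 * q
    lem q = trans (cong (_* 16) (sym (*-assoc 19 65536 q))) (trans (*-comm (1245184 * q) 16) (sym (*-assoc 16 1245184 q)))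
    lem′ : ∀ l → l * l * l ≡ l * (l * (l * 1))
    lem′ = solve-∀
    ν : ℕ
    ν = n div 16
    1≤ν : 1 ≤ ν
    1≤ν = ≤div n 16 (≤-trans (m≤m+n 16 4) 20≤n)
    instance
      ν≢0 : NonZero ν
      ν≢0 = >-nonZero 1≤ν
    lem″ : ∀ a b {k} → a * 2 * b ≡ k → ∀ s d → a * (2 * s * d) * b ≡ k * (s * d)
    lem″ a b refl = regroup a b
      where
      regroup : ∀ a b s d → a * (2 * s * d) * b ≡ a * 2 * b * (s * d)
      regroup = solve-∀
    open IndependentSets {n} d (12 * e)
    open Bipartite ν 3≤d (≤-trans (≤-reflexive (*-comm 16 ν)) (m/n*n≤m n 16)) (≤-trans (<⇒≤ (<div n 16)) (≤-reflexive (trans (+-comm 16 (ν * 16)) (cong (_+ 16) (*-comm ν 16)))))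
      (≤div n 16 (≤-trans (≤-reflexive (lem″ 6 16 refl (suc d) d)) (≤-trans (*-monoʳ-≤ 192 suc-d*d≤) (≤-trans (≤-reflexive (sym (*-assoc 192 2 X))) (X≤n (m≤m+n 384 575616))))))
    numeric : 7 * Λ * (729 * (d * d) * (12 * e)) ^ 14 ≤ n
    numeric = begin
      7 * Λ * (729 * (d * d) * (12 * e)) ^ 14 ≤⟨ *-mono-≤ (*-monoˡ-≤ Λ (constant (m≤m+n 7 575993))) (^-monoˡ-≤ 14 (*-mono-≤ (*-mono-≤ (constant (m≤m+n 729 575271)) (*-mono-≤ d≤ℓ³ d≤ℓ³)) 12e≤ℓ)) ⟩
      ℓ * Λ * (ℓ * (ℓ ^ 3 * ℓ ^ 3) * ℓ) ^ 14 ≡⟨ cong₂ (λ p q → p * q ^ 14) (lem‴ ℓ r (ℓ ^ 4)) (lem⁗ ℓ) ⟩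
      r * ℓ ^ 5 * (ℓ ^ 8) ^ 14 ≡⟨ trans (*-assoc r (ℓ ^ 5) _) (cong (r *_) (trans (cong (ℓ ^ 5 *_) (^-*-assoc ℓ 8 14)) (sym (^-distribˡ-+-* ℓ 5 112)))) ⟩
      r * ℓ ^ 117 ≤⟨ *-monoʳ-≤ r (^-monoʳ-≤ ℓ (m≤m+n 117 33)) ⟩
      r * ℓ ^ 150 ≤⟨ r-small ⟩
      n ∎
      where
      lem‴ : ∀ l r p → l * (r * p) ≡ r * (l * p)
      lem‴ = solve-∀
      lem⁗ : ∀ l → l * (l * (l * (l * 1)) * (l * (l * (l * 1)))) * l ≡ l * (l * (l * (l * (l * (l * (l * (l * 1)))))))
      lem⁗ = solve-∀

  -- The conditions say t₀ = ⌊d / 512ℓ⌋, α = ⌊n / t₀⌋ and τ = ⌊t₀ / 48⌋. Thus α is of order ℓn / d,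
  -- large enough for independent sets of that size to be unlikely, while t₀ is only a factor of
  -- order ℓ below d.
  module ManyDegrees {t₀ α τ : ℕ} (ℓ³<d : ℓ ^ 3 < d) (t₀q≤d : t₀ * (512 * ℓ) ≤ d) (d<t₀q : d < suc t₀ * (512 * ℓ))
    (αt₀≤n : α * t₀ ≤ n) (n<αt₀ : n < suc α * t₀) (48τ≤t₀ : τ * 48 ≤ t₀) (t₀<48τ : t₀ < suc τ * 48) where

    q : ℕ
    q = 512 * ℓ

    instance
      q≢0 : NonZero q
      q≢0 = m*n≢0 512 ℓ

    opaque
      t₀-big : 96 * ℓ + 48 ≤ t₀
      t₀-big = ≮⇒≥ λ h → <⇒≱ ℓ³<d (begin
        d ≤⟨ <⇒≤ d<t₀q ⟩
        suc t₀ * q ≤⟨ *-monoˡ-≤ q (≤-trans h (+-monoʳ-≤ (96 * ℓ) (m≤m*n 48 ℓ))) ⟩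
        (96 * ℓ + 48 * ℓ) * q ≡⟨ lem 96 48 512 refl ℓ ⟩
        73728 * ℓ ^ 2 ≤⟨ scale 73728 (m≤m+n 73728 502272) (ℓ ^ 2) ⟩
        ℓ ^ 3 ∎)
        where
        lem : ∀ a b c {k} → (a + b) * c ≡ k → ∀ l → (a * l + b * l) * (c * l) ≡ k * l ^ 2
        lem a b c refl = regroup a b c
          where
          regroup : ∀ a b c l → (a * l + b * l) * (c * l) ≡ (a + b) * c * (l * (l * 1))
          regroup = solve-∀

      1≤t₀ : 1 ≤ t₀
      1≤t₀ = ≤-trans (≤-trans (m≤m+n 1 47) (m≤n+m 48 (96 * ℓ))) t₀-big

    instance
      t₀≢0 : NonZero t₀
      t₀≢0 = >-nonZero 1≤t₀

    d≤2t₀q : d ≤ 2 * t₀ * q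
    d≤2t₀q = ≤-trans (<⇒≤ d<t₀q) (*-monoˡ-≤ q (≤-trans (+-monoˡ-≤ t₀ 1≤t₀) (≤-reflexive (cong (t₀ +_) (sym (+-identityʳ t₀))))))

    1≤α : 1 ≤ α
    1≤α = ≤-pred (*-cancelʳ-< t₀ 1 (suc α) (≤-<-trans (≤-trans (≤-reflexive (*-identityˡ t₀)) (≤-trans (m≤m*n t₀ q) (≤-trans t₀q≤d d≤n))) n<αt₀))

    α≤n : α ≤ n
    α≤n = ≤-trans (m≤m*n α t₀) αt₀≤n

    αd-lower : 256 * ℓ * n ≤ α * d
    αd-lower = begin
      256 * ℓ * n ≤⟨ *-monoʳ-≤ (256 * ℓ) (≤-trans (<⇒≤ n<αt₀) (*-monoˡ-≤ t₀ (≤-trans (+-monoˡ-≤ α 1≤α) (≤-reflexive (cong (α +_) (sym (+-identityʳ α))))))) ⟩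
      256 * ℓ * (2 * α * t₀) ≡⟨ lem 256 refl ℓ α t₀ ⟩
      α * (t₀ * q) ≤⟨ *-monoʳ-≤ α t₀q≤d ⟩
      α * d ∎
      where
      lem : ∀ c {k} → c * 2 ≡ k → ∀ l a t → c * l * (2 * a * t) ≡ a * (t * (k * l))
      lem c refl = regroup c
        where
        regroup : ∀ c l a t → c * l * (2 * a * t) ≡ a * (t * (c * 2 * l))
        regroup = solve-∀

    αd-upper : α * d ≤ 1024 * ℓ * n
    αd-upper = begin
      α * d ≤⟨ *-monoʳ-≤ α d≤2t₀q ⟩
      α * (2 * t₀ * q) ≡⟨ lem 512 refl ℓ α t₀ ⟩
      1024 * ℓ * (α * t₀) ≤⟨ *-monoʳ-≤ (1024 * ℓ) αt₀≤n ⟩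
      1024 * ℓ * n ∎
      where
      lem : ∀ c {k} → c * 2 ≡ k → ∀ l a t → a * (2 * t * (c * l)) ≡ k * l * (a * t)
      lem c refl = regroup c
        where
        regroup : ∀ c l a t → a * (2 * t * (c * l)) ≡ c * 2 * l * (a * t)
        regroup = solve-∀

    αd≤ : α * d ≤ n * ℓ ^ 3
    αd≤ = begin
      α * d ≤⟨ αd-upper ⟩
      1024 * ℓ * n ≤⟨ *-monoˡ-≤ n (≤-trans (scale 1024 (m≤m+n 1024 574976) ℓ) (m≤m*n (ℓ * ℓ) ℓ)) ⟩
      ℓ * ℓ * ℓ * n ≡⟨ lem ℓ n ⟩
      n * ℓ ^ 3 ∎
      where
      lem : ∀ l n → l * l * l * n ≡ n * (l * (l * (l * 1)))
      lem = solve-∀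

    nQ≤ : n * (12 * e) ≤ 2 ^ (2 * ℓ)
    nQ≤ = ≤-trans (*-mono-≤ n≤2^ℓ (≤-trans (≤-trans 12e≤ℓ (≤-trans (≤-reflexive (sym (*-identityʳ ℓ))) (power 1 (m≤m+n 1 399)))) n≤2^ℓ))
      (≤-reflexive (trans (sym (^-distribˡ-+-* 2 ℓ ℓ)) (cong (2 ^_) (cong (ℓ +_) (sym (+-identityʳ ℓ))))))

    open IndependentSets {n} d (12 * e) using (module Large)

    -- 2ℓ doublings per vertex give 2^(2ℓ) ≥ nQ. With w = 64ℓn the bounds 256ℓn ≤ αd ≤ 1024ℓn are
    -- just what is needed: 4 · 64 = 256 and 4 · 1024 = 64².
    no-large-independent : 12 * e * prob (Large.exceptional α α) ≤ 2 * N
    no-large-independent = Large.independent-rare α (64 * ℓ * n) (2 * ℓ * α) (2 * ℓ) 2≤12e 1≤α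
      (≤-trans (≤-reflexive (lem₁ 4 64 refl ℓ n)) αd-lower)
      (≤-trans (≤-reflexive (*-assoc 2 (suc d) d)) (≤-trans (*-monoʳ-≤ 2 suc-d*d≤) (≤-trans (≤-reflexive (sym (*-assoc 2 2 X))) (≤-trans (X≤n (m≤m+n 4 575996)) (m≤n*m n (64 * ℓ) {{m*n≢0 64 ℓ}})))))
      (≤-trans (*-mono-≤ (*-monoˡ-≤ ℓ (m≤m+n 2 62)) α≤n) ≤-refl)
      (≤-trans (≤-reflexive (lem₂ ℓ α n d)) (≤-trans (*-monoʳ-≤ (4 * ℓ * n) αd-upper) (≤-reflexive (lem₃ 4 16 64 refl refl ℓ n))))
      nQ≤ ≤-refl
      where
      lem₁ : ∀ a b {k} → a * b ≡ k → ∀ l n → a * (b * l * n) ≡ k * l * n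
      lem₁ a b refl = regroup a b
        where
        regroup : ∀ a b l n → a * (b * l * n) ≡ a * b * l * n
        regroup = solve-∀
      lem₂ : ∀ l a n d → 2 * (2 * l * a) * (n * d) ≡ 4 * l * n * (a * d)
      lem₂ = solve-∀
      lem₃ : ∀ a b c {j k} → b * c ≡ j → a * b ≡ k → ∀ l n → a * l * n * (j * l * n) ≡ k * l * n * (c * l * n)
      lem₃ a b c refl refl = regroup a b c
        where
        regroup : ∀ a b c l n → a * l * n * (b * c * l * n) ≡ a * b * l * n * (c * l * n)
        regroup = solve-∀

    dense : (9 * (2 * Λ) * d) ^ 6 * (12 * e) ≤ n ^ 5
    dense = begin
      (9 * (2 * Λ) * d) ^ 6 * (12 * e) ≡⟨ cong (λ z → z ^ 6 * (12 * e)) (lem₁ r (ℓ ^ 4) d) ⟩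
      (r * d * (18 * ℓ ^ 4)) ^ 6 * (12 * e) ≤⟨ *-mono-≤ (^-monoˡ-≤ 6 (*-monoʳ-≤ (r * d) (*-monoˡ-≤ (ℓ ^ 4) (constant (m≤m+n 18 575982))))) 12e≤ℓ ⟩
      (r * d * ℓ ^ 5) ^ 6 * ℓ ≡⟨ cong (_* ℓ) (trans (*^-distrib (r * d) (ℓ ^ 5) 6) (cong₂ _*_ (trans (*^-distrib r d 6) (cong₂ _*_ (sym (^-*-assoc r 2 3)) (^-distribˡ-+-* d 2 4))) (^-*-assoc ℓ 5 6))) ⟩
      (r ^ 2) ^ 3 * (d ^ 2 * d ^ 4) * ℓ ^ 30 * ℓ ≤⟨ *-monoˡ-≤ ℓ (*-monoˡ-≤ (ℓ ^ 30) (*-mono-≤ (≤-trans (^-monoˡ-≤ 3 r²≤4n) (≤-trans (≤-reflexive (*^-distrib 4 n 3)) (*-monoˡ-≤ (n ^ 3) (constant (m≤m+n 64 575936))))) (*-monoˡ-≤ (d ^ 4) d²≤n))) ⟩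
      ℓ * n ^ 3 * (n * d ^ 4) * ℓ ^ 30 * ℓ ≡⟨ lem₂ ℓ (n ^ 3) n (d ^ 4) (ℓ ^ 30) ⟩
      n ^ 3 * n * (d ^ 4 * ℓ ^ 32) ≤⟨ *-monoʳ-≤ (n ^ 3 * n) (≤-trans (*-monoʳ-≤ (d ^ 4) (^-monoʳ-≤ ℓ (m≤m+n 32 18))) d⁴-small) ⟩
      n ^ 3 * n * n ≡⟨ trans (*-comm (n ^ 3 * n) n) (cong (n *_) (*-comm (n ^ 3) n)) ⟩
      n ^ 5 ∎
      where
      d²≤n : d ^ 2 ≤ n
      d²≤n = ≤-trans (^-monoʳ-≤ d (m≤m+n 2 2)) d⁴≤n
      lem₁ : ∀ r p d → 9 * (2 * (r * p)) * d ≡ r * d * (18 * p)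
      lem₁ = solve-∀
      lem₂ : ∀ l m n p q → l * m * (n * p) * q * l ≡ m * n * (p * (l * (l * q)))
      lem₂ = solve-∀

    2ℓ≤τ : 2 * ℓ ≤ τ
    2ℓ≤τ = ≤-pred (*-cancelʳ-< 48 (2 * ℓ) (suc τ) (≤-<-trans (≤-trans (≤-reflexive (lem 48 refl ℓ)) (≤-trans (m≤m+n (96 * ℓ) 48) t₀-big)) t₀<48τ))
      where
      lem : ∀ c {k} → 2 * c ≡ k → ∀ l → 2 * l * c ≡ k * l
      lem c refl = regroup c
        where
        regroup : ∀ c l → 2 * l * c ≡ 2 * c * l
        regroup = solve-∀

    crowd : 18 * (d * d * d) * Λ ≤ τ * n
    crowd = begin
      18 * (d * d * d) * Λ ≤⟨ *-monoˡ-≤ Λ (*-monoʳ-≤ 18 (*-monoʳ-≤ (d * d) d≤)) ⟩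
      18 * (d * d * (ℓ * (ℓ * τ))) * Λ ≤⟨ *-monoˡ-≤ Λ (scale 18 (m≤m+n 18 575982) (d * d * (ℓ * (ℓ * τ)))) ⟩
      ℓ * (d * d * (ℓ * (ℓ * τ))) * Λ ≡⟨ lem₁ d ℓ τ r (ℓ ^ 4) ⟩
      τ * (d ^ 2 * r * ℓ ^ 7) ≤⟨ *-monoʳ-≤ τ (≤-trans (*-monoʳ-≤ (d ^ 2 * r) (^-monoʳ-≤ ℓ (m≤m+n 7 13))) d²r-small) ⟩
      τ * n ∎
      where
      1≤τ : 1 ≤ τ
      1≤τ = ≤-trans (>-nonZero⁻¹ (2 * ℓ) {{m*n≢0 2 ℓ}}) 2ℓ≤τ
      d≤ : d ≤ ℓ * (ℓ * τ)
      d≤ = begin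
        d ≤⟨ d≤2t₀q ⟩
        2 * t₀ * q ≤⟨ *-monoˡ-≤ q (*-monoʳ-≤ 2 (≤-trans (<⇒≤ t₀<48τ) (*-monoˡ-≤ 48 (≤-trans (+-monoˡ-≤ τ 1≤τ) (≤-reflexive (cong (τ +_) (sym (+-identityʳ τ)))))))) ⟩
        2 * (2 * τ * 48) * (512 * ℓ) ≡⟨ lem₃ 48 512 refl τ ℓ ⟩
        98304 * (ℓ * τ) ≤⟨ scale 98304 (m≤m+n 98304 477696) (ℓ * τ) ⟩
        ℓ * (ℓ * τ) ∎
        where
        lem₃ : ∀ b c {k} → 2 * b * (2 * c) ≡ k → ∀ t l → 2 * (2 * t * b) * (c * l) ≡ k * (l * t)
        lem₃ b c refl = regroup b c
          where
          regroup : ∀ b c t l → 2 * (2 * t * b) * (c * l) ≡ 2 * b * (2 * c) * (l * t)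
          regroup = solve-∀
      lem₁ : ∀ d l t r p → l * (d * d * (l * (l * t))) * (r * p) ≡ t * (d * (d * 1) * r * (l * (l * (l * p))))
      lem₁ = solve-∀

    two-values : ∃ λ t → e * prob (λ G → not (χIn t G)) ≤ N
    two-values = WithColours.many-colours Λ α (v α + n) (v-small α αd≤) (concentrated α) t₀ τ 1≤α (≤-trans (≤-reflexive (*-comm t₀ α)) αt₀≤n)
      (≤-trans (≤-trans (m≤n+m 48 (96 * ℓ)) t₀-big) (n≤1+n t₀)) (≤-trans (≤-trans (≤-reflexive (*-comm 48 τ)) 48τ≤t₀) (n≤1+n t₀))
      no-large-independent (dense₁₂-rare (2 * Λ) (room 2 (m≤m+n 2 5)) dense)
      (crowded-rare τ Λ (≤-trans (*-monoʳ-≤ 2 (+-mono-≤ (+-mono-≤ (+-mono-≤ Λd≤X Λ≤X) Λ≤X) (*-monoʳ-≤ 2 suc-d≤))) (≤-trans (≤-reflexive (lem X)) (X≤n (m≤m+n 14 575986))))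
        crowd (≤-trans nQ≤ (^-monoʳ-≤ 2 2ℓ≤τ)))
      where
      lem : ∀ X → 2 * (X + X + X + 2 * (2 * X)) ≡ 14 * X
      lem = solve-∀

  quotient : ∀ m q → 0 < q → ∃ λ k → k * q ≤ m × m < suc k * q
  quotient m q 0<q = m div q , m/n*n≤m m q , <div m q
    where
    instance
      q≢0 : NonZero q
      q≢0 = >-nonZero 0<q

  many-degrees : ℓ ^ 3 < d → ∃ λ t → e * prob (λ G → not (χIn t G)) ≤ N
  many-degrees ℓ³<d = first (quotient d (512 * ℓ) (>-nonZero⁻¹ (512 * ℓ) {{m*n≢0 512 ℓ}}))
    where
    second : ∀ k → k * (512 * ℓ) ≤ d → d < suc k * (512 * ℓ) → (∃ λ α → α * k ≤ n × n < suc α * k) → (∃ λ τ → τ * 48 ≤ k × k < suc τ * 48) → ∃ λ t → e * prob (λ G → not (χIn t G)) ≤ N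
    second k ≤d d< (α , ≤n , n<) (τ , ≤k , k<) = ManyDegrees.two-values {k} {α} {τ} ℓ³<d ≤d d< ≤n n< ≤k k<
    first : (∃ λ k → k * (512 * ℓ) ≤ d × d < suc k * (512 * ℓ)) → ∃ λ t → e * prob (λ G → not (χIn t G)) ≤ N
    first (zero , _ , d<) = ⊥-elim (<⇒≱ ℓ³<d (≤-trans (<⇒≤ d<) (≤-trans (≤-reflexive (*-identityˡ (512 * ℓ)))
      (≤-trans (scale 512 (m≤m+n 512 575488) ℓ) (*-monoʳ-≤ ℓ (m≤m*n ℓ (ℓ * 1) {{m*n≢0 ℓ 1}}))))))
    first (suc k , ≤d , d<) = second (suc k) ≤d d< (quotient n (suc k) (s≤s z≤n)) (quotient (suc k) 48 (s≤s z≤n))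

  regimes : ∃ λ t → e * prob (λ G → not (χIn t G)) ≤ N
  regimes = by-degree (d ≤? ℓ ^ 3)
    where
    by-degree : Dec (d ≤ ℓ ^ 3) → ∃ λ t → e * prob (λ G → not (χIn t G)) ≤ N
    by-degree (yes p) = few-degrees p
    by-degree (no ¬p) = many-degrees (≰⇒> ¬p)

-- Choice of the parameters, and degrees one and two

sqrt-bounds : ∀ n → 0 < n → ∃ λ r → n ≤ r ^ 2 × r ^ 2 ≤ 4 * n
sqrt-bounds n 0<n = from-least (least (λ r → n ≤ r ^ 2) (λ r → n ≤? r ^ 2) n (m≤m*n n (n * 1) {{m*n≢0 n 1 {{>-nonZero 0<n}}}}))
  where
  open ≤-Reasoning
  double : ∀ s → (s + s) * ((s + s) * 1) ≡ 4 * (s * (s * 1))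
  double = solve-∀
  from-least : (∃ λ r → n ≤ r ^ 2 × (∀ s → s < r → ¬ n ≤ s ^ 2)) → ∃ λ r → n ≤ r ^ 2 × r ^ 2 ≤ 4 * n
  from-least (0 , n≤ , _) = ⊥-elim (<⇒≱ 0<n n≤)
  from-least (1 , n≤ , _) = 1 , n≤ , ≤-trans 0<n (m≤n*m n 4)
  from-least (r@(suc s@(suc _)) , n≤ , minimal) = r , n≤ , (begin
    suc s ^ 2 ≤⟨ ^-monoˡ-≤ 2 (+-monoˡ-≤ s {1} {s} (s≤s z≤n)) ⟩
    (s + s) ^ 2 ≡⟨ double s ⟩
    4 * s ^ 2 ≤⟨ *-monoʳ-≤ 4 (<⇒≤ (≰⇒> (minimal s ≤-refl))) ⟩
    4 * n ∎)

suc≤2^ : ∀ a → suc a ≤ 2 ^ a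
suc≤2^ zero = ≤-refl
suc≤2^ (suc a) = +-mono-≤ (m^n>0 2 a) (≤-trans (suc≤2^ a) (m≤m+n (2 ^ a) 0))

opaque
  -- With c = k + 1 the quotient j = ⌊m/c⌋ satisfies (j + 1)^c ≤ 2^(jc) ≤ 2^m. One of these c
  -- factors j + 1 pays for the c^k lost in passing from m + 1 to j + 1.
  power≤exponential : ∀ k → ∃ λ L → ∀ m → L ≤ m → suc m ^ k ≤ 2 ^ m
  power≤exponential k = c ^ k * c , bound
    where
    open ≤-Reasoning
    c : ℕ
    c = suc k
    bound : ∀ m → c ^ k * c ≤ m → suc m ^ k ≤ 2 ^ m
    bound m h = begin
      suc m ^ k ≤⟨ ^-monoˡ-≤ k (<div m c) ⟩
      (suc (m div c) * c) ^ k ≡⟨ *^-distrib (suc (m div c)) c k ⟩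
      suc (m div c) ^ k * c ^ k ≤⟨ *-monoʳ-≤ (suc (m div c) ^ k) (≤-trans (≤div m c h) (n≤1+n _)) ⟩
      suc (m div c) ^ k * suc (m div c) ≡⟨ *-comm (suc (m div c) ^ k) _ ⟩
      suc (m div c) ^ c ≤⟨ ^-monoˡ-≤ c (suc≤2^ (m div c)) ⟩
      (2 ^ (m div c)) ^ c ≡⟨ ^-*-assoc 2 (m div c) c ⟩
      2 ^ (m div c * c) ≤⟨ ^-monoʳ-≤ 2 (m/n*n≤m m c) ⟩
      2 ^ m ∎

-- ℓ is the least exponent with n ≤ 2^ℓ. Minimality gives 2^(ℓ-1) < n, hence ℓ^k ≤ n.
log-bounds : ∀ k B → ∃ λ n₀ → ∀ n → n₀ < n → ∃ λ ℓ → B ≤ ℓ × ℓ ^ k ≤ n × n ≤ 2 ^ ℓ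
log-bounds k B = 2 ^ (B + L) , λ n big → from-least n big (least (λ ℓ → n ≤ 2 ^ ℓ) (λ ℓ → n ≤? 2 ^ ℓ) n (<⇒≤ (suc≤2^ n)))
  where
  L : ℕ
  L = proj₁ (power≤exponential k)
  from-least : ∀ n → 2 ^ (B + L) < n → (∃ λ ℓ → n ≤ 2 ^ ℓ × (∀ m → m < ℓ → ¬ n ≤ 2 ^ m)) → ∃ λ ℓ → B ≤ ℓ × ℓ ^ k ≤ n × n ≤ 2 ^ ℓ
  from-least n big (zero , n≤ , _) = ⊥-elim (<⇒≱ big (≤-trans n≤ (m^n>0 2 (B + L))))
  from-least n big (suc m , n≤ , minimal) = suc m , ≤-trans (m≤m+n B L) (≤-trans B+L≤m (n≤1+n m)) ,
    ≤-trans (proj₂ (power≤exponential k) m (≤-trans (m≤n+m L B) B+L≤m)) (<⇒≤ (≰⇒> (minimal m ≤-refl))) , n≤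
    where
    B+L≤m : B + L ≤ m
    B+L≤m = ≮⇒≥ λ h → <⇒≱ big (≤-trans n≤ (^-monoʳ-≤ 2 h))

-- For d ≤ 2 the chromatic number is always 2 or 3. The greedy bound comes from `recolour` with
-- every vertex in U: then the frontier is empty, and the obstacles of a vertex are among its
-- neighbours.
module SmallDegree {n d : ℕ} (0<n : 0 < n) (0<d : 0 < d) (d≤2 : d ≤ 2) {G : Graph n} (R : Regular d G) where

  not-1-colourable : colourable 1 G ≡ false
  not-1-colourable with colourable 1 G in e
  ... | false = refl
  ... | true with colourable⇒ 1 G e | sum-pos (λ j → ⟦ G (fromℕ< 0<n) j ⟧) (≤-trans 0<d (≤-reflexive (sym (deg R (fromℕ< 0<n)))))
  ...   | c , p | j , q = ⊥-elim (p (fromℕ< 0<n) j (⟦⟧-pos q) (one (c _) (c j)))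
    where
    one : (i j : Fin 1) → i ≡ j
    one fzero fzero = refl

  open Extend {n} {3} G (symm R) (irr R) (λ _ → fzero) (λ _ → true) (λ _ _ _ _ → refl)

  free : ∀ W → (∀ u → W u ≡ true → true ≡ true) → 0 < count W → ∃ λ u → W u ≡ true × obstacles W u < 3
  free W _ 0<W with sum-pos (λ u → ⟦ W u ⟧) 0<W
  ... | u , w = u , ⟦⟧-pos w , s≤s (≤-trans (+-mono-≤ (≤-reflexive (sum-zero (λ v → ⟦⟧-false (∧-false (G u v))))) (sum-mono (λ v → ⟦⟧-mono (λ q → proj₂ (∧-split {W v} q))))) (≤-trans (≤-reflexive (deg R u)) d≤2))
    where
    ∧-false : ∀ b → b ∧ false ≡ false
    ∧-false true = refl
    ∧-false false = refl

  3-colourable : colourable 3 G ≡ true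
  3-colourable with recolour free n (λ _ → true) (count≤ _) (λ _ w → w)
  ... | ι , good = colourable⇐ G ι (λ i j → Recolouring.inner good i j refl refl)

opaque
  two-values-eventually : ∀ e → 0 < e → ∃ λ n₀ → ∀ n d → n₀ < n → 1 ≤ d → d ^ 5 ≤ n → 2 ∣ d * n →
    0 < sumR {n} d (λ _ → 1) × ∃ λ t → e * sumR {n} d (λ G → ⟦ not (χIn t G) ⟧) ≤ sumR {n} d (λ _ → 1)
  two-values-eventually e 0<e = n₀ , λ n d big 0<d d⁵≤n even → bounds n d big 0<d d⁵≤n even
    where
    instance
      e≢0 : NonZero e
      e≢0 = >-nonZero 0<e
    logs : ∃ λ n₀ → ∀ n → n₀ < n → ∃ λ ℓ → 576000 * (e * e) ≤ ℓ × ℓ ^ 400 ≤ n × n ≤ 2 ^ ℓ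
    logs = log-bounds 400 (576000 * (e * e))
    n₀ : ℕ
    n₀ = 2 + proj₁ logs
    module _ (n d : ℕ) (big : n₀ < n) (0<d : 1 ≤ d) (d⁵≤n : d ^ 5 ≤ n) (even : 2 ∣ d * n) where
      2<n : 2 < n
      2<n = ≤-trans (s≤s (m≤m+n 2 (proj₁ logs))) big
      d<n : Dec (d ≤ 2) → d < n
      d<n (yes p) = ≤-<-trans p 2<n
      d<n (no ¬p) = <-≤-trans (m<m*n d d {{>-nonZero 0<d}} (≤-trans (s≤s (s≤s z≤n)) (≰⇒> ¬p))) (≤-trans (≤-trans (≤-reflexive (cong (d *_) (sym (*-identityʳ d)))) (^-monoʳ-≤ d {{>-nonZero 0<d}} (m≤m+n 2 3))) d⁵≤n)
      0<N : 0 < sumR {n} d (λ _ → 1)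
      0<N = regular-exists (d<n (d ≤? 2)) even
      bad : ∀ t → ℕ
      bad t = sumR {n} d (λ G → ⟦ not (χIn t G) ⟧)
      values : Dec (d ≤ 2) → ∃ λ t → e * bad t ≤ sumR {n} d (λ _ → 1)
      values (yes d≤2) = 2 , ≤-trans (≤-reflexive (trans (cong (e *_) none) (*-zeroʳ e))) z≤n
        where
        none : bad 2 ≡ 0
        none = trans (sumR-cong d {ψ = λ _ → 0} (λ G R → cong (λ b → ⟦ not b ⟧)
          (χIn-intro G (irr R) 1 (SmallDegree.not-1-colourable (<-trans (s≤s z≤n) 2<n) 0<d d≤2 R) (SmallDegree.3-colourable (<-trans (s≤s z≤n) 2<n) 0<d d≤2 R)))) (sumR-*ˡ d 0 (λ _ → 0))
      values (no ¬p) = large (sqrt-bounds n (<-trans (s≤s z≤n) 2<n)) (proj₂ logs n (≤-trans (s≤s (m≤n+m (proj₁ logs) 2)) big))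
        where
        large : (∃ λ r → n ≤ r ^ 2 × r ^ 2 ≤ 4 * n) → (∃ λ ℓ → 576000 * (e * e) ≤ ℓ × ℓ ^ 400 ≤ n × n ≤ 2 ^ ℓ) → ∃ λ t → e * bad t ≤ sumR {n} d (λ _ → 1)
        large (r , n≤r² , r²≤4n) (ℓ , e≤ℓ , ℓ≤n , n≤2^ℓ) = Regimes.regimes {n} {d} {ℓ} {r} {e} (≰⇒> ¬p) d⁵≤n n≤r² r²≤4n e≤ℓ ℓ≤n n≤2^ℓ 0<N
      bounds : 0 < sumR {n} d (λ _ → 1) × ∃ λ t → e * bad t ≤ sumR {n} d (λ _ → 1)
      bounds = 0<N , values (d ≤? 2)

-- Passage to rational probabilities

open import Data.Integer using (+_)
open import Data.Rational using (ℚ; _/_; 0ℚ; 1ℚ; _-_) renaming (_<_ to _<ℚ_; _≤_ to _≤ℚ_; _*_ to _*ℚ_)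
import Data.Integer as ℤ
import Data.Integer.Properties as ℤ
import Data.Integer.Tactic.RingSolver as ℤ-Solver
import Data.Rational as ℚ
import Data.Rational.Properties as ℚ
import Data.Rational.Unnormalised as ℚᵘ
import Data.Rational.Unnormalised.Properties as ℚᵘ

drop-ratio-≤ : ∀ {a b} → ((+ a) / 1) ≤ℚ 1ℚ *ℚ ((+ b) / 1) → a ≤ b
drop-ratio-≤ {a} {b} h = unfold (ℚᵘ.≤-respʳ-≃ (ℚ.toℚᵘ-fromℚᵘ (ℚᵘ.mkℚᵘ (+ b) 0)) (ℚᵘ.≤-respˡ-≃ (ℚ.toℚᵘ-fromℚᵘ (ℚᵘ.mkℚᵘ (+ a) 0)) (ℚ.toℚᵘ-mono-≤ (ℚ.≤-trans h (ℚ.≤-reflexive (ℚ.*-identityˡ ((+ b) / 1)))))))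
  where
  unfold : ℚᵘ.mkℚᵘ (+ a) 0 ℚᵘ.≤ ℚᵘ.mkℚᵘ (+ b) 0 → a ≤ b
  unfold (ℚᵘ.*≤* p) = ℤ.drop‿+≤+ (subst₂ ℤ._≤_ (ℤ.*-identityʳ (+ a)) (ℤ.*-identityʳ (+ b)) p)

-- A positive ε = p/q has p ≥ 1, so a failure probability of at most 1/q is at most ε. This is why
-- the natural-number argument runs with e the denominator of ε.
1-ε≤ratio : ∀ ε → 0ℚ <ℚ ε → ∀ {g b m} → g + b ≡ suc m → ℚ.↧ₙ ε * b ≤ suc m → 1ℚ - ε ≤ℚ (+ g) / suc m
1-ε≤ratio (ℚ.mkℚ (+ zero) q _) (ℚ.*<* (ℤ.+<+ ()))
1-ε≤ratio (ℚ.mkℚ ℤ.-[1+ _ ] q _) (ℚ.*<* ())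
1-ε≤ratio ε@(ℚ.mkℚ (+ suc p) q _) _ {g} {b} {m} total few = ℚ.toℚᵘ-cancel-≤ (ℚᵘ.≤-respˡ-≃ (ℚᵘ.≃-sym (ℚᵘ.≃-trans (ℚ.toℚᵘ-homo-+ 1ℚ (ℚ.- ε)) (ℚᵘ.+-congʳ ℚᵘ.1ℚᵘ (ℚ.toℚᵘ-homo‿- ε))))
  (ℚᵘ.≤-respʳ-≃ (ℚᵘ.≃-sym (ℚ.toℚᵘ-fromℚᵘ (ℚᵘ.mkℚᵘ (+ g) m))) (ℚᵘ.*≤* (subst (λ r → (+ 1 ℤ.* + suc q ℤ.+ (ℤ.- (+ suc p)) ℤ.* + 1) ℤ.* + suc m ℤ.≤ + g ℤ.* + suc r) (sym (+-identityʳ q)) integers))))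
  where
  open ≤-Reasoning
  naturals : suc q * suc m ≤ g * suc q + suc p * suc m
  naturals = begin
    suc q * suc m ≡⟨ cong (suc q *_) (sym total) ⟩
    suc q * (g + b) ≡⟨ *-distribˡ-+ (suc q) g b ⟩
    suc q * g + suc q * b ≤⟨ +-mono-≤ (≤-reflexive (*-comm (suc q) g)) few ⟩
    g * suc q + suc m ≤⟨ +-monoʳ-≤ (g * suc q) (m≤n*m (suc m) (suc p)) ⟩
    g * suc q + suc p * suc m ∎
  expand : ∀ p q m → (+ 1 ℤ.* q ℤ.+ (ℤ.- p) ℤ.* + 1) ℤ.* m ≡ q ℤ.* m ℤ.+ ℤ.- (p ℤ.* m)
  expand = ℤ-Solver.solve-∀
  cancel : ∀ i j → i ℤ.+ j ℤ.+ ℤ.- j ≡ i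
  cancel = ℤ-Solver.solve-∀
  integers : (+ 1 ℤ.* + suc q ℤ.+ (ℤ.- (+ suc p)) ℤ.* + 1) ℤ.* + suc m ℤ.≤ + g ℤ.* + suc q
  integers = ℤ.≤-trans (ℤ.≤-reflexive (expand (+ suc p) (+ suc q) (+ suc m)))
    (ℤ.≤-trans (ℤ.+-monoˡ-≤ (ℤ.- (+ suc p ℤ.* + suc m)) (ℤ.≤-trans (ℤ.+≤+ naturals) (ℤ.≤-reflexive (cong₂ ℤ._+_ (ℤ.pos-* g (suc q)) (ℤ.pos-* (suc p) (suc m))))))
      (ℤ.≤-reflexive (cancel (+ g ℤ.* + suc q) (+ suc p ℤ.* + suc m))))

1-ε≤probList : ∀ {A : Set} (P : A → Bool) xs ε → 0ℚ <ℚ ε → 0 < length xs →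
  length (bfilter P xs) + length (bfilter (not ∘ P) xs) ≡ length xs → ℚ.↧ₙ ε * length (bfilter (not ∘ P) xs) ≤ length xs → 1ℚ - ε ≤ℚ probList P xs
1-ε≤probList P xs ε ε>0 pos total few with length xs
... | suc m = 1-ε≤ratio ε ε>0 total few

theorem1p2 : (d : ℕ → ℕ)
    → (∀ n → 1 ≤ d n)
    → (∀ (δ : ℚ) → 0ℚ <ℚ δ → ∃ λ N → ∀ n → n ≥ N → ((+ (d n ^ 5)) / 1) ≤ℚ δ *ℚ ((+ n) / 1))
    → ∀ (ε : ℚ) → 0ℚ <ℚ ε
    → ∃ λ n₀ → ∀ n → n₀ < n → 2 ∣ (d n * n)
    → ∃ λ t → 1ℚ - ε ≤ℚ Pr n (d n) (χIn t)
theorem1p2 d 1≤d d⁵≪n ε ε>0 = n₁ + n₂ , λ n big even → conclude n (proj₂ large n (d n) (≤-<-trans (m≤m+n n₁ n₂) big) (1≤d n)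
    (drop-ratio-≤ (proj₂ small n (≤-trans (m≤n+m n₂ n₁) (<⇒≤ big)))) even)
  where
  e : ℕ
  e = ℚ.↧ₙ ε
  large : ∃ λ n₁ → ∀ n d → n₁ < n → 1 ≤ d → d ^ 5 ≤ n → 2 ∣ d * n →
    0 < sumR {n} d (λ _ → 1) × ∃ λ t → e * sumR {n} d (λ G → ⟦ not (χIn t G) ⟧) ≤ sumR {n} d (λ _ → 1)
  large = two-values-eventually e (s≤s z≤n)
  small : ∃ λ N → ∀ n → n ≥ N → ((+ (d n ^ 5)) / 1) ≤ℚ 1ℚ *ℚ ((+ n) / 1)
  -- With δ = 1 the asymptotic hypothesis becomes d⁵ ≤ n for all large n.
  small = d⁵≪n 1ℚ (ℚ.*<* (ℤ.+<+ (s≤s z≤n)))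
  n₁ n₂ : ℕ
  n₁ = proj₁ large
  n₂ = proj₁ small
  conclude : ∀ n → (0 < sumR {n} (d n) (λ _ → 1) × ∃ λ t → e * sumR {n} (d n) (λ G → ⟦ not (χIn t G) ⟧) ≤ sumR {n} (d n) (λ _ → 1)) →
    ∃ λ t → 1ℚ - ε ≤ℚ Pr n (d n) (χIn t)
  conclude n (0<N , t , few) = t , 1-ε≤probList (χIn t) xs ε ε>0 (≤-trans 0<N (≤-reflexive size))
      (trans (cong₂ _+_ (count≡ (χIn t)) (count≡ (not ∘ χIn t))) (trans (sym (sumR-+ (d n) _ _)) (trans (sumR-cong (d n) (λ G _ → ⟦not⟧ (χIn t G))) size)))
      (≤-trans (≤-reflexive (cong (e *_) (count≡ (not ∘ χIn t)))) (≤-trans few (≤-reflexive size)))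
    where
    xs : List (Graph n)
    xs = regularGraphs n (d n)
    count≡ : ∀ P → length (bfilter P xs) ≡ sumR (d n) (⟦_⟧ ∘ P)
    count≡ P = trans (length-bfilter P xs) (sym (sumR-list (d n) _))
    size : sumR {n} (d n) (λ _ → 1) ≡ length xs
    size = trans (sumR-list (d n) (λ _ → 1)) (trans (sum-const (length xs) 1) (*-identityʳ (length xs)))
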